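{- Fix a finite field $\mathbb{F}_q$ of characteristic $p$. For each $n\ge1$ let $g$ be chosen uniformly at random from $\mathrm{GL}_n(\mathbb{F}_q)$. Let $k=k(n)$ be a positive integer with $p\nmid k$ and $\log k=o(n)$ as $n\to\infty$, and let $a_1,\dots,a_k\in\mathbb{F}_q$ (possibly depending on $n$) be arbitrary with $a_k\neq 0$. Then the distribution of $\sum_{i=1}^k a_i\,\mathrm{Tr}(g^i)$ tends to the uniform distribution on $\mathbb{F}_q$ as $n\to\infty$.
   Context: $q$ is a fixed prime power; $\mathrm{GL}_n(\mathbb{F}_q)$ carries the uniform probability measure. -}

module Defs where

open import Level using (0ℓ)
open import Algebra.Bundles using (CommutativeRing)
open import Data.Nat as ℕ using (ℕ; zero; suc)
open import Data.Fin using (Fin; zero; suc)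
open import Data.List using (List; []; _∷_; [_]; map; concatMap; filter; length)
open import Data.List.Relation.Unary.Any using (Any)
open import Data.List.Relation.Unary.AllPairs using (AllPairs)
open import Data.Product using (∃; _×_)
open import Relation.Nullary using (¬_; Dec; yes; no)
open import Relation.Nullary.Decidable using (_×-dec_)
open import Relation.Binary using (Decidable)
import Data.Fin.Properties as FinP
import Data.List.Relation.Unary.Any as Any

record FiniteField : Set₁ where
  field
    commRing : CommutativeRing 0ℓ 0ℓ
  open CommutativeRing commRing public
    using (Carrier; _≈_; _+_; _*_; 0#; 1#)
  field
    _≟_      : Decidable _≈_
    0≉1      : ¬ (0# ≈ 1#)
    inverse  : ∀ x → ¬ (x ≈ 0#) → ∃ λ y → (x * y) ≈ 1#
    elements : List Carrier
    complete : ∀ x → Any (x ≈_) elements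
    distinct : AllPairs (λ x y → ¬ (x ≈ y)) elements

  card : ℕ
  card = length elements

  fromℕ : ℕ → Carrier
  fromℕ zero    = 0#
  fromℕ (suc n) = 1# + fromℕ n

  sumFin : (n : ℕ) → (Fin n → Carrier) → Carrier
  sumFin zero    f = 0#
  sumFin (suc n) f = f zero + sumFin n (λ i → f (suc i))

  sum1to : ℕ → (ℕ → Carrier) → Carrier
  sum1to zero    f = 0#
  sum1to (suc k) f = sum1to k f + f (suc k)

  Mat : ℕ → Set
  Mat n = Fin n → Fin n → Carrier

  _⊗_ : ∀ {n} → Mat n → Mat n → Mat n
  _⊗_ {n} g h i j = sumFin n (λ l → g i l * h l j)

  I : ∀ {n} → Mat n
  I i j with i FinP.≟ j
  ... | yes _ = 1#
  ... | no  _ = 0#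

  _^ᴹ_ : ∀ {n} → Mat n → ℕ → Mat n
  g ^ᴹ zero  = I
  g ^ᴹ suc m = g ⊗ (g ^ᴹ m)

  Tr : ∀ {n} → Mat n → Carrier
  Tr {n} g = sumFin n (λ i → g i i)

  _≈ᴹ_ : ∀ {n} → Mat n → Mat n → Set
  g ≈ᴹ h = ∀ i j → g i j ≈ h i j

  _≟ᴹ_ : ∀ {n} → (g h : Mat n) → Dec (g ≈ᴹ h)
  g ≟ᴹ h = FinP.all? (λ i → FinP.all? (λ j → g i j ≟ h i j))

  allVecs : (n : ℕ) → List (Fin n → Carrier)
  allVecs zero    = [ (λ ()) ]
  allVecs (suc n) = concatMap (λ x → map (λ v → cons x v) (allVecs n)) elements
    where
    cons : ∀ {m} → Carrier → (Fin m → Carrier) → Fin (suc m) → Carrier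
    cons x v zero    = x
    cons x v (suc i) = v i

  allMats : (n : ℕ) → List (Mat n)
  allMats n = allRows n
    where
    allRows : (m : ℕ) → List (Fin m → Fin n → Carrier)
    allRows zero    = [ (λ ()) ]
    allRows (suc m) = concatMap (λ r → map (λ rs → cons r rs) (allRows m)) (allVecs n)
      where
      cons : (Fin n → Carrier) → (Fin m → Fin n → Carrier) → Fin (suc m) → Fin n → Carrier
      cons r rs zero    = r
      cons r rs (suc i) = rs i

  invertible? : ∀ {n} → (g : Mat n) → Dec (Any (λ h → (g ⊗ h) ≈ᴹ I × (h ⊗ g) ≈ᴹ I) (allMats n))
  invertible? {n} g = Any.any? (λ h → ((g ⊗ h) ≟ᴹ I) ×-dec ((h ⊗ g) ≟ᴹ I)) (allMats n)

  GL : (n : ℕ) → List (Mat n)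
  GL n = filter invertible? (allMats n)

  countGL : (n : ℕ) → (Mat n → Carrier) → Carrier → ℕ
  countGL n X c = length (filter (λ g → X g ≟ c) (GL n))

  traceSum : ∀ {n} → (k : ℕ) → (ℕ → Carrier) → Mat n → Carrier
  traceSum k a g = sum1to k (λ i → a i * Tr (g ^ᴹ i))

  HasCharacteristic : ℕ → Set
  HasCharacteristic p = Data.Nat.Primality.Prime p × (fromℕ p ≈ 0#)
    where import Data.Nat.Primality

-- log k(n) = o(n):  for every rational ε = num/den > 0, eventually
-- den · log₂ k(n) ≤ num · n, i.e. k(n)^den ≤ 2^(num · n).
LogLittleO : (ℕ → ℕ) → Set
LogLittleO k = ∀ num den → 1 ℕ.≤ num → 1 ℕ.≤ den →
  ∃ λ N → ∀ n → N ℕ.≤ n → (k n ℕ.^ den) ℕ.≤ (2 ℕ.^ (num ℕ.* n))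

{-# OPTIONS --safe #-}

-- For an irreducible P let N_P(g) be the number of nonzero maps F[x]/P → Fⁿ intertwining multiplication
-- by x with g. Over GL_n each N_P has mean 1 and distinct N_P are nearly uncorrelated, so the sum W of the N_P
-- over a long range of degrees, weighted by q^(n − deg P), concentrates around its mean by Chebyshev's inequality.
-- Weighting g by N_P(g) amounts to conditioning g to be block triangular with block the companion matrix C_P and a
-- uniform complementary block D, and then the statistic is X(D) + X(C_P). Here X(C_P) is the trace of
-- h(x) = Σ aᵢ xⁱ in F[x]/P, because C_P has the eigenvalues x, x^q, x^(q²), ….
-- For p ∤ k every value of this trace is taken by at most about 1/q of all P of a given degree: by Stepanov's
-- method on the curve y^q − y = h(x), where x and y have coprime weights q and k, a polynomial of small degree is
-- divisible by all P with the given trace. With the lower bound for the number of irreducible P obtained from the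
-- factorisation of x^Q − x, every value of X has probability at most (1 + ε)/q, which forces equidistribution.
-- The method needs deg P to exceed a multiple of log k, and Chebyshev needs the range of degrees up to n to have a
-- large harmonic sum: this is what log k = o(n) provides.

module Submission where

open import Level using (0ℓ)
open import Algebra.Bundles using (CommutativeRing; CommutativeMonoid)
open import Data.Nat as ℕ using (ℕ; zero; suc; _≤_; _<_; z≤n; s≤s; ⌊_/2⌋; ∣_-_∣; ⌈_/2⌉)
import Data.Nat.Properties as ℕP
import Data.Integer.Properties as ℤP
open import Data.Maybe using (Maybe; just; nothing)
open import Relation.Nullary using (yes; no; ¬_; Dec)
import Relation.Binary.PropositionalEquality as ≡
open import Algebra.Solver.Ring.AlmostCommutativeRing using (fromCommutativeRing; _-Raw-AlmostCommutative⟶_)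
open import Data.Empty using (⊥-elim; ⊥)
open import Data.Fin as Fin using (Fin; zero; suc; toℕ; fromℕ; inject₁; fromℕ<; _↑ˡ_; _↑ʳ_; splitAt)
import Data.Fin.Properties as FinP
open import Data.List using (List; []; _∷_; _++_; map; concatMap; filter; length; drop; lookup)
open import Data.List.Relation.Unary.Any as Any using (Any; here; there)
open import Data.Product using (∃; _×_; _,_; proj₁; proj₂)
open import Relation.Nullary.Decidable using (_×-dec_; ¬?; map′; decidable-stable)
open import Relation.Binary using (Decidable; IsEquivalence; Tri; tri<; tri≈; tri>)
open ≡ using (_≡_; _≢_)
open import Data.Sum using (_⊎_; inj₁; inj₂; [_,_]′; [_,_])
open import Data.Nat.Combinatorics using (nCn≡1; nCk≡nC[n∸k]; nC1≡n; nCk+nC[k+1]≡[n+1]C[k+1]; k>n⇒nCk≡0) renaming (_C_ to _choose_)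
open import Data.List.Relation.Unary.All as All using (All; []; _∷_)
open import Data.List.Relation.Unary.AllPairs as AllPairs using (AllPairs; []; _∷_)
open import Defs
open import Data.Nat.Induction using (<-wellFounded)
open import Induction.WellFounded using (Acc; acc)
open import Data.List.Properties using (length-map)
import Data.List.Relation.Unary.Any.Properties as AnyP
import Data.List.Relation.Unary.AllPairs.Properties as AllPairsP
open import Data.Unit using (⊤; tt)
open import Data.Nat.Solver using (module +-*-Solver)
import Data.Nat.DivMod as DM
open import Data.Nat.Divisibility using (_∣_; divides; ∣-trans; ∣⇒≤; _∣?_)
open import Data.Nat.Coprimality using (Coprime; coprime-divisor; coprime-Bézout)
open import Data.Nat.GCD using (module Bézout)
open import Data.Nat.Primality using (prime⇒irreducible)
import Data.List.Relation.Unary.All.Properties as AllP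

-- The reason for summing over many degrees: degree e alone contributes to W a mean of about q^n /
-- e, but a variance of about q^(2n) / e, since N_P is mostly 0 and has second moment of order q^e.
-- Within one degree the relative variance is thus of order e, while for the sum over degrees it is
-- of order 1 / H, with H the sum of the 1 / e. Between a first degree of order log k and the last
-- degree n, H grows like log (n / log k), so what matters is that n / log k tends to infinity.
-- Conditioning leaves D free, so the bound for X(C_P) has to hold uniformly in the target value c -
-- X(D); irreducibles are therefore counted for each trace value separately. Probabilities appear as
-- counts, and every estimate is an inequality in ℕ with cleared denominators. The field is given by
-- a list of q elements; additivity of z ↦ z^q and coprimality of q and k are both drawn from the
-- vanishing of the binomial coefficients of q itself.

module RingTools (R : CommutativeRing 0ℓ 0ℓ) where
  open import Data.Integer as ℤ using (ℤ; +_; -[1+_]; _⊖_)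
  open CommutativeRing R hiding (zero)
  open import Algebra.Properties.Ring ring
  open import Algebra.Properties.Semiring.Mult semiring renaming (_×_ to _×ⁿ_)
  open import Relation.Binary.Reasoning.Setoid setoid

  private
    ⟦_⟧ : ℤ → Carrier
    ⟦ + n ⟧      = n ×ⁿ 1#
    ⟦ -[1+ n ] ⟧ = - (suc n ×ⁿ 1#)

    cancel : ∀ a b c → (c + a) - (c + b) ≈ a - b
    cancel a b c = begin
      (c + a) - (c + b)        ≈⟨ +-cong (+-comm c a) (sym (-‿+-comm c b)) ⟩
      (a + c) + (- c - b)      ≈⟨ +-assoc a c _ ⟩
      a + (c + (- c - b))      ≈⟨ +-congˡ (sym (+-assoc c _ _)) ⟩
      a + ((c - c) - b)        ≈⟨ +-congˡ (+-congʳ (-‿inverseʳ c)) ⟩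
      a + (0# - b)             ≈⟨ +-congˡ (+-identityˡ _) ⟩
      a - b                    ∎

    ⊖-homo : ∀ m n → ⟦ m ⊖ n ⟧ ≈ (m ×ⁿ 1#) - (n ×ⁿ 1#)
    ⊖-homo m       zero    = sym (trans (+-congˡ -0#≈0#) (+-identityʳ _))
    ⊖-homo zero    (suc n) = sym (+-identityˡ _)
    ⊖-homo (suc m) (suc n) rewrite ℤP.[1+m]⊖[1+n]≡m⊖n m n =
      trans (⊖-homo m n) (sym (cancel _ _ 1#))

    +-homo : ∀ i j → ⟦ i ℤ.+ j ⟧ ≈ ⟦ i ⟧ + ⟦ j ⟧
    +-homo (+ m)      (+ n)      = ×-homo-+ 1# m n
    +-homo (+ m)      -[1+ n ]   = ⊖-homo m (suc n)
    +-homo -[1+ m ]   (+ n)      = trans (⊖-homo n (suc m)) (+-comm _ _)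
    +-homo -[1+ m ]   -[1+ n ]   = begin
      - (suc (suc (m ℕ.+ n)) ×ⁿ 1#)         ≡⟨ ≡.cong (λ z → - (z ×ⁿ 1#)) (≡.cong suc (≡.sym (ℕP.+-suc m n))) ⟩
      - ((suc m ℕ.+ suc n) ×ⁿ 1#)           ≈⟨ -‿cong (×-homo-+ 1# (suc m) (suc n)) ⟩
      - ((suc m ×ⁿ 1#) + (suc n ×ⁿ 1#))      ≈⟨ sym (-‿+-comm _ _) ⟩
      - (suc m ×ⁿ 1#) - (suc n ×ⁿ 1#)        ∎

    neg-homo : ∀ i → ⟦ ℤ.- i ⟧ ≈ - ⟦ i ⟧
    neg-homo (+ zero)  = sym -0#≈0#
    neg-homo (+ suc n) = refl
    neg-homo -[1+ n ]  = sym (-‿involutive _)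

    *-homo⁺ : ∀ m j → ⟦ + m ℤ.* j ⟧ ≈ (m ×ⁿ 1#) * ⟦ j ⟧
    *-homo⁺ zero    j = trans (reflexive (≡.cong ⟦_⟧ (ℤP.*-zeroˡ j))) (sym (zeroˡ _))
    *-homo⁺ (suc m) j = begin
      ⟦ + suc m ℤ.* j ⟧            ≡⟨ ≡.cong ⟦_⟧ (ℤP.suc-* (+ m) j) ⟩
      ⟦ j ℤ.+ + m ℤ.* j ⟧          ≈⟨ +-homo j (+ m ℤ.* j) ⟩
      ⟦ j ⟧ + ⟦ + m ℤ.* j ⟧        ≈⟨ +-cong (sym (*-identityˡ _)) (*-homo⁺ m j) ⟩
      1# * ⟦ j ⟧ + (m ×ⁿ 1#) * ⟦ j ⟧ ≈⟨ sym (distribʳ _ _ _) ⟩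
      (suc m ×ⁿ 1#) * ⟦ j ⟧          ∎

    *-homo : ∀ i j → ⟦ i ℤ.* j ⟧ ≈ ⟦ i ⟧ * ⟦ j ⟧
    *-homo (+ m)    j = *-homo⁺ m j
    *-homo -[1+ m ] j = begin
      ⟦ -[1+ m ] ℤ.* j ⟧          ≡⟨ ≡.cong ⟦_⟧ (≡.sym (ℤP.neg-distribˡ-* (+ suc m) j)) ⟩
      ⟦ ℤ.- (+ suc m ℤ.* j) ⟧     ≈⟨ neg-homo (+ suc m ℤ.* j) ⟩
      - ⟦ + suc m ℤ.* j ⟧         ≈⟨ -‿cong (*-homo⁺ (suc m) j) ⟩
      - ((suc m ×ⁿ 1#) * ⟦ j ⟧)    ≈⟨ -‿distribˡ-* _ _ ⟩
      - (suc m ×ⁿ 1#) * ⟦ j ⟧      ∎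

    -- Integer coefficients let the solver cancel terms by deciding equality in ℤ instead of in R.
    morphism : ℤ.+-*-rawRing -Raw-AlmostCommutative⟶ fromCommutativeRing R
    morphism = record
      { ⟦_⟧ = ⟦_⟧ ; +-homo = +-homo ; *-homo = *-homo ; -‿homo = neg-homo
      ; 0-homo = refl ; 1-homo = +-identityʳ 1# }

    weak : ∀ i j → Maybe (⟦ i ⟧ ≈ ⟦ j ⟧)
    weak i j with i ℤ.≟ j
    ... | yes ≡.refl = just refl
    ... | no  _      = nothing

  open import Algebra.Solver.Ring ℤ.+-*-rawRing (fromCommutativeRing R) morphism weak public
    using (solve; _:=_; _:+_; _:*_; _:-_; :-_; con)

-- Finite sums and finite types

-- Generic in the monoid because the same reindexing serves sums in ℕ and the product over the
-- nonzero elements in Fermat's theorem.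
module BigOp (M : CommutativeMonoid 0ℓ 0ℓ) where
  open CommutativeMonoid M
  open import Algebra.Properties.CommutativeSemigroup commutativeSemigroup using (interchange)
  open import Algebra.Properties.Monoid.Mult monoid using () renaming (_×_ to _·_) public

  ⨁ : {A : Set} → List A → (A → Carrier) → Carrier
  ⨁ []       f = ε
  ⨁ (x ∷ xs) f = f x ∙ ⨁ xs f

  when : {P : Set} → Dec P → Carrier → Carrier
  when (yes _) m = m
  when (no _)  m = ε

  module _ {A : Set} where
    ⨁-cong : (xs : List A) {f g : A → Carrier} → (∀ x → f x ≈ g x) → ⨁ xs f ≈ ⨁ xs g
    ⨁-cong []       e = refl
    ⨁-cong (x ∷ xs) e = ∙-cong (e x) (⨁-cong xs e)

    ⨁-ε : (xs : List A) → ⨁ xs (λ _ → ε) ≈ ε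
    ⨁-ε []       = refl
    ⨁-ε (x ∷ xs) = trans (identityˡ _) (⨁-ε xs)

    ⨁-∙ : (xs : List A) (f g : A → Carrier) → ⨁ xs (λ x → f x ∙ g x) ≈ ⨁ xs f ∙ ⨁ xs g
    ⨁-∙ []       f g = sym (identityˡ ε)
    ⨁-∙ (x ∷ xs) f g = trans (∙-congˡ (⨁-∙ xs f g)) (interchange _ _ _ _)

    ⨁-++ : (xs ys : List A) (f : A → Carrier) → ⨁ (xs ++ ys) f ≈ ⨁ xs f ∙ ⨁ ys f
    ⨁-++ []       ys f = sym (identityˡ _)
    ⨁-++ (x ∷ xs) ys f = trans (∙-congˡ (⨁-++ xs ys f)) (sym (assoc _ _ _))

    ⨁-const : (xs : List A) (m : Carrier) → ⨁ xs (λ _ → m) ≈ length xs · m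
    ⨁-const []       m = refl
    ⨁-const (x ∷ xs) m = ∙-congˡ (⨁-const xs m)

  module _ {A B : Set} where
    ⨁-swap : (xs : List A) (ys : List B) (f : A → B → Carrier) →
      ⨁ xs (λ x → ⨁ ys (f x)) ≈ ⨁ ys (λ y → ⨁ xs (λ x → f x y))
    ⨁-swap []       ys f = sym (⨁-ε ys)
    ⨁-swap (x ∷ xs) ys f = trans (∙-congˡ (⨁-swap xs ys f)) (sym (⨁-∙ ys _ _))

    ⨁-map : (h : A → B) (xs : List A) (f : B → Carrier) → ⨁ (map h xs) f ≈ ⨁ xs (λ x → f (h x))
    ⨁-map h []       f = refl
    ⨁-map h (x ∷ xs) f = ∙-congˡ (⨁-map h xs f)

    ⨁-concatMap : (h : A → List B) (xs : List A) (f : B → Carrier) →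
      ⨁ (concatMap h xs) f ≈ ⨁ xs (λ x → ⨁ (h x) f)
    ⨁-concatMap h []       f = refl
    ⨁-concatMap h (x ∷ xs) f = trans (⨁-++ (h x) _ f) (∙-congˡ (⨁-concatMap h xs f))

  when-⇔ : {P Q : Set} (p : Dec P) (q : Dec Q) → (P → Q) → (Q → P) → ∀ {m m'} → m ≈ m' → when p m ≈ when q m'
  when-⇔ (yes p) (yes q) f g e = e
  when-⇔ (yes p) (no q)  f g e = ⊥-elim (q (f p))
  when-⇔ (no p)  (yes q) f g e = ⊥-elim (p (g q))
  when-⇔ (no p)  (no q)  f g e = refl

open BigOp ℕP.+-0-commutativeMonoid public
  using () renaming (⨁ to ∑; ⨁-cong to ∑-cong; ⨁-ε to ∑-0; ⨁-∙ to ∑-+; ⨁-swap to ∑-swap; ⨁-map to ∑-map; ⨁-concatMap to ∑-concatMap)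

⟦_⟧ : {P : Set} → Dec P → ℕ
⟦ yes _ ⟧ = 1
⟦ no _ ⟧  = 0

⟦⟧-⇔ : {P Q : Set} (p : Dec P) (q : Dec Q) → (P → Q) → (Q → P) → ⟦ p ⟧ ≡ ⟦ q ⟧
⟦⟧-⇔ (yes p) (yes q) f g = ≡.refl
⟦⟧-⇔ (yes p) (no q)  f g = ⊥-elim (q (f p))
⟦⟧-⇔ (no p)  (yes q) f g = ⊥-elim (p (g q))
⟦⟧-⇔ (no p)  (no q)  f g = ≡.refl

⟦⟧-mono : {P Q : Set} (p : Dec P) (q : Dec Q) → (P → Q) → ⟦ p ⟧ ≤ ⟦ q ⟧
⟦⟧-mono (yes p) (yes q) f = ℕP.≤-refl
⟦⟧-mono (yes p) (no q)  f = ⊥-elim (q (f p))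
⟦⟧-mono (no p)  q       f = z≤n

⟦⟧-× : {P Q R : Set} (p : Dec P) (q : Dec Q) (r : Dec R) → (R → P × Q) → (P → Q → R) → ⟦ r ⟧ ≡ ⟦ p ⟧ ℕ.* ⟦ q ⟧
⟦⟧-× (yes p) (yes q) (yes r) f g = ≡.refl
⟦⟧-× (yes p) (yes q) (no r)  f g = ⊥-elim (r (g p q))
⟦⟧-× (yes p) (no q)  (yes r) f g = ⊥-elim (q (proj₂ (f r)))
⟦⟧-× (yes p) (no q)  (no r)  f g = ≡.refl
⟦⟧-× (no p)  q       (yes r) f g = ⊥-elim (p (proj₁ (f r)))
⟦⟧-× (no p)  q       (no r)  f g = ≡.refl

⟦⟧-≤1 : {P : Set} (p : Dec P) → ⟦ p ⟧ ≤ 1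
⟦⟧-≤1 (yes _) = ℕP.≤-refl
⟦⟧-≤1 (no _)  = z≤n

⟦⟧-yes : {P : Set} (p : Dec P) → P → ⟦ p ⟧ ≡ 1
⟦⟧-yes (yes _) p = ≡.refl
⟦⟧-yes (no ¬p) p = ⊥-elim (¬p p)

⟦⟧-no : {P : Set} (p : Dec P) → ¬ P → ⟦ p ⟧ ≡ 0
⟦⟧-no (yes p) ¬p = ⊥-elim (¬p p)
⟦⟧-no (no _)  ¬p = ≡.refl

⟦⟧-¬ : {P : Set} (p : Dec P) → ⟦ p ⟧ ℕ.+ ⟦ ¬? p ⟧ ≡ 1
⟦⟧-¬ (yes _) = ≡.refl
⟦⟧-¬ (no _)  = ≡.refl

⟦⟧-disjoint : {P Q : Set} (p : Dec P) (q : Dec Q) → (P → ¬ Q) → ⟦ p ⟧ ℕ.* ⟦ q ⟧ ≡ 0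
⟦⟧-disjoint (yes p) (yes q) f = ⊥-elim (f p q)
⟦⟧-disjoint (yes _) (no _)  f = ≡.refl
⟦⟧-disjoint (no _)  q       f = ≡.refl

⟦⟧-select : {P : Set} (p : Dec P) {x y : ℕ} → (P → x ≡ y) → (¬ P → x ≡ 0) → x ≡ ⟦ p ⟧ ℕ.* y
⟦⟧-select (yes p) f g = ≡.trans (f p) (≡.sym (ℕP.+-identityʳ _))
⟦⟧-select (no ¬p) f g = g ¬p

⟦⟧-select-≤ : {P : Set} (p : Dec P) {x y : ℕ} → (P → x ≤ y) → (¬ P → x ≡ 0) → x ≤ ⟦ p ⟧ ℕ.* y
⟦⟧-select-≤ (yes p) f g = ℕP.≤-trans (f p) (ℕP.≤-reflexive (≡.sym (ℕP.+-identityʳ _)))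
⟦⟧-select-≤ (no ¬p) f g = ℕP.≤-reflexive (g ¬p)

module _ {A : Set} where
  ∑-≤ : (xs : List A) {f g : A → ℕ} → (∀ x → f x ≤ g x) → ∑ xs f ≤ ∑ xs g
  ∑-≤ []       e = z≤n
  ∑-≤ (x ∷ xs) e = ℕP.+-mono-≤ (e x) (∑-≤ xs e)

  ∑-*ˡ : (xs : List A) (c : ℕ) (f : A → ℕ) → ∑ xs (λ x → c ℕ.* f x) ≡ c ℕ.* ∑ xs f
  ∑-*ˡ []       c f = ≡.sym (ℕP.*-zeroʳ c)
  ∑-*ˡ (x ∷ xs) c f = ≡.trans (≡.cong (c ℕ.* f x ℕ.+_) (∑-*ˡ xs c f)) (≡.sym (ℕP.*-distribˡ-+ c _ _))

  ∑-*ʳ : (xs : List A) (c : ℕ) (f : A → ℕ) → ∑ xs (λ x → f x ℕ.* c) ≡ ∑ xs f ℕ.* c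
  ∑-*ʳ []       c f = ≡.refl
  ∑-*ʳ (x ∷ xs) c f = ≡.trans (≡.cong (f x ℕ.* c ℕ.+_) (∑-*ʳ xs c f)) (≡.sym (ℕP.*-distribʳ-+ c (f x) _))

  ∑-const : (xs : List A) (c : ℕ) → ∑ xs (λ _ → c) ≡ length xs ℕ.* c
  ∑-const []       c = ≡.refl
  ∑-const (x ∷ xs) c = ≡.cong (c ℕ.+_) (∑-const xs c)

  filter-∑ : {P : A → Set} (P? : ∀ x → Dec (P x)) (xs : List A) (f : A → ℕ) →
    ∑ (filter P? xs) f ≡ ∑ xs (λ x → ⟦ P? x ⟧ ℕ.* f x)
  filter-∑ P? []       f = ≡.refl
  filter-∑ P? (x ∷ xs) f with P? x
  ... | yes _ = ≡.cong₂ ℕ._+_ (≡.sym (ℕP.+-identityʳ (f x))) (filter-∑ P? xs f)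
  ... | no _  = filter-∑ P? xs f

  ∑-Any : {P : A → Set} (P? : ∀ x → Dec (P x)) (xs : List A) → 1 ≤ ∑ xs (λ x → ⟦ P? x ⟧) → Any P xs
  ∑-Any P? []       ()
  ∑-Any P? (x ∷ xs) l with P? x
  ... | yes p = here p
  ... | no _  = there (∑-Any P? xs l)

  Any-∑ : {P : A → Set} (P? : ∀ x → Dec (P x)) (xs : List A) → Any P xs → 1 ≤ ∑ xs (λ x → ⟦ P? x ⟧)
  Any-∑ P? (x ∷ xs) (here p) rewrite ⟦⟧-yes (P? x) p = s≤s z≤n
  Any-∑ P? (x ∷ xs) (there p) = ℕP.≤-trans (Any-∑ P? xs p) (ℕP.m≤n+m _ _)

  length-∑ : (xs : List A) → length xs ≡ ∑ xs (λ _ → 1)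
  length-∑ xs = ≡.sym (≡.trans (∑-const xs 1) (ℕP.*-identityʳ _))

-- A finite setoid. That the list meets every class exactly once is expressed by a sum of
-- indicators, the form in which double counting with `∑-swap` consumes it.
record Finite : Set₁ where
  infix 4 _≈_ _≟_
  field
    Carrier       : Set
    _≈_           : Carrier → Carrier → Set
    isEquivalence : IsEquivalence _≈_
    _≟_           : Decidable _≈_
    list          : List Carrier
    once          : ∀ a → ∑ list (λ x → ⟦ x ≟ a ⟧) ≡ 1
  open IsEquivalence isEquivalence public

  card : ℕ
  card = length list

  complete : ∀ a → Any (_≈ a) list
  complete a = ∑-Any (_≟ a) list (ℕP.≤-reflexive (≡.sym (once a)))

  search : {P : Carrier → Set} → (∀ x → Dec (P x)) → (∀ {x y} → x ≈ y → P x → P y) → Dec (∃ P)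
  search P? resp with Any.any? P? list
  ... | yes p = yes (Any.satisfied p)
  ... | no ¬p = no λ (x , px) → ¬p (Any.map (λ e → resp (sym e) px) (complete x))

  at-most-one : {P : Carrier → Set} (P? : ∀ x → Dec (P x)) →
    (∀ {x y} → P x → P y → x ≈ y) → ∑ list (λ x → ⟦ P? x ⟧) ≤ 1
  at-most-one P? u with Any.any? P? list
  ... | yes p = ℕP.≤-trans (∑-≤ list (λ x → ⟦⟧-mono (P? x) (x ≟ _) (λ q → u q (proj₂ (Any.satisfied p)))))
                           (ℕP.≤-reflexive (once (proj₁ (Any.satisfied p))))
  ... | no ¬p = ℕP.≮⇒≥ (λ l → ¬p (∑-Any P? list (ℕP.<⇒≤ l)))

module Reindex (M : CommutativeMonoid 0ℓ 0ℓ) where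
  open CommutativeMonoid M renaming (Carrier to Val)
  open BigOp M

  module _ (A : Finite) where
    private module A = Finite A

    private
      pick-count : ∀ a (xs : List A.Carrier) (f : A.Carrier → Val) → (∀ {x y} → x A.≈ y → f x ≈ f y) →
        ⨁ xs (λ x → when (x A.≟ a) (f x)) ≈ ∑ xs (λ x → ⟦ x A.≟ a ⟧) · f a
      pick-count a []       f c = refl
      pick-count a (x ∷ xs) f c with x A.≟ a
      ... | yes e = ∙-cong (c e) (pick-count a xs f c)
      ... | no _  = trans (identityˡ _) (pick-count a xs f c)

    pick : ∀ a (f : A.Carrier → Val) → (∀ {x y} → x A.≈ y → f x ≈ f y) →
      ⨁ A.list (λ x → when (x A.≟ a) (f x)) ≈ f a
    pick a f c = trans (pick-count a A.list f c)
      (trans (reflexive (≡.cong (_· f a) (A.once a))) (identityʳ _))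

  module _ (A B : Finite) where
    private
      module A = Finite A
      module B = Finite B

    -- The two implications say that `φ` and `ψ` have the same graph; summing `f` over that graph in
    -- either order gives the two sides.
    reindex : (φ : A.Carrier → B.Carrier) (ψ : B.Carrier → A.Carrier) →
      (∀ {a b} → a A.≈ ψ b → b B.≈ φ a) → (∀ {a b} → b B.≈ φ a → a A.≈ ψ b) →
      (f : B.Carrier → Val) → (∀ {x y} → x B.≈ y → f x ≈ f y) →
      ⨁ B.list f ≈ ⨁ A.list (λ a → f (φ a))
    reindex φ ψ to from f c =
      trans (⨁-cong B.list (λ b → sym (pick A (ψ b) (λ _ → f b) (λ _ → refl))))
      (trans (⨁-swap B.list A.list _)
             (⨁-cong A.list (λ a → trans (⨁-cong B.list (λ b → when-⇔ (a A.≟ ψ b) (b B.≟ φ a) to from refl))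
                                          (pick B (φ a) f c))))

∑-when : {A : Set} (xs : List A) {P : A → Set} (P? : ∀ x → Dec (P x)) (f : A → ℕ) →
  ∑ xs (λ x → ⟦ P? x ⟧ ℕ.* f x) ≡ ∑ xs (λ x → BigOp.when ℕP.+-0-commutativeMonoid (P? x) (f x))
∑-when xs P? f = ∑-cong xs lem
  where
  lem : ∀ x → ⟦ P? x ⟧ ℕ.* f x ≡ BigOp.when ℕP.+-0-commutativeMonoid (P? x) (f x)
  lem x with P? x
  ... | yes _ = ℕP.+-identityʳ _
  ... | no _  = ≡.refl

module _ (A : Finite) where
  private module A = Finite A

  ∑-pick : ∀ a (f : A.Carrier → ℕ) → (∀ {x y} → x A.≈ y → f x ≡ f y) →
    ∑ A.list (λ x → ⟦ x A.≟ a ⟧ ℕ.* f x) ≡ f a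
  ∑-pick a f c = ≡.trans (∑-when A.list (A._≟ a) f) (Reindex.pick ℕP.+-0-commutativeMonoid A a f c)

  card-∑ : A.card ≡ ∑ A.list (λ _ → 1)
  card-∑ = length-∑ A.list

module _ (A B : Finite) where
  private
    module A = Finite A
    module B = Finite B

  ∑-reindex : (φ : A.Carrier → B.Carrier) (ψ : B.Carrier → A.Carrier) →
    (∀ {a b} → a A.≈ ψ b → b B.≈ φ a) → (∀ {a b} → b B.≈ φ a → a A.≈ ψ b) →
    (f : B.Carrier → ℕ) → (∀ {x y} → x B.≈ y → f x ≡ f y) →
    ∑ B.list f ≡ ∑ A.list (λ a → f (φ a))
  ∑-reindex = Reindex.reindex ℕP.+-0-commutativeMonoid A B

  private
    graph : (φ : A.Carrier → B.Carrier) → A.card ≡ ∑ B.list (λ b → ∑ A.list (λ a → ⟦ b B.≟ φ a ⟧))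
    graph φ = ≡.trans (card-∑ A) (≡.trans (∑-cong A.list (λ a → ≡.sym (B.once (φ a)))) (∑-swap A.list B.list _))

    fibre : (φ : A.Carrier → B.Carrier) → (∀ {x y} → φ x B.≈ φ y → x A.≈ y) →
      ∀ b → ∑ A.list (λ a → ⟦ b B.≟ φ a ⟧) ≤ 1
    fibre φ inj b = A.at-most-one (λ a → b B.≟ φ a) (λ e e' → inj (B.trans (B.sym e) e'))

  card-inj : (φ : A.Carrier → B.Carrier) → (∀ {x y} → φ x B.≈ φ y → x A.≈ y) → A.card ≤ B.card
  card-inj φ inj = begin
    A.card                                              ≡⟨ graph φ ⟩
    ∑ B.list (λ b → ∑ A.list (λ a → ⟦ b B.≟ φ a ⟧))     ≤⟨ ∑-≤ B.list (fibre φ inj) ⟩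
    ∑ B.list (λ _ → 1)                                  ≡⟨ ≡.sym (card-∑ B) ⟩
    B.card                                              ∎
    where open ℕP.≤-Reasoning

  card-inj-missing : (φ : A.Carrier → B.Carrier) → (∀ {x y} → φ x B.≈ φ y → x A.≈ y) →
    ∀ b₀ → (∀ a → ¬ (b₀ B.≈ φ a)) → A.card < B.card
  card-inj-missing φ inj b₀ out = begin
    suc A.card                                                               ≡⟨ ≡.trans (≡.cong suc (graph φ)) (≡.cong (ℕ._+ rest) (≡.sym (B.once b₀))) ⟩
    ∑ B.list (λ b → ⟦ b B.≟ b₀ ⟧) ℕ.+ rest                                   ≡⟨ ≡.sym (∑-+ B.list _ _) ⟩
    ∑ B.list (λ b → ⟦ b B.≟ b₀ ⟧ ℕ.+ ∑ A.list (λ a → ⟦ b B.≟ φ a ⟧))         ≤⟨ ∑-≤ B.list pointwise ⟩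
    ∑ B.list (λ _ → 1)                                                       ≡⟨ ≡.sym (card-∑ B) ⟩
    B.card                                                                   ∎
    where
    open ℕP.≤-Reasoning
    rest = ∑ B.list (λ b → ∑ A.list (λ a → ⟦ b B.≟ φ a ⟧))
    pointwise : ∀ b → ⟦ b B.≟ b₀ ⟧ ℕ.+ ∑ A.list (λ a → ⟦ b B.≟ φ a ⟧) ≤ 1
    pointwise b with b B.≟ b₀
    ... | no _  = fibre φ inj b
    ... | yes e = ℕP.≤-reflexive (≡.cong suc (≡.trans
          (∑-cong A.list (λ a → ⟦⟧-no (b B.≟ φ a) (λ e' → out a (B.trans (B.sym e) e')))) (∑-0 A.list)))

  -- Pigeonhole. The colliding pair is found by exhaustive search, and a failed search would make
  -- `φ` injective. This is the existence step of Siegel's lemma below.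
  collision : (φ : A.Carrier → B.Carrier) → (∀ {x y} → x A.≈ y → φ x B.≈ φ y) → B.card < A.card →
    ∃ λ x → ∃ λ y → ¬ (x A.≈ y) × φ x B.≈ φ y
  collision φ φ-cong l with A.search (λ x → A.search (bad? x) (resp x)) resp'
    where
    Bad : A.Carrier → A.Carrier → Set
    Bad x y = ¬ (x A.≈ y) × φ x B.≈ φ y
    bad? : ∀ x y → Dec (Bad x y)
    bad? x y = ¬? (x A.≟ y) ×-dec (φ x B.≟ φ y)
    resp : ∀ x {y y'} → y A.≈ y' → Bad x y → Bad x y'
    resp x e (n , m) = (λ e' → n (A.trans e' (A.sym e))) , B.trans m (φ-cong e)
    resp' : ∀ {x x'} → x A.≈ x' → ∃ (Bad x) → ∃ (Bad x')
    resp' e (y , n , m) = y , (λ e' → n (A.trans e e')) , B.trans (φ-cong (A.sym e)) m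
  ... | yes r = r
  ... | no ¬r = ⊥-elim (ℕP.<⇒≱ l (card-inj φ inj))
    where
    inj : ∀ {x y} → φ x B.≈ φ y → x A.≈ y
    inj {x} {y} e with x A.≟ y
    ... | yes e' = e'
    ... | no n   = ⊥-elim (¬r (x , y , n , e))

-- Counting takes the place of elimination in the linear algebra below: an injective square matrix
-- over a finite field is surjective.
inj⇒surj : (A : Finite) (φ : Finite.Carrier A → Finite.Carrier A) → (∀ {x y} → Finite._≈_ A x y → Finite._≈_ A (φ x) (φ y)) →
  (∀ {x y} → Finite._≈_ A (φ x) (φ y) → Finite._≈_ A x y) →
  ∀ b → ∃ λ a → Finite._≈_ A b (φ a)
inj⇒surj A φ φ-cong inj b with Finite.search A (λ a → Finite._≟_ A b (φ a)) (λ e e' → Finite.trans A e' (φ-cong e))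
... | yes r = r
... | no ¬r = ⊥-elim (ℕP.<-irrefl ≡.refl (card-inj-missing A A φ inj b (λ a e → ¬r (a , e))))

module _ (A B : Finite) where
  private
    module A = Finite A
    module B = Finite B

  pairList : List (A.Carrier × B.Carrier)
  pairList = concatMap (λ x → map (x ,_) B.list) A.list

  ∑-pair : (f : A.Carrier × B.Carrier → ℕ) → ∑ pairList f ≡ ∑ A.list (λ x → ∑ B.list (λ y → f (x , y)))
  ∑-pair f = ≡.trans (∑-concatMap _ A.list f) (∑-cong A.list (λ x → ∑-map (x ,_) B.list f))

  infixr 2 _⊠_
  _⊠_ : Finite
  _⊠_ = record
    { Carrier = A.Carrier × B.Carrier
    ; _≈_ = λ (a , b) (a' , b') → a A.≈ a' × b B.≈ b'
    ; isEquivalence = record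
      { refl = A.refl , B.refl ; sym = λ (e , e') → A.sym e , B.sym e'
      ; trans = λ (e , e') (f , f') → A.trans e f , B.trans e' f' }
    ; _≟_ = λ (a , b) (a' , b') → (a A.≟ a') ×-dec (b B.≟ b')
    ; list = pairList
    ; once = λ (a , b) → ≡.trans (∑-pair _) (≡.trans
        (∑-cong A.list (λ x → ≡.trans (∑-cong B.list (λ y →
            ⟦⟧-× (x A.≟ a) (y B.≟ b) ((x A.≟ a) ×-dec (y B.≟ b)) (λ p → p) _,_))
          (≡.trans (∑-*ˡ B.list ⟦ x A.≟ a ⟧ (λ y → ⟦ y B.≟ b ⟧)) (≡.trans (≡.cong (⟦ x A.≟ a ⟧ ℕ.*_) (B.once b)) (ℕP.*-identityʳ _)))))
        (A.once a))
    }

module Functions (A : Finite) where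
  private module A = Finite A

  infix 4 _≗_ _≗?_
  _≗_ : ∀ {n} → (Fin n → A.Carrier) → (Fin n → A.Carrier) → Set
  v ≗ w = ∀ i → v i A.≈ w i

  _≗?_ : ∀ {n} (v w : Fin n → A.Carrier) → Dec (v ≗ w)
  v ≗? w = FinP.all? (λ i → v i A.≟ w i)

  -- The enumerations in the statement prepend with local functions that cannot be named outside.
  -- Abstracting over `cons` makes one proof of `lists-once` serve both them and the standard
  -- enumeration.
  record Enumeration : Set where
    field
      lists : ∀ n → List (Fin n → A.Carrier)
      cons  : ∀ n → A.Carrier → (Fin n → A.Carrier) → Fin (suc n) → A.Carrier
      nil   : Fin 0 → A.Carrier
      cons-zero  : ∀ n x v → cons n x v zero ≡ x
      cons-suc   : ∀ n x v i → cons n x v (suc i) ≡ v i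
      lists-zero : lists 0 ≡ nil ∷ []
      lists-suc  : ∀ n → lists (suc n) ≡ concatMap (λ x → map (λ v → cons n x v) (lists n)) A.list

    ∑-suc : ∀ n (f : (Fin (suc n) → A.Carrier) → ℕ) →
      ∑ (lists (suc n)) f ≡ ∑ A.list (λ x → ∑ (lists n) (λ v → f (cons n x v)))
    ∑-suc n f rewrite lists-suc n =
      ≡.trans (∑-concatMap _ A.list f) (∑-cong A.list (λ x → ∑-map _ (lists n) f))

    lists-card : ∀ n → length (lists n) ≡ A.card ℕ.^ n
    lists-card zero    rewrite lists-zero = ≡.refl
    lists-card (suc n) = ≡.trans (length-∑ (lists (suc n))) (≡.trans (∑-suc n _)
      (≡.trans (∑-const A.list _) (≡.cong (A.card ℕ.*_) (≡.trans (≡.sym (length-∑ (lists n))) (lists-card n)))))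

    lists-once : ∀ n (w : Fin n → A.Carrier) → ∑ (lists n) (λ v → ⟦ v ≗? w ⟧) ≡ 1
    lists-once zero w rewrite lists-zero = ≡.cong (ℕ._+ 0) (⟦⟧-yes (nil ≗? w) (λ ()))
    lists-once (suc n) w = ≡.trans (∑-suc n _) (≡.trans
        (∑-cong A.list (λ x → ≡.trans (∑-cong (lists n) (λ v → split x v))
          (≡.trans (∑-*ˡ (lists n) ⟦ x A.≟ w zero ⟧ (λ v → ⟦ v ≗? (λ i → w (suc i)) ⟧)) (≡.trans (≡.cong (⟦ x A.≟ w zero ⟧ ℕ.*_) (lists-once n (λ i → w (suc i)))) (ℕP.*-identityʳ _)))))
        (A.once (w zero)))
      where
      split : ∀ x v → ⟦ cons n x v ≗? w ⟧ ≡ ⟦ x A.≟ w zero ⟧ ℕ.* ⟦ v ≗? (λ i → w (suc i)) ⟧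
      split x v = ⟦⟧-× (x A.≟ w zero) (v ≗? (λ i → w (suc i))) (cons n x v ≗? w)
        (λ e → ≡.subst (A._≈ w zero) (cons-zero n x v) (e zero) ,
               λ i → ≡.subst (A._≈ w (suc i)) (cons-suc n x v i) (e (suc i)))
        (λ e e' → λ { zero → ≡.subst (A._≈ w zero) (≡.sym (cons-zero n x v)) e
                    ; (suc i) → ≡.subst (A._≈ w (suc i)) (≡.sym (cons-suc n x v i)) (e' i) })

    finite : ℕ → Finite
    finite n = record
      { Carrier = Fin n → A.Carrier
      ; _≈_ = _≗_
      ; isEquivalence = record { refl = λ i → A.refl ; sym = λ e i → A.sym (e i) ; trans = λ e e' i → A.trans (e i) (e' i) }
      ; _≟_ = _≗?_
      ; list = lists n
      ; once = lists-once n
      }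

  private
    stdCons : ∀ n → A.Carrier → (Fin n → A.Carrier) → Fin (suc n) → A.Carrier
    stdCons n x v zero    = x
    stdCons n x v (suc i) = v i

    stdLists : ∀ n → List (Fin n → A.Carrier)
    stdLists zero    = (λ ()) ∷ []
    stdLists (suc n) = concatMap (λ x → map (λ v → stdCons n x v) (stdLists n)) A.list

  standard : Enumeration
  standard = record
    { lists = stdLists ; cons = stdCons ; nil = λ () ; cons-zero = λ _ _ _ → ≡.refl ; cons-suc = λ _ _ _ _ → ≡.refl
    ; lists-zero = ≡.refl ; lists-suc = λ _ → ≡.refl }

_⇒_ : ℕ → Finite → Finite
n ⇒ A = Functions.Enumeration.finite (Functions.standard A) n

card-⇒ : ∀ n A → Finite.card (n ⇒ A) ≡ Finite.card A ℕ.^ n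
card-⇒ n A = Functions.Enumeration.lists-card (Functions.standard A) n

-- Polynomials and their quotients

-- The operations are separated from the laws so that F[x] and its quotients literally share them.
module RawPoly {C : Set} (_+_ _*_ : C → C → C) (-_ : C → C) (0# 1# : C) where
  infixl 6 _⊕_
  infixl 7 _⊛_ _·_

  coeff : List C → ℕ → C
  coeff []      i       = 0#
  coeff (a ∷ u) zero    = a
  coeff (a ∷ u) (suc i) = coeff u i

  _⊕_ : List C → List C → List C
  []      ⊕ v       = v
  (a ∷ u) ⊕ []      = a ∷ u
  (a ∷ u) ⊕ (b ∷ v) = (a + b) ∷ (u ⊕ v)

  _·_ : C → List C → List C
  a · u = map (a *_) u

  neg : List C → List C
  neg = map -_

  _⊛_ : List C → List C → List C
  []      ⊛ v = []
  (a ∷ u) ⊛ v = (a · v) ⊕ (0# ∷ (u ⊛ v))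

  lst : ∀ {n} → (Fin n → C) → List C
  lst {zero}  v = []
  lst {suc n} v = v zero ∷ lst (λ i → v (suc i))

  monic : ∀ {n} → (Fin n → C) → List C
  monic {zero}  v = 1# ∷ []
  monic {suc n} v = v zero ∷ monic (λ i → v (suc i))

  module _ {n : ℕ} (f : Fin (suc n) → C) where
    shift : (Fin (suc n) → C) → Fin (suc n) → C
    shift r zero    = 0#
    shift r (suc i) = r (inject₁ i)

    -- Multiplication by x on remainders modulo the monic polynomial with lower coefficients `f`:
    -- shift up, then replace the coefficient pushed over the top by a multiple of -f.
    step : (Fin (suc n) → C) → Fin (suc n) → C
    step r i = shift r i + (- (r (fromℕ n) * f i))

    const : C → Fin (suc n) → C
    const a zero    = a
    const a (suc i) = 0#

    -- Horner's scheme for u in the quotient. No degree of u is consulted, so trailing zeros of the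
    -- list are harmless.
    rem : List C → Fin (suc n) → C
    rem []      i = 0#
    rem (a ∷ u) i = const a i + step (rem u) i

    -- Collects the coefficient that each Horner step pushes over the top.
    quo : List C → List C
    quo []      = []
    quo (a ∷ u) = rem u (fromℕ n) ∷ quo u

module Poly (R : CommutativeRing 0ℓ 0ℓ) where
  open CommutativeRing R hiding (zero)
  open RawPoly _+_ _*_ -_ 0# 1# public
  open RingTools R
  open import Algebra.Properties.Ring ring using (-0#≈0#)
  open import Algebra.Properties.CommutativeSemigroup +-commutativeSemigroup using (interchange)
  open import Relation.Binary.Reasoning.Setoid setoid

  infix 4 _≋_
  -- Coefficientwise equality identifies lists that differ in trailing zeros. As a record it lets
  -- unification recover u and v.
  record _≋_ (u v : List Carrier) : Set where
    constructor mk
    field at : ∀ i → coeff u i ≈ coeff v i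
  open _≋_ public

  ≋-refl : ∀ {u} → u ≋ u
  ≋-refl = mk λ i → refl

  ≋-sym : ∀ {u v} → u ≋ v → v ≋ u
  ≋-sym e = mk λ i → sym (at e i)

  ≋-trans : ∀ {u v w} → u ≋ v → v ≋ w → u ≋ w
  ≋-trans e f = mk λ i → trans (at e i) (at f i)

  coeff-⊕ : ∀ u v i → coeff (u ⊕ v) i ≈ coeff u i + coeff v i
  coeff-⊕ []      v       i       = sym (+-identityˡ _)
  coeff-⊕ (a ∷ u) []      i       = sym (+-identityʳ _)
  coeff-⊕ (a ∷ u) (b ∷ v) zero    = refl
  coeff-⊕ (a ∷ u) (b ∷ v) (suc i) = coeff-⊕ u v i

  coeff-· : ∀ a u i → coeff (a · u) i ≈ a * coeff u i
  coeff-· a []      i       = sym (zeroʳ a)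
  coeff-· a (b ∷ u) zero    = refl
  coeff-· a (b ∷ u) (suc i) = coeff-· a u i

  coeff-neg : ∀ u i → coeff (neg u) i ≈ - coeff u i
  coeff-neg []      i       = sym -0#≈0#
  coeff-neg (b ∷ u) zero    = refl
  coeff-neg (b ∷ u) (suc i) = coeff-neg u i

  ∷-cong : ∀ {a b u v} → a ≈ b → u ≋ v → (a ∷ u) ≋ (b ∷ v)
  ∷-cong e f = mk λ { zero → e ; (suc i) → at f i }

  0∷[]≋[] : (0# ∷ []) ≋ []
  0∷[]≋[] = mk λ { zero → refl ; (suc i) → refl }

  ⊕-cong : ∀ {u u' v v'} → u ≋ u' → v ≋ v' → u ⊕ v ≋ u' ⊕ v'
  ⊕-cong {u} {u'} {v} {v'} e f = mk λ i → trans (coeff-⊕ u v i) (trans (+-cong (at e i) (at f i)) (sym (coeff-⊕ u' v' i)))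

  ·-cong : ∀ {a b u v} → a ≈ b → u ≋ v → a · u ≋ b · v
  ·-cong {a} {b} {u} {v} e f = mk λ i → trans (coeff-· a u i) (trans (*-cong e (at f i)) (sym (coeff-· b v i)))

  ⊕-assoc : ∀ u v w → (u ⊕ v) ⊕ w ≋ u ⊕ (v ⊕ w)
  ⊕-assoc u v w = mk λ i → begin
    coeff ((u ⊕ v) ⊕ w) i                   ≈⟨ trans (coeff-⊕ (u ⊕ v) w i) (+-congʳ (coeff-⊕ u v i)) ⟩
    (coeff u i + coeff v i) + coeff w i     ≈⟨ +-assoc _ _ _ ⟩
    coeff u i + (coeff v i + coeff w i)     ≈⟨ sym (trans (coeff-⊕ u (v ⊕ w) i) (+-congˡ (coeff-⊕ v w i))) ⟩
    coeff (u ⊕ (v ⊕ w)) i                   ∎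

  ⊕-comm : ∀ u v → u ⊕ v ≋ v ⊕ u
  ⊕-comm u v = mk λ i → trans (coeff-⊕ u v i) (trans (+-comm _ _) (sym (coeff-⊕ v u i)))

  ⊕-identityʳ : ∀ u → u ⊕ [] ≋ u
  ⊕-identityʳ u = mk λ i → trans (coeff-⊕ u [] i) (+-identityʳ _)

  ⊕-inverseʳ : ∀ u → u ⊕ neg u ≋ []
  ⊕-inverseʳ u = mk λ i → trans (coeff-⊕ u (neg u) i) (trans (+-congˡ (coeff-neg u i)) (-‿inverseʳ _))

  neg-cong : ∀ {u v} → u ≋ v → neg u ≋ neg v
  neg-cong {u} {v} e = mk λ i → trans (coeff-neg u i) (trans (-‿cong (at e i)) (sym (coeff-neg v i)))

  ⊕-interchange : ∀ a b c d → (a ⊕ b) ⊕ (c ⊕ d) ≋ (a ⊕ c) ⊕ (b ⊕ d)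
  ⊕-interchange a b c d = mk λ i → begin
    coeff ((a ⊕ b) ⊕ (c ⊕ d)) i  ≈⟨ trans (coeff-⊕ (a ⊕ b) (c ⊕ d) i) (+-cong (coeff-⊕ a b i) (coeff-⊕ c d i)) ⟩
    (coeff a i + coeff b i) + (coeff c i + coeff d i) ≈⟨ interchange _ _ _ _ ⟩
    (coeff a i + coeff c i) + (coeff b i + coeff d i) ≈⟨ sym (trans (coeff-⊕ (a ⊕ c) (b ⊕ d) i) (+-cong (coeff-⊕ a c i) (coeff-⊕ b d i))) ⟩
    coeff ((a ⊕ c) ⊕ (b ⊕ d)) i ∎

  ·-distrib-⊕ : ∀ a u v → a · (u ⊕ v) ≋ (a · u) ⊕ (a · v)
  ·-distrib-⊕ a u v = mk λ i → begin
    coeff (a · (u ⊕ v)) i             ≈⟨ trans (coeff-· a (u ⊕ v) i) (*-congˡ (coeff-⊕ u v i)) ⟩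
    a * (coeff u i + coeff v i)       ≈⟨ distribˡ _ _ _ ⟩
    a * coeff u i + a * coeff v i     ≈⟨ sym (trans (coeff-⊕ (a · u) (a · v) i) (+-cong (coeff-· a u i) (coeff-· a v i))) ⟩
    coeff ((a · u) ⊕ (a · v)) i       ∎

  ·-assoc : ∀ a b u → (a * b) · u ≋ a · (b · u)
  ·-assoc a b u = mk λ i → trans (coeff-· (a * b) u i) (trans (*-assoc _ _ _)
    (sym (trans (coeff-· a (b · u) i) (*-congˡ (coeff-· b u i)))))

  0·≋[] : ∀ u → 0# · u ≋ []
  0·≋[] u = mk λ i → trans (coeff-· 0# u i) (zeroˡ _)

  1·≋ : ∀ u → 1# · u ≋ u
  1·≋ u = mk λ i → trans (coeff-· 1# u i) (*-identityˡ _)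

  ·-shift : ∀ a u → a · (0# ∷ u) ≋ 0# ∷ (a · u)
  ·-shift a u = ∷-cong (zeroʳ a) ≋-refl

  ⊛-congˡ : ∀ u {v w} → v ≋ w → u ⊛ v ≋ u ⊛ w
  ⊛-congˡ []      e = ≋-refl
  ⊛-congˡ (a ∷ u) e = ⊕-cong (·-cong refl e) (∷-cong refl (⊛-congˡ u e))

  ⊛-zeroʳ : ∀ u → u ⊛ [] ≋ []
  ⊛-zeroʳ []      = ≋-refl
  ⊛-zeroʳ (a ∷ u) = ≋-trans (∷-cong refl (⊛-zeroʳ u)) 0∷[]≋[]

  ⊛-∷ : ∀ u b v → u ⊛ (b ∷ v) ≋ (b · u) ⊕ (0# ∷ (u ⊛ v))
  ⊛-∷ []      b v = ≋-sym 0∷[]≋[]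
  ⊛-∷ (a ∷ u) b v = ∷-cong (trans (+-identityʳ _) (trans (*-comm a b) (sym (+-identityʳ _))))
    (≋-trans (⊕-cong (≋-refl {a · v}) (⊛-∷ u b v)) (≋-trans (≋-sym (⊕-assoc (a · v) (b · u) (0# ∷ (u ⊛ v))))
      (≋-trans (⊕-cong (⊕-comm (a · v) (b · u)) (≋-refl {0# ∷ (u ⊛ v)})) (⊕-assoc (b · u) (a · v) (0# ∷ (u ⊛ v))))))

  ⊛-comm : ∀ u v → u ⊛ v ≋ v ⊛ u
  ⊛-comm []      v = ≋-sym (⊛-zeroʳ v)
  ⊛-comm (a ∷ u) v = ≋-trans (⊕-cong ≋-refl (∷-cong refl (⊛-comm u v))) (≋-sym (⊛-∷ v a u))

  ⊛-cong : ∀ {u u' v v'} → u ≋ u' → v ≋ v' → u ⊛ v ≋ u' ⊛ v'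
  ⊛-cong {u} {u'} {v} {v'} e f = ≋-trans (⊛-congˡ u f) (≋-trans (⊛-comm u v') (≋-trans (⊛-congˡ v' e) (⊛-comm v' u')))

  ⊛-distribˡ : ∀ u v w → u ⊛ (v ⊕ w) ≋ (u ⊛ v) ⊕ (u ⊛ w)
  ⊛-distribˡ []      v w = ≋-refl
  ⊛-distribˡ (a ∷ u) v w = ≋-trans
    (⊕-cong (·-distrib-⊕ a v w) (≋-trans (∷-cong (sym (+-identityʳ _)) (⊛-distribˡ u v w)) ≋-refl))
    (⊕-interchange (a · v) (a · w) (0# ∷ (u ⊛ v)) (0# ∷ (u ⊛ w)))

  ⊛-distribʳ : ∀ w u v → (u ⊕ v) ⊛ w ≋ (u ⊛ w) ⊕ (v ⊛ w)
  ⊛-distribʳ w u v = ≋-trans (⊛-comm (u ⊕ v) w) (≋-trans (⊛-distribˡ w u v) (⊕-cong (⊛-comm w u) (⊛-comm w v)))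

  ·-⊛ : ∀ a u v → (a · u) ⊛ v ≋ a · (u ⊛ v)
  ·-⊛ a []      v = ≋-refl
  ·-⊛ a (b ∷ u) v = ≋-trans (⊕-cong (·-assoc a b v) (≋-trans (∷-cong refl (·-⊛ a u v)) (≋-sym (·-shift a (u ⊛ v)))))
    (≋-sym (·-distrib-⊕ a (b · v) (0# ∷ (u ⊛ v))))

  shift-⊛ : ∀ u v → (0# ∷ u) ⊛ v ≋ 0# ∷ (u ⊛ v)
  shift-⊛ u v = ⊕-cong (0·≋[] v) ≋-refl

  ⊛-assoc : ∀ u v w → (u ⊛ v) ⊛ w ≋ u ⊛ (v ⊛ w)
  ⊛-assoc []      v w = ≋-refl
  ⊛-assoc (a ∷ u) v w = ≋-trans (⊛-distribʳ w (a · v) (0# ∷ (u ⊛ v)))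
    (⊕-cong (·-⊛ a v w) (≋-trans (shift-⊛ (u ⊛ v) w) (∷-cong refl (⊛-assoc u v w))))

  one : List Carrier
  one = 1# ∷ []

  const-⊛ : ∀ a u → (a ∷ []) ⊛ u ≋ a · u
  const-⊛ a u = ≋-trans (⊕-cong ≋-refl 0∷[]≋[]) (⊕-identityʳ _)

  ⊛-identityˡ : ∀ u → one ⊛ u ≋ u
  ⊛-identityˡ u = ≋-trans (const-⊛ 1# u) (1·≋ u)

  polyRing : CommutativeRing 0ℓ 0ℓ
  polyRing = record
    { Carrier = List Carrier ; _≈_ = _≋_ ; _+_ = _⊕_ ; _*_ = _⊛_ ; -_ = neg ; 0# = [] ; 1# = one
    ; isCommutativeRing = record
      { isRing = record
        { +-isAbelianGroup = record
          { isGroup = record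
            { isMonoid = record
              { isSemigroup = record
                { isMagma = record { isEquivalence = record { refl = ≋-refl ; sym = ≋-sym ; trans = ≋-trans } ; ∙-cong = ⊕-cong }
                ; assoc = ⊕-assoc }
              ; identity = (λ u → ≋-refl) , ⊕-identityʳ }
            ; inverse = (λ u → ≋-trans (⊕-comm (neg u) u) (⊕-inverseʳ u)) , ⊕-inverseʳ
            ; ⁻¹-cong = neg-cong }
          ; comm = ⊕-comm }
        ; *-cong = ⊛-cong
        ; *-assoc = ⊛-assoc
        ; *-identity = ⊛-identityˡ , (λ u → ≋-trans (⊛-comm u one) (⊛-identityˡ u))
        ; distrib = ⊛-distribˡ , ⊛-distribʳ }
      ; *-comm = ⊛-comm } }

  X : List Carrier
  X = 0# ∷ 1# ∷ []

  X⊛ : ∀ u → X ⊛ u ≋ 0# ∷ u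
  X⊛ u = ≋-trans (shift-⊛ one u) (∷-cong refl (⊛-identityˡ u))

  infix 4 _deg<_
  _deg<_ : List Carrier → ℕ → Set
  u deg< m = ∀ i → m ≤ i → coeff u i ≈ 0#

  deg<-≋ : ∀ {u v m} → u ≋ v → u deg< m → v deg< m
  deg<-≋ e l i m≤i = trans (sym (at e i)) (l i m≤i)

  deg<-mono : ∀ {u m m'} → m ≤ m' → u deg< m → u deg< m'
  deg<-mono m≤m' l i p = l i (ℕP.≤-trans m≤m' p)

  deg<0⇒≋[] : ∀ {u} → u deg< 0 → u ≋ []
  deg<0⇒≋[] l = mk λ i → l i z≤n

  coeff-lst : ∀ {n} (v : Fin n → Carrier) i → coeff (lst v) (toℕ i) ≈ v i
  coeff-lst v zero    = refl
  coeff-lst v (suc i) = coeff-lst (λ i → v (suc i)) i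

  lst-deg : ∀ {n} (v : Fin n → Carrier) → lst v deg< n
  lst-deg {zero}  v i       p       = refl
  lst-deg {suc n} v (suc i) (s≤s p) = lst-deg (λ i → v (suc i)) i p

  lst-cong : ∀ {n} {v w : Fin n → Carrier} → (∀ i → v i ≈ w i) → lst v ≋ lst w
  lst-cong {zero}  e = ≋-refl
  lst-cong {suc n} e = ∷-cong (e zero) (lst-cong (λ i → e (suc i)))

  lst-⊕ : ∀ {n} (v w : Fin n → Carrier) → lst (λ i → v i + w i) ≋ lst v ⊕ lst w
  lst-⊕ {zero}  v w = ≋-refl
  lst-⊕ {suc n} v w = ∷-cong refl (lst-⊕ _ _)

  lst-0 : ∀ {n} → lst {n} (λ _ → 0#) ≋ []
  lst-0 {zero}  = ≋-refl
  lst-0 {suc n} = ≋-trans (∷-cong refl lst-0) 0∷[]≋[]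

  lst-coeff : ∀ {n} u → u deg< n → u ≋ lst {n} (λ i → coeff u (toℕ i))
  lst-coeff {n} u l = mk go
    where
    go : ∀ i → coeff u i ≈ coeff (lst {n} (λ i → coeff u (toℕ i))) i
    go i with i ℕ.<? n
    ... | yes p = ≡.subst (λ j → coeff u j ≈ coeff (lst {n} (λ i → coeff u (toℕ i))) j) (FinP.toℕ-fromℕ< p)
                    (sym (coeff-lst {n} (λ i → coeff u (toℕ i)) (fromℕ< p)))
    ... | no p  = trans (l i (ℕP.≮⇒≥ p)) (sym (lst-deg {n} (λ i → coeff u (toℕ i)) i (ℕP.≮⇒≥ p)))

  coeff-monic : ∀ {n} (v : Fin n → Carrier) i → coeff (monic v) (toℕ i) ≈ v i
  coeff-monic v zero    = refl
  coeff-monic v (suc i) = coeff-monic (λ i → v (suc i)) i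

  coeff-monic-top : ∀ {n} (v : Fin n → Carrier) → coeff (monic v) n ≈ 1#
  coeff-monic-top {zero}  v = refl
  coeff-monic-top {suc n} v = coeff-monic-top (λ i → v (suc i))

  monic-deg : ∀ {n} (v : Fin n → Carrier) → monic v deg< suc n
  monic-deg {zero}  v (suc i) p       = refl
  monic-deg {suc n} v (suc i) (s≤s p) = monic-deg (λ i → v (suc i)) i p

  monic-cong : ∀ {n} {v w : Fin n → Carrier} → (∀ i → v i ≈ w i) → monic v ≋ monic w
  monic-cong {zero}  e = ≋-refl
  monic-cong {suc n} e = ∷-cong (e zero) (monic-cong (λ i → e (suc i)))

  monic-coeff : ∀ {n} u → u deg< suc n → coeff u n ≈ 1# → u ≋ monic {n} (λ i → coeff u (toℕ i))
  monic-coeff {zero}  []      l e = mk λ { zero → e ; (suc i) → refl }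
  monic-coeff {zero}  (a ∷ u) l e = mk λ { zero → e ; (suc i) → l (suc i) (s≤s z≤n) }
  monic-coeff {suc n} []      l e = ≋-trans (mk λ { zero → refl ; (suc i) → refl }) (∷-cong {0#} {0#} {[]} refl (monic-coeff {n} [] (λ i _ → refl) e))
  monic-coeff {suc n} (a ∷ u) l e = ∷-cong refl (monic-coeff {n} u (λ i p → l (suc i) (s≤s p)) e)

  drop-coeff : ∀ j u i → coeff (drop j u) i ≈ coeff u (j ℕ.+ i)
  drop-coeff zero    u       i = refl
  drop-coeff (suc j) []      i = refl
  drop-coeff (suc j) (a ∷ u) i = drop-coeff j u i

  module Division {n : ℕ} (f : Fin (suc n) → Carrier) where
    private
      last = fromℕ n

    step-cong : ∀ {r s : Fin (suc n) → Carrier} → (∀ i → r i ≈ s i) → ∀ i → step f r i ≈ step f s i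
    step-cong e zero    = +-congˡ (-‿cong (*-congʳ (e last)))
    step-cong e (suc i) = +-cong (e (inject₁ i)) (-‿cong (*-congʳ (e last)))

    step-+ : ∀ r s i → step f (λ i → r i + s i) i ≈ step f r i + step f s i
    step-+ r s zero    = solve 4 (λ z a b c → z :+ :- ((a :+ b) :* c) := (z :+ :- (a :* c)) :+ (:- (b :* c))) refl 0# (r last) (s last) (f zero)
                         ⟨trans⟩ +-congˡ (sym (+-identityˡ _))
      where _⟨trans⟩_ = trans
    step-+ r s (suc i) = solve 5 (λ x y a b c → (x :+ y) :+ :- ((a :+ b) :* c) := (x :+ :- (a :* c)) :+ (y :+ :- (b :* c))) refl
                           (r (inject₁ i)) (s (inject₁ i)) (r last) (s last) (f (suc i))

    step-* : ∀ c r i → step f (λ i → c * r i) i ≈ c * step f r i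
    step-* c r zero    = trans (+-congʳ (sym (zeroʳ c)))
                           (solve 4 (λ c z a b → c :* z :+ :- ((c :* a) :* b) := c :* (z :+ :- (a :* b))) refl c 0# (r last) (f zero))
    step-* c r (suc i) = solve 4 (λ c z a b → c :* z :+ :- ((c :* a) :* b) := c :* (z :+ :- (a :* b))) refl c (r (inject₁ i)) (r last) (f (suc i))

    step-0 : ∀ {r} → (∀ i → r i ≈ 0#) → ∀ i → step f r i ≈ 0#
    step-0 e i = trans (step-cong (λ i → trans (e i) (sym (zeroˡ 0#))) i)
                       (trans (step-* 0# (λ _ → 0#) i) (zeroˡ _))

    private
      const-0 : ∀ i → const f 0# i ≈ 0#
      const-0 zero    = refl
      const-0 (suc i) = refl

      const-cong : ∀ {a b} → a ≈ b → ∀ i → const f a i ≈ const f b i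
      const-cong e zero    = e
      const-cong e (suc i) = refl

      const-+ : ∀ a b i → const f (a + b) i ≈ const f a i + const f b i
      const-+ a b zero    = refl
      const-+ a b (suc i) = sym (+-identityˡ _)

      const-* : ∀ c a i → const f (c * a) i ≈ c * const f a i
      const-* c a zero    = refl
      const-* c a (suc i) = sym (zeroʳ c)

    rem-shift : ∀ u i → rem f (0# ∷ u) i ≈ step f (rem f u) i
    rem-shift u i = trans (+-congʳ (const-0 i)) (+-identityˡ _)

    rem-zero : ∀ u → u ≋ [] → ∀ i → rem f u i ≈ 0#
    rem-zero []      e i = refl
    rem-zero (a ∷ u) e i = trans (+-cong (trans (const-cong (at e 0) i) (const-0 i))
      (step-0 (rem-zero u (mk λ i → at e (suc i))) i)) (+-identityˡ _)

    rem-cong : ∀ u v → u ≋ v → ∀ i → rem f u i ≈ rem f v i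
    rem-cong []      v       e i = sym (rem-zero v (≋-sym e) i)
    rem-cong (a ∷ u) []      e i = rem-zero (a ∷ u) e i
    rem-cong (a ∷ u) (b ∷ v) e i = +-cong (const-cong (at e 0) i) (step-cong (rem-cong u v (mk λ i → at e (suc i))) i)

    rem-⊕ : ∀ u v i → rem f (u ⊕ v) i ≈ rem f u i + rem f v i
    rem-⊕ []      v       i = sym (+-identityˡ _)
    rem-⊕ (a ∷ u) []      i = sym (+-identityʳ _)
    rem-⊕ (a ∷ u) (b ∷ v) i = trans (+-cong (const-+ a b i) (trans (step-cong (rem-⊕ u v) i) (step-+ _ _ i))) (interchange _ _ _ _)

    rem-· : ∀ c u i → rem f (c · u) i ≈ c * rem f u i
    rem-· c []      i = sym (zeroʳ c)
    rem-· c (a ∷ u) i = trans (+-cong (const-* c a i) (trans (step-cong (rem-· c u) i) (step-* c _ i))) (sym (distribˡ _ _ _))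

    rem-neg : ∀ u i → rem f (neg u) i ≈ - rem f u i
    rem-neg u i = uniqueˡ (trans (sym (rem-⊕ (neg u) u i)) (rem-zero (neg u ⊕ u) (≋-trans (⊕-comm (neg u) u) (⊕-inverseʳ u)) i))
      where
      uniqueˡ : ∀ {x y} → x + y ≈ 0# → x ≈ - y
      uniqueˡ {x} {y} e = trans (solve 2 (λ x y → x := (x :+ y) :+ :- y) refl x y) (trans (+-congʳ e) (+-identityˡ _))

    rem-short : ∀ u → u deg< suc n → ∀ i → rem f u i ≈ coeff u (toℕ i)
    rem-short []      l i = refl
    rem-short (a ∷ u) l i = trans (+-congˡ (+-congˡ (trans (-‿cong (trans (*-congʳ top) (zeroˡ _))) -0#≈0#))) (go i)
      where
      l' : u deg< suc n
      l' j p = l (suc j) (s≤s (ℕP.<⇒≤ p))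
      top : rem f u last ≈ 0#
      top = trans (rem-short u l' last) (trans (reflexive (≡.cong (coeff u) (FinP.toℕ-fromℕ n))) (l (suc n) ℕP.≤-refl))
      go : ∀ i → const f a i + (shift f (rem f u) i + 0#) ≈ coeff (a ∷ u) (toℕ i)
      go zero    = trans (+-congˡ (+-identityˡ _)) (+-identityʳ _)
      go (suc i) = trans (+-identityˡ _) (trans (+-identityʳ _) (trans (rem-short u l' (inject₁ i))
        (reflexive (≡.cong (coeff u) (FinP.toℕ-inject₁ i)))))

    private
      f⁺ = monic (λ i → f (suc i))

      rem-f⁺ : ∀ i → rem f f⁺ i ≈ coeff f⁺ (toℕ i)
      rem-f⁺ = rem-short f⁺ (monic-deg (λ i → f (suc i)))

      rem-f⁺-last : rem f f⁺ last ≈ 1#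
      rem-f⁺-last = trans (rem-f⁺ last) (trans (reflexive (≡.cong (coeff f⁺) (FinP.toℕ-fromℕ n))) (coeff-monic-top (λ i → f (suc i))))

    -- Write the polynomial as f₀ + x f⁺. The monic f⁺ of degree n is its own remainder with top
    -- coefficient 1, so the last Horner step subtracts exactly `f`.
    rem-monic : ∀ i → rem f (monic f) i ≈ 0#
    rem-monic i = trans (+-congˡ (+-congˡ (-‿cong (trans (*-congʳ rem-f⁺-last) (*-identityˡ _))))) (go i)
      where
      go : ∀ i → const f (f zero) i + (shift f (rem f f⁺) i + (- f i)) ≈ 0#
      go zero    = trans (+-congˡ (+-identityˡ _)) (-‿inverseʳ _)
      go (suc i) = trans (+-identityˡ _) (trans (+-congʳ (trans (rem-f⁺ (inject₁ i))
        (trans (reflexive (≡.cong (coeff f⁺) (FinP.toℕ-inject₁ i))) (coeff-monic (λ i → f (suc i)) i)))) (-‿inverseʳ _))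

    -- Multiplication by v acts on remainders by iterating `step`.
    rem-⊛-cong : ∀ v {u u'} → (∀ i → rem f u i ≈ rem f u' i) → ∀ i → rem f (v ⊛ u) i ≈ rem f (v ⊛ u') i
    rem-⊛-cong []      e i = refl
    rem-⊛-cong (a ∷ v) {u} {u'} e i = begin
      rem f ((a ∷ v) ⊛ u) i                           ≈⟨ rem-⊕ (a · u) (0# ∷ (v ⊛ u)) i ⟩
      rem f (a · u) i + rem f (0# ∷ (v ⊛ u)) i        ≈⟨ +-cong (rem-· a u i) (rem-shift (v ⊛ u) i) ⟩
      a * rem f u i + step f (rem f (v ⊛ u)) i        ≈⟨ +-cong (*-congˡ (e i)) (step-cong (rem-⊛-cong v e) i) ⟩
      a * rem f u' i + step f (rem f (v ⊛ u')) i      ≈⟨ sym (+-cong (rem-· a u' i) (rem-shift (v ⊛ u') i)) ⟩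
      rem f (a · u') i + rem f (0# ∷ (v ⊛ u')) i      ≈⟨ sym (rem-⊕ (a · u') (0# ∷ (v ⊛ u')) i) ⟩
      rem f ((a ∷ v) ⊛ u') i                          ∎

    rem-⊛-zero : ∀ v {u} → (∀ i → rem f u i ≈ 0#) → ∀ i → rem f (v ⊛ u) i ≈ 0#
    rem-⊛-zero v {u} e i = trans (rem-⊛-cong v {u} {[]} e i) (rem-zero (v ⊛ []) (⊛-zeroʳ v) i)

    quo-⊕ : ∀ u v → quo f (u ⊕ v) ≋ quo f u ⊕ quo f v
    quo-⊕ []      v       = ≋-refl
    quo-⊕ (a ∷ u) []      = ≋-refl
    quo-⊕ (a ∷ u) (b ∷ v) = ∷-cong (rem-⊕ u v last) (quo-⊕ u v)

    quo-· : ∀ c u → quo f (c · u) ≋ c · quo f u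
    quo-· c []      = ≋-refl
    quo-· c (a ∷ u) = ∷-cong (rem-· c u last) (quo-· c u)

    coeff-quo : ∀ m u → coeff (quo f u) m ≈ rem f (drop (suc m) u) last
    coeff-quo m       []      = refl
    coeff-quo zero    (a ∷ u) = refl
    coeff-quo (suc m) (a ∷ u) = coeff-quo m u

    -- The tail `drop (suc m) u` is too short to be reduced, so its remainder is itself and the top
    -- coefficient can be read off u.
    coeff-quo-top : ∀ m u → u deg< (suc m ℕ.+ suc n) → coeff (quo f u) m ≈ coeff u (suc m ℕ.+ n)
    coeff-quo-top m u l = trans (coeff-quo m u) (trans (rem-short (drop (suc m) u) (λ i p → trans (drop-coeff (suc m) u i) (l _ (ℕP.+-monoʳ-≤ (suc m) p))) last)
      (trans (drop-coeff (suc m) u (toℕ last)) (reflexive (≡.cong (λ z → coeff u (suc m ℕ.+ z)) (FinP.toℕ-fromℕ n)))))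

    quo-deg : ∀ m u → u deg< (m ℕ.+ suc n) → quo f u deg< m
    quo-deg m u l i p = trans (coeff-quo-top i u (λ j q → l j (ℕP.≤-trans (ℕP.+-monoˡ-≤ (suc n) (ℕP.≤-trans p (ℕP.n≤1+n i))) q)))
      (l (suc i ℕ.+ n) (ℕP.≤-trans (ℕP.+-monoˡ-≤ (suc n) p) (ℕP.≤-reflexive (ℕP.+-suc i n))))

    quo-monic : quo f (monic f) ≋ one
    quo-monic = ∷-cong rem-f⁺-last (deg<0⇒≋[] (quo-deg 0 f⁺ (monic-deg (λ i → f (suc i)))))

    -- Division recovers cofactors, so degree bounds for a multiple of f pass to the cofactor in
    -- `factor-deg` and `factor-top`.
    quo-multiple : ∀ g → quo f (g ⊛ monic f) ≋ g
    quo-multiple []      = ≋-refl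
    quo-multiple (a ∷ g) = ≋-trans (quo-⊕ (a · monic f) (0# ∷ (g ⊛ monic f))) (≋-trans
      (⊕-cong (≋-trans (quo-· a (monic f)) (·-cong refl quo-monic))
              (∷-cong (rem-⊛-zero g rem-monic last) (quo-multiple g)))
      (∷-cong (trans (+-identityʳ _) (*-identityʳ a)) ≋-refl))

    factor-deg : ∀ m g → (g ⊛ monic f) deg< (m ℕ.+ suc n) → g deg< m
    factor-deg m g l = deg<-≋ (quo-multiple g) (quo-deg m (g ⊛ monic f) l)

    factor-top : ∀ m g → (g ⊛ monic f) deg< (suc m ℕ.+ suc n) → coeff g m ≈ coeff (g ⊛ monic f) (suc m ℕ.+ n)
    factor-top m g l = trans (sym (at (quo-multiple g) m)) (coeff-quo-top m (g ⊛ monic f) l)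

    -- One Horner step as a polynomial identity. It carries the induction in `division`, and later
    -- shows that the conjugates of X are eigenvalues of the companion matrix.
    X-lst : ∀ r → (0# ∷ lst r) ≋ lst (step f r) ⊕ (r last · monic f)
    X-lst r = mk λ j → trans (go j) (sym (trans (coeff-⊕ (lst (step f r)) (r last · monic f) j) (+-congˡ (coeff-· (r last) (monic f) j))))
      where
      fin : ∀ (i : Fin (suc n)) → coeff (0# ∷ lst r) (toℕ i) ≈ shift f r i
      fin zero    = refl
      fin (suc i) = trans (reflexive (≡.cong (coeff (lst r)) (≡.sym (FinP.toℕ-inject₁ i)))) (coeff-lst r (inject₁ i))
      go : ∀ j → coeff (0# ∷ lst r) j ≈ coeff (lst (step f r)) j + r last * coeff (monic f) j
      go j with j ℕ.<? suc n
      ... | yes p = ≡.subst (λ j → coeff (0# ∷ lst r) j ≈ coeff (lst (step f r)) j + r last * coeff (monic f) j) (FinP.toℕ-fromℕ< p)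
          (trans (fin i) (trans (solve 2 (λ a b → a := (a :+ :- b) :+ b) refl (shift f r i) (r last * f i))
            (+-cong (sym (coeff-lst (step f r) i)) (*-congˡ (sym (coeff-monic f i))))))
        where i = fromℕ< p
      ... | no p with ℕP.m≤n⇒m<n∨m≡n (ℕP.≮⇒≥ p)
      ...   | inj₂ ≡.refl = trans (trans (reflexive (≡.cong (coeff (lst r)) (≡.sym (FinP.toℕ-fromℕ n)))) (coeff-lst r last))
                (sym (trans (+-cong (lst-deg (step f r) (suc n) ℕP.≤-refl) (trans (*-congˡ (coeff-monic-top f)) (*-identityʳ _))) (+-identityˡ _)))
      go zero    | no p | inj₁ ()
      go (suc j) | no p | inj₁ (s≤s q) = trans (lst-deg r j q) (sym (trans (+-cong (lst-deg (step f r) (suc j) (ℕP.≤-trans q (ℕP.n≤1+n j)))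
                (trans (*-congˡ (monic-deg f (suc j) (s≤s q))) (zeroʳ _))) (+-identityˡ _)))

    const-lst : ∀ a → (a ∷ []) ≋ lst (const f a)
    const-lst a = ∷-cong refl (≋-sym (lst-0 {n}))

    division : ∀ u → u ≋ lst (rem f u) ⊕ (quo f u ⊛ monic f)
    division []      = ≋-sym (≋-trans (⊕-identityʳ (lst (rem f []))) (lst-0 {suc n}))
    division (a ∷ u) = ≋-trans (mk λ { zero → sym (+-identityʳ a) ; (suc i) → refl })
      (≋-trans (⊕-cong {a ∷ []} {a ∷ []} {0# ∷ u} ≋-refl (≋-trans (∷-cong (sym (+-identityʳ 0#)) (division u)) ≋-refl))
      (≋-trans (⊕-cong (const-lst a) (⊕-cong (X-lst r) (≋-refl {w})))
      (≋-trans (⊕-cong (≋-refl {c}) (⊕-assoc s t w))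
      (≋-trans (≋-sym (⊕-assoc c s (t ⊕ w)))
      (⊕-cong (≋-sym (lst-⊕ (const f a) (step f r))) (≋-refl {t ⊕ w}))))))
      where
      r = rem f u
      c = lst (const f a)
      s = lst (step f r)
      t = r last · monic f
      w = 0# ∷ (quo f u ⊛ monic f)

    rem-zero⇒multiple : ∀ u → (∀ i → rem f u i ≈ 0#) → u ≋ quo f u ⊛ monic f
    rem-zero⇒multiple u e = ≋-trans (division u) (⊕-cong (≋-trans (lst-cong e) (lst-0 {suc n})) ≋-refl)

    rem-lst : ∀ v i → rem f (lst v) i ≈ v i
    rem-lst v i = trans (rem-short (lst v) (lst-deg v) i) (coeff-lst v i)

    infix 4 _≃_
    record _≃_ (u v : List Carrier) : Set where
      constructor mk
      field on : ∀ i → rem f u i ≈ rem f v i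
    open _≃_ public

    ≋⇒≃ : ∀ {u v} → u ≋ v → u ≃ v
    ≋⇒≃ {u} {v} e = mk (rem-cong u v e)

    ≃-rem : ∀ u → u ≃ lst (rem f u)
    ≃-rem u = mk λ i → sym (rem-lst (rem f u) i)

    quotient : CommutativeRing 0ℓ 0ℓ
    quotient = record
      { Carrier = List Carrier ; _≈_ = _≃_ ; _+_ = _⊕_ ; _*_ = _⊛_ ; -_ = neg ; 0# = [] ; 1# = one
      ; isCommutativeRing = record
        { isRing = record
          { +-isAbelianGroup = record
            { isGroup = record
              { isMonoid = record
                { isSemigroup = record
                  { isMagma = record { isEquivalence = record { refl = mk (λ i → refl) ; sym = λ e → mk λ i → sym (on e i) ; trans = ≃-trans }
                                     ; ∙-cong = λ {u} {u'} {v} {v'} e e' → mk λ i → trans (rem-⊕ u v i) (trans (+-cong (on e i) (on e' i)) (sym (rem-⊕ u' v' i))) }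
                  ; assoc = λ u v w → ≋⇒≃ (⊕-assoc u v w) }
                ; identity = (λ u → mk λ i → refl) , λ u → ≋⇒≃ (⊕-identityʳ u) }
              ; inverse = (λ u → ≋⇒≃ (≋-trans (⊕-comm (neg u) u) (⊕-inverseʳ u))) , λ u → ≋⇒≃ (⊕-inverseʳ u)
              ; ⁻¹-cong = λ {u} {v} e → mk λ i → trans (rem-neg u i) (trans (-‿cong (on e i)) (sym (rem-neg v i))) }
            ; comm = λ u v → ≋⇒≃ (⊕-comm u v) }
          ; *-cong = λ {u} {u'} {v} {v'} e e' → ≃-trans (mk (rem-⊛-cong u (on e'))) (≃-trans (≋⇒≃ (⊛-comm u v'))
                       (≃-trans (mk (rem-⊛-cong v' (on e))) (≋⇒≃ (⊛-comm v' u'))))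
          ; *-assoc = λ u v w → ≋⇒≃ (⊛-assoc u v w)
          ; *-identity = (λ u → ≋⇒≃ (⊛-identityˡ u)) , (λ u → ≋⇒≃ (≋-trans (⊛-comm u one) (⊛-identityˡ u)))
          ; distrib = (λ u v w → ≋⇒≃ (⊛-distribˡ u v w)) , λ w u v → ≋⇒≃ (⊛-distribʳ w u v) }
        ; *-comm = λ u v → ≋⇒≃ (⊛-comm u v) } }
      where
      ≃-trans : ∀ {u v w} → u ≃ v → v ≃ w → u ≃ w
      ≃-trans e e' = mk λ i → trans (on e i) (on e' i)

record Hom (R A : CommutativeRing 0ℓ 0ℓ) : Set where
  private
    module R = CommutativeRing R
    module A = CommutativeRing A
  field
    ι      : R.Carrier → A.Carrier
    ι-cong : ∀ {a b} → a R.≈ b → ι a A.≈ ι b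
    ι-+    : ∀ a b → ι (a R.+ b) A.≈ ι a A.+ ι b
    ι-*    : ∀ a b → ι (a R.* b) A.≈ ι a A.* ι b
    ι-0    : ι R.0# A.≈ A.0#
    ι-1    : ι R.1# A.≈ A.1#

  open import Algebra.Properties.Semiring.Mult R.semiring using () renaming (_×_ to _×ᴿ_)
  open import Algebra.Properties.Semiring.Mult A.semiring using () renaming (_×_ to _×ᴬ_)

  ι-× : ∀ n a → ι (n ×ᴿ a) A.≈ n ×ᴬ ι a
  ι-× zero    a = ι-0
  ι-× (suc n) a = A.trans (ι-+ a _) (A.+-congˡ (ι-× n a))

  open import Algebra.Properties.Semiring.Exp R.semiring using () renaming (_^_ to _^ᴿ_)
  open import Algebra.Properties.Semiring.Exp A.semiring using () renaming (_^_ to _^ᴬ_)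

  ι-^ : ∀ a n → ι (a ^ᴿ n) A.≈ ι a ^ᴬ n
  ι-^ a zero    = ι-1
  ι-^ a (suc n) = A.trans (ι-* a _) (A.*-congˡ (ι-^ a n))

  ι-neg : ∀ a → ι (R.- a) A.≈ A.- ι a
  ι-neg a = A.sym (unique (A.trans (A.sym (ι-+ a (R.- a))) (A.trans (ι-cong (R.-‿inverseʳ a)) ι-0)))
    where
    unique : ∀ {x y} → x A.+ y A.≈ A.0# → A.- x A.≈ y
    unique {x} {y} e = A.trans (A.sym (A.+-identityʳ _)) (A.trans (A.+-congˡ (A.sym e))
      (A.trans (A.sym (A.+-assoc _ _ _)) (A.trans (A.+-congʳ (A.-‿inverseˡ x)) (A.+-identityˡ y))))

idHom : (R : CommutativeRing 0ℓ 0ℓ) → Hom R R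
idHom R = record { ι = λ a → a ; ι-cong = λ e → e ; ι-+ = λ _ _ → refl ; ι-* = λ _ _ → refl ; ι-0 = refl ; ι-1 = refl }
  where open CommutativeRing R

infixr 9 _∘H_
_∘H_ : {R A B : CommutativeRing 0ℓ 0ℓ} → Hom A B → Hom R A → Hom R B
_∘H_ {R} {A} {B} G H = record
  { ι = λ a → G.ι (H.ι a) ; ι-cong = λ e → G.ι-cong (H.ι-cong e)
  ; ι-+ = λ a b → B.trans (G.ι-cong (H.ι-+ a b)) (G.ι-+ _ _)
  ; ι-* = λ a b → B.trans (G.ι-cong (H.ι-* a b)) (G.ι-* _ _)
  ; ι-0 = B.trans (G.ι-cong H.ι-0) G.ι-0 ; ι-1 = B.trans (G.ι-cong H.ι-1) G.ι-1 }
  where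
  module G = Hom G
  module H = Hom H
  module B = CommutativeRing B

constHom : (R : CommutativeRing 0ℓ 0ℓ) → Hom R (Poly.polyRing R)
constHom R = record
  { ι = _∷ [] ; ι-cong = λ e → ∷-cong e ≋-refl ; ι-+ = λ _ _ → ≋-refl
  ; ι-* = λ a b → ∷-cong (sym (+-identityʳ _)) ≋-refl ; ι-0 = 0∷[]≋[] ; ι-1 = ≋-refl }
  where
  open CommutativeRing R
  open Poly R

module _ (R : CommutativeRing 0ℓ 0ℓ) where
  open Poly R

  quotientHom : ∀ {n} (f : Fin (suc n) → CommutativeRing.Carrier R) → Hom polyRing (Division.quotient f)
  quotientHom f = record
    { ι = λ u → u ; ι-cong = Division.≋⇒≃ f ; ι-+ = λ _ _ → Q.refl ; ι-* = λ _ _ → Q.refl ; ι-0 = Q.refl ; ι-1 = Q.refl }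
    where module Q = CommutativeRing (Division.quotient f)

module Eval {R A : CommutativeRing 0ℓ 0ℓ} (H : Hom R A) where
  private
    module R = CommutativeRing R
  open CommutativeRing A hiding (zero)
  open Hom H
  open Poly R
  open RingTools A
  open import Algebra.Properties.CommutativeSemiring.Exp commutativeSemiring
  open import Algebra.Properties.Semiring.Sum semiring

  ev : Carrier → List R.Carrier → Carrier
  ev z []      = 0#
  ev z (a ∷ u) = ι a + z * ev z u

  ev-zero : ∀ z u → u ≋ [] → ev z u ≈ 0#
  ev-zero z []      e = refl
  ev-zero z (a ∷ u) e = trans (+-cong (trans (ι-cong (at e 0)) ι-0) (trans (*-congˡ (ev-zero z u (mk λ i → at e (suc i)))) (zeroʳ z))) (+-identityˡ _)

  ev-cong : ∀ {z z'} → z ≈ z' → ∀ u v → u ≋ v → ev z u ≈ ev z' v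
  ev-cong e []      v       f = sym (ev-zero _ v (≋-sym f))
  ev-cong e (a ∷ u) []      f = ev-zero _ (a ∷ u) f
  ev-cong e (a ∷ u) (b ∷ v) f = +-cong (ι-cong (at f 0)) (*-cong e (ev-cong e u v (mk λ i → at f (suc i))))

  ev-⊕ : ∀ z u v → ev z (u ⊕ v) ≈ ev z u + ev z v
  ev-⊕ z []      v       = sym (+-identityˡ _)
  ev-⊕ z (a ∷ u) []      = sym (+-identityʳ _)
  ev-⊕ z (a ∷ u) (b ∷ v) = trans (+-cong (ι-+ a b) (*-congˡ (ev-⊕ z u v)))
    (solve 5 (λ a b z u v → (a :+ b) :+ z :* (u :+ v) := (a :+ z :* u) :+ (b :+ z :* v)) refl (ι a) (ι b) z (ev z u) (ev z v))

  ev-· : ∀ z c u → ev z (c · u) ≈ ι c * ev z u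
  ev-· z c []      = sym (zeroʳ _)
  ev-· z c (a ∷ u) = trans (+-cong (ι-* c a) (*-congˡ (ev-· z c u)))
    (solve 4 (λ c a z u → c :* a :+ z :* (c :* u) := c :* (a :+ z :* u)) refl (ι c) (ι a) z (ev z u))

  ev-⊛ : ∀ z u v → ev z (u ⊛ v) ≈ ev z u * ev z v
  ev-⊛ z []      v = sym (zeroˡ _)
  ev-⊛ z (a ∷ u) v = trans (ev-⊕ z (a · v) (R.0# ∷ (u ⊛ v))) (trans
    (+-cong (ev-· z a v) (trans (+-congʳ ι-0) (trans (+-identityˡ _) (*-congˡ (ev-⊛ z u v)))))
    (solve 4 (λ a z u v → a :* v :+ z :* (u :* v) := (a :+ z :* u) :* v) refl (ι a) z (ev z u) (ev z v)))

  ev-lst : ∀ {n} z (v : Fin n → R.Carrier) → ev z (lst v) ≈ sum (λ i → ι (v i) * z ^ toℕ i)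
  ev-lst {zero}  z v = refl
  ev-lst {suc n} z v = +-cong (sym (*-identityʳ _)) (trans (*-congˡ (ev-lst z (λ i → v (suc i))))
    (trans (*-distribˡ-sum z (λ i → ι (v (suc i)) * z ^ toℕ i))
      (sum-cong-≋ (λ i → solve 3 (λ z a b → z :* (a :* b) := a :* (z :* b)) refl z (ι (v (suc i))) (z ^ toℕ i)))))

  ev-monic : ∀ {n} z (v : Fin n → R.Carrier) → ev z (monic v) ≈ ev z (lst v) + z ^ n
  ev-monic {zero}  z v = trans (+-cong ι-1 (zeroʳ z)) (+-comm _ _)
  ev-monic {suc n} z v = trans (+-congˡ (*-congˡ (ev-monic z (λ i → v (suc i)))))
    (solve 4 (λ a z b c → a :+ z :* (b :+ c) := (a :+ z :* b) :+ z :* c) refl (ι (v zero)) z (ev z (lst (λ i → v (suc i)))) (z ^ n))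

module _ (R : CommutativeRing 0ℓ 0ℓ) where
  open CommutativeRing R
  open Poly R

  ev-X : ∀ u → CommutativeRing._≈_ polyRing (Eval.ev (constHom R) X u) u
  ev-X []      = ≋-refl
  ev-X (a ∷ u) = ≋-trans (⊕-cong {a ∷ []} ≋-refl (≋-trans (X⊛ _) (∷-cong refl (ev-X u)))) (∷-cong (+-identityʳ a) ≋-refl)

module QuotientEval (R : CommutativeRing 0ℓ 0ℓ) {n : ℕ} (v : Fin (suc n) → CommutativeRing.Carrier R) where
  open Poly R
  open Division v

  toQuotient : Hom R quotient
  toQuotient = quotientHom R v ∘H constHom R

  ev-quotient : ∀ z u → Eval.ev toQuotient z u ≡ Eval.ev (constHom R) z u
  ev-quotient z []      = ≡.refl
  ev-quotient z (a ∷ u) = ≡.cong (λ w → (a ∷ []) ⊕ (z ⊛ w)) (ev-quotient z u)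

  -- Every class u is u(X), so the effect of Frobenius on the whole quotient is known as soon as the
  -- power X^(q^n) is.
  ev-X-quotient : ∀ u → Eval.ev toQuotient X u ≃ u
  ev-X-quotient u = ≡.subst (_≃ u) (≡.sym (ev-quotient X u)) (≋⇒≃ (ev-X R u))

-- Frobenius and elementary facts on finite fields

nC0≡1 : ∀ n → n choose 0 ≡ 1
nC0≡1 n = ≡.trans (nCk≡nC[n∸k] {k = 0} {n = n} z≤n) (nCn≡1 n)

module Frobenius (A : CommutativeRing 0ℓ 0ℓ) (q' : ℕ) where
  open CommutativeRing A hiding (zero)
  open RingTools A
  open import Algebra.Properties.CommutativeSemiring.Exp commutativeSemiring
  open import Algebra.Properties.Semiring.Sum semiring
  open import Algebra.Properties.Semiring.Mult semiring renaming (_×_ to _×ⁿ_)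
  open import Algebra.Properties.CommutativeSemiring.Binomial commutativeSemiring
  open import Relation.Binary.Reasoning.Setoid setoid
  private q = suc q'

  middle : Carrier → Carrier → Fin q' → Carrier
  middle x y i = ((q choose suc (toℕ i)) ×ⁿ 1#) * (x ^ suc (toℕ i) * y ^ (q' ℕ.∸ toℕ i))

  ^q-expand : ∀ x y → (x + y) ^ q ≈ (x ^ q + y ^ q) + sum (middle x y)
  ^q-expand x y = begin
    (x + y) ^ q                                                           ≈⟨ theorem q x y ⟩
    t zero + sum (λ i → t (suc i))                                        ≈⟨ +-cong first (trans (sum-init-last (λ i → t (suc i))) (+-cong (sum-cong-≋ mid) final)) ⟩
    y ^ q + (sum (middle x y) + x ^ q)                                    ≈⟨ solve 3 (λ a b c → a :+ (b :+ c) := (c :+ a) :+ b) refl (y ^ q) (sum (middle x y)) (x ^ q) ⟩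
    (x ^ q + y ^ q) + sum (middle x y)                                    ∎
    where
    t = binomialTerm x y q
    first : t zero ≈ y ^ q
    first = trans (×-congˡ (nC0≡1 q)) (trans (×-homo-1 _) (*-identityˡ _))
    mid : ∀ i → t (suc (inject₁ i)) ≈ middle x y i
    mid i rewrite FinP.toℕ-inject₁ i = trans (×-congʳ (q choose suc (toℕ i)) (sym (*-identityˡ _))) (sym (×-assoc-* (q choose suc (toℕ i)) 1# _))
    final : t (suc (fromℕ q')) ≈ x ^ q
    final rewrite FinP.toℕ-fromℕ q' = trans (×-congˡ (nCn≡1 q)) (trans (×-homo-1 _) (trans (*-congˡ (^-congʳ y (ℕP.n∸n≡0 q'))) (*-identityʳ _)))

  -- The criterion for additivity of z ↦ z^q, posed at q itself rather than through the prime p. It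
  -- is proved once in F and transported to every F-algebra.
  BinomialsVanish : Set
  BinomialsVanish = ∀ (i : Fin q') → (q choose suc (toℕ i)) ×ⁿ 1# ≈ 0#

  module Additive (vanish : BinomialsVanish) where
    ^q-+ : ∀ x y → (x + y) ^ q ≈ x ^ q + y ^ q
    ^q-+ x y = trans (^q-expand x y) (trans (+-congˡ (trans (sum-cong-≋ (λ i → trans (*-congʳ (vanish i)) (zeroˡ _))) (sum-replicate-zero q'))) (+-identityʳ _))

    ^qⁿ-+ : ∀ n x y → (x + y) ^ (q ℕ.^ n) ≈ x ^ (q ℕ.^ n) + y ^ (q ℕ.^ n)
    ^qⁿ-+ zero    x y = trans (*-identityʳ _) (sym (+-cong (*-identityʳ _) (*-identityʳ _)))
    ^qⁿ-+ (suc n) x y = begin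
      (x + y) ^ (q ℕ.* q ℕ.^ n)                              ≈⟨ sym (^-assocʳ (x + y) q (q ℕ.^ n)) ⟩
      ((x + y) ^ q) ^ (q ℕ.^ n)                              ≈⟨ ^-congˡ (q ℕ.^ n) (^q-+ x y) ⟩
      (x ^ q + y ^ q) ^ (q ℕ.^ n)                            ≈⟨ ^qⁿ-+ n (x ^ q) (y ^ q) ⟩
      (x ^ q) ^ (q ℕ.^ n) + (y ^ q) ^ (q ℕ.^ n)              ≈⟨ +-cong (^-assocʳ x q (q ℕ.^ n)) (^-assocʳ y q (q ℕ.^ n)) ⟩
      x ^ (q ℕ.* q ℕ.^ n) + y ^ (q ℕ.* q ℕ.^ n)              ∎

module FieldFacts (K : FiniteField) where
  open FiniteField K using (commRing; elements; complete; distinct; _≟_; inverse; 0≉1) renaming (card to q)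
  open CommutativeRing commRing hiding (zero)
  open RingTools commRing
  open import Algebra.Properties.CommutativeSemiring.Exp commutativeSemiring
  open import Algebra.Properties.Semiring.Sum semiring
  open import Algebra.Properties.Semiring.Mult semiring using () renaming (_×_ to _×ⁿ_)
  open import Relation.Binary.Reasoning.Setoid setoid
  open Poly commRing
  open Eval (idHom commRing)

  private
    once : ∀ {xs} a → Any (a ≈_) xs → AllPairs (λ x y → ¬ (x ≈ y)) xs → ∑ xs (λ x → ⟦ x ≟ a ⟧) ≡ 1
    once {x ∷ xs} a (here e) (ne ∷ _) = ≡.cong₂ ℕ._+_ (⟦⟧-yes (x ≟ a) (sym e)) (none xs ne)
      where
      none : ∀ ys → All (λ y → ¬ (x ≈ y)) ys → ∑ ys (λ y → ⟦ y ≟ a ⟧) ≡ 0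
      none []       []       = ≡.refl
      none (y ∷ ys) (n ∷ ns) = ≡.cong₂ ℕ._+_ (⟦⟧-no (y ≟ a) (λ e' → n (trans (sym e) (sym e')))) (none ys ns)
    once {x ∷ xs} a (there p) (ne ∷ ds) = ≡.cong₂ ℕ._+_ (⟦⟧-no (x ≟ a) (λ e → absurd xs ne p e)) (once a p ds)
      where
      absurd : ∀ ys → All (λ y → ¬ (x ≈ y)) ys → Any (a ≈_) ys → ¬ (x ≈ a)
      absurd (y ∷ ys) (n ∷ ns) (here e)  e' = n (trans e' e)
      absurd (y ∷ ys) (n ∷ ns) (there p) e' = absurd ys ns p e'

  finite : Finite
  finite = record { Carrier = Carrier ; _≈_ = _≈_ ; isEquivalence = isEquivalence ; _≟_ = _≟_ ; list = elements
                  ; once = λ a → once a (complete a) distinct }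

  noZeroDivisors : ∀ {x y} → x * y ≈ 0# → x ≈ 0# ⊎ y ≈ 0#
  noZeroDivisors {x} {y} e with x ≟ 0#
  ... | yes p = inj₁ p
  ... | no n  = inj₂ (begin
    y              ≈⟨ sym (*-identityˡ y) ⟩
    1# * y         ≈⟨ *-congʳ (sym (proj₂ (inverse x n))) ⟩
    x * x' * y     ≈⟨ solve 3 (λ a b c → a :* b :* c := b :* (a :* c)) refl x x' y ⟩
    x' * (x * y)   ≈⟨ trans (*-congˡ e) (zeroʳ x') ⟩
    0#             ∎)
    where x' = proj₁ (inverse x n)

  *-nonzero : ∀ {x y} → ¬ (x ≈ 0#) → ¬ (y ≈ 0#) → ¬ (x * y ≈ 0#)
  *-nonzero nx ny e with noZeroDivisors e
  ... | inj₁ p = nx p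
  ... | inj₂ p = ny p

  ^-nonzero : ∀ {x} → ¬ (x ≈ 0#) → ∀ n → ¬ (x ^ n ≈ 0#)
  ^-nonzero nx zero    e = 0≉1 (sym e)
  ^-nonzero nx (suc n) e = *-nonzero nx (^-nonzero nx n) e

  ^-zero⇒zero : ∀ x n → x ^ n ≈ 0# → x ≈ 0#
  ^-zero⇒zero x n e with x ≟ 0#
  ... | yes p = p
  ... | no p  = ⊥-elim (^-nonzero p n e)

  x-y≈0⇒x≈y : ∀ {x y} → x - y ≈ 0# → x ≈ y
  x-y≈0⇒x≈y {x} {y} e = trans (solve 2 (λ x y → x := (x :- y) :+ y) refl x y) (trans (+-congʳ e) (+-identityˡ y))

  *-cancelˡ : ∀ {a x y} → ¬ (a ≈ 0#) → a * x ≈ a * y → x ≈ y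
  *-cancelˡ {a} {x} {y} n e with noZeroDivisors {a} {x - y} (begin
    a * (x - y)       ≈⟨ solve 3 (λ a x y → a :* (x :- y) := a :* x :- a :* y) refl a x y ⟩
    a * x - a * y     ≈⟨ trans (+-congʳ e) (-‿inverseʳ _) ⟩
    0#                ∎)
  ... | inj₁ p = ⊥-elim (n p)
  ... | inj₂ p = x-y≈0⇒x≈y p

  q≥2 : 2 ≤ q
  q≥2 = two elements (complete 0#) (complete 1#)
    where
    two : ∀ xs → Any (0# ≈_) xs → Any (1# ≈_) xs → 2 ≤ length xs
    two (x ∷ [])     (here e) (here e') = ⊥-elim (0≉1 (trans e (sym e')))
    two (x ∷ y ∷ xs) _        _         = s≤s (s≤s z≤n)

  private
    module Π = BigOp *-commutativeMonoid

    -- Multiplication by a permutes the nonzero elements, so their product is unchanged and can be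
    -- cancelled. The products run over the whole list: `g` and `t` take the value 1 at zero, and
    -- `s` carries the factor a left over there.
    fermat-unit : ∀ a → ¬ (a ≈ 0#) → a ^ q ≈ a
    fermat-unit a a≉0 = begin
      a ^ q                                 ≈⟨ sym (Π.⨁-const elements a) ⟩
      Π.⨁ elements (λ _ → a)                ≈⟨ Π.⨁-cong elements (λ y → sym (ts y)) ⟩
      Π.⨁ elements (λ y → t y * s y)        ≈⟨ Π.⨁-∙ elements t s ⟩
      Π.⨁ elements t * Π.⨁ elements s       ≈⟨ *-cong Πt Πs ⟩
      1# * a                                ≈⟨ *-identityˡ a ⟩
      a                                     ∎
      where
      a' = proj₁ (inverse a a≉0)
      aa' = proj₂ (inverse a a≉0)
      g t s : Carrier → Carrier
      g y with y ≟ 0#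
      ... | yes _ = 1#
      ... | no _  = y
      t y with y ≟ 0#
      ... | yes _ = 1#
      ... | no _  = a
      s y = Π.when (y ≟ 0#) a
      ts : ∀ y → t y * s y ≈ a
      ts y with y ≟ 0#
      ... | yes _ = *-identityˡ a
      ... | no _  = *-identityʳ a
      g-cong : ∀ {y z} → y ≈ z → g y ≈ g z
      g-cong {y} {z} e with y ≟ 0# | z ≟ 0#
      ... | yes _ | yes _ = refl
      ... | yes p | no n  = ⊥-elim (n (trans (sym e) p))
      ... | no n  | yes p = ⊥-elim (n (trans e p))
      ... | no _  | no _  = e
      g-a : ∀ y → g (a * y) ≈ t y * g y
      g-a y with y ≟ 0# | (a * y) ≟ 0#
      ... | yes _ | yes _ = sym (*-identityˡ _)
      ... | yes p | no n  = ⊥-elim (n (trans (*-congˡ p) (zeroʳ a)))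
      ... | no n  | yes p = ⊥-elim (*-nonzero a≉0 n p)
      ... | no _  | no _  = refl
      g-nonzero : ∀ y → ¬ (g y ≈ 0#)
      g-nonzero y e with y ≟ 0#
      ... | yes _ = 0≉1 (sym e)
      ... | no n  = n e
      Πg = Π.⨁ elements g
      Πg-nonzero : ∀ ys → ¬ (Π.⨁ ys g ≈ 0#)
      Πg-nonzero []       e = 0≉1 (sym e)
      Πg-nonzero (y ∷ ys) e = *-nonzero (g-nonzero y) (Πg-nonzero ys) e
      Πs : Π.⨁ elements s ≈ a
      Πs = Reindex.pick *-commutativeMonoid finite 0# (λ _ → a) (λ _ → refl)
      Πt : Π.⨁ elements t ≈ 1#
      Πt = *-cancelˡ (Πg-nonzero elements) (begin
        Πg * Π.⨁ elements t                        ≈⟨ *-comm _ _ ⟩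
        Π.⨁ elements t * Πg                        ≈⟨ sym (Π.⨁-∙ elements t g) ⟩
        Π.⨁ elements (λ y → t y * g y)             ≈⟨ Π.⨁-cong elements (λ y → sym (g-a y)) ⟩
        Π.⨁ elements (λ y → g (a * y))             ≈⟨ sym (Reindex.reindex *-commutativeMonoid finite finite (a *_) (a' *_) to from g g-cong) ⟩
        Πg                                         ≈⟨ sym (*-identityʳ _) ⟩
        Πg * 1#                                    ∎)
        where
        cancel : ∀ {u v} → u * v ≈ 1# → ∀ z → u * (v * z) ≈ z
        cancel e z = trans (sym (*-assoc _ _ _)) (trans (*-congʳ e) (*-identityˡ z))
        to : ∀ {y z} → y ≈ a' * z → z ≈ a * y
        to {y} {z} e = trans (sym (cancel aa' z)) (*-congˡ (sym e))
        from : ∀ {y z} → z ≈ a * y → y ≈ a' * z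
        from {y} {z} e = trans (sym (cancel (trans (*-comm a' a) aa') y)) (*-congˡ (sym e))

  0^suc : ∀ {n} → 1 ≤ n → 0# ^ n ≈ 0#
  0^suc (s≤s _) = zeroˡ _

  fermat : ∀ a → a ^ q ≈ a
  fermat a with a ≟ 0#
  ... | no n  = fermat-unit a n
  ... | yes p = trans (^-congˡ q p) (trans (0^suc (ℕP.≤-trans (s≤s z≤n) q≥2)) (sym p))

  fermatⁿ : ∀ n a → a ^ (q ℕ.^ n) ≈ a
  fermatⁿ zero    a = *-identityʳ a
  fermatⁿ (suc n) a = trans (sym (^-assocʳ a q (q ℕ.^ n))) (trans (^-congˡ (q ℕ.^ n) (fermat a)) (fermatⁿ n a))

  -- Dividing by X - θ₀ leaves the remainder u(θ₀) = 0, and the quotient keeps the other roots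
  -- because θᵢ - θ₀ is not a zero divisor.
  roots : ∀ {m} (θ : Fin m → Carrier) → (∀ i j → i ≢ j → ¬ (θ i ≈ θ j)) →
    ∀ u → u deg< m → (∀ i → ev (θ i) u ≈ 0#) → u ≋ []
  roots {zero}  θ dist u l root = deg<0⇒≋[] l
  roots {suc m} θ dist u l root = ≋-trans u≋ (≋-trans (⊛-cong {quo f u} {[]} {monic f} quo≋ ≋-refl) ≋-refl)
    where
    f : Fin 1 → Carrier
    f _ = - θ zero
    open Division f
    ev-f : ∀ z → ev z (monic f) ≈ z - θ zero
    ev-f z = trans (+-congˡ (*-congˡ (trans (+-congˡ (zeroʳ z)) (+-identityʳ 1#)))) (trans (+-congˡ (*-identityʳ z)) (+-comm _ _))
    ev-division : ∀ z → ev z u ≈ rem f u zero + ev z (quo f u) * (z - θ zero)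
    ev-division z = trans (ev-cong refl u _ (division u)) (trans (ev-⊕ z (lst (rem f u)) (quo f u ⊛ monic f))
      (+-cong (trans (+-congˡ (zeroʳ z)) (+-identityʳ _)) (trans (ev-⊛ z (quo f u) (monic f)) (*-congˡ (ev-f z)))))
    r≈0 : rem f u zero ≈ 0#
    r≈0 = trans (sym (trans (ev-division (θ zero)) (trans (+-congˡ (trans (*-congˡ (-‿inverseʳ _)) (zeroʳ _))) (+-identityʳ _)))) (root zero)
    u≋ : u ≋ quo f u ⊛ monic f
    u≋ = rem-zero⇒multiple u λ { zero → r≈0 }
    root' : ∀ i → ev (θ (suc i)) (quo f u) ≈ 0#
    root' i with noZeroDivisors (trans (sym (trans (ev-division (θ (suc i))) (trans (+-congʳ r≈0) (+-identityˡ _)))) (root (suc i)))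
    ... | inj₁ p = p
    ... | inj₂ p = ⊥-elim (dist (suc i) zero (λ ()) (x-y≈0⇒x≈y p))
    quo≋ : quo f u ≋ []
    quo≋ = roots (λ i → θ (suc i)) (λ i j ne → dist (suc i) (suc j) (λ e → ne (FinP.suc-injective e))) (quo f u)
      (quo-deg m u (deg<-mono {u} (ℕP.≤-reflexive (ℕP.+-comm 1 m)) l)) root'

  lookup-distinct : ∀ {xs : List Carrier} → AllPairs (λ x y → ¬ (x ≈ y)) xs → ∀ i j → i ≢ j → ¬ (lookup xs i ≈ lookup xs j)
  lookup-distinct (ne ∷ ds) zero    zero    n e = n ≡.refl
  lookup-distinct (ne ∷ ds) zero    (suc j) n e = All.lookupAny ne (Any.map (λ p → p) (anyAt _ j)) |> λ (n' , e') → n' (trans e e')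
    where
    anyAt : ∀ xs (j : Fin (length xs)) → Any (lookup xs j ≈_) xs
    anyAt (x ∷ xs) zero    = here refl
    anyAt (x ∷ xs) (suc j) = there (anyAt xs j)
    _|>_ : ∀ {a b} {A : Set a} {B : Set b} → A → (A → B) → B
    x |> f = f x
  lookup-distinct (ne ∷ ds) (suc i) zero    n e = lookup-distinct (ne ∷ ds) zero (suc i) (λ ()) (sym e)
  lookup-distinct (ne ∷ ds) (suc i) (suc j) n e = lookup-distinct ds i j (λ p → n (≡.cong suc p)) e

  vanishing : ∀ u → u deg< q → (∀ a → ev a u ≈ 0#) → u ≋ []
  vanishing u l root = roots (lookup elements) (lookup-distinct distinct) u l (λ i → root (lookup elements i))

  -- X ↦ (X+1)^q - X^q - 1 has degree < q and, by Fermat, q roots.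
  binomialsVanish : ∀ q' → q ≡ suc q' → Frobenius.BinomialsVanish commRing q'
  binomialsVanish q' e i = trans (sym (coeff-lst c i)) (at zero-poly (suc (toℕ i)))
    where
    open Frobenius commRing q'
    c : Fin q' → Carrier
    c i = (suc q' choose suc (toℕ i)) ×ⁿ 1#
    fermat' : ∀ a → a ^ suc q' ≈ a
    fermat' a = ≡.subst (λ z → a ^ z ≈ a) e (fermat a)
    1^ : ∀ n → 1# ^ n ≈ 1#
    1^ zero    = refl
    1^ (suc n) = trans (*-identityˡ _) (1^ n)
    mid : ∀ a → sum (middle a 1#) ≈ 0#
    mid a = begin
      sum (middle a 1#)                                                ≈⟨ solve 3 (λ m x y → m := (((x :+ y) :+ m) :- x) :- y) refl (sum (middle a 1#)) (a ^ suc q') (1# ^ suc q') ⟩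
      (((a ^ suc q' + 1# ^ suc q') + sum (middle a 1#)) - a ^ suc q') - 1# ^ suc q'    ≈⟨ +-cong (+-cong (sym (^q-expand a 1#)) (-‿cong (fermat' a))) (-‿cong (1^ (suc q'))) ⟩
      ((a + 1#) ^ suc q' - a) - 1#                                     ≈⟨ +-congʳ (+-congʳ (fermat' (a + 1#))) ⟩
      ((a + 1#) - a) - 1#                                              ≈⟨ solve 2 (λ a b → ((a :+ b) :- a) :- b := a :- a) refl a 1# ⟩
      a - a                                                            ≈⟨ -‿inverseʳ a ⟩
      0#                                                               ∎
    ev≈ : ∀ a → ev a (0# ∷ lst c) ≈ 0#
    ev≈ a = trans (+-identityˡ _) (trans (*-congˡ (ev-lst a c)) (trans (*-distribˡ-sum a (λ i → c i * a ^ toℕ i))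
      (trans (sum-cong-≋ (λ i → trans (solve 3 (λ a c b → a :* (c :* b) := c :* (a :* b)) refl a (c i) (a ^ toℕ i))
        (*-congˡ {c i} (trans (sym (*-identityʳ (a * a ^ toℕ i))) (*-congˡ (sym (1^ (q' ℕ.∸ toℕ i)))))))) (mid a))))
    zero-poly : (0# ∷ lst c) ≋ []
    zero-poly = vanishing (0# ∷ lst c) deg ev≈
      where
      deg : (0# ∷ lst c) deg< q
      deg rewrite e = λ { (suc i) (s≤s p) → lst-deg c i p }

once⇒distinct : ∀ {A : Set} {_≈_ : A → A → Set} (_≟_ : ∀ x y → Dec (x ≈ y)) → (∀ {x} → x ≈ x) → (∀ {x y} → x ≈ y → y ≈ x) →
  (xs : List A) → (∀ a → ∑ xs (λ x → ⟦ x ≟ a ⟧) ≤ 1) → AllPairs (λ x y → ¬ (x ≈ y)) xs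
once⇒distinct         _≟_ r s []       h = []
once⇒distinct {A} {_≈_} _≟_ r s (x ∷ xs) h = All.tabulate (λ {y} y∈ e → ℕP.<⇒≱ (ℕP.n<1+n 1) (ℕP.≤-trans (two y∈ e) (h x)))
  ∷ once⇒distinct _≟_ r s xs (λ a → ℕP.≤-trans (ℕP.m≤n+m _ _) (h a))
  where
  open import Data.List.Membership.Propositional using (_∈_)
  two : ∀ {y} → y ∈ xs → x ≈ y → 2 ≤ ⟦ x ≟ x ⟧ ℕ.+ ∑ xs (λ z → ⟦ z ≟ x ⟧)
  two y∈ e = ℕP.+-mono-≤ (ℕP.≤-reflexive (≡.sym (⟦⟧-yes (x ≟ x) r)))
                         (Any-∑ (_≟ x) xs (Any.map (λ { ≡.refl → s e }) y∈))

sumTo : ℕ → (ℕ → ℕ) → ℕ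
sumTo zero    f = 0
sumTo (suc n) f = sumTo n f ℕ.+ f n

sumTo-≤ : ∀ n {f g} → (∀ i → i < n → f i ≤ g i) → sumTo n f ≤ sumTo n g
sumTo-≤ zero    e = z≤n
sumTo-≤ (suc n) e = ℕP.+-mono-≤ (sumTo-≤ n (λ i p → e i (ℕP.m≤n⇒m≤1+n p))) (e n ℕP.≤-refl)

sumTo-term : ∀ n f {i} → i < n → f i ≤ sumTo n f
sumTo-term (suc n) f {i} (s≤s p) with ℕP.m≤n⇒m<n∨m≡n p
... | inj₁ q      = ℕP.≤-trans (sumTo-term n f q) (ℕP.m≤m+n _ _)
... | inj₂ ≡.refl = ℕP.m≤n+m _ _

∑-sumTo : {A : Set} (xs : List A) (n : ℕ) (f : A → ℕ → ℕ) → ∑ xs (λ x → sumTo n (f x)) ≡ sumTo n (λ i → ∑ xs (λ x → f x i))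
∑-sumTo xs zero    f = ∑-0 xs
∑-sumTo xs (suc n) f = ≡.trans (∑-+ xs _ _) (≡.cong (ℕ._+ ∑ xs (λ x → f x n)) (∑-sumTo xs n f))

-- Irreducible polynomials over a finite field

module Factorisation (F : FiniteField) where
  open FiniteField F using (commRing; _≟_; inverse; 0≉1) renaming (card to q)
  open CommutativeRing commRing hiding (zero)
  open FieldFacts F using (finite; q≥2; binomialsVanish; fermatⁿ)
  open Poly commRing

  Vec : ℕ → Finite
  Vec n = n ⇒ finite

  module _ {n : ℕ} (v : Fin (suc n) → Carrier) where
    open Division v

    InverseOf : (w w' : Fin (suc n) → Carrier) → Set
    InverseOf w w' = ∀ i → rem v (lst w ⊛ lst w') i ≈ rem v one i

    NotInvertible : (Fin (suc n) → Carrier) → Set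
    NotInvertible w = ¬ (∀ i → w i ≈ 0#) × ¬ ∃ (InverseOf w)

    private
      inverse? : ∀ w → Dec (∃ (InverseOf w))
      inverse? w = Finite.search (Vec (suc n)) (λ w' → FinP.all? (λ i → rem v (lst w ⊛ lst w') i ≟ rem v one i))
        (λ {x} {y} e p i → trans (rem-cong (lst w ⊛ lst y) (lst w ⊛ lst x) (⊛-congˡ (lst w) (lst-cong (λ i → sym (e i)))) i) (p i))

      resp : ∀ {w w'} → (∀ i → w i ≈ w' i) → NotInvertible w → NotInvertible w'
      resp {w} {w'} e (n , m) = (λ z → n (λ i → trans (e i) (z i))) ,
        λ (w'' , p) → m (w'' , λ i → trans (rem-cong (lst w ⊛ lst w'') (lst w' ⊛ lst w'') (⊛-cong {lst w} {lst w'} {lst w''} (lst-cong e) ≋-refl) i) (p i))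

    -- Irreducibility as "the quotient is a field", phrased as the absence of a nonzero
    -- non-invertible remainder: it is decidable by search and gives the residue field directly.
    Irr : Set
    Irr = ¬ ∃ NotInvertible

    irr? : Dec Irr
    irr? = ¬? (Finite.search (Vec (suc n)) (λ w → ¬? (FinP.all? (λ i → w i ≟ 0#)) ×-dec ¬? (inverse? w)) resp)

    private module K = CommutativeRing quotient

    invert : Irr → ∀ u → ¬ (u ≃ []) → ∃ λ u' → u ⊛ u' ≃ one
    invert irr u u≄0 with inverse? (rem v u)
    ... | yes (w' , p) = lst w' , K.trans (K.*-congʳ {lst w'} (≃-rem u)) (mk p)
    ... | no ¬p = ⊥-elim (irr (rem v u , (λ z → u≄0 (mk z)) , ¬p))

    private
      dec : ∀ u u' → Dec (u ≃ u')
      dec u u' = map′ mk on (FinP.all? (λ i → rem v u i ≟ rem v u' i))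

      one≄0 : ¬ ([] ≃ one)
      one≄0 e = 0≉1 (trans (on e zero) (rem-short one (λ { (suc i) _ → refl }) zero))

    residueField : Irr → FiniteField
    residueField irr = record
      { commRing = quotient ; _≟_ = dec ; 0≉1 = one≄0 ; inverse = invert irr
      ; elements = map lst (list (Vec (suc n)))
      ; complete = λ u → AnyP.map⁺ (Any.map (λ {x} e → mk λ i → trans (sym (e i)) (sym (rem-lst x i))) (Finite.complete (Vec (suc n)) (rem v u)))
      ; distinct = AllPairsP.map⁺ (AllPairs.map (λ {x} {y} ne e → ne (λ i → trans (sym (rem-lst x i)) (trans (on e i) (rem-lst y i))))
          (once⇒distinct (Finite._≟_ (Vec (suc n))) (λ i → refl) (λ e i → sym (e i)) (list (Vec (suc n)))
            (λ a → ℕP.≤-reflexive (Finite.once (Vec (suc n)) a))))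
      }
      where open Finite using (list)

    residueField-card : ∀ irr → FiniteField.card (residueField irr) ≡ q ℕ.^ suc n
    residueField-card irr = ≡.trans (length-map lst (Finite.list (Vec (suc n)))) (card-⇒ (suc n) finite)

  q' : ℕ
  q' = ℕ.pred q

  q≡suc : q ≡ suc q'
  q≡suc with q | q≥2
  ... | suc _ | _ = ≡.refl

  q≥1 : 1 ≤ q
  q≥1 = ℕP.≤-trans (s≤s z≤n) q≥2

  qⁿ≥1 : ∀ n → 1 ≤ q ℕ.^ n
  qⁿ≥1 n = ℕP.≤-trans (ℕP.≤-reflexive (≡.sym (ℕP.^-zeroˡ n))) (ℕP.^-monoˡ-≤ n q≥1)

  module FAlgebra (A : CommutativeRing 0ℓ 0ℓ) (H : Hom commRing A) where
    private module A = CommutativeRing A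
    open import Algebra.Properties.CommutativeSemiring.Exp A.commutativeSemiring
    open Hom H
    open Eval H
    open Frobenius A q'

    vanish : BinomialsVanish
    vanish i = A.trans (×-congʳ (suc q' choose suc (toℕ i)) (A.sym ι-1)) (A.trans (A.sym (ι-× (suc q' choose suc (toℕ i)) 1#))
      (A.trans (ι-cong (binomialsVanish q' q≡suc i)) ι-0))
      where open import Algebra.Properties.Semiring.Mult A.semiring using (×-congʳ)

    ^qⁿ-+ : ∀ n x y → (x A.+ y) ^ (q ℕ.^ n) A.≈ x ^ (q ℕ.^ n) A.+ y ^ (q ℕ.^ n)
    ^qⁿ-+ n x y = ≡.subst (λ z → (x A.+ y) ^ (z ℕ.^ n) A.≈ x ^ (z ℕ.^ n) A.+ y ^ (z ℕ.^ n)) (≡.sym q≡suc) (Additive.^qⁿ-+ vanish n x y)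

    ι-^qⁿ : ∀ n a → ι a ^ (q ℕ.^ n) A.≈ ι a
    ι-^qⁿ n a = A.trans (A.sym (ι-^ a (q ℕ.^ n))) (ι-cong (fermatⁿ n a))

    0^qⁿ : ∀ n → A.0# ^ (q ℕ.^ n) A.≈ A.0#
    0^qⁿ n with q ℕ.^ n | qⁿ≥1 n
    ... | suc _ | _ = A.zeroˡ _

    -- Coefficients are fixed by Frobenius, by Fermat in F, so it acts on the point alone.
    ev-^qⁿ : ∀ n z u → ev z u ^ (q ℕ.^ n) A.≈ ev (z ^ (q ℕ.^ n)) u
    ev-^qⁿ n z []      = 0^qⁿ n
    ev-^qⁿ n z (a ∷ u) = A.trans (^qⁿ-+ n (ι a) (z A.* ev z u)) (A.+-cong (ι-^qⁿ n a)
      (A.trans (^-distrib-* z (ev z u) (q ℕ.^ n)) (A.*-congˡ (ev-^qⁿ n z u))))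

  module _ {n : ℕ} (v : Fin (suc n) → Carrier) where
    open QuotientEval commRing v public using (toQuotient; ev-X-quotient)

  -- Inverses modulo v by Euclid's algorithm: dividing v by a polynomial of smaller degree always leaves a nonzero remainder.
  module _ {n : ℕ} (v : Fin (suc n) → Carrier)
    (noDivisor : ∀ {m} → m < n → (w : Fin (suc m) → Carrier) → ¬ (∀ i → rem w (monic v) i ≈ 0#)) where
    open Division v
    private module K = CommutativeRing quotient
    open RingTools quotient

    private
      leading : ∀ m → m ≤ n → (∀ u → u deg< m → ¬ (u ≋ []) → ∃ λ u' → u ⊛ u' ≃ one) →
        ∀ u → u deg< suc m → ¬ (coeff u m ≈ 0#) → ∃ λ u' → u ⊛ u' ≃ one
      leading zero p _ u l c≉0 = (c' ∷ []) , K.trans (≋⇒≃ (⊛-cong {u} {c ∷ []} {c' ∷ []} u≋ ≋-refl))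
          (≋⇒≃ (≋-trans (const-⊛ c (c' ∷ [])) (∷-cong (proj₂ (inverse c c≉0)) ≋-refl)))
        where
        c = coeff u 0
        c' = proj₁ (inverse c c≉0)
        u≋ : u ≋ (c ∷ [])
        u≋ = mk λ { zero → refl ; (suc i) → l (suc i) (s≤s z≤n) }
      leading (suc m) m<n rec u l c≉0 = result
        where
        c = coeff u (suc m)
        c' = proj₁ (inverse c c≉0)
        u₁ = c' · u
        w : Fin (suc m) → Carrier
        w i = coeff u₁ (toℕ i)
        u₁≋ : u₁ ≋ monic w
        u₁≋ = monic-coeff u₁ (λ i p → trans (coeff-· c' u i) (trans (*-congˡ (l i p)) (zeroʳ c')))
                            (trans (coeff-· c' u (suc m)) (trans (*-comm c' c) (proj₂ (inverse c c≉0))))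
        r = lst (rem w (monic v))
        g = quo w (monic v)
        r≉0 : ¬ (r ≋ [])
        r≉0 e = noDivisor m<n w (λ i → trans (sym (coeff-lst (rem w (monic v)) i)) (at e (toℕ i)))
        ih = rec r (lst-deg (rem w (monic v))) r≉0
        r' = proj₁ ih
        0≃ : [] ≃ r ⊕ (g ⊛ ((c' ∷ []) ⊛ u))
        0≃ = K.trans (K.sym (mk λ i → rem-monic i)) (≋⇒≃ (≋-trans (Division.division w (monic v))
               (⊕-cong (≋-refl {r}) (⊛-congˡ g (≋-trans (≋-sym u₁≋) (≋-sym (const-⊛ c' u)))))))
        result : ∃ λ u' → u ⊛ u' ≃ one
        -- Modulo v one has 0 = r + g c' u and r r' = 1, so -g c' r' inverts u.
        result = (neg (g ⊛ (c' ∷ [])) ⊛ r') , K.trans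
          (solve 5 (λ u g c r' r → u :* ((:- (g :* c)) :* r') := r :* r' :- (r :+ g :* (c :* u)) :* r') K.refl u g (c' ∷ []) r' r)
          (K.trans (K.+-cong (proj₂ ih) (K.-‿cong (K.trans (K.*-congʳ {r'} (K.sym 0≃)) (K.zeroˡ r')))) (≋⇒≃ (⊕-identityʳ one)))

    bezout : ∀ m → m ≤ suc n → ∀ u → u deg< m → ¬ (u ≋ []) → ∃ λ u' → u ⊛ u' ≃ one
    bezout zero    _ u l u≉0 = ⊥-elim (u≉0 (deg<0⇒≋[] l))
    bezout (suc m) (s≤s p) u l u≉0 with coeff u m ≟ 0#
    ... | no c≉0 = leading m p (bezout m (ℕP.m≤n⇒m≤1+n p)) u l c≉0
    ... | yes e  = bezout m (ℕP.m≤n⇒m≤1+n p) u l' u≉0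
      where
      l' : u deg< m
      l' i m≤i with ℕP.m≤n⇒m<n∨m≡n m≤i
      ... | inj₁ m<i    = l i m<i
      ... | inj₂ ≡.refl = e

    noDivisor⇒Irr : Irr v
    noDivisor⇒Irr (w , w≉0 , none) = none (rem v u' , λ i → trans (sym (on (K.*-congˡ {lst w} {u'} {lst (rem v u')} (≃-rem u')) i)) (on (proj₂ b) i))
      where
      b = bezout (suc n) ℕP.≤-refl (lst w) (lst-deg w) (λ e → w≉0 (λ i → trans (sym (coeff-lst w i)) (at e (toℕ i))))
      u' = proj₁ b

  record Irreducible : Set where
    constructor irreducible
    field
      {pred-deg} : ℕ
      lower      : Fin (suc pred-deg) → Carrier
      irr        : Irr lower

    deg : ℕ
    deg = suc pred-deg

    poly : List Carrier
    poly = monic lower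

    field' : FiniteField
    field' = residueField lower irr

  open Irreducible using (deg; poly; lower; field')

  infix 4 _∣ᴾ_
  _∣ᴾ_ : Irreducible → List Carrier → Set
  P ∣ᴾ u = ∀ i → rem (lower P) u i ≈ 0#

  ∣-multiple : ∀ P u → P ∣ᴾ (u ⊛ poly P)
  ∣-multiple P u = Division.rem-⊛-zero (lower P) u (Division.rem-monic (lower P))

  ∣-≋ : ∀ P {u v} → u ≋ v → P ∣ᴾ u → P ∣ᴾ v
  ∣-≋ P {u} {v} e p i = trans (sym (Division.rem-cong (lower P) u v e i)) (p i)

  ∣-⊛ : ∀ P u v → P ∣ᴾ (u ⊛ v) → P ∣ᴾ u ⊎ P ∣ᴾ v
  ∣-⊛ P u v p with FieldFacts.noZeroDivisors (field' P) {u} {v} (Division.mk p)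
  ... | inj₁ e = inj₁ (Division._≃_.on e)
  ... | inj₂ e = inj₂ (Division._≃_.on e)

  poly≉0 : ∀ {n} (w : Fin n → Carrier) → ¬ (monic w ≋ [])
  poly≉0 {n} w e = 0≉1 (trans (sym (at e n)) (coeff-monic-top w))

  ¬∣-small : ∀ P u → u deg< deg P → ¬ (u ≋ []) → ¬ (P ∣ᴾ u)
  ¬∣-small P u l u≉0 p = u≉0 (≋-trans (Division.rem-zero⇒multiple (lower P) u p)
    (⊛-cong {quo (lower P) u} {[]} {poly P} (deg<0⇒≋[] (Division.quo-deg (lower P) 0 u l)) ≋-refl))

  -- Compare degrees. If P' is smaller, then P = S P' would divide one of two nonzero polynomials of
  -- smaller degree, as F[x]/P has no zero divisors. In equal degree the cofactor is constant, with
  -- leading coefficient 1.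
  irreducible-∣ : ∀ P P' → P' ∣ᴾ poly P → poly P ≋ poly P'
  irreducible-∣ P P' p with ℕP.<-cmp (deg P) (deg P')
  ... | tri< l _ _ = ⊥-elim (¬∣-small P' (poly P) (deg<-mono {poly P} l (monic-deg (lower P))) (poly≉0 (lower P)) p)
  ... | tri≈ _ e _ = ≋-trans P≋ (≋-trans (⊛-cong {S} {one} {poly P'} S≋one ≋-refl) (⊛-identityˡ (poly P')))
    where
    S = quo (lower P') (poly P)
    P≋ : poly P ≋ S ⊛ poly P'
    P≋ = Division.rem-zero⇒multiple (lower P') (poly P) p
    l : (S ⊛ poly P') deg< (1 ℕ.+ deg P')
    l = deg<-≋ P≋ (≡.subst (λ z → poly P deg< suc z) e (monic-deg (lower P)))
    S≋one : S ≋ one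
    S≋one = mk λ { zero → trans (Division.factor-top (lower P') 0 S l) (trans (sym (at P≋ (deg P')))
                     (≡.subst (λ z → coeff (poly P) z ≈ 1#) e (coeff-monic-top (lower P))))
                 ; (suc i) → Division.factor-deg (lower P') 1 S l (suc i) (s≤s z≤n) }
  ... | tri> _ _ l with ∣-⊛ P S (poly P') (∣-≋ P P≋ (λ i → Division.rem-monic (lower P) i))
    where
    S = quo (lower P') (poly P)
    P≋ : poly P ≋ S ⊛ poly P'
    P≋ = Division.rem-zero⇒multiple (lower P') (poly P) p
  ...   | inj₂ r = ⊥-elim (¬∣-small P (poly P') (deg<-mono {poly P'} l (monic-deg (lower P'))) (poly≉0 (lower P')) r)
  ...   | inj₁ r = ⊥-elim (¬∣-small P S S-deg S≉0 r)
    where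
    S = quo (lower P') (poly P)
    P≋ : poly P ≋ S ⊛ poly P'
    P≋ = Division.rem-zero⇒multiple (lower P') (poly P) p
    S≉0 : ¬ (S ≋ [])
    S≉0 e = poly≉0 (lower P) (≋-trans P≋ (⊛-cong {S} {[]} {poly P'} e ≋-refl))
    S-deg : S deg< deg P
    S-deg = Division.factor-deg (lower P') (deg P) S (deg<-≋ P≋ (deg<-mono {poly P}
      (ℕP.≤-trans (ℕP.≤-reflexive (ℕP.+-comm 1 (deg P))) (ℕP.+-monoʳ-≤ (deg P) (s≤s z≤n))) (monic-deg (lower P))))

  totalDegree : List Irreducible → ℕ
  totalDegree ps = ∑ ps deg

  Distinct : List Irreducible → Set
  Distinct = AllPairs (λ P P' → ¬ (poly P ≋ poly P'))

  -- Every upper bound on numbers of irreducibles goes through this. They are divided out one at a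
  -- time; a later P' still divides the quotient, since dividing P would make it equal to P.
  totalDegree-< : ∀ ps G D → Distinct ps → All (_∣ᴾ G) ps → ¬ (G ≋ []) → G deg< D → totalDegree ps < D
  totalDegree-< []       G zero    _ _ G≉0 l = ⊥-elim (G≉0 (deg<0⇒≋[] l))
  totalDegree-< []       G (suc D) _ _ G≉0 l = s≤s z≤n
  totalDegree-< (P ∷ ps) G D (ne ∷ ds) (p ∷ qs) G≉0 l = begin-strict
    deg P ℕ.+ totalDegree ps  <⟨ ℕP.+-monoʳ-< (deg P) (totalDegree-< ps G' m ds (divide-rest ps ne qs) G'≉0 l') ⟩
    deg P ℕ.+ m               ≡⟨ ℕP.m+[n∸m]≡n P≤D ⟩
    D                         ∎
    where
    open ℕP.≤-Reasoning
    G' = quo (lower P) G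
    G≋ : G ≋ G' ⊛ poly P
    G≋ = Division.rem-zero⇒multiple (lower P) G p
    G'≉0 : ¬ (G' ≋ [])
    G'≉0 e = G≉0 (≋-trans G≋ (⊛-cong {G'} {[]} {poly P} e ≋-refl))
    P≤D : deg P ≤ D
    P≤D with deg P ℕ.≤? D
    ... | yes r = r
    ... | no r  = ⊥-elim (¬∣-small P G (deg<-mono {G} (ℕP.<⇒≤ (ℕP.≰⇒> r)) l) G≉0 p)
    m = D ℕ.∸ deg P
    l' : G' deg< m
    l' = Division.quo-deg (lower P) m G (≡.subst (G deg<_) (≡.sym (ℕP.m∸n+n≡m P≤D)) l)
    divide-rest : ∀ ps → All (λ P' → ¬ (poly P ≋ poly P')) ps → All (_∣ᴾ G) ps → All (_∣ᴾ G') ps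
    divide-rest []        []        []       = []
    divide-rest (P' ∷ ps) (n ∷ ne) (p ∷ qs) with ∣-⊛ P' G' (poly P) (∣-≋ P' G≋ p)
    ... | inj₁ r = r ∷ divide-rest ps ne qs
    ... | inj₂ r = ⊥-elim (n (irreducible-∣ P P' r))

  product : List Irreducible → List Carrier
  product []       = one
  product (P ∷ ps) = poly P ⊛ product ps

  product-++ : ∀ ps qs → product (ps ++ qs) ≋ product ps ⊛ product qs
  product-++ []       qs = ≋-sym (⊛-identityˡ (product qs))
  product-++ (P ∷ ps) qs = ≋-trans (⊛-congˡ (poly P) (product-++ ps qs)) (≋-sym (⊛-assoc (poly P) (product ps) (product qs)))

  totalDegree-++ : ∀ ps qs → totalDegree (ps ++ qs) ≡ totalDegree ps ℕ.+ totalDegree qs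
  totalDegree-++ ps qs = BigOp.⨁-++ ℕP.+-0-commutativeMonoid ps qs deg

  -- A monic divisor of degree between 1 and n is sought by exhaustion. If there is none, Euclid's
  -- algorithm makes every nonzero remainder invertible, so the polynomial is irreducible.
  factorisation : ∀ {n} (v : Fin (suc n) → Carrier) → Acc _<_ n →
    ∃ λ ps → product ps ≋ monic v × totalDegree ps ≡ suc n
  factorisation {n} v (acc rs)
    with FinP.any? {n = n} (λ m → Finite.search (Vec (suc (toℕ m)))
      (λ w → FinP.all? (λ i → rem w (monic v) i ≟ 0#)) (resp m))
    where
    resp : ∀ (m : Fin n) {w w' : Fin (suc (toℕ m)) → Carrier} → (∀ i → w i ≈ w' i) → (∀ i → rem w (monic v) i ≈ 0#) → ∀ i → rem w' (monic v) i ≈ 0#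
    resp m {w} {w'} e p i = trans (Division.rem-cong w' (monic v) (quo w (monic v) ⊛ monic w')
      (≋-trans (Division.rem-zero⇒multiple w (monic v) p) (⊛-congˡ (quo w (monic v)) (monic-cong e))) i)
      (Division.rem-⊛-zero w' (quo w (monic v)) {monic w'} (Division.rem-monic w') i)
  ... | no none = (P ∷ []) , ≋-trans (⊛-comm (poly P) one) (⊛-identityˡ (poly P)) , ℕP.+-identityʳ (suc n)
    where
    P = irreducible v (noDivisor⇒Irr v (λ {m} m<n w p → none (fromℕ< m<n ,
      ≡.subst (λ z → ∃ λ (w : Fin (suc z) → Carrier) → ∀ i → rem w (monic v) i ≈ 0#) (≡.sym (FinP.toℕ-fromℕ< m<n)) (w , p))))
  ... | yes (m' , w , p) = (proj₁ f₁ ++ proj₁ f₂) ,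
        ≋-trans (product-++ (proj₁ f₁) (proj₁ f₂)) (≋-trans (⊛-cong (proj₁ (proj₂ f₁)) (proj₁ (proj₂ f₂)))
          (≋-trans (⊛-cong {monic z} {g} {monic w} (≋-sym g≋) ≋-refl) (≋-sym v≋))) ,
        ≡.trans (totalDegree-++ (proj₁ f₁) (proj₁ f₂)) (≡.trans (≡.cong₂ ℕ._+_ (proj₂ (proj₂ f₁)) (proj₂ (proj₂ f₂))) (≡.sym sn≡))
    where
    m = toℕ m'
    m<n : m < n
    m<n = FinP.toℕ<n m'
    e = n ℕ.∸ suc m
    sn≡ : suc n ≡ suc e ℕ.+ suc m
    sn≡ = ≡.cong suc (≡.sym (ℕP.m∸n+n≡m m<n))
    g = quo w (monic v)
    v≋ : monic v ≋ g ⊛ monic w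
    v≋ = Division.rem-zero⇒multiple w (monic v) p
    v-deg : (g ⊛ monic w) deg< (suc (suc e) ℕ.+ suc m)
    v-deg = deg<-≋ v≋ (≡.subst (λ z → monic v deg< suc z) sn≡ (monic-deg v))
    z : Fin (suc e) → Carrier
    z i = coeff g (toℕ i)
    g≋ : g ≋ monic z
    g≋ = monic-coeff g (Division.factor-deg w (suc (suc e)) g v-deg)
      (trans (Division.factor-top w (suc e) g v-deg) (trans (sym (at v≋ (suc (suc e) ℕ.+ m)))
        (≡.subst (λ k → coeff (monic v) k ≈ 1#) (≡.trans sn≡ (≡.cong suc (ℕP.+-suc e m))) (coeff-monic-top v))))
    f₁ = factorisation z (rs (ℕP.∸-monoʳ-< {n} {suc m} {0} (s≤s z≤n) m<n))
    f₂ = factorisation w (rs m<n)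

-- Counting irreducible polynomials through X^n - X

module Monomials (R : CommutativeRing 0ℓ 0ℓ) where
  open CommutativeRing R hiding (zero)
  open Poly R
  open import Algebra.Properties.Semiring.Exp (CommutativeRing.semiring polyRing) using () renaming (_^_ to _^ᵖ_)

  X^-suc : ∀ n → X ^ᵖ suc n ≋ 0# ∷ (X ^ᵖ n)
  X^-suc n = X⊛ (X ^ᵖ n)

  X^-top : ∀ n → coeff (X ^ᵖ n) n ≈ 1#
  X^-top zero    = refl
  X^-top (suc n) = trans (at (X^-suc n) (suc n)) (X^-top n)

  X^-deg : ∀ n → (X ^ᵖ n) deg< suc n
  X^-deg zero    (suc i) _       = refl
  X^-deg (suc n) (suc i) (s≤s p) = trans (at (X^-suc n) (suc i)) (X^-deg n i p)

  Xⁿ-X : ℕ → List Carrier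
  Xⁿ-X n = (X ^ᵖ n) ⊕ neg X

  Xⁿ-X-deg : ∀ n → 2 ≤ n → Xⁿ-X n deg< suc n
  Xⁿ-X-deg n 2≤n zero          ()
  Xⁿ-X-deg n 2≤n (suc zero)    (s≤s p) = ⊥-elim (ℕP.<⇒≱ (s≤s z≤n) (ℕP.≤-trans 2≤n p))
  Xⁿ-X-deg n 2≤n (suc (suc i)) p = trans (coeff-⊕ (X ^ᵖ n) (neg X) (2 ℕ.+ i)) (trans (+-congʳ (X^-deg n (2 ℕ.+ i) p)) (+-identityˡ _))

  Xⁿ-X-top : ∀ n → 2 ≤ n → coeff (Xⁿ-X n) n ≈ 1#
  Xⁿ-X-top (suc (suc i)) _ = trans (coeff-⊕ (X ^ᵖ (2 ℕ.+ i)) (neg X) (2 ℕ.+ i)) (trans (+-identityʳ _) (X^-top (2 ℕ.+ i)))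
  Xⁿ-X-top (suc zero) (s≤s ())

  module _ {A : CommutativeRing 0ℓ 0ℓ} (H : Hom R A) where
    private module A = CommutativeRing A
    open import Algebra.Properties.Semiring.Exp A.semiring
    open Eval H
    open Hom H

    ev-at-X : ∀ a → ev a X A.≈ a
    ev-at-X a = A.trans (A.+-cong ι-0 (A.*-congˡ (A.trans (A.+-cong ι-1 (A.zeroʳ a)) (A.+-identityʳ _))))
      (A.trans (A.+-identityˡ _) (A.*-identityʳ a))

    ev-X^ : ∀ a n → ev a (X ^ᵖ n) A.≈ a ^ n
    ev-X^ a zero    = A.trans (A.+-cong ι-1 (A.zeroʳ a)) (A.+-identityʳ _)
    ev-X^ a (suc n) = A.trans (ev-⊛ a X (X ^ᵖ n)) (A.*-cong (ev-at-X a) (ev-X^ a n))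

    ev-Xⁿ-X : ∀ a n → ev a (Xⁿ-X n) A.≈ a ^ n A.- a
    ev-Xⁿ-X a n = A.trans (ev-⊕ a (X ^ᵖ n) (neg X)) (A.+-cong (ev-X^ a n)
      (A.trans (ev-cong A.refl (neg X) ((- 1#) · X) (mk λ { zero → trans -0≈ (sym (zeroʳ _)) ; (suc zero) → sym (*-identityʳ _) ; (suc (suc i)) → refl }))
        (A.trans (ev-· a (- 1#) X) (A.trans (A.*-cong (A.trans (ι-neg 1#) (A.-‿cong ι-1)) (ev-at-X a)) (-1*x≈-x a)))))
      where
      open import Algebra.Properties.Ring A.ring using (-1*x≈-x)
      -0≈ : - 0# ≈ 0#
      -0≈ = RingProps.-0#≈0#
        where import Algebra.Properties.Ring ring as RingProps

module _ (K : FiniteField) where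
  open CommutativeRing (FiniteField.commRing K)
  open import Algebra.Properties.Semiring.Exp semiring
  open Poly (FiniteField.commRing K)
  open Monomials (FiniteField.commRing K)

  -- Otherwise X^n - X, of degree n below the number of elements, would vanish everywhere.
  fixed-all : ∀ n → 2 ≤ n → n < FiniteField.card K → ¬ (∀ y → y ^ n ≈ y)
  fixed-all n 2≤n n<c fix = FiniteField.0≉1 K (trans (sym (at zero-poly n)) (Xⁿ-X-top n 2≤n))
    where
    zero-poly : Xⁿ-X n ≋ []
    zero-poly = FieldFacts.vanishing K (Xⁿ-X n) (deg<-mono {Xⁿ-X n} n<c (Xⁿ-X-deg n 2≤n))
      (λ a → trans (ev-Xⁿ-X (idHom (FiniteField.commRing K)) a n) (trans (+-congʳ (fix a)) (-‿inverseʳ a)))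

∑-unique : {A : Set} {R : A → A → Set} (xs : List A) → AllPairs (λ x y → ¬ R x y) xs → (f : A → ℕ) (T : A → Set) →
  (∀ x → f x ≤ 1) → (∀ x → f x ≡ 0 ⊎ T x) → (∀ {x y} → T x → T y → R x y) → ∑ xs f ≤ 1
∑-unique []       _         f T le dec u = z≤n
∑-unique (x ∷ xs) (ne ∷ ds) f T le dec u with dec x
... | inj₁ e rewrite e = ∑-unique xs ds f T le dec u
... | inj₂ t = ℕP.≤-trans (ℕP.+-mono-≤ (le x) (ℕP.≤-reflexive (none xs ne))) ℕP.≤-refl
  where
  none : ∀ ys → All (λ y → ¬ _) ys → ∑ ys f ≡ 0
  none []       []       = ≡.refl
  none (y ∷ ys) (n ∷ ns) with dec y
  ... | inj₁ e  = ≡.cong₂ ℕ._+_ e (none ys ns)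
  ... | inj₂ t' = ⊥-elim (n (u t t'))

module PrimeCount (F : FiniteField) where
  open FiniteField F using (commRing; _≟_; 0≉1) renaming (card to q)
  open CommutativeRing commRing hiding (zero)
  open FieldFacts F using (q≥2)
  open Poly commRing
  open Monomials commRing
  open Factorisation F
  open Irreducible using (deg; poly; pred-deg; lower; irr; field')

  rem-divisor-cong : ∀ {n} {v v' : Fin (suc n) → Carrier} → (∀ i → v i ≈ v' i) → ∀ u i → rem v u i ≈ rem v' u i
  rem-divisor-cong e []      i       = refl
  rem-divisor-cong {n} e (a ∷ u) zero    = +-congˡ (+-congˡ (-‿cong (*-cong (rem-divisor-cong e u (fromℕ n)) (e zero))))
  rem-divisor-cong {n} e (a ∷ u) (suc i) = +-congˡ (+-cong (rem-divisor-cong e u (inject₁ i)) (-‿cong (*-cong (rem-divisor-cong e u (fromℕ n)) (e (suc i)))))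

  Irr-resp : ∀ {n} {v v' : Fin (suc n) → Carrier} → (∀ i → v i ≈ v' i) → Irr v → Irr v'
  Irr-resp {n} {v} {v'} e irr (w , w≉0 , none) = irr (w , w≉0 , λ (w' , p) → none (w' , λ i →
    trans (sym (rem-divisor-cong e (lst w ⊛ lst w') i)) (trans (p i) (rem-divisor-cong e one i))))

  q^≥2 : ∀ n → 1 ≤ n → 2 ≤ q ℕ.^ n
  q^≥2 (suc n) _ = ℕP.≤-trans q≥2 (ℕP.≤-trans (ℕP.≤-reflexive (≡.sym (ℕP.*-identityʳ q))) (ℕP.*-monoʳ-≤ q (qⁿ≥1 n)))

  q^-mono-< : ∀ {m n} → m < n → q ℕ.^ m < q ℕ.^ n
  q^-mono-< = ℕP.^-monoʳ-< q q≥2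

  module Residue (P : Irreducible) where
    K = field' P
    module K = CommutativeRing (FiniteField.commRing K)
    open import Algebra.Properties.CommutativeSemiring.Exp K.commutativeSemiring public
    toK = toQuotient (lower P)
    module AlgK = FAlgebra (FiniteField.commRing K) toK
    open Division (lower P) using (mk; on)

    card-K : FiniteField.card K ≡ q ℕ.^ deg P
    card-K = residueField-card (lower P) (irr P)

    fixed-point : ∀ n → P ∣ᴾ Xⁿ-X n → X ^ n K.≈ X
    fixed-point n p = FieldFacts.x-y≈0⇒x≈y K {X ^ n} {X} (K.trans (K.+-congʳ {neg X} (K.sym (ι-^ X n))) (mk p))
      where open Hom (quotientHom commRing (lower P))

    ev-power : ∀ n y → y ^ (q ℕ.^ n) K.≈ Eval.ev toK (X ^ (q ℕ.^ n)) y
    ev-power n y = K.trans (^-congˡ (q ℕ.^ n) (K.sym (ev-X-quotient (lower P) y))) (AlgK.ev-^qⁿ n X y)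

    all-fixed : ∀ n → X ^ (q ℕ.^ n) K.≈ X → ∀ y → y ^ (q ℕ.^ n) K.≈ y
    all-fixed n e y = K.trans (ev-power n y) (K.trans (Eval.ev-cong toK e y y ≋-refl) (ev-X-quotient (lower P) y))

    fermatK : ∀ y → y ^ (q ℕ.^ deg P) K.≈ y
    fermatK y = ≡.subst (λ z → y ^ z K.≈ y) card-K (FieldFacts.fermat K y)

    divides-Xⁿ-X : P ∣ᴾ Xⁿ-X (q ℕ.^ deg P)
    divides-Xⁿ-X i = on {Xⁿ-X (q ℕ.^ deg P)} {[]} (K.trans (K.+-congʳ {neg X} (K.trans (ι-^ X (q ℕ.^ deg P)) (fermatK X))) (K.-‿inverseʳ X)) i
      where open Hom (quotientHom commRing (lower P))

    too-few : ∀ n → 1 ≤ n → n < deg P → ¬ (∀ y → y ^ (q ℕ.^ n) K.≈ y)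
    too-few n 1≤n n<d = fixed-all K (q ℕ.^ n) (q^≥2 n 1≤n) (≡.subst (q ℕ.^ n <_) (≡.sym card-K) (q^-mono-< n<d))

    -- A coarse form of "deg P divides d". If deg P < d < 2 deg P, then with e = d - deg P the e-th
    -- power of Frobenius would be the identity on the residue field although 0 < e < deg P.
    degree-bound : ∀ d → 1 ≤ d → P ∣ᴾ Xⁿ-X (q ℕ.^ d) → deg P ≡ d ⊎ 2 ℕ.* deg P ≤ d
    degree-bound d 1≤d p with ℕP.<-cmp (deg P) d
    ... | tri≈ _ e _ = inj₁ e
    ... | tri> _ _ l = ⊥-elim (too-few d 1≤d l (all-fixed d (fixed-point (q ℕ.^ d) p)))
    ... | tri< l _ _ with (d ℕ.∸ deg P) ℕ.<? deg P
    ...   | no n  = inj₂ (≡.subst (2 ℕ.* deg P ≤_) (ℕP.m+[n∸m]≡n (ℕP.<⇒≤ l)) (ℕP.+-monoʳ-≤ (deg P) (ℕP.≤-trans (ℕP.≤-reflexive (ℕP.+-identityʳ (deg P))) (ℕP.≮⇒≥ n))))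
    ...   | yes r = ⊥-elim (too-few e (ℕP.m<n⇒0<n∸m l) r fixed)
      where
      e = d ℕ.∸ deg P
      split : q ℕ.^ d ≡ q ℕ.^ deg P ℕ.* q ℕ.^ e
      split = ≡.trans (≡.cong (q ℕ.^_) (≡.sym (ℕP.m+[n∸m]≡n (ℕP.<⇒≤ l)))) (ℕP.^-distribˡ-+-* q (deg P) e)
      fixed : ∀ y → y ^ (q ℕ.^ e) K.≈ y
      fixed y = K.trans (^-congˡ (q ℕ.^ e) (K.sym (fermatK y))) (K.trans (^-assocʳ y (q ℕ.^ deg P) (q ℕ.^ e))
        (K.trans (^-congʳ y (≡.sym split)) (all-fixed d (fixed-point (q ℕ.^ d) p) y)))

  -- Modulo P² every u satisfies u^Q = u if X does; but P^Q vanishes there.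
  squarefree : ∀ n → 1 ≤ n → ∀ P S → ¬ (Xⁿ-X (q ℕ.^ n) ≋ S ⊛ (poly P ⊛ poly P))
  squarefree n 1≤n P S R≋ = 0≉1 (trans (sym (at p≋0 (deg P))) (coeff-monic-top (lower P)))
    where
    Q = q ℕ.^ n
    d = pred-deg P
    sq = poly P ⊛ poly P
    sq-deg : sq deg< (suc (suc d) ℕ.+ suc d)
    sq-deg = deg<-product (poly P) (suc (suc d)) (monic-deg (lower P))
      where
      deg<-product : ∀ g m → g deg< m → (g ⊛ poly P) deg< (m ℕ.+ suc d)
      deg<-product []      m l i p = refl
      deg<-product (a ∷ g) zero l i p = at (≋-trans (⊛-cong {a ∷ g} {[]} {poly P} (deg<0⇒≋[] l) ≋-refl) ≋-refl) i
      deg<-product (a ∷ g) (suc m) l i p = trans (coeff-⊕ (a · poly P) (0# ∷ (g ⊛ poly P)) i)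
        (trans (+-cong (trans (coeff-· a (poly P) i) (trans (*-congˡ (monic-deg (lower P) i (ℕP.≤-trans (s≤s (ℕP.m≤n+m (suc d) m)) p))) (zeroʳ a))) (rest i p)) (+-identityˡ _))
        where
        rest : ∀ i → suc m ℕ.+ suc d ≤ i → coeff (0# ∷ (g ⊛ poly P)) i ≈ 0#
        rest (suc i) (s≤s p) = deg<-product g m (λ j r → l (suc j) (s≤s r)) i p
    w : Fin (suc (d ℕ.+ suc d)) → Carrier
    w i = coeff sq (toℕ i)
    sq≋ : sq ≋ monic w
    sq≋ = monic-coeff sq sq-deg (trans (reflexive (≡.cong (coeff sq) (≡.cong suc (ℕP.+-suc d d))))
      (trans (sym (Division.factor-top (lower P) (suc d) (poly P) sq-deg)) (coeff-monic-top (lower P))))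
    open Division w
    module A = CommutativeRing quotient
    open import Algebra.Properties.CommutativeSemiring.Exp A.commutativeSemiring
    module AlgA = FAlgebra quotient (toQuotient w)
    R≃0 : Xⁿ-X Q ≃ []
    R≃0 = A.trans (≋⇒≃ (≋-trans R≋ (⊛-congˡ S sq≋))) (mk (rem-⊛-zero S rem-monic))
    X^Q≃X : X ^ Q ≃ X
    X^Q≃X = A.trans (solve 2 (λ a b → a := (a :+ :- b) :+ b) A.refl (X ^ Q) X)
      (A.trans (A.+-congʳ {X} (A.trans (A.+-congʳ {neg X} (A.sym (ι-^ X Q))) R≃0)) (A.+-identityˡ X))
      where
      open RingTools quotient
      open Hom (quotientHom commRing w)
    p≃ : poly P ^ Q ≃ poly P
    p≃ = A.trans (^-congˡ Q (A.sym (ev-X-quotient w (poly P)))) (A.trans (AlgA.ev-^qⁿ n X (poly P))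
      (A.trans (Eval.ev-cong (toQuotient w) X^Q≃X (poly P) (poly P) ≋-refl) (ev-X-quotient w (poly P))))
    p^≃0 : ∀ m → 2 ≤ m → poly P ^ m ≃ []
    p^≃0 (suc (suc m)) _ = A.trans (A.sym (A.*-assoc (poly P) (poly P) (poly P ^ m)))
      (A.trans (A.*-congʳ {poly P ^ m} {sq} {[]} (A.trans (≋⇒≃ sq≋) (mk rem-monic))) (A.zeroˡ (poly P ^ m)))
    p^≃0 (suc zero) (s≤s ())
    p≋0 : poly P ≋ []
    p≋0 = ≋-trans (rem-zero⇒multiple (poly P) (on (A.trans (A.sym p≃) (p^≃0 Q (q^≥2 n 1≤n)))))
      (⊛-cong {quo w (poly P)} {[]} {monic w} (deg<0⇒≋[] (quo-deg 0 (poly P)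
        (deg<-mono {poly P} (s≤s (ℕP.m≤n+m (suc d) d)) (monic-deg (lower P))))) ≋-refl)

  -- `S` accumulates the factors already passed, so that R = S · `product ps` persists through the
  -- recursion.
  factors-distinct : ∀ R → (∀ P S → ¬ (R ≋ S ⊛ (poly P ⊛ poly P))) → ∀ ps S → R ≋ S ⊛ product ps → Distinct ps
  factors-distinct R sf []       S e = []
  factors-distinct R sf (P ∷ ps) S e = head ps S e ∷ factors-distinct R sf ps (S ⊛ poly P) (≋-trans e (≋-sym (⊛-assoc S (poly P) (product ps))))
    where
    open RingTools polyRing
    head : ∀ ps S → R ≋ S ⊛ (poly P ⊛ product ps) → All (λ P' → ¬ (poly P ≋ poly P')) ps
    head []        S e = []
    head (P' ∷ ps) S e = (λ same → sf P (S ⊛ product ps) (≋-trans e (≋-trans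
        (⊛-congˡ S (⊛-congˡ (poly P) (⊛-cong {poly P'} {poly P} {product ps} (≋-sym same) ≋-refl)))
        (solve 3 (λ s p r → s :* (p :* (p :* r)) := (s :* r) :* (p :* p)) ≋-refl S (poly P) (product ps)))))
      ∷ head ps (S ⊛ poly P') (≋-trans e (solve 4 (λ s p p' r → s :* (p :* (p' :* r)) := (s :* p') :* (p :* r)) ≋-refl S (poly P) (poly P') (product ps)))

  factors-divide : ∀ R ps S → R ≋ S ⊛ product ps → All (_∣ᴾ R) ps
  factors-divide R []       S e = []
  factors-divide R (P ∷ ps) S e = ∣-≋ P (≋-sym (≋-trans e (solve 3 (λ s p r → s :* (p :* r) := (s :* r) :* p) ≋-refl S (poly P) (product ps))))
      (∣-multiple P (S ⊛ product ps))
    ∷ factors-divide R ps (S ⊛ poly P) (≋-trans e (≋-sym (⊛-assoc S (poly P) (product ps))))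
    where open RingTools polyRing

  module _ {d : ℕ} {Q : (Fin (suc d) → Carrier) → Set} (Q? : ∀ v → Dec (Q v)) where
    private
      push : ∀ v → Dec (Irr v) → Dec (Q v) → List Irreducible → List Irreducible
      push v (yes i) (yes _) ps = irreducible v i ∷ ps
      push v (yes _) (no _)  ps = ps
      push v (no _)  _       ps = ps

      push-degree : ∀ v i r ps x → totalDegree ps ≡ suc d ℕ.* x → totalDegree (push v i r ps) ≡ suc d ℕ.* (⟦ i ⟧ ℕ.* ⟦ r ⟧ ℕ.+ x)
      push-degree v (yes _) (yes _) ps x e = ≡.trans (≡.cong (suc d ℕ.+_) e) (≡.sym (ℕP.*-suc (suc d) x))
      push-degree v (yes _) (no _)  ps x e = e
      push-degree v (no _)  _       ps x e = e

      push-All : ∀ {T : Irreducible → Set} v i r ps → (∀ i → Q v → T (irreducible v i)) → All T ps → All T (push v i r ps)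
      push-All v (yes i) (yes r) ps t ts = t i r ∷ ts
      push-All v (yes _) (no _)  ps t ts = ts
      push-All v (no _)  _       ps t ts = ts

      push-distinct : ∀ v i r ps → All (λ P → ¬ (monic v ≋ poly P)) ps → Distinct ps → Distinct (push v i r ps)
      push-distinct v (yes _) (yes _) ps ne ds = ne ∷ ds
      push-distinct v (yes _) (no _)  ps ne ds = ds
      push-distinct v (no _)  _       ps ne ds = ds

    collect : List (Fin (suc d) → Carrier) → List Irreducible
    collect []       = []
    collect (v ∷ vs) = push v (irr? v) (Q? v) (collect vs)

    collect-degree : ∀ vs → totalDegree (collect vs) ≡ suc d ℕ.* ∑ vs (λ v → ⟦ irr? v ⟧ ℕ.* ⟦ Q? v ⟧)
    collect-degree []       = ≡.sym (ℕP.*-zeroʳ (suc d))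
    collect-degree (v ∷ vs) = push-degree v (irr? v) (Q? v) (collect vs) (∑ vs (λ v → ⟦ irr? v ⟧ ℕ.* ⟦ Q? v ⟧)) (collect-degree vs)

    collect-All : {T : Irreducible → Set} → ∀ vs → All (λ v → ∀ i → Q v → T (irreducible v i)) vs → All T (collect vs)
    collect-All []       []       = []
    collect-All (v ∷ vs) (t ∷ ts) = push-All v (irr? v) (Q? v) (collect vs) t (collect-All vs ts)

    collect-distinct : ∀ vs → AllPairs (λ v w → ¬ (∀ i → v i ≈ w i)) vs → Distinct (collect vs)
    collect-distinct []       []        = []
    collect-distinct (v ∷ vs) (ne ∷ ds) = push-distinct v (irr? v) (Q? v) (collect vs)
      (collect-All vs (All.map (λ {w} n _ _ e → n (λ k → trans (sym (coeff-monic v k)) (trans (at e (toℕ k)) (coeff-monic w k)))) ne))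
      (collect-distinct vs ds)

    count : ℕ
    count = ∑ (Finite.list (Vec (suc d))) (λ v → ⟦ irr? v ⟧ ℕ.* ⟦ Q? v ⟧)

    -- Where Stepanov's method attaches: one nonzero G of small degree, divisible by all
    -- irreducibles with property `Q`, bounds their number.
    count-bound : ∀ G D → (∀ v (i : Irr v) → Q v → irreducible v i ∣ᴾ G) → ¬ (G ≋ []) → G deg< D → suc d ℕ.* count < D
    count-bound G D div G≉0 l = ≡.subst (_< D) (collect-degree vs)
      (totalDegree-< (collect vs) G D (collect-distinct vs (once⇒distinct (Finite._≟_ (Vec (suc d))) (λ i → refl) (λ e i → sym (e i)) vs
        (λ a → ℕP.≤-reflexive (Finite.once (Vec (suc d)) a)))) (collect-All vs (All.tabulate (λ {v} _ → div v))) G≉0 l)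
      where vs = Finite.list (Vec (suc d))

  π : ℕ → ℕ
  π d = ∑ (Finite.list (Vec (suc d))) (λ v → ⟦ irr? v ⟧)

  π-upper : ∀ d → suc d ℕ.* π d ≤ q ℕ.^ suc d
  π-upper d = ℕP.≤-pred (≡.subst (λ z → suc d ℕ.* z < suc (q ℕ.^ suc d))
    (∑-cong (Finite.list (Vec (suc d))) (λ v → ℕP.*-identityʳ ⟦ irr? v ⟧))
    (count-bound {d} {λ _ → ⊤} (λ _ → yes tt) (Xⁿ-X Q) (suc Q) (λ v i _ → Residue.divides-Xⁿ-X (irreducible v i))
      (λ e → 0≉1 (trans (sym (at e Q)) (Xⁿ-X-top Q 2≤Q))) (Xⁿ-X-deg Q 2≤Q)))
    where
    Q = q ℕ.^ suc d
    2≤Q = q^≥2 (suc d) (s≤s z≤n)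

  private
    -- Indicator that P has lower coefficients v. It is 0 across different degrees, where the two
    -- coefficient vectors have different types.
    matches : ∀ d (P : Irreducible) → (Fin (suc d) → Carrier) → ℕ
    matches d P v with pred-deg P ℕ.≟ d
    ... | yes ≡.refl = ⟦ Finite._≟_ (Vec (suc d)) v (lower P) ⟧
    ... | no _       = 0

    matches-≤1 : ∀ d P v → matches d P v ≤ 1
    matches-≤1 d P v with pred-deg P ℕ.≟ d
    ... | yes ≡.refl = ⟦⟧-≤1 (Finite._≟_ (Vec (suc d)) v (lower P))
    ... | no _       = z≤n

    matches-≋ : ∀ d v P → matches d P v ≡ 0 ⊎ poly P ≋ monic v
    matches-≋ d v P with pred-deg P ℕ.≟ d
    ... | no _       = inj₁ ≡.refl
    ... | yes ≡.refl with Finite._≟_ (Vec (suc d)) v (lower P)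
    ...   | yes e = inj₂ (monic-cong (λ i → sym (e i)))
    ...   | no _  = inj₁ ≡.refl

    matches-exists : ∀ d P → ⟦ pred-deg P ℕ.≟ d ⟧ ≤ ∑ (Finite.list (Vec (suc d))) (λ v → matches d P v ℕ.* ⟦ irr? v ⟧)
    matches-exists d P with pred-deg P ℕ.≟ d
    ... | no _       = z≤n
    ... | yes ≡.refl = ℕP.≤-reflexive (≡.sym (≡.trans (∑-pick (Vec (suc d)) (lower P) (λ v → ⟦ irr? v ⟧)
            (λ {x} {y} e → ⟦⟧-⇔ (irr? x) (irr? y) (Irr-resp e) (Irr-resp (λ i → sym (e i))))) (⟦⟧-yes (irr? (lower P)) (irr P))))

    degree-count : ∀ ps → Distinct ps → ∀ d → ∑ ps (λ P → ⟦ pred-deg P ℕ.≟ d ⟧) ≤ π d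
    degree-count ps ds d = begin
      ∑ ps (λ P → ⟦ pred-deg P ℕ.≟ d ⟧)                                ≤⟨ ∑-≤ ps (matches-exists d) ⟩
      ∑ ps (λ P → ∑ vs (λ v → matches d P v ℕ.* ⟦ irr? v ⟧))           ≡⟨ ∑-swap ps vs _ ⟩
      ∑ vs (λ v → ∑ ps (λ P → matches d P v ℕ.* ⟦ irr? v ⟧))           ≡⟨ ∑-cong vs (λ v → ∑-*ʳ ps ⟦ irr? v ⟧ (λ P → matches d P v)) ⟩
      ∑ vs (λ v → ∑ ps (λ P → matches d P v) ℕ.* ⟦ irr? v ⟧)           ≤⟨ ∑-≤ vs (λ v → ℕP.*-monoˡ-≤ ⟦ irr? v ⟧
            (∑-unique ps ds (λ P → matches d P v) (λ P → poly P ≋ monic v) (λ P → matches-≤1 d P v) (matches-≋ d v) (λ e e' → ≋-trans e (≋-sym e')))) ⟩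
      ∑ vs (λ v → 1 ℕ.* ⟦ irr? v ⟧)                                    ≡⟨ ∑-cong vs (λ v → ℕP.*-identityˡ ⟦ irr? v ⟧) ⟩
      π d                                                              ∎
      where
      open ℕP.≤-Reasoning
      vs = Finite.list (Vec (suc d))

  geometric : ∀ h → sumTo h (λ e → q ℕ.^ suc e) ≤ 2 ℕ.* q ℕ.^ h
  geometric zero    = z≤n
  geometric (suc h) = begin
    sumTo h (λ e → q ℕ.^ suc e) ℕ.+ q ℕ.^ suc h  ≤⟨ ℕP.+-monoˡ-≤ _ (ℕP.≤-trans (geometric h) (ℕP.*-monoˡ-≤ (q ℕ.^ h) q≥2)) ⟩
    q ℕ.^ suc h ℕ.+ q ℕ.^ suc h                  ≡⟨ ≡.cong (q ℕ.^ suc h ℕ.+_) (≡.sym (ℕP.+-identityʳ _)) ⟩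
    2 ℕ.* q ℕ.^ suc h                            ∎
    where open ℕP.≤-Reasoning

  -- The factors of X^Q - X, for Q = q^(d+1), are distinct by `squarefree` and have total degree Q.
  -- By `degree-bound` each has degree d + 1 or at most half of it; the small ones are bounded by
  -- `π-upper` and a geometric sum.
  π-lower : ∀ d → q ℕ.^ suc d ≤ suc d ℕ.* π d ℕ.+ 2 ℕ.* q ℕ.^ ⌊ suc d /2⌋
  π-lower d = begin
    Q                                                                             ≡⟨ ≡.sym (proj₂ (proj₂ f)) ⟩
    ∑ ps deg                                                                      ≤⟨ bound ps (factors-divide R ps one (≋-trans R≋ (≋-sym (⊛-identityˡ (product ps))))) ⟩
    ∑ ps (λ P → at-degree P d ℕ.+ sumTo h (at-degree P))                          ≡⟨ ∑-+ ps _ _ ⟩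
    ∑ ps (λ P → at-degree P d) ℕ.+ ∑ ps (λ P → sumTo h (at-degree P))             ≡⟨ ≡.cong (∑ ps (λ P → at-degree P d) ℕ.+_) (∑-sumTo ps h at-degree) ⟩
    ∑ ps (λ P → at-degree P d) ℕ.+ sumTo h (λ e → ∑ ps (λ P → at-degree P e))     ≤⟨ ℕP.+-mono-≤ (per-degree d) (sumTo-≤ h (λ e _ → ℕP.≤-trans (per-degree e) (π-upper e))) ⟩
    suc d ℕ.* π d ℕ.+ sumTo h (λ e → q ℕ.^ suc e)                                 ≤⟨ ℕP.+-monoʳ-≤ (suc d ℕ.* π d) (geometric h) ⟩
    suc d ℕ.* π d ℕ.+ 2 ℕ.* q ℕ.^ h                                               ∎
    where
    open ℕP.≤-Reasoning
    h = ⌊ suc d /2⌋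
    Q = q ℕ.^ suc d
    2≤Q = q^≥2 (suc d) (s≤s z≤n)
    R = Xⁿ-X Q
    Q' = ℕ.pred Q
    Q≡ : suc Q' ≡ Q
    Q≡ = ℕP.suc-pred Q {{ℕ.>-nonZero (ℕP.≤-trans (s≤s z≤n) 2≤Q)}}
    v : Fin (suc Q') → Carrier
    v i = coeff R (toℕ i)
    R≋v : R ≋ monic v
    R≋v = monic-coeff R (≡.subst (λ z → R deg< suc z) (≡.sym Q≡) (Xⁿ-X-deg Q 2≤Q))
                        (≡.subst (λ z → coeff R z ≈ 1#) (≡.sym Q≡) (Xⁿ-X-top Q 2≤Q))
    f : ∃ λ ps → product ps ≋ monic v × totalDegree ps ≡ Q
    f = let ps , e , t = factorisation v (<-wellFounded Q') in ps , e , ≡.trans t Q≡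
    ps = proj₁ f
    R≋ : R ≋ product ps
    R≋ = ≋-trans R≋v (≋-sym (proj₁ (proj₂ f)))
    distinct : Distinct ps
    distinct = factors-distinct R (squarefree (suc d) (s≤s z≤n)) ps one (≋-trans R≋ (≋-sym (⊛-identityˡ (product ps))))
    at-degree : Irreducible → ℕ → ℕ
    at-degree P e = ⟦ pred-deg P ℕ.≟ e ⟧ ℕ.* suc e
    at-self : ∀ P → at-degree P (pred-deg P) ≡ deg P
    at-self P = ≡.trans (≡.cong (ℕ._* deg P) (⟦⟧-yes (pred-deg P ℕ.≟ pred-deg P) ≡.refl)) (ℕP.*-identityˡ _)
    bound : ∀ qs → All (_∣ᴾ R) qs → ∑ qs deg ≤ ∑ qs (λ P → at-degree P d ℕ.+ sumTo h (at-degree P))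
    bound []       []       = z≤n
    bound (P ∷ qs) (p ∷ ds) = ℕP.+-mono-≤ one-bound (bound qs ds)
      where
      one-bound : deg P ≤ at-degree P d ℕ.+ sumTo h (at-degree P)
      one-bound with Residue.degree-bound P (suc d) (s≤s z≤n) p
      ... | inj₁ ≡.refl = ℕP.≤-trans (ℕP.≤-reflexive (≡.sym (at-self P))) (ℕP.m≤m+n _ _)
      ... | inj₂ l = ℕP.≤-trans (ℕP.≤-reflexive (≡.sym (at-self P)))
              (ℕP.≤-trans (sumTo-term h (at-degree P) half) (ℕP.m≤n+m _ _))
        where
        half : pred-deg P < h
        half = ≡.subst (_≤ h) (≡.trans (≡.cong ⌊_/2⌋ (≡.cong (deg P ℕ.+_) (ℕP.+-identityʳ (deg P)))) (≡.sym (ℕP.n≡⌊n+n/2⌋ (deg P)))) (ℕP.⌊n/2⌋-mono l)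
    per-degree : ∀ e → ∑ ps (λ P → at-degree P e) ≤ suc e ℕ.* π e
    per-degree e = begin
      ∑ ps (λ P → at-degree P e)                      ≡⟨ ∑-*ʳ ps (suc e) _ ⟩
      ∑ ps (λ P → ⟦ pred-deg P ℕ.≟ e ⟧) ℕ.* suc e     ≤⟨ ℕP.*-monoˡ-≤ (suc e) (degree-count ps distinct e) ⟩
      π e ℕ.* suc e                                   ≡⟨ ℕP.*-comm (π e) (suc e) ⟩
      suc e ℕ.* π e                                   ∎

module SumTools (R : CommutativeRing 0ℓ 0ℓ) where
  open CommutativeRing R hiding (zero)
  open import Algebra.Properties.Semiring.Sum semiring

  sum-zero : ∀ {n} (t : Fin n → Carrier) → (∀ i → t i ≈ 0#) → sum t ≈ 0#
  sum-zero {n} t e = trans (sum-cong-≋ e) (sum-replicate-zero n)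

  sum-single : ∀ {n} (t : Fin n → Carrier) i → (∀ j → j ≢ i → t j ≈ 0#) → sum t ≈ t i
  sum-single {suc n} t zero    e = trans (+-congˡ (sum-zero (λ j → t (suc j)) (λ j → e (suc j) (λ ())))) (+-identityʳ _)
  sum-single {suc n} t (suc i) e = trans (+-cong (e zero (λ ())) (sum-single (λ j → t (suc j)) i (λ j ne → e (suc j) (λ p → ne (FinP.suc-injective p))))) (+-identityˡ _)

  sum₁ : ℕ → (ℕ → Carrier) → Carrier
  sum₁ zero    f = 0#
  sum₁ (suc n) f = sum₁ n f + f (suc n)

-- Stepanov's method for y^q − y = h(x)

-- B = F[x,y]/(y^q - y - h(x)) graded by wt x = q, wt y = k; `coord a b` reads off the coefficient of x^a y^b, b < q.
module Weighted (F : FiniteField) (B : CommutativeRing 0ℓ 0ℓ) (H : Hom (FiniteField.commRing F) B)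
  (x y : CommutativeRing.Carrier B) (k : ℕ) (1≤k : 1 ≤ k) (a : ℕ → FiniteField.Carrier F)
  (aₖ≉0 : ¬ (FiniteField._≈_ F (a k) (FiniteField.0# F)))
  (coord : ℕ → ℕ → CommutativeRing.Carrier B → FiniteField.Carrier F)
  where
  private
    module F = CommutativeRing (FiniteField.commRing F)
  open FiniteField F using () renaming (card to q)
  open FieldFacts F using (q≥2; finite; *-nonzero; noZeroDivisors)
  open CommutativeRing B hiding (zero)
  open Hom H
  open RingTools B
  open SumTools B
  open import Algebra.Properties.CommutativeSemiring.Exp commutativeSemiring
  open import Algebra.Properties.Semiring.Sum semiring

  import Algebra.Properties.Semiring.Sum F.semiring as SF

  mon : ℕ → ℕ → Carrier
  mon i j = x ^ i * y ^ j

  h : Carrier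
  h = sum₁ k (λ i → ι (a i) * x ^ i)

  wt : ℕ → ℕ → ℕ
  wt i j = q ℕ.* i ℕ.+ k ℕ.* j

  record Laws : Set where
    field
      relation   : y ^ q ≈ y + h
      coord-cong : ∀ i j {u v} → u ≈ v → coord i j u F.≈ coord i j v
      coord-+    : ∀ i j u v → coord i j (u + v) F.≈ coord i j u F.+ coord i j v
      coord-ι    : ∀ i j c u → coord i j (ι c * u) F.≈ c F.* coord i j u
      coord-self : ∀ i j → j < q → coord i j (mon i j) F.≈ F.1#
      coord-else : ∀ i j i' j' → j < q → j' < q → (i , j) ≢ (i' , j') → coord i j (mon i' j') F.≈ F.0#

  module _ (laws : Laws) where
    open Laws laws

    coord-0 : ∀ i j → coord i j 0# F.≈ F.0#
    coord-0 i j = F.trans (coord-cong i j (sym (zeroʳ (ι F.0#)))) (F.trans (coord-ι i j F.0# 0#) (F.zeroˡ _))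

    coord-sum : ∀ i j {n} (t : Fin n → Carrier) → coord i j (sum t) F.≈ SF.sum (λ s → coord i j (t s))
    coord-sum i j {zero}  t = coord-0 i j
    coord-sum i j {suc n} t = F.trans (coord-+ i j (t zero) _) (F.+-congˡ (coord-sum i j (λ s → t (suc s))))

    -- The weight filtration, with an explicit expansion into reduced monomials (j < q) of weight
    -- below ω as evidence.
    data Lt (ω : ℕ) : Carrier → Set where
      nil : ∀ {u} → u ≈ 0# → Lt ω u
      add : ∀ {u v} c i j → j < q → wt i j < ω → Lt ω v → u ≈ ι c * mon i j + v → Lt ω u

    Lt-≈ : ∀ {ω u v} → u ≈ v → Lt ω u → Lt ω v
    Lt-≈ e (nil z)             = nil (trans (sym e) z)
    Lt-≈ e (add c i j p l r f) = add c i j p l r (trans (sym e) f)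

    Lt-mono : ∀ {ω ω' u} → ω ≤ ω' → Lt ω u → Lt ω' u
    Lt-mono ω≤ (nil z)             = nil z
    Lt-mono ω≤ (add c i j p l r f) = add c i j p (ℕP.<-≤-trans l ω≤) (Lt-mono ω≤ r) f

    Lt-+ : ∀ {ω u v} → Lt ω u → Lt ω v → Lt ω (u + v)
    Lt-+ (nil z)             r' = Lt-≈ (trans (sym (+-identityˡ _)) (+-congʳ (sym z))) r'
    Lt-+ (add c i j p l r f) r' = add c i j p l (Lt-+ r r') (trans (+-congʳ f) (+-assoc _ _ _))

    Lt-ι : ∀ {ω u} c → Lt ω u → Lt ω (ι c * u)
    Lt-ι c (nil z) = nil (trans (*-congˡ z) (zeroʳ _))
    Lt-ι c (add {u} {v} c' i j p l r f) = add (c F.* c') i j p l (Lt-ι c r)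
      (trans (*-congˡ f) (trans (solve 4 (λ c c' m v → c :* (c' :* m :+ v) := (c :* c') :* m :+ c :* v) refl (ι c) (ι c') (mon i j) v)
        (+-congʳ (*-congʳ (sym (ι-* c c'))))))

    Lt-mon : ∀ {ω} i j → j < q → wt i j < ω → Lt ω (mon i j)
    Lt-mon i j p l = add F.1# i j p l (nil refl) (sym (trans (+-identityʳ _) (trans (*-congʳ ι-1) (*-identityˡ _))))

    Lt-linear : ∀ {ω ω'} z → (∀ i j → j < q → wt i j < ω → Lt ω' (z * mon i j)) → ∀ {u} → Lt ω u → Lt ω' (z * u)
    Lt-linear z g (nil e) = nil (trans (*-congˡ e) (zeroʳ z))
    Lt-linear z g (add {u} {v} c i j p l r f) = Lt-≈ (sym (trans (*-congˡ f)
        (solve 4 (λ z c m v → z :* (c :* m :+ v) := c :* (z :* m) :+ z :* v) refl z (ι c) (mon i j) v)))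
      (Lt-+ (Lt-ι c (g i j p l)) (Lt-linear z g r))

    x*mon : ∀ i j → x * mon i j ≈ mon (suc i) j
    x*mon i j = sym (*-assoc x (x ^ i) (y ^ j))

    y*mon : ∀ i j → y * mon i j ≈ mon i (suc j)
    y*mon i j = solve 3 (λ y a b → y :* (a :* b) := a :* (y :* b)) refl y (x ^ i) (y ^ j)

    Lt-x : ∀ {ω u} → Lt ω u → Lt (ω ℕ.+ q) (x * u)
    Lt-x {ω} = Lt-linear x (λ i j p l → Lt-≈ (sym (x*mon i j)) (Lt-mon (suc i) j p
      (ℕP.≤-trans (ℕP.≤-reflexive (≡.cong suc (arith i j))) (ℕP.+-monoˡ-≤ q l))))
      where
      arith : ∀ i j → wt (suc i) j ≡ wt i j ℕ.+ q
      arith i j = solve' 3 (λ q i kj → q :*' (con' 1 :+' i) :+' kj :=' (q :*' i :+' kj) :+' q) ≡.refl q i (k ℕ.* j)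
        where open +-*-Solver renaming (solve to solve'; _:*_ to _:*'_; _:+_ to _:+'_; _:=_ to _:='_; con to con')

    private
      Lt-h : ∀ {ω} i n → q ℕ.* (i ℕ.+ n) < ω → Lt ω (x ^ i * sum₁ n (λ i → ι (a i) * x ^ i))
      Lt-h i zero    l = nil (zeroʳ _)
      Lt-h {ω} i (suc n) l = Lt-≈ (sym (trans (distribˡ _ _ _) (+-congˡ term)))
          (Lt-+ (Lt-h i n (ℕP.≤-trans (s≤s (ℕP.*-monoʳ-≤ q (ℕP.+-monoʳ-≤ i (ℕP.n≤1+n n)))) l))
                (Lt-ι (a (suc n)) (Lt-mon (i ℕ.+ suc n) 0 (ℕP.≤-trans (s≤s z≤n) q≥2)
                  (≡.subst (_< ω) (≡.sym (≡.trans (≡.cong (q ℕ.* (i ℕ.+ suc n) ℕ.+_) (ℕP.*-zeroʳ k)) (ℕP.+-identityʳ _))) l))))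
        where
        term : x ^ i * (ι (a (suc n)) * x ^ suc n) ≈ ι (a (suc n)) * mon (i ℕ.+ suc n) 0
        term = trans (solve 3 (λ s c t → s :* (c :* t) := c :* (s :* t)) refl (x ^ i) (ι (a (suc n))) (x ^ suc n))
          (*-congˡ (trans (sym (^-homo-* x i (suc n))) (sym (*-identityʳ _))))

      overflow : ∀ i j → suc j ≡ q → y * mon i j ≈ mon i 1 + x ^ i * h
      overflow i j e = trans (y*mon i j) (trans (*-congˡ (trans (^-congʳ y e) relation)) (trans (distribˡ _ _ _) (+-congʳ (*-congˡ (sym (*-identityʳ y))))))

      wt-suc : ∀ i j → wt i (suc j) ≡ wt i j ℕ.+ k
      wt-suc i j = solve' 3 (λ k j qi → qi :+' k :*' (con' 1 :+' j) :=' (qi :+' k :*' j) :+' k) ≡.refl k j (q ℕ.* i)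
        where open +-*-Solver renaming (solve to solve'; _:*_ to _:*'_; _:+_ to _:+'_; _:=_ to _:='_; con to con')

      wt-overflow : ∀ i j → suc j ≡ q → q ℕ.* (i ℕ.+ k) ≡ wt i (suc j)
      wt-overflow i j e rewrite e = ≡.trans (ℕP.*-distribˡ-+ q i k) (≡.cong (q ℕ.* i ℕ.+_) (ℕP.*-comm q k))

      wt-1 : ∀ i j → suc j ≡ q → wt i 1 < wt i (suc j)
      wt-1 i j e rewrite e = ℕP.+-monoʳ-< (q ℕ.* i) (ℕP.*-monoʳ-< k {{ℕ.>-nonZero 1≤k}} q≥2)

    -- The weights are chosen so that y^q and the top term of h both weigh q k. Replacing x^i y^q by
    -- x^i y + x^i h therefore does not raise the weight.
    Lt-y : ∀ {ω u} → Lt ω u → Lt (ω ℕ.+ k) (y * u)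
    Lt-y {ω} = Lt-linear y gen
      where
      gen : ∀ i j → j < q → wt i j < ω → Lt (ω ℕ.+ k) (y * mon i j)
      gen i j p l with ℕP.m≤n⇒m<n∨m≡n p
      ... | inj₁ p' = Lt-≈ (sym (y*mon i j)) (Lt-mon i (suc j) p' l')
        where
        l' : wt i (suc j) < ω ℕ.+ k
        l' = ℕP.≤-trans (ℕP.≤-reflexive (≡.cong suc (wt-suc i j))) (ℕP.+-monoˡ-≤ k l)
      ... | inj₂ e = Lt-≈ (sym (overflow i j e)) (Lt-+ (Lt-mon i 1 q≥2 (ℕP.<-trans (wt-1 i j e) l'))
              (Lt-h i k (≡.subst (_< ω ℕ.+ k) (≡.sym (wt-overflow i j e)) l')))
        where
        l' : wt i (suc j) < ω ℕ.+ k
        l' = ℕP.≤-trans (ℕP.≤-reflexive (≡.cong suc (wt-suc i j))) (ℕP.+-monoˡ-≤ k l)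

    -- Reduction of a monomial with arbitrary j, keeping its weight. Each replacement of y^q has
    -- leading term a_k x^k, so `c` is a power of a_k and stays nonzero.
    record Leading (i j : ℕ) : Set where
      field
        i' j'   : ℕ
        c       : F.Carrier
        rest    : Carrier
        j'<q    : j' < q
        wt-≡    : wt i' j' ≡ wt i j
        c≉0     : ¬ (c F.≈ F.0#)
        rest-Lt : Lt (wt i j) rest
        expand  : mon i j ≈ ι c * mon i' j' + rest

    leading : ∀ i j → Leading i j
    leading i zero = record
      { i' = i ; j' = 0 ; c = F.1# ; rest = 0# ; j'<q = ℕP.≤-trans (s≤s z≤n) q≥2 ; wt-≡ = ≡.refl
      ; c≉0 = λ e → FiniteField.0≉1 F (F.sym e) ; rest-Lt = nil refl
      ; expand = sym (trans (+-identityʳ _) (trans (*-congʳ ι-1) (*-identityˡ _))) }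
    leading i (suc j) with leading i j
    ... | record { i' = i' ; j' = j' ; c = c ; rest = rest ; j'<q = p ; wt-≡ = w≡ ; c≉0 = c≉0 ; rest-Lt = r ; expand = e }
        with ℕP.m≤n⇒m<n∨m≡n p
    ... | inj₁ p' = record
        { i' = i' ; j' = suc j' ; c = c ; rest = y * rest ; j'<q = p'
        ; wt-≡ = ≡.trans (wt-suc i' j') (≡.trans (≡.cong (ℕ._+ k) w≡) (≡.sym (wt-suc i j))) ; c≉0 = c≉0
        ; rest-Lt = ≡.subst (λ w → Lt w (y * rest)) (≡.sym (wt-suc i j)) (Lt-y r)
        ; expand = trans (sym (y*mon i j)) (trans (*-congˡ e) (trans
            (solve 4 (λ y c m r → y :* (c :* m :+ r) := c :* (y :* m) :+ y :* r) refl y (ι c) (mon i' j') rest)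
            (+-congʳ (*-congˡ (y*mon i' j'))))) }
    ... | inj₂ e' = record
        { i' = i' ℕ.+ k ; j' = 0 ; c = c F.* a k ; rest = ι c * (mon i' 1 + x ^ i' * low) + y * rest
        ; j'<q = ℕP.≤-trans (s≤s z≤n) q≥2
        ; wt-≡ = ≡.trans (≡.trans (≡.cong (q ℕ.* (i' ℕ.+ k) ℕ.+_) (ℕP.*-zeroʳ k)) (ℕP.+-identityʳ _)) (≡.trans (wt-overflow i' j' e') wt'≡)
        ; c≉0 = *-nonzero c≉0 aₖ≉0
        ; rest-Lt = Lt-+ (Lt-ι c (Lt-+ (Lt-mon i' 1 q≥2 (≡.subst (wt i' 1 <_) wt'≡ (wt-1 i' j' e'))) (low-Lt k 1≤k ≡.refl)))
            (≡.subst (λ w → Lt w (y * rest)) (≡.sym (wt-suc i j)) (Lt-y r))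
        ; expand = trans (sym (y*mon i j)) (trans (*-congˡ e) (trans
            (solve 4 (λ y c m r → y :* (c :* m :+ r) := c :* (y :* m) :+ y :* r) refl y (ι c) (mon i' j') rest)
            (trans (+-congʳ (*-congˡ (trans (overflow i' j' e') (+-congˡ (*-congˡ (h≈ k 1≤k))))))
            (trans (solve 7 (λ c m xi l ak xk yr → c :* (m :+ xi :* (l :+ ak :* xk)) :+ yr := (c :* ak) :* (xi :* xk) :+ (c :* (m :+ xi :* l) :+ yr)) refl
                (ι c) (mon i' 1) (x ^ i') low (ι (a k)) (x ^ k) (y * rest))
              (+-congʳ (*-cong (sym (ι-* c (a k))) (trans (sym (^-homo-* x i' k)) (sym (*-identityʳ _))))))))) }
      where
      low : Carrier
      low = sum₁ (ℕ.pred k) (λ i → ι (a i) * x ^ i)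
      wt'≡ : wt i' (suc j') ≡ wt i (suc j)
      wt'≡ = ≡.trans (wt-suc i' j') (≡.trans (≡.cong (ℕ._+ k) w≡) (≡.sym (wt-suc i j)))
      h≈ : ∀ n → 1 ≤ n → sum₁ n (λ i → ι (a i) * x ^ i) ≈ sum₁ (ℕ.pred n) (λ i → ι (a i) * x ^ i) + ι (a n) * x ^ n
      h≈ (suc n) _ = refl
      low-Lt : ∀ n → 1 ≤ n → n ≡ k → Lt (wt i (suc j)) (x ^ i' * sum₁ (ℕ.pred n) (λ i → ι (a i) * x ^ i))
      low-Lt (suc n) _ n≡k = Lt-h i' n (≡.subst (q ℕ.* (i' ℕ.+ n) <_) (≡.trans (wt-overflow i' j' e') wt'≡)
        (ℕP.*-monoʳ-< q {{ℕ.>-nonZero (ℕP.≤-trans (s≤s z≤n) q≥2)}} (ℕP.+-monoʳ-< i' (≡.subst (n <_) n≡k ℕP.≤-refl))))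

    Lt-any : ∀ i j → Lt (suc (wt i j)) (mon i j)
    Lt-any i j = add c i' j' j'<q (s≤s (ℕP.≤-reflexive wt-≡)) (Lt-mono (ℕP.n≤1+n _) rest-Lt) expand
      where open Leading (leading i j)

    coord-Lt : ∀ {ω u} i j → j < q → ω ≤ wt i j → Lt ω u → coord i j u F.≈ F.0#
    coord-Lt i j p l (nil e) = F.trans (coord-cong i j e) (coord-0 i j)
    coord-Lt i j p l (add {u} {v} c i' j' p' l' r e) = F.trans (coord-cong i j e) (F.trans (coord-+ i j _ v)
      (F.trans (F.+-cong (F.trans (coord-ι i j c _) (F.trans (F.*-congˡ (coord-else i j i' j' p p' ne)) (F.zeroʳ c))) (coord-Lt i j p l r)) (F.+-identityˡ _)))
      where
      ne : (i , j) ≢ (i' , j')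
      ne ≡.refl = ℕP.<⇒≱ l' l

    module Family {N : ℕ} (I J : Fin N → ℕ) (w-injective : ∀ s s' → wt (I s) (J s) ≡ wt (I s') (J s') → s ≡ s') where

      combination : (Fin N → F.Carrier) → Carrier
      combination e = sum (λ s → ι (e s) * mon (I s) (J s))

      private
        w : Fin N → ℕ
        w s = wt (I s) (J s)

      -- Downward induction on the weight. At the leading monomial of s, terms of smaller weight
      -- have coordinate 0, and the coefficients at larger weights are already known to vanish.
      -- `bound` exceeds all weights, so the induction starts vacuously.
      independent : ∀ e → combination e ≈ 0# → ∀ s → e s F.≈ F.0#
      independent e z s₀ = downward (w s₀) (bound ℕ.∸ w s₀) (ℕP.m∸n+n≡m (w≤bound s₀)) s₀ ℕP.≤-refl
        where
        maximum : ∀ {n} (f : Fin n → ℕ) → ∃ λ m → ∀ i → f i ≤ m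
        maximum {zero}  f = 0 , λ ()
        maximum {suc n} f with maximum (λ i → f (suc i))
        ... | m , p = f zero ℕ.⊔ m , λ { zero → ℕP.m≤m⊔n _ _ ; (suc i) → ℕP.≤-trans (p i) (ℕP.m≤n⊔m (f zero) m) }
        bound = suc (proj₁ (maximum w))
        w≤bound : ∀ s → w s ≤ bound
        w≤bound s = ℕP.m≤n⇒m≤1+n (proj₂ (maximum w) s)
        downward : ∀ n r → r ℕ.+ n ≡ bound → ∀ s → n ≤ w s → e s F.≈ F.0#
        downward n zero ≡.refl s l = ⊥-elim (ℕP.<⇒≱ l (proj₂ (maximum w) s))
        downward n (suc r) eq s l with ℕP.m≤n⇒m<n∨m≡n l
        ... | inj₁ n<w = downward (suc n) r (≡.trans (ℕP.+-suc r n) eq) s n<w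
        ... | inj₂ n≡w = conclude
          where
          open Leading (leading (I s) (J s))
          term : Fin N → F.Carrier
          term s' = coord i' j' (ι (e s') * mon (I s') (J s'))
          others : ∀ s' → s' ≢ s → term s' F.≈ F.0#
          others s' ne with ℕP.<-cmp (w s') (w s)
          ... | tri≈ _ p _ = ⊥-elim (ne (w-injective s' s p))
          ... | tri< p _ _ = F.trans (coord-ι i' j' (e s') _) (F.trans (F.*-congˡ
                (coord-Lt i' j' j'<q (ℕP.≤-trans p (ℕP.≤-reflexive (≡.sym wt-≡))) (Lt-any (I s') (J s')))) (F.zeroʳ _))
          ... | tri> _ _ p = F.trans (coord-ι i' j' (e s') _) (F.trans (F.*-congʳ
                (downward (suc n) r (≡.trans (ℕP.+-suc r n) eq) s' (≡.subst (λ z → suc z ≤ w s') (≡.sym n≡w) p))) (F.zeroˡ _))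
          lead : coord i' j' (mon (I s) (J s)) F.≈ c
          lead = F.trans (coord-cong i' j' expand) (F.trans (coord-+ i' j' _ rest) (F.trans
            (F.+-cong (F.trans (coord-ι i' j' c _) (F.trans (F.*-congˡ (coord-self i' j' j'<q)) (F.*-identityʳ c)))
                      (coord-Lt i' j' j'<q (ℕP.≤-reflexive (≡.sym wt-≡)) rest-Lt)) (F.+-identityʳ c)))
          conclude : e s F.≈ F.0#
          conclude with noZeroDivisors {e s} {c} (F.trans (F.*-congˡ (F.sym lead)) (F.trans (F.sym (coord-ι i' j' (e s) _))
                (F.trans (F.sym (SumTools.sum-single (FiniteField.commRing F) term s others))
                (F.trans (F.sym (coord-sum i' j' (λ s' → ι (e s') * mon (I s') (J s')))) (F.trans (coord-cong i' j' z) (coord-0 i' j'))))))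
          ... | inj₁ p = p
          ... | inj₂ p = ⊥-elim (c≉0 p)

    Lt-sum : ∀ {ω n} (t : Fin n → Carrier) → (∀ s → Lt ω (t s)) → Lt ω (sum t)
    Lt-sum {n = zero}  t l = nil refl
    Lt-sum {n = suc n} t l = Lt-+ (l zero) (Lt-sum (λ s → t (suc s)) (λ s → l (suc s)))

    Lt-mon-* : ∀ {ω u} i j → Lt ω u → Lt (ω ℕ.+ wt i j) (mon i j * u)
    Lt-mon-* {ω} {u} zero zero l = Lt-≈ (sym (trans (*-congʳ (*-identityˡ _)) (*-identityˡ u))) (Lt-mono (ℕP.m≤m+n ω _) l)
    Lt-mon-* {ω} {u} zero (suc j) l = ≡.subst (λ z → Lt z (mon 0 (suc j) * u)) (≡.trans (ℕP.+-assoc ω _ k) (≡.cong (ω ℕ.+_) (≡.sym (wt-suc 0 j))))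
      (Lt-≈ (trans (sym (*-assoc y _ _)) (*-congʳ (y*mon 0 j))) (Lt-y (Lt-mon-* 0 j l)))
    Lt-mon-* {ω} {u} (suc i) j l = ≡.subst (λ z → Lt z (mon (suc i) j * u))
        (solve' 4 (λ ω q i kj → (ω :+' (q :*' i :+' kj)) :+' q :=' ω :+' (q :*' (con' 1 :+' i) :+' kj)) ≡.refl ω q i (k ℕ.* j))
      (Lt-≈ (trans (sym (*-assoc x _ _)) (*-congʳ (x*mon i j))) (Lt-x (Lt-mon-* i j l)))
      where open +-*-Solver renaming (solve to solve'; _:*_ to _:*'_; _:+_ to _:+'_; _:=_ to _:='_; con to con')

    Lt-y+c : ∀ {ω u} c j → Lt ω u → Lt (ω ℕ.+ k ℕ.* j) ((y + ι c) ^ j * u)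
    Lt-y+c {ω} {u} c zero l = Lt-≈ (sym (*-identityˡ u)) (Lt-mono (ℕP.m≤m+n ω _) l)
    Lt-y+c {ω} {u} c (suc j) l = ≡.subst (λ z → Lt z ((y + ι c) ^ suc j * u))
        (≡.trans (ℕP.+-assoc ω _ k) (≡.cong (ω ℕ.+_) (≡.trans (ℕP.+-comm _ k) (≡.sym (ℕP.*-suc k j)))))
      (Lt-≈ (trans (sym (distribʳ _ _ _)) (sym (*-assoc _ _ _))) (Lt-+ (Lt-y ih) (Lt-mono (ℕP.m≤m+n _ k) (Lt-ι c ih))))
      where ih = Lt-y+c c j l

    reconstruct : ∀ {ω u} A → ω ≤ q ℕ.* A → Lt ω u →
      u ≈ sum {A} (λ i → sum {q} (λ j → ι (coord (toℕ i) (toℕ j) u) * mon (toℕ i) (toℕ j)))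
    reconstruct {ω} A l (nil {u} e) = trans e (sym (sum-zero {A} _ (λ i → sum-zero {q} _ (λ j →
      trans (*-congʳ (trans (ι-cong (F.trans (coord-cong _ _ e) (coord-0 _ _))) ι-0)) (zeroˡ _)))))
    reconstruct {ω} A l (add {u} {v} c i j p l' r e) = trans e (trans (+-cong first (reconstruct A l r))
        (trans (sym (∑-distrib-+ {A} _ _)) (sum-cong-≋ {A} (λ i' → trans (sym (∑-distrib-+ {q} _ _)) (sum-cong-≋ {q} (λ j' → combine i' j'))))))
      where
      i<A : i < A
      i<A = ℕP.*-cancelˡ-< q i A (ℕP.<-≤-trans (ℕP.≤-<-trans (ℕP.m≤m+n _ (k ℕ.* j)) l') l)
      t : Fin A → Fin q → Carrier
      t i' j' = ι (coord (toℕ i') (toℕ j') (ι c * mon i j)) * mon (toℕ i') (toℕ j')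
      i₀ = fromℕ< i<A
      j₀ = fromℕ< p
      zero-at : ∀ i' j' → (toℕ i' , toℕ j') ≢ (i , j) → t i' j' ≈ 0#
      zero-at i' j' ne = trans (*-congʳ (trans (ι-cong (F.trans (coord-ι _ _ c _) (F.trans (F.*-congˡ
        (coord-else _ _ i j (FinP.toℕ<n j') p ne)) (F.zeroʳ c)))) ι-0)) (zeroˡ _)
      first : ι c * mon i j ≈ sum {A} (λ i' → sum {q} (t i'))
      first = sym (trans (sum-single (λ i' → sum (t i')) i₀ (λ i' ne → sum-zero (t i') (λ j' → zero-at i' j'
            (λ eq → ne (FinP.toℕ-injective (≡.trans (≡.cong proj₁ eq) (≡.sym (FinP.toℕ-fromℕ< i<A))))))))
        (trans (sum-single (t i₀) j₀ (λ j' ne → zero-at i₀ j' (λ eq → ne (FinP.toℕ-injective (≡.trans (≡.cong proj₂ eq) (≡.sym (FinP.toℕ-fromℕ< p)))))))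
          (hit (FinP.toℕ-fromℕ< i<A) (FinP.toℕ-fromℕ< p))))
        where
        hit : ∀ {i' j'} → i' ≡ i → j' ≡ j → ι (coord i' j' (ι c * mon i j)) * mon i' j' ≈ ι c * mon i j
        hit ≡.refl ≡.refl = *-congʳ (ι-cong (F.trans (coord-ι i j c _) (F.trans (F.*-congˡ (coord-self i j p)) (F.*-identityʳ c))))
      combine : ∀ i' j' → t i' j' + ι (coord (toℕ i') (toℕ j') v) * mon (toℕ i') (toℕ j') ≈ ι (coord (toℕ i') (toℕ j') u) * mon (toℕ i') (toℕ j')
      combine i' j' = trans (sym (distribʳ _ _ _)) (*-congʳ (trans (sym (ι-+ _ _)) (ι-cong (F.sym (F.trans (coord-cong _ _ e) (coord-+ _ _ _ v))))))

    zero-coords : ∀ {ω u} A → ω ≤ q ℕ.* A → Lt ω u → (∀ (i : Fin A) (j : Fin q) → coord (toℕ i) (toℕ j) u F.≈ F.0#) → u ≈ 0#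
    zero-coords A l r z = trans (reconstruct A l r) (sum-zero {A} _ (λ i → sum-zero {q} _ (λ j → trans (*-congʳ (trans (ι-cong (z i j)) ι-0)) (zeroˡ _))))

    -- The A q coordinates are linear conditions on N > A q unknowns. Over a finite field the q^N
    -- coefficient vectors collide under the coordinate map, and the difference of two colliding
    -- vectors is a solution.
    siegel : ∀ {N ω} A (t : Fin N → Carrier) → (∀ s → Lt ω (t s)) → ω ≤ q ℕ.* A → A ℕ.* q < N →
      ∃ λ e → ¬ (∀ s → e s F.≈ F.0#) × sum (λ s → ι (e s) * t s) ≈ 0#
    siegel {N} {ω} A t t-Lt l A*q<N = e , e≉0 , zero-coords A l (Lt-sum _ (λ s → Lt-ι (e s) (t-Lt s))) coords
      where
      image : (Fin N → F.Carrier) → Fin A → Fin q → F.Carrier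
      image e i j = coord (toℕ i) (toℕ j) (sum (λ s → ι (e s) * t s))
      cards : Finite.card (A ⇒ (q ⇒ finite)) < Finite.card (N ⇒ finite)
      cards rewrite card-⇒ A (q ⇒ finite) | card-⇒ q finite | card-⇒ N finite | ℕP.^-*-assoc q q A =
        ℕP.^-monoʳ-< q q≥2 (≡.subst (_< N) (ℕP.*-comm A q) A*q<N)
      c = collision (N ⇒ finite) (A ⇒ (q ⇒ finite)) image
        (λ e i j → coord-cong _ _ (sum-cong-≋ (λ s → *-congʳ (ι-cong (e s))))) cards
      e₁ = proj₁ c
      e₂ = proj₁ (proj₂ c)
      e : Fin N → F.Carrier
      e s = e₁ s F.- e₂ s
      e≉0 : ¬ (∀ s → e s F.≈ F.0#)
      e≉0 z = proj₁ (proj₂ (proj₂ c)) (λ s → FieldFacts.x-y≈0⇒x≈y F (z s))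
      Σ : (Fin N → F.Carrier) → Carrier
      Σ e = sum (λ s → ι (e s) * t s)
      additive : Σ e + Σ e₂ ≈ Σ e₁
      additive = trans (sym (∑-distrib-+ (λ s → ι (e s) * t s) (λ s → ι (e₂ s) * t s))) (sum-cong-≋ {N} (λ s →
        trans (sym (distribʳ (t s) _ _)) (*-congʳ (trans (sym (ι-+ (e s) (e₂ s))) (ι-cong (F.trans (F.+-assoc _ _ _) (F.trans (F.+-congˡ (F.-‿inverseˡ _)) (F.+-identityʳ _))))))))
      coords : ∀ (i : Fin A) (j : Fin q) → coord (toℕ i) (toℕ j) (Σ e) F.≈ F.0#
      coords i j = cancel (F.trans (F.sym (coord-+ (toℕ i) (toℕ j) (Σ e) (Σ e₂)))
        (F.trans (coord-cong (toℕ i) (toℕ j) additive) (proj₂ (proj₂ (proj₂ c)) i j)))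
        where
        cancel : ∀ {u v} → u F.+ v F.≈ v → u F.≈ F.0#
        cancel {u} {v} e = F.trans (F.sym (F.trans (F.+-assoc u v (F.- v)) (F.trans (F.+-congˡ (F.-‿inverseʳ v)) (F.+-identityʳ u)))) (F.trans (F.+-congʳ e) (F.-‿inverseʳ v))

module HomSums {R A : CommutativeRing 0ℓ 0ℓ} (H : Hom R A) where
  private
    module R = CommutativeRing R
    module A = CommutativeRing A
  open Hom H
  import Algebra.Properties.Semiring.Sum R.semiring as SR
  import Algebra.Properties.Semiring.Sum A.semiring as SA

  ι-sum : ∀ {n} (t : Fin n → R.Carrier) → ι (SR.sum t) A.≈ SA.sum (λ i → ι (t i))
  ι-sum {zero}  t = ι-0
  ι-sum {suc n} t = A.trans (ι-+ _ _) (A.+-congˡ (ι-sum (λ i → t (suc i))))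

  ι-sum₁ : ∀ n (f : ℕ → R.Carrier) → ι (SumTools.sum₁ R n f) A.≈ SumTools.sum₁ A n (λ i → ι (f i))
  ι-sum₁ zero    f = ι-0
  ι-sum₁ (suc n) f = A.trans (ι-+ _ _) (A.+-congʳ (ι-sum₁ n f))

module _ (A : CommutativeRing 0ℓ 0ℓ) where
  open CommutativeRing A

  sum₁-cong : ∀ n {f g : ℕ → Carrier} → (∀ i → f i ≈ g i) → SumTools.sum₁ A n f ≈ SumTools.sum₁ A n g
  sum₁-cong zero    e = refl
  sum₁-cong (suc n) e = +-cong (sum₁-cong n e) (e (suc n))

-- When x^Q = x and y^Q = y + c, raising G to the power M turns the high exponents i + L i' into the low
-- exponents of E; as z ↦ z^M is injective on the algebra generated by x and y, E = 0 forces G = 0.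
module Twist (F : FiniteField) (A : CommutativeRing 0ℓ 0ℓ) (H : Hom (FiniteField.commRing F) A)
  (x y : CommutativeRing.Carrier A) (c : FiniteField.Carrier F) (m l : ℕ) where
  private
    module F = CommutativeRing (FiniteField.commRing F)
  open FiniteField F using () renaming (card to q)
  open FieldFacts F using (q≥2; binomialsVanish)
  open Factorisation F using (module FAlgebra; q'; q≡suc)
  open CommutativeRing A hiding (zero)
  open Hom H
  open FAlgebra A H
  open RingTools A
  open import Algebra.Properties.CommutativeSemiring.Exp commutativeSemiring
  open import Algebra.Properties.Semiring.Sum semiring
  open import Algebra.Properties.Semiring.Mult F.semiring using () renaming (_×_ to _×ⁿ_; ×-congˡ to ×ⁿ-congˡ; ×-assoc-* to ×ⁿ-assoc-*; ×-congʳ to ×ⁿ-congʳ)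
  open import Relation.Binary.Reasoning.Setoid setoid

  M L Q : ℕ
  M = q ℕ.^ m
  L = q ℕ.^ l
  Q = q ℕ.^ (l ℕ.+ m)

  L*M≡Q : L ℕ.* M ≡ Q
  L*M≡Q = ≡.sym (ℕP.^-distribˡ-+-* q l m)

  sum-^ : ∀ n {N} (t : Fin N → Carrier) → sum t ^ (q ℕ.^ n) ≈ sum (λ s → t s ^ (q ℕ.^ n))
  sum-^ n {zero}  t = 0^qⁿ n
  sum-^ n {suc N} t = trans (^qⁿ-+ n (t zero) _) (+-congˡ (sum-^ n (λ s → t (suc s))))

  -- q · 1 = C(q,1) · 1 is one of the vanishing binomials.
  q×c≈0 : q ×ⁿ c F.≈ F.0#
  q×c≈0 = F.trans (×ⁿ-congʳ q (F.sym (F.*-identityˡ c))) (F.trans (F.sym (×ⁿ-assoc-* q F.1# c))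
    (F.trans (F.*-congʳ (F.trans (×ⁿ-congˡ (≡.trans q≡suc (≡.sym (nC1≡n (suc q'))))) (vanish₁ q' q≡suc))) (F.zeroˡ c)))
    where
    vanish₁ : ∀ q' → q ≡ suc q' → (suc q' choose 1) ×ⁿ F.1# F.≈ F.0#
    vanish₁ zero    e = ⊥-elim (ℕP.<⇒≱ (≡.subst (_< 2) (≡.sym e) ℕP.≤-refl) q≥2)
    vanish₁ (suc p) e = binomialsVanish (suc p) e zero

  module _ (x^Q : x ^ Q ≈ x) (y^Q : y ^ Q ≈ y + ι c) where

    x^Qᵗ : ∀ t → x ^ (Q ℕ.^ t) ≈ x
    x^Qᵗ zero    = *-identityʳ x
    x^Qᵗ (suc t) = trans (sym (^-assocʳ x Q (Q ℕ.^ t))) (trans (^-congˡ (Q ℕ.^ t) x^Q) (x^Qᵗ t))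

    y^Qᵗ : ∀ t → y ^ (Q ℕ.^ t) ≈ y + ι (t ×ⁿ c)
    y^Qᵗ zero    = trans (*-identityʳ y) (sym (trans (+-congˡ ι-0) (+-identityʳ y)))
    y^Qᵗ (suc t) = begin
      y ^ (Q ℕ.* Q ℕ.^ t)                           ≈⟨ ^-congʳ y (ℕP.*-comm Q (Q ℕ.^ t)) ⟩
      y ^ (Q ℕ.^ t ℕ.* Q)                           ≈⟨ sym (^-assocʳ y (Q ℕ.^ t) Q) ⟩
      (y ^ (Q ℕ.^ t)) ^ Q                           ≈⟨ ^-congˡ Q (y^Qᵗ t) ⟩
      (y + ι (t ×ⁿ c)) ^ Q                          ≈⟨ ^qⁿ-+ (l ℕ.+ m) y _ ⟩
      y ^ Q + ι (t ×ⁿ c) ^ Q                        ≈⟨ +-cong y^Q (ι-^qⁿ (l ℕ.+ m) _) ⟩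
      (y + ι c) + ι (t ×ⁿ c)                        ≈⟨ trans (+-assoc _ _ _) (+-congˡ (sym (ι-+ c _))) ⟩
      y + ι (suc t ×ⁿ c)                            ∎

    Q^q : ℕ
    Q^q = Q ℕ.^ q

    -- After q rounds the translations by c add up to q c = 0, so both x and y are fixed by z ↦
    -- z^(Q^q).
    y^Q^q : y ^ Q^q ≈ y
    y^Q^q = trans (y^Qᵗ q) (trans (+-congˡ (trans (ι-cong q×c≈0) ι-0)) (+-identityʳ y))

    Q^q≡ : Q^q ≡ q ℕ.^ ((l ℕ.+ m) ℕ.* q)
    Q^q≡ = ℕP.^-*-assoc q (l ℕ.+ m) q

    mon^ : ∀ n i j → (x ^ i * y ^ j) ^ n ≈ (x ^ n) ^ i * (y ^ n) ^ j
    mon^ n i j = trans (^-distrib-* (x ^ i) (y ^ j) n) (*-cong (swap x i) (swap y j))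
      where
      swap : ∀ z i → (z ^ i) ^ n ≈ (z ^ n) ^ i
      swap z i = trans (^-assocʳ z i n) (trans (^-congʳ z (ℕP.*-comm i n)) (sym (^-assocʳ z n i)))

    module _ {N : ℕ} (e : Fin N → F.Carrier) (i j i' j' : Fin N → ℕ) where

      G : Carrier
      G = sum (λ s → ι (e s) * (x ^ (i s ℕ.+ L ℕ.* i' s) * y ^ (j s ℕ.+ L ℕ.* j' s)))

      -- G^M after substituting x^Q = x and y^Q = y + c, with L M = Q. The idle factors `y ^ 0` and
      -- `1#` keep the shape in which the weight bounds for products apply.
      E : Carrier
      E = sum (λ s → ι (e s) * ((x ^ (M ℕ.* i s) * y ^ (M ℕ.* j s)) * ((x ^ i' s * y ^ 0) * ((y + ι c) ^ j' s * 1#))))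

      private
        term : Fin N → Carrier
        term s = ι (e s) * (x ^ (i s ℕ.+ L ℕ.* i' s) * y ^ (j s ℕ.+ L ℕ.* j' s))

        G^M≈E : G ^ M ≈ E
        G^M≈E = trans (sum-^ m term) (sum-cong-≋ {N} λ s → begin
          (ι (e s) * (x ^ (i s ℕ.+ L ℕ.* i' s) * y ^ (j s ℕ.+ L ℕ.* j' s))) ^ M      ≈⟨ ^-distrib-* _ _ M ⟩
          ι (e s) ^ M * (x ^ (i s ℕ.+ L ℕ.* i' s) * y ^ (j s ℕ.+ L ℕ.* j' s)) ^ M    ≈⟨ *-cong (ι-^qⁿ m (e s)) (^-distrib-* _ _ M) ⟩
          ι (e s) * ((x ^ (i s ℕ.+ L ℕ.* i' s)) ^ M * (y ^ (j s ℕ.+ L ℕ.* j' s)) ^ M)  ≈⟨ *-congˡ (*-cong (power x (i s) (i' s)) (power y (j s) (j' s))) ⟩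
          ι (e s) * ((x ^ (M ℕ.* i s) * (x ^ Q) ^ i' s) * (y ^ (M ℕ.* j s) * (y ^ Q) ^ j' s))  ≈⟨ *-congˡ (*-cong (*-congˡ (^-congˡ (i' s) x^Q)) (*-congˡ (^-congˡ (j' s) y^Q))) ⟩
          ι (e s) * ((x ^ (M ℕ.* i s) * x ^ i' s) * (y ^ (M ℕ.* j s) * (y + ι c) ^ j' s))
            ≈⟨ *-congˡ (solve 4 (λ a b c d → (a :* b) :* (c :* d) := (a :* c) :* (b :* d)) refl _ _ _ _) ⟩
          ι (e s) * ((x ^ (M ℕ.* i s) * y ^ (M ℕ.* j s)) * (x ^ i' s * (y + ι c) ^ j' s))
            ≈⟨ *-congˡ (*-congˡ (*-cong (sym (*-identityʳ _)) (sym (*-identityʳ _)))) ⟩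
          ι (e s) * ((x ^ (M ℕ.* i s) * y ^ (M ℕ.* j s)) * ((x ^ i' s * y ^ 0) * ((y + ι c) ^ j' s * 1#))) ∎)
          where
          power : ∀ z i i' → (z ^ (i ℕ.+ L ℕ.* i')) ^ M ≈ z ^ (M ℕ.* i) * (z ^ Q) ^ i'
          power z i i' = trans (^-assocʳ z (i ℕ.+ L ℕ.* i') M) (trans (^-congʳ z (≡.trans (ℕP.*-comm (i ℕ.+ L ℕ.* i') M) (≡.trans (ℕP.*-distribˡ-+ M i (L ℕ.* i'))
            (≡.cong (M ℕ.* i ℕ.+_) (≡.trans (≡.sym (ℕP.*-assoc M L i')) (≡.cong (ℕ._* i') (≡.trans (ℕP.*-comm M L) L*M≡Q)))))))
            (trans (^-homo-* z (M ℕ.* i) (Q ℕ.* i')) (*-congˡ (sym (^-assocʳ z Q i')))))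

        G^Q^q≈G : G ^ Q^q ≈ G
        G^Q^q≈G = trans (^-congʳ G Q^q≡) (trans (sum-^ ((l ℕ.+ m) ℕ.* q) term) (sum-cong-≋ {N} λ s →
          trans (^-congʳ (term s) (≡.sym Q^q≡)) (trans (^-distrib-* _ _ Q^q) (*-cong
            (trans (^-congʳ (ι (e s)) Q^q≡) (ι-^qⁿ ((l ℕ.+ m) ℕ.* q) (e s)))
            (trans (mon^ Q^q (i s ℕ.+ L ℕ.* i' s) (j s ℕ.+ L ℕ.* j' s)) (*-cong (^-congˡ (i s ℕ.+ L ℕ.* i' s) (x^Qᵗ q)) (^-congˡ (j s ℕ.+ L ℕ.* j' s) y^Q^q)))))))

      -- G is fixed by z ↦ z^(Q^q), and that map factors through z ↦ z^M, so G is a power of G^M =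
      -- E.
      G-vanishes : E ≈ 0# → G ≈ 0#
      G-vanishes E≈0 = trans (sym G^Q^q≈G) (trans (^-congʳ G split) (trans (sym (^-assocʳ G M (q ℕ.^ r)))
        (trans (^-congˡ (q ℕ.^ r) (trans G^M≈E E≈0)) (0^qⁿ r))))
        where
        r = (l ℕ.+ m) ℕ.* q ℕ.∸ m
        m≤ : m ≤ (l ℕ.+ m) ℕ.* q
        m≤ = ℕP.≤-trans (ℕP.m≤n+m m l) (ℕP.m≤m*n (l ℕ.+ m) q {{ℕ.>-nonZero (ℕP.≤-trans (s≤s z≤n) q≥2)}})
        split : Q^q ≡ M ℕ.* q ℕ.^ r
        split = ≡.trans Q^q≡ (≡.trans (≡.cong (q ℕ.^_) (≡.sym (ℕP.m+[n∸m]≡n m≤))) (ℕP.^-distribˡ-+-* q m r))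

module _ (R : CommutativeRing 0ℓ 0ℓ) where
  open CommutativeRing R hiding (zero)
  open Poly R
  open Monomials R
  open import Algebra.Properties.Semiring.Exp (CommutativeRing.semiring polyRing) using () renaming (_^_ to _^ᵖ_)

  X^-else : ∀ n i → i ≢ n → coeff (X ^ᵖ n) i ≈ 0#
  X^-else zero    zero    ne = ⊥-elim (ne ≡.refl)
  X^-else zero    (suc i) ne = refl
  X^-else (suc n) zero    ne = at (X^-suc n) zero
  X^-else (suc n) (suc i) ne = trans (at (X^-suc n) (suc i)) (X^-else n i (λ e → ne (≡.cong suc e)))

-- For y^q - y - h: constant term -h, linear term -1, zeros above. The length is a variable because
-- q is not a literal to match on.
curveCoefficients : {C : Set} (c₀ c₁ c₂ : C) → ∀ n → Fin (suc n) → C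
curveCoefficients c₀ c₁ c₂ n       zero          = c₀
curveCoefficients c₀ c₁ c₂ (suc n) (suc zero)    = c₁
curveCoefficients c₀ c₁ c₂ (suc n) (suc (suc i)) = c₂

module ArtinSchreier (F : FiniteField) (k : ℕ) (1≤k : 1 ≤ k) (a : ℕ → FiniteField.Carrier F)
  (aₖ≉0 : ¬ (FiniteField._≈_ F (a k) (FiniteField.0# F))) where
  open FiniteField F using (commRing) renaming (card to q)
  open FieldFacts F using (q≥2)
  private
    module F = CommutativeRing commRing
  open Factorisation F
  open PrimeCount F
  open Irreducible using (deg; lower; field')
  open Poly commRing

  hAt : {A : CommutativeRing 0ℓ 0ℓ} (H : Hom commRing A) → CommutativeRing.Carrier A → CommutativeRing.Carrier A
  hAt {A} H z = SumTools.sum₁ A k (λ i → Hom.ι H (a i) A.* z ^ i)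
    where
    module A = CommutativeRing A
    open import Algebra.Properties.Semiring.Exp A.semiring

  -- Over R = F[x] this is the curve itself (`Base`), over R = F[x]/P its fibre above P; one
  -- construction makes the two comparable.
  module Curve (R : CommutativeRing 0ℓ 0ℓ) (HR : Hom commRing R) (x₀ hR : CommutativeRing.Carrier R)
    (hR≈ : CommutativeRing._≈_ R hR (hAt HR x₀)) where
    private module R = CommutativeRing R
    module PR = Poly R

    f : Fin (suc q') → R.Carrier
    f = curveCoefficients (R.- hR) (R.- R.1#) R.0# q'

    module D = PR.Division f
    B = D.quotient
    module B = CommutativeRing B
    open import Algebra.Properties.CommutativeSemiring.Exp B.commutativeSemiring

    fromR : Hom R B
    fromR = quotientHom R f ∘H constHom R

    fromF : Hom commRing B
    fromF = fromR ∘H HR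

    x y : B.Carrier
    x = x₀ ∷ []
    y = PR.X

    h≈ : hAt fromF x B.≈ Hom.ι fromR hR
    h≈ = B.sym (B.trans (Hom.ι-cong fromR hR≈) (B.trans (HomSums.ι-sum₁ fromR k _) (sum₁-cong B k (λ i →
      B.trans (Hom.ι-* fromR _ _) (B.*-congˡ {Hom.ι fromF (a i)} (Hom.ι-^ fromR x₀ i))))))

    relation : y ^ q B.≈ y B.+ hAt fromF x
    relation = B.trans (^-congʳ y q≡suc) (B.trans (rearrange (B.trans (B.sym total) zero-total)) (B.+-congˡ {y} (B.sym h≈)))
      where
      open RingTools B
      open Eval fromR
      yq = y ^ suc q'
      zero-total : PR.monic f B.≈ B.0#
      zero-total = D.mk D.rem-monic
      lst-f : ∀ p → q ≡ suc p → ev y (PR.lst (curveCoefficients (R.- hR) (R.- R.1#) R.0# p)) B.≈ Hom.ι fromR (R.- hR) B.+ y B.* (Hom.ι fromR (R.- R.1#) B.+ y B.* B.0#)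
      lst-f zero    e = ⊥-elim (ℕP.<⇒≱ (≡.subst (_< 2) (≡.sym e) ℕP.≤-refl) q≥2)
      lst-f (suc p) e = B.+-congˡ {Hom.ι fromR (R.- hR)} (B.*-congˡ {y} (B.+-congˡ {Hom.ι fromR (R.- R.1#)} (B.*-congˡ {y} (ev-zero y (PR.lst {p} (λ _ → R.0#)) PR.lst-0))))
      total : PR.monic f B.≈ ev y (PR.lst f) B.+ yq
      total = B.trans (B.sym (QuotientEval.ev-X-quotient R f (PR.monic f))) (ev-monic y f)
      rearrange : ev y (PR.lst f) B.+ yq B.≈ B.0# → yq B.≈ y B.+ Hom.ι fromR hR
      rearrange e = B.trans (solve 3 (λ w y h → w := ((:- h :- y) :+ w) :+ (y :+ h)) B.refl yq y hB)
        (B.trans (B.+-congʳ {y B.+ hB} (B.trans (B.+-congʳ {yq} (B.sym ev≈)) e)) (B.+-identityˡ _))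
        where
        hB = Hom.ι fromR hR
        ev≈ : ev y (PR.lst f) B.≈ (B.- hB) B.- y
        ev≈ = B.trans (lst-f q' q≡suc) (B.+-cong (Hom.ι-neg fromR hR) (B.trans (B.*-congˡ {y} {Hom.ι fromR (R.- R.1#) B.+ y B.* B.0#} {B.- B.1#}
          (B.trans (B.+-cong (B.trans (Hom.ι-neg fromR R.1#) (B.-‿cong (Hom.ι-1 fromR))) (B.zeroʳ y)) (B.+-identityʳ (B.- B.1#))))
          (B.trans (B.*-comm y (B.- B.1#)) (-1*x≈-x y))))
          where open import Algebra.Properties.Ring B.ring using (-1*x≈-x)

  private
    module Fx = CommutativeRing polyRing

  hₓ : List F.Carrier
  hₓ = hAt (constHom commRing) X

  module Base = Curve polyRing (constHom commRing) X hₓ Fx.refl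
  module PB = Poly polyRing

  coordₓ : ℕ → Base.B.Carrier → List F.Carrier
  coordₓ j u = PB.coeff (PB.lst (PB.rem Base.f u)) j

  coord : ℕ → ℕ → Base.B.Carrier → F.Carrier
  coord i j u = coeff (coordₓ j u) i

  module W = Weighted F Base.B Base.fromF Base.x Base.y k 1≤k a aₖ≉0 coord

  private
    coordₓ-cong : ∀ j {u v} → u Base.B.≈ v → coordₓ j u ≋ coordₓ j v
    coordₓ-cong j e = PB.at (PB.lst-cong (Base.D.on e)) j

    coordₓ-short : ∀ j u → u PB.deg< suc q' → coordₓ j u ≋ PB.coeff u j
    coordₓ-short j u l = PB.at (PB.≋-trans (PB.lst-cong (Base.D.rem-short u l)) (PB.≋-sym (PB.lst-coeff u l))) j

    coordₓ-+ : ∀ j u v → coordₓ j (u Base.B.+ v) ≋ coordₓ j u ⊕ coordₓ j v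
    coordₓ-+ j u v = ≋-trans (PB.at (PB.lst-cong (Base.D.rem-⊕ u v)) j) (≋-trans (PB.at (PB.lst-⊕ (PB.rem Base.f u) (PB.rem Base.f v)) j)
      (PB.coeff-⊕ (PB.lst (PB.rem Base.f u)) (PB.lst (PB.rem Base.f v)) j))

    lst-· : ∀ {n} g (r : Fin n → List F.Carrier) j → PB.coeff (PB.lst (λ i → g ⊛ r i)) j ≋ g ⊛ PB.coeff (PB.lst r) j
    lst-· {zero}  g r j       = ≋-sym (⊛-zeroʳ g)
    lst-· {suc n} g r zero    = ≋-refl
    lst-· {suc n} g r (suc j) = lst-· g (λ i → r (suc i)) j

    coordₓ-· : ∀ j g u → coordₓ j ((g ∷ []) PB.⊛ u) ≋ g ⊛ coordₓ j u
    coordₓ-· j g u = ≋-trans (coordₓ-cong j {(g ∷ []) PB.⊛ u} {g PB.· u} (Base.D.≋⇒≃ (PB.const-⊛ g u)))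
      (≋-trans (PB.at (PB.lst-cong (Base.D.rem-· g u)) j) (lst-· g (PB.rem Base.f u) j))

    open import Algebra.Properties.Semiring.Exp Fx.semiring using () renaming (_^_ to _^ₓ_)
    open import Algebra.Properties.Semiring.Exp (CommutativeRing.semiring PB.polyRing) using () renaming (_^_ to _^ᵇ_)

    coordₓ-mon : ∀ i j j' → j < q → coordₓ j' (W.mon i j) ≋ (X ^ₓ i) ⊛ PB.coeff (PB.X ^ᵇ j) j'
    coordₓ-mon i j j' j<q = ≋-trans (coordₓ-cong j' {W.mon i j} {((X ^ₓ i) ∷ []) PB.⊛ (PB.X ^ᵇ j)}
        (Base.B.*-cong (Base.B.sym (Hom.ι-^ Base.fromR X i)) (Base.B.sym (Hom.ι-^ (quotientHom polyRing Base.f) PB.X j))))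
      (≋-trans (coordₓ-· j' (X ^ₓ i) (PB.X ^ᵇ j)) (⊛-congˡ (X ^ₓ i) (coordₓ-short j' (PB.X ^ᵇ j)
        (PB.deg<-mono {PB.X ^ᵇ j} (≡.subst (suc j ≤_) q≡suc j<q) (Monomials.X^-deg polyRing j)))))

  laws : W.Laws
  laws = record
    { relation   = Base.relation
    ; coord-cong = λ i j {u} {v} e → at (coordₓ-cong j {u} {v} e) i
    ; coord-+    = λ i j u v → F.trans (at (coordₓ-+ j u v) i) (coeff-⊕ (coordₓ j u) (coordₓ j v) i)
    ; coord-ι    = λ i j c u → F.trans (at (≋-trans (coordₓ-· j (c ∷ []) u) (const-⊛ c (coordₓ j u))) i) (coeff-· c (coordₓ j u) i)
    ; coord-self = λ i j p → F.trans (at (≋-trans (coordₓ-mon i j j p) (≋-trans (⊛-congˡ (X ^ₓ i) (Monomials.X^-top polyRing j))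
        (≋-trans (⊛-comm (X ^ₓ i) one) (⊛-identityˡ (X ^ₓ i))))) i) (Monomials.X^-top commRing i)
    ; coord-else = λ i j i' j' p p' ne → else i j i' j' p p' ne }
    where
    else : ∀ i j i' j' → j < q → j' < q → (i , j) ≢ (i' , j') → coord i j (W.mon i' j') F.≈ F.0#
    else i j i' j' p p' ne with j ℕ.≟ j'
    ... | no n = at (≋-trans (coordₓ-mon i' j' j p') (≋-trans (⊛-congˡ (X ^ₓ i') (X^-else polyRing j' j n)) (⊛-zeroʳ (X ^ₓ i')))) i
    ... | yes ≡.refl = F.trans (at (≋-trans (coordₓ-mon i' j j p) (≋-trans (⊛-congˡ (X ^ₓ i') (Monomials.X^-top polyRing j))
        (≋-trans (⊛-comm (X ^ₓ i') one) (⊛-identityˡ (X ^ₓ i'))))) i) (X^-else commRing i' i (λ e → ne (≡.cong (_, j) e)))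

  module Fibre (P : Irreducible) where
    open Residue P using (K; toK; fermatK)
    Kr = FiniteField.commRing K
    open import Algebra.Properties.CommutativeSemiring.Exp K.commutativeSemiring

    hₖ≈ : hₓ K.≈ hAt toK X
    hₖ≈ = K.trans (HomSums.ι-sum₁ G k _) (sum₁-cong Kr k (λ i → K.*-congˡ {a i ∷ []} (Hom.ι-^ G X i)))
      where G = quotientHom commRing (lower P)

    -- At n = deg P this is the trace of h(X) from the residue field down to F, written as the sum
    -- of its Frobenius conjugates.
    trace : ℕ → K.Carrier
    trace zero    = K.0#
    trace (suc n) = trace n K.+ hAt toK X ^ (q ℕ.^ n)

    module C = Curve Kr toK X hₓ hₖ≈
    module AlgB = FAlgebra C.B C.fromF

    fromBase : Hom Base.B C.B
    fromBase = record
      { ι = λ u → u ; ι-cong = λ e → C.D.mk (λ i → Division.≋⇒≃ (lower P) (Base.D.on e i))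
      ; ι-+ = λ _ _ → C.B.refl ; ι-* = λ _ _ → C.B.refl ; ι-0 = C.B.refl ; ι-1 = C.B.refl }

    module SC where
      open import Algebra.Properties.Semiring.Sum C.B.semiring public

    module EB where
      open import Algebra.Properties.CommutativeSemiring.Exp C.B.commutativeSemiring public
    open EB using () renaming (_^_ to _^ᴮ_)

    -- Iterate y^q = y + h. At n = deg P, prescribing the trace c of h(X) becomes y^Q = y + c, the
    -- hypothesis of `Twist`.
    y^qⁿ : ∀ n → C.y ^ᴮ (q ℕ.^ n) C.B.≈ C.y C.B.+ Hom.ι C.fromR (trace n)
    y^qⁿ zero    = C.B.trans (C.B.*-identityʳ C.y) (C.B.sym (C.B.trans (C.B.+-congˡ {C.y} (Hom.ι-0 C.fromR)) (C.B.+-identityʳ C.y)))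
    y^qⁿ (suc n) = C.B.trans (C.B.sym (EB.^-assocʳ C.y q (q ℕ.^ n))) (C.B.trans (EB.^-congˡ (q ℕ.^ n) C.relation)
      (C.B.trans (AlgB.^qⁿ-+ n C.y (hAt C.fromF C.x)) (C.B.trans (C.B.+-cong (y^qⁿ n)
        (C.B.trans (EB.^-congˡ (q ℕ.^ n) (C.B.trans C.h≈ (Hom.ι-cong C.fromR hₖ≈))) (C.B.sym (Hom.ι-^ C.fromR (hAt toK X) (q ℕ.^ n)))))
        (C.B.trans (C.B.+-assoc C.y (Hom.ι C.fromR (trace n)) (Hom.ι C.fromR (hAt toK X ^ (q ℕ.^ n)))) (C.B.+-congˡ {C.y} (C.B.sym (Hom.ι-+ C.fromR (trace n) (hAt toK X ^ (q ℕ.^ n)))))))))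

    x^Q : C.x ^ᴮ (q ℕ.^ deg P) C.B.≈ C.x
    x^Q = C.B.trans (C.B.sym (Hom.ι-^ C.fromR X (q ℕ.^ deg P))) (Hom.ι-cong C.fromR (fermatK X))

    -- Reduction modulo P is the identity on representatives, and both quotients compute remainders
    -- by the same function; vanishing in the fibre says that P divides every F[x]-coordinate.
    coordₓ-zero : ∀ u → u C.B.≈ C.B.0# → ∀ j → P ∣ᴾ coordₓ j u
    coordₓ-zero u e j i = Division._≃_.on (C.PR.at (C.PR.≋-trans (C.PR.lst-cong (C.D.on e)) C.PR.lst-0) j) i

  -- Stepanov's auxiliary polynomial: the coefficients e solve E = 0 identically on the curve, so G = 0 at every
  -- irreducible P of degree l + m where h has trace c, while distinct weights keep G itself nonzero.
  module Auxiliary (c : F.Carrier) (m l S U A₁ A₂ : ℕ)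
    (small     : ∀ i j → i < S → j < q → W.wt i j < q ℕ.^ l)
    (wt-unique : ∀ i j i' j' → j < q → j' < q → W.wt i j ≡ W.wt i' j' → i ≡ i' × j ≡ j')
    (bound₁    : ∀ i j i' j' → i < S → j < q → i' < U → j' < q →
                 ((1 ℕ.+ k ℕ.* j') ℕ.+ W.wt i' 0) ℕ.+ W.wt (q ℕ.^ m ℕ.* i) (q ℕ.^ m ℕ.* j) ≤ q ℕ.* A₁)
    (unknowns  : A₁ ℕ.* q < (S ℕ.* q) ℕ.* (U ℕ.* q))
    (bound₂    : ∀ i j i' j' → i < S → j < q → i' < U → j' < q →
                 W.wt (i ℕ.+ q ℕ.^ l ℕ.* i') (j ℕ.+ q ℕ.^ l ℕ.* j') < q ℕ.* A₂)
    where
    private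
      L M N : ℕ
      L = q ℕ.^ l
      M = q ℕ.^ m
      N = (S ℕ.* q) ℕ.* (U ℕ.* q)

      outer : Fin N → Fin (S ℕ.* q) × Fin (U ℕ.* q)
      outer = Fin.remQuot (U ℕ.* q)

      iᶠ : Fin N → Fin S
      iᶠ s = proj₁ (Fin.remQuot q (proj₁ (outer s)))
      jᶠ : Fin N → Fin q
      jᶠ s = proj₂ (Fin.remQuot {S} q (proj₁ (outer s)))
      i'ᶠ : Fin N → Fin U
      i'ᶠ s = proj₁ (Fin.remQuot q (proj₂ (outer s)))
      j'ᶠ : Fin N → Fin q
      j'ᶠ s = proj₂ (Fin.remQuot {U} q (proj₂ (outer s)))

      i j i' j' I J : Fin N → ℕ
      i s = toℕ (iᶠ s)
      j s = toℕ (jᶠ s)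
      i' s = toℕ (i'ᶠ s)
      j' s = toℕ (j'ᶠ s)
      I s = i s ℕ.+ L ℕ.* i' s
      J s = j s ℕ.+ L ℕ.* j' s

      i<S : ∀ s → i s < S
      i<S s = FinP.toℕ<n (iᶠ s)
      j<q : ∀ s → j s < q
      j<q s = FinP.toℕ<n (jᶠ s)
      i'<U : ∀ s → i' s < U
      i'<U s = FinP.toℕ<n (i'ᶠ s)
      j'<q : ∀ s → j' s < q
      j'<q s = FinP.toℕ<n (j'ᶠ s)

      -- Since wt(i, j) < L, this is an expansion in base L: the weight determines wt(i, j) and
      -- wt(i', j'), and these determine the four indices.
      wt-split : ∀ s → W.wt (I s) (J s) ≡ W.wt (i s) (j s) ℕ.+ L ℕ.* W.wt (i' s) (j' s)
      wt-split s = solve 7 (λ q k L i j i' j' → q :* (i :+ L :* i') :+ k :* (j :+ L :* j') := (q :* i :+ k :* j) :+ L :* (q :* i' :+ k :* j')) ≡.refl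
          q k L (i s) (j s) (i' s) (j' s)
        where open +-*-Solver

      digits : ∀ {r r' t t'} → r < L → r' < L → r ℕ.+ L ℕ.* t ≡ r' ℕ.+ L ℕ.* t' → r ≡ r' × t ≡ t'
      digits {r} {r'} {t} {t'} r<L r'<L e = r≡r' , ℕP.*-cancelˡ-≡ t t' L (ℕP.+-cancelˡ-≡ r _ _ (≡.trans e (≡.cong (ℕ._+ L ℕ.* t') (≡.sym r≡r'))))
        where
        instance
          L≢0 : ℕ.NonZero L
          L≢0 = ℕ.>-nonZero (ℕP.≤-<-trans z≤n r<L)
        rem≡ : ∀ r t → r < L → (r ℕ.+ L ℕ.* t) DM.% L ≡ r
        rem≡ r t l = ≡.trans (≡.cong (λ z → (r ℕ.+ z) DM.% L) (ℕP.*-comm L t)) (≡.trans (DM.[m+kn]%n≡m%n r t L) (DM.m<n⇒m%n≡m l))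
        r≡r' : r ≡ r'
        r≡r' = ≡.trans (≡.sym (rem≡ r t r<L)) (≡.trans (≡.cong (DM._% L) e) (rem≡ r' t' r'<L))

      remQuot-injective : ∀ {a b} (s s' : Fin (a ℕ.* b)) → proj₁ (Fin.remQuot {a} b s) ≡ proj₁ (Fin.remQuot {a} b s') →
        proj₂ (Fin.remQuot {a} b s) ≡ proj₂ (Fin.remQuot {a} b s') → s ≡ s'
      remQuot-injective {a} {b} s s' e e' = ≡.trans (≡.sym (FinP.combine-remQuot {a} b s))
        (≡.trans (≡.cong₂ Fin.combine e e') (FinP.combine-remQuot {a} b s'))

      w-injective : ∀ s s' → W.wt (I s) (J s) ≡ W.wt (I s') (J s') → s ≡ s'
      w-injective s s' e = remQuot-injective {S ℕ.* q} {U ℕ.* q} s s'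
          (remQuot-injective {S} {q} _ _ (FinP.toℕ-injective (proj₁ inner)) (FinP.toℕ-injective (proj₂ inner)))
          (remQuot-injective {U} {q} _ _ (FinP.toℕ-injective (proj₁ inner')) (FinP.toℕ-injective (proj₂ inner')))
        where
        split : W.wt (i s) (j s) ≡ W.wt (i s') (j s') × W.wt (i' s) (j' s) ≡ W.wt (i' s') (j' s')
        split = digits (small (i s) (j s) (i<S s) (j<q s)) (small (i s') (j s') (i<S s') (j<q s'))
          (≡.trans (≡.sym (wt-split s)) (≡.trans e (wt-split s')))
        inner : i s ≡ i s' × j s ≡ j s'
        inner = wt-unique (i s) (j s) (i s') (j s') (j<q s) (j<q s') (proj₁ split)
        inner' : i' s ≡ i' s' × j' s ≡ j' s'
        inner' = wt-unique (i' s) (j' s) (i' s') (j' s') (j'<q s) (j'<q s') (proj₂ split)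

      module B = Base.B
      open Hom Base.fromF using (ι)
      open import Algebra.Properties.CommutativeSemiring.Exp B.commutativeSemiring
      open import Algebra.Properties.Semiring.Sum B.semiring

      t : Fin N → B.Carrier
      t s = W.mon (M ℕ.* i s) (M ℕ.* j s) B.* (W.mon (i' s) 0 B.* ((Base.y B.+ ι c) ^ j' s B.* B.1#))

      t-Lt : ∀ s → W.Lt laws (q ℕ.* A₁) (t s)
      t-Lt s = W.Lt-mono laws (bound₁ (i s) (j s) (i' s) (j' s) (i<S s) (j<q s) (i'<U s) (j'<q s))
        (W.Lt-mon-* laws (M ℕ.* i s) (M ℕ.* j s) (W.Lt-mon-* laws (i' s) 0 (W.Lt-y+c laws c (j' s)
          (W.Lt-≈ laws (B.*-identityˡ B.1#) (W.Lt-mon laws 0 0 (ℕP.≤-trans (s≤s z≤n) q≥2)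
            (s≤s (ℕP.≤-reflexive (≡.cong₂ ℕ._+_ (ℕP.*-zeroʳ q) (ℕP.*-zeroʳ k)))))))))

      solution = W.siegel laws A₁ t t-Lt ℕP.≤-refl unknowns

      e : Fin N → F.Carrier
      e = proj₁ solution

      module Fam = W.Family laws I J w-injective

      G : B.Carrier
      G = Fam.combination e

      G-Lt : W.Lt laws (q ℕ.* A₂) G
      G-Lt = W.Lt-sum laws _ (λ s → W.Lt-ι laws (e s) (W.Lt-mono laws (bound₂ (i s) (j s) (i' s) (j' s) (i<S s) (j<q s) (i'<U s) (j'<q s)) (W.Lt-any laws (I s) (J s))))

      G≉0 : ¬ (G B.≈ B.0#)
      G≉0 z = proj₁ (proj₂ solution) (Fam.independent e z)

      nonzero : ∃ λ (j : Fin q) → ∃ λ (i : Fin A₂) → ¬ (coord (toℕ i) (toℕ j) G F.≈ F.0#)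
      nonzero = let j , n = FinP.¬∀⟶∃¬ q (λ j → ∀ i → coord (toℕ i) (toℕ j) G F.≈ F.0#) (λ j → FinP.all? (λ i → FiniteField._≟_ F _ _))
                              (λ z → G≉0 (W.zero-coords laws A₂ ℕP.≤-refl G-Lt (λ i j → z j i)))
                in j , FinP.¬∀⟶∃¬ A₂ (λ i → coord (toℕ i) (toℕ j) G F.≈ F.0#) (λ i → FiniteField._≟_ F _ _) n

    -- Any nonzero coordinate of G serves, as P divides all of them whenever G vanishes in the
    -- fibre.
    auxiliary : List F.Carrier
    auxiliary = coordₓ (toℕ (proj₁ nonzero)) G

    auxiliary≉0 : ¬ (auxiliary ≋ [])
    auxiliary≉0 z = proj₂ (proj₂ nonzero) (at z (toℕ (proj₁ (proj₂ nonzero))))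

    auxiliary-deg : auxiliary deg< A₂
    auxiliary-deg i A₂≤i = W.coord-Lt laws i (toℕ (proj₁ nonzero)) (FinP.toℕ<n (proj₁ nonzero))
      (ℕP.≤-trans (ℕP.*-monoʳ-≤ q A₂≤i) (ℕP.m≤m+n _ _)) G-Lt

    auxiliary-divisible : ∀ P → deg P ≡ l ℕ.+ m →
      CommutativeRing._≈_ (FiniteField.commRing (field' P)) (Fibre.trace P (deg P)) (c ∷ []) → P ∣ᴾ auxiliary
    auxiliary-divisible P deg≡ tr = coordₓ-zero G (C.B.trans G≈ (T.G-vanishes x^Q' y^Q' e i j i' j' (C.B.trans (C.B.sym E≈) (Hom.ι-cong fromBase (proj₂ (proj₂ solution)))))) (toℕ (proj₁ nonzero))
      where
      open Fibre P
      module T = Twist F C.B C.fromF C.x C.y c m l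
      open EB using () renaming (_^_ to _^ᴮ_)
      x^Q' : C.x ^ᴮ T.Q C.B.≈ C.x
      x^Q' = ≡.subst (λ z → C.x ^ᴮ (q ℕ.^ z) C.B.≈ C.x) deg≡ x^Q
      y^Q' : C.y ^ᴮ T.Q C.B.≈ C.y C.B.+ Hom.ι C.fromF c
      y^Q' = ≡.subst (λ z → C.y ^ᴮ (q ℕ.^ z) C.B.≈ C.y C.B.+ Hom.ι C.fromF c) deg≡
        (C.B.trans (y^qⁿ (deg P)) (C.B.+-congˡ {C.y} (Hom.ι-cong C.fromR tr)))
      image-sum : ∀ (u : Fin N → B.Carrier) → sum u C.B.≈ SC.sum u
      image-sum u = HomSums.ι-sum fromBase u
      image-^ : ∀ u n → (u ^ n) C.B.≈ (u ^ᴮ n)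
      image-^ = Hom.ι-^ fromBase
      G≈ : G C.B.≈ T.G x^Q' y^Q' e i j i' j'
      G≈ = C.B.trans (image-sum (λ s → ι (e s) B.* W.mon (I s) (J s))) (SC.sum-cong-≋ {N} (λ s →
        C.B.*-congˡ {Hom.ι C.fromF (e s)} (C.B.*-cong (image-^ Base.x (I s)) (image-^ Base.y (J s)))))
      E≈ : sum (λ s → ι (e s) B.* t s) C.B.≈ T.E x^Q' y^Q' e i j i' j'
      E≈ = C.B.trans (image-sum (λ s → ι (e s) B.* t s)) (SC.sum-cong-≋ {N} (λ s →
        C.B.*-congˡ {Hom.ι C.fromF (e s)} (C.B.*-cong (C.B.*-cong (image-^ Base.x (M ℕ.* i s)) (image-^ Base.y (M ℕ.* j s)))
          (C.B.*-cong (C.B.*-congʳ {C.B.1#} (image-^ Base.x (i' s))) (C.B.*-congʳ {C.B.1#} (image-^ (Base.y B.+ ι c) (j' s)))))))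

-- Coprimality of q and k, and uniqueness of weights

absorption : ∀ n k → suc k ℕ.* (suc n choose suc k) ≡ suc n ℕ.* (n choose k)
absorption zero    zero    = ≡.refl
absorption zero    (suc k) = ≡.trans (≡.cong (suc (suc k) ℕ.*_) (k>n⇒nCk≡0 {1} {suc (suc k)} (s≤s (s≤s z≤n))))
  (≡.trans (ℕP.*-zeroʳ (suc (suc k))) (≡.sym (≡.trans (ℕP.+-identityʳ (0 choose suc k)) (k>n⇒nCk≡0 {0} {suc k} (s≤s z≤n)))))
absorption (suc n) zero    = ≡.trans (ℕP.*-identityˡ _) (≡.trans (nC1≡n (suc (suc n)))
  (≡.sym (≡.trans (≡.cong (suc (suc n) ℕ.*_) (nC0≡1 (suc n))) (ℕP.*-identityʳ _))))
absorption (suc n) (suc k) = begin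
  suc (suc k) ℕ.* (suc (suc n) choose suc (suc k))                                      ≡⟨ ≡.cong (suc (suc k) ℕ.*_) (≡.sym (nCk+nC[k+1]≡[n+1]C[k+1] (suc n) (suc k))) ⟩
  suc (suc k) ℕ.* ((suc n choose suc k) ℕ.+ (suc n choose suc (suc k)))                      ≡⟨ ℕP.*-distribˡ-+ (suc (suc k)) (suc n choose suc k) _ ⟩
  suc (suc k) ℕ.* (suc n choose suc k) ℕ.+ suc (suc k) ℕ.* (suc n choose suc (suc k))        ≡⟨ ≡.cong₂ (λ u v → (suc n choose suc k) ℕ.+ u ℕ.+ v) (absorption n k) (absorption n (suc k)) ⟩
  (suc n choose suc k) ℕ.+ suc n ℕ.* (n choose k) ℕ.+ suc n ℕ.* (n choose suc k)                  ≡⟨ ≡.trans (ℕP.+-assoc (suc n choose suc k) _ _) (≡.cong ((suc n choose suc k) ℕ.+_) (≡.sym (ℕP.*-distribˡ-+ (suc n) (n choose k) _))) ⟩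
  (suc n choose suc k) ℕ.+ suc n ℕ.* ((n choose k) ℕ.+ (n choose suc k))                          ≡⟨ ≡.cong (λ z → (suc n choose suc k) ℕ.+ suc n ℕ.* z) (nCk+nC[k+1]≡[n+1]C[k+1] n k) ⟩
  suc (suc n) ℕ.* (suc n choose suc k)                                                  ∎
  where open ≡.≡-Reasoning

module Characteristic (F : FiniteField) (p : ℕ) (char : FiniteField.HasCharacteristic F p) where
  open FiniteField F using (commRing; 0≉1) renaming (card to q; fromℕ to natural)
  open CommutativeRing commRing hiding (zero)
  open FieldFacts F
  open Factorisation F using (q'; q≡suc)
  open import Algebra.Properties.Semiring.Mult semiring renaming (_×_ to _×ⁿ_)

  private
    natural-× : ∀ n → natural n ≡ n ×ⁿ 1#
    natural-× zero    = ≡.refl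
    natural-× (suc n) = ≡.cong (1# +_) (natural-× n)

    multiple : ∀ r x → r ×ⁿ 1# ≈ 0# → (x ℕ.* r) ×ⁿ 1# ≈ 0#
    multiple r x e = trans (×1-homo-* x r) (trans (*-congˡ e) (zeroʳ _))

    1≈0 : ∀ x y {m n} → m ×ⁿ 1# ≈ 0# → n ×ⁿ 1# ≈ 0# → 1 ℕ.+ y ℕ.* n ≡ x ℕ.* m → 1# ≈ 0#
    1≈0 x y {m} {n} e e' eq = trans (sym (+-identityʳ 1#)) (trans (+-congˡ (sym (multiple n y e')))
      (trans (×-congˡ {1#} eq) (multiple m x e)))

  -- Otherwise p and r would be coprime, and Bézout's identity would give 1 = 0 in F.
  p∣zero : ∀ r → r ×ⁿ 1# ≈ 0# → p ∣ r
  p∣zero r e with p ∣? r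
  ... | yes d = d
  ... | no ¬d = ⊥-elim (0≉1 (sym (bezout (coprime-Bézout coprime))))
    where
    p≈0 : p ×ⁿ 1# ≈ 0#
    p≈0 = trans (reflexive (≡.sym (natural-× p))) (proj₂ char)
    coprime : Coprime p r
    coprime (d∣p , d∣r) with prime⇒irreducible (proj₁ char) d∣p
    ... | inj₁ d≡1 = d≡1
    ... | inj₂ ≡.refl = ⊥-elim (¬d d∣r)
    bezout : Bézout.Identity 1 p r → 1# ≈ 0#
    bezout (Bézout.+- x y eq) = 1≈0 x y p≈0 e eq
    bezout (Bézout.-+ x y eq) = 1≈0 y x e p≈0 eq

  -- Pascal's rule and C(q,j+1) = 0 give C(q-1,j) = ±1 in F.
  binomial-q-1 : ∀ j → j ≤ q' → ¬ ((q' choose j) ×ⁿ 1# ≈ 0#)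
  binomial-q-1 zero    _ e = 0≉1 (sym (trans (sym (+-identityʳ 1#)) (trans (×-congˡ {1#} (≡.sym (nC0≡1 q'))) e)))
  binomial-q-1 (suc j) l e = binomial-q-1 j (ℕP.<⇒≤ l) (trans (sym (trans (+-congˡ e) (+-identityʳ _)))
    (trans (sym (×-homo-+ 1# (q' choose j) (q' choose suc j))) (trans (×-congˡ {1#} (nCk+nC[k+1]≡[n+1]C[k+1] q' j))
      (≡.subst (λ z → (suc q' choose suc z) ×ⁿ 1# ≈ 0#) (FinP.toℕ-fromℕ< l) (binomialsVanish q' q≡suc (fromℕ< l))))))

  -- Let r > 1 divide k and q = i r. By absorption C(q, i) = r C(q-1, i-1); the left side vanishes
  -- in F while C(q-1, i-1) does not, so r = 0 in F. Then p divides r and hence k.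
  q-coprime : ∀ k → ¬ (p ∣ k) → Coprime q k
  q-coprime k p∤k {r} (divides i q≡i*r , r∣k) with r ℕ.≟ 1
  ... | yes r≡1 = r≡1
  ... | no r≢1 = ⊥-elim (case i ≡.refl)
    where
    r≢0 : r ≢ 0
    r≢0 e = ℕP.1+n≢0 {q'} (≡.trans (≡.sym q≡suc) (≡.trans q≡i*r (≡.trans (≡.cong (i ℕ.*_) e) (ℕP.*-zeroʳ i))))
    case : ∀ i₀ → i₀ ≡ i → ⊥
    case zero     eq = ℕP.<⇒≱ (≡.subst (_< 2) (≡.sym (≡.trans q≡i*r (≡.cong (ℕ._* r) (≡.sym eq)))) (s≤s z≤n)) q≥2
    case (suc i') eq = [ (λ e → p∤k (∣-trans (p∣zero r e) r∣k)) , binomial-q-1 i' (ℕP.<⇒≤ i'<q') ]′ (noZeroDivisors product≈0)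
      where
      q≡ : suc q' ≡ suc i' ℕ.* r
      q≡ = ≡.trans (≡.sym q≡suc) (≡.trans q≡i*r (≡.cong (ℕ._* r) (≡.sym eq)))
      2≤r : 2 ≤ r
      2≤r = ℕP.≤∧≢⇒< (ℕP.n≢0⇒n>0 r≢0) (λ e → r≢1 (≡.sym e))
      i'<q' : i' < q'
      i'<q' = ℕP.≤-pred (≡.subst (suc (suc i') ≤_) (≡.sym q≡) (ℕP.≤-trans (ℕP.≤-trans (s≤s (ℕP.m≤n+m (suc i') i')) (ℕP.≤-reflexive
        (≡.cong (suc i' ℕ.+_) (≡.sym (ℕP.+-identityʳ (suc i')))))) (ℕP.≤-trans (ℕP.≤-reflexive (ℕP.*-comm 2 (suc i'))) (ℕP.*-monoʳ-≤ (suc i') 2≤r))))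
      C≡ : suc q' choose suc i' ≡ r ℕ.* (q' choose i')
      C≡ = ℕP.*-cancelˡ-≡ _ _ (suc i') (≡.trans (absorption q' i') (≡.trans (≡.cong (ℕ._* (q' choose i')) q≡) (ℕP.*-assoc (suc i') r (q' choose i'))))
      C≈0 : (suc q' choose suc i') ×ⁿ 1# ≈ 0#
      C≈0 = ≡.subst (λ z → (suc q' choose suc z) ×ⁿ 1# ≈ 0#) (FinP.toℕ-fromℕ< i'<q') (binomialsVanish q' q≡suc (fromℕ< i'<q'))
      product≈0 : (r ×ⁿ 1#) * ((q' choose i') ×ⁿ 1#) ≈ 0#
      product≈0 = trans (sym (×1-homo-* r (q' choose i'))) (trans (×-congˡ {1#} (≡.sym C≡)) C≈0)

-- Modulo q the equation reads k j = k j', so coprimality determines j among 0, ..., q - 1. This is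
-- where p ∤ k enters.
wt-unique : ∀ {q k} → Coprime q k → ∀ i j i' j' → j < q → j' < q →
  q ℕ.* i ℕ.+ k ℕ.* j ≡ q ℕ.* i' ℕ.+ k ℕ.* j' → i ≡ i' × j ≡ j'
wt-unique {q} {k} cop i j i' j' l l' e = i≡ , j≡
  where
  half : ∀ i j i' j' → j < q → j' < q → j ≤ j' → q ℕ.* i ℕ.+ k ℕ.* j ≡ q ℕ.* i' ℕ.+ k ℕ.* j' → j ≡ j'
  half i j i' j' l l' j≤j' e = ℕP.≤-antisym j≤j' (ℕP.m∸n≡0⇒m≤n (zero-below _ (ℕP.≤-<-trans (ℕP.m∸n≤m j' j) l') (coprime-divisor cop (divides (i ℕ.∸ i') eq))))
    where
    zero-below : ∀ d → d < q → q ∣ d → d ≡ 0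
    zero-below zero    _ _ = ≡.refl
    zero-below (suc d) p d∣ = ⊥-elim (ℕP.<⇒≱ p (∣⇒≤ d∣))
    qi : q ℕ.* i ≡ q ℕ.* i' ℕ.+ k ℕ.* (j' ℕ.∸ j)
    qi = ℕP.+-cancelʳ-≡ (k ℕ.* j) _ _ (≡.trans e (≡.trans (≡.cong (λ z → q ℕ.* i' ℕ.+ k ℕ.* z) (≡.sym (ℕP.m∸n+n≡m j≤j')))
      (≡.trans (≡.cong (q ℕ.* i' ℕ.+_) (ℕP.*-distribˡ-+ k (j' ℕ.∸ j) j)) (≡.sym (ℕP.+-assoc (q ℕ.* i') _ _)))))
    eq : k ℕ.* (j' ℕ.∸ j) ≡ (i ℕ.∸ i') ℕ.* q
    eq = ≡.trans (≡.sym (ℕP.m+n∸m≡n (q ℕ.* i') _)) (≡.trans (≡.cong (ℕ._∸ q ℕ.* i') (≡.sym qi)) (≡.trans (≡.sym (ℕP.*-distribˡ-∸ q i i')) (ℕP.*-comm q _)))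
  j≡ : j ≡ j'
  j≡ with ℕP.≤-total j j'
  ... | inj₁ p = half i j i' j' l l' p e
  ... | inj₂ p = ≡.sym (half i' j' i j l' l p (≡.sym e))
  i≡ : i ≡ i'
  i≡ = ℕP.*-cancelˡ-≡ i i' q {{ℕ.>-nonZero (ℕP.≤-<-trans z≤n l)}} (ℕP.+-cancelʳ-≡ (k ℕ.* j) _ _ (≡.trans e (≡.cong (λ z → q ℕ.* i' ℕ.+ k ℕ.* z) (≡.sym j≡))))

-- Upper bound for the number of irreducibles with a given trace

module TraceBound (F : FiniteField) (k : ℕ) (1≤k : 1 ≤ k) (a : ℕ → FiniteField.Carrier F)
  (aₖ≉0 : ¬ (FiniteField._≈_ F (a k) (FiniteField.0# F))) (coprime : Coprime (FiniteField.card F) k) where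
  open FiniteField F using (commRing; Carrier) renaming (card to q)
  open FieldFacts F using (q≥2)
  open Factorisation F
  open PrimeCount F
  open ArtinSchreier F k 1≤k a aₖ≉0

  -- The auxiliary polynomial has degree below A₂ = L (q^m' + 2 k), which is q^d up to the error 2 k
  -- L, while the irreducibles of degree d + 1 have total degree close to q^(d+1): hence the share
  -- 1/q. The lower bound on L ensures more unknowns than equations.
  trace-count : ∀ d m' l' → suc d ≡ suc l' ℕ.+ suc m' → q ℕ.^ suc m' ℕ.+ q ℕ.* k ℕ.+ 2 ≤ q ℕ.^ suc l' →
    (c : Carrier) {T : (Fin (suc d) → Carrier) → Set} (T? : ∀ v → Dec (T v)) →
    (∀ v (i : Irr v) → T v → CommutativeRing._≈_ (FiniteField.commRing (residueField v i)) (Fibre.trace (irreducible v i) (suc d)) (c ∷ [])) →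
    q ℕ.* (suc d ℕ.* count T?) ≤ q ℕ.^ suc d ℕ.+ 2 ℕ.* q ℕ.* k ℕ.* q ℕ.^ suc l'
  trace-count d m' l' d≡ L≥ c {T} T? tr = begin
    q ℕ.* (suc d ℕ.* count T?)                           ≤⟨ ℕP.*-monoʳ-≤ q (ℕP.<⇒≤ (count-bound T? Aux.auxiliary A₂
                                                              (λ v i t → Aux.auxiliary-divisible (irreducible v i) d≡ (tr v i t)) Aux.auxiliary≉0 Aux.auxiliary-deg)) ⟩
    q ℕ.* A₂                                             ≡⟨ solve 4 (λ q L w k → q :* (L :* (w :+ con 2 :* k)) := L :* (q :* w) :+ con 2 :* q :* k :* L) ≡.refl q L w k ⟩
    L ℕ.* M ℕ.+ 2 ℕ.* q ℕ.* k ℕ.* L                      ≡⟨ ≡.cong (ℕ._+ 2 ℕ.* q ℕ.* k ℕ.* L) (≡.trans (≡.sym (ℕP.^-distribˡ-+-* q (suc l') (suc m'))) (≡.cong (q ℕ.^_) (≡.sym d≡))) ⟩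
    q ℕ.^ suc d ℕ.+ 2 ℕ.* q ℕ.* k ℕ.* L                  ∎
    where
    open ℕP.≤-Reasoning
    open +-*-Solver
    w z L M S U A₁ A₂ : ℕ
    w = q ℕ.^ m'
    z = q ℕ.^ l'
    M = q ℕ.^ suc m'
    L = q ℕ.^ suc l'
    -- Subtracting k makes q S + q k = L, which keeps wt(i, j) below L. The k + 1 added in `U` more
    -- than makes up for the unknowns lost here.
    S = z ℕ.∸ k
    U = w ℕ.+ k ℕ.+ 1
    -- q A₁ = L M + 2 q k and q A₂ = L (M + 2 q k) are the weight bounds for E and for G.
    A₁ = L ℕ.* w ℕ.+ 2 ℕ.* k
    A₂ = L ℕ.* (w ℕ.+ 2 ℕ.* k)

    instance
      q≢0 : ℕ.NonZero q
      q≢0 = ℕ.>-nonZero (ℕP.≤-trans (s≤s z≤n) q≥2)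

    k≤z : k ≤ z
    k≤z = ℕP.*-cancelˡ-≤ q (ℕP.≤-trans (ℕP.≤-trans (ℕP.m≤n+m (q ℕ.* k) M) (ℕP.m≤m+n _ 2)) L≥)

    qS+qk≡L : q ℕ.* S ℕ.+ q ℕ.* k ≡ L
    qS+qk≡L = ≡.trans (≡.sym (ℕP.*-distribˡ-+ q S k)) (≡.cong (q ℕ.*_) (ℕP.m∸n+n≡m k≤z))

    small : ∀ i j → i < S → j < q → W.wt i j < L
    small i j i<S j<q = ≡.subst (W.wt i j <_) qS+qk≡L (ℕP.+-mono-<-≤ (ℕP.*-monoʳ-< q i<S)
      (ℕP.≤-trans (ℕP.*-monoʳ-≤ k (ℕP.<⇒≤ j<q)) (ℕP.≤-reflexive (ℕP.*-comm k q))))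

    weight' : ∀ i' j' → i' < U → j' < q → 1 ℕ.+ k ℕ.* j' ℕ.+ q ℕ.* i' ≤ M ℕ.+ 2 ℕ.* q ℕ.* k
    weight' i' j' p p' = ℕP.+-cancelʳ-≤ q _ _ (begin
      1 ℕ.+ k ℕ.* j' ℕ.+ q ℕ.* i' ℕ.+ q       ≤⟨ ℕP.+-monoˡ-≤ q (ℕP.+-monoˡ-≤ (q ℕ.* i') (ℕP.+-monoˡ-≤ (k ℕ.* j') 1≤k)) ⟩
      k ℕ.+ k ℕ.* j' ℕ.+ q ℕ.* i' ℕ.+ q       ≡⟨ solve 4 (λ k j q i → k :+ k :* j :+ q :* i :+ q := k :* (con 1 :+ j) :+ q :* (con 1 :+ i)) ≡.refl k j' q i' ⟩
      k ℕ.* suc j' ℕ.+ q ℕ.* suc i'           ≤⟨ ℕP.+-mono-≤ (ℕP.*-monoʳ-≤ k p') (ℕP.*-monoʳ-≤ q p) ⟩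
      k ℕ.* q ℕ.+ q ℕ.* U                     ≡⟨ solve 3 (λ k q w → k :* q :+ q :* (w :+ k :+ con 1) := q :* w :+ con 2 :* q :* k :+ q) ≡.refl k q w ⟩
      M ℕ.+ 2 ℕ.* q ℕ.* k ℕ.+ q               ∎)

    bound₁ : ∀ i j i' j' → i < S → j < q → i' < U → j' < q →
      ((1 ℕ.+ k ℕ.* j') ℕ.+ W.wt i' 0) ℕ.+ W.wt (M ℕ.* i) (M ℕ.* j) ≤ q ℕ.* A₁
    bound₁ i j i' j' i<S j<q i'<U j'<q = begin
      ((1 ℕ.+ k ℕ.* j') ℕ.+ W.wt i' 0) ℕ.+ W.wt (M ℕ.* i) (M ℕ.* j)
        ≡⟨ solve 7 (λ q k M i j i' kj → ((con 1 :+ kj) :+ (q :* i' :+ k :* con 0)) :+ (q :* (M :* i) :+ k :* (M :* j))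
                                        := (con 1 :+ kj :+ q :* i') :+ M :* (q :* i :+ k :* j)) ≡.refl q k M i j i' (k ℕ.* j') ⟩
      (1 ℕ.+ k ℕ.* j' ℕ.+ q ℕ.* i') ℕ.+ M ℕ.* W.wt i j        ≤⟨ ℕP.+-monoˡ-≤ _ (weight' i' j' i'<U j'<q) ⟩
      (M ℕ.+ 2 ℕ.* q ℕ.* k) ℕ.+ M ℕ.* W.wt i j                ≡⟨ solve 3 (λ M c w → (M :+ c) :+ M :* w := M :* (con 1 :+ w) :+ c) ≡.refl M (2 ℕ.* q ℕ.* k) (W.wt i j) ⟩
      M ℕ.* suc (W.wt i j) ℕ.+ 2 ℕ.* q ℕ.* k                  ≤⟨ ℕP.+-monoˡ-≤ (2 ℕ.* q ℕ.* k) (ℕP.*-monoʳ-≤ M (small i j i<S j<q)) ⟩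
      M ℕ.* L ℕ.+ 2 ℕ.* q ℕ.* k                               ≡⟨ solve 4 (λ q w L k → (q :* w) :* L :+ con 2 :* q :* k := q :* (L :* w :+ con 2 :* k)) ≡.refl q w L k ⟩
      q ℕ.* A₁                                                ∎

    bound₂ : ∀ i j i' j' → i < S → j < q → i' < U → j' < q →
      W.wt (i ℕ.+ L ℕ.* i') (j ℕ.+ L ℕ.* j') < q ℕ.* A₂
    bound₂ i j i' j' i<S j<q i'<U j'<q = begin-strict
      W.wt (i ℕ.+ L ℕ.* i') (j ℕ.+ L ℕ.* j')
        ≡⟨ solve 7 (λ q k L i j i' j' → q :* (i :+ L :* i') :+ k :* (j :+ L :* j') := (q :* i :+ k :* j) :+ L :* (k :* j' :+ q :* i')) ≡.refl q k L i j i' j' ⟩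
      W.wt i j ℕ.+ L ℕ.* (k ℕ.* j' ℕ.+ q ℕ.* i')       <⟨ ℕP.+-monoˡ-< _ (small i j i<S j<q) ⟩
      L ℕ.+ L ℕ.* (k ℕ.* j' ℕ.+ q ℕ.* i')              ≡⟨ solve 2 (λ L t → L :+ L :* t := L :* (con 1 :+ t)) ≡.refl L (k ℕ.* j' ℕ.+ q ℕ.* i') ⟩
      L ℕ.* (1 ℕ.+ k ℕ.* j' ℕ.+ q ℕ.* i')              ≤⟨ ℕP.*-monoʳ-≤ L (weight' i' j' i'<U j'<q) ⟩
      L ℕ.* (M ℕ.+ 2 ℕ.* q ℕ.* k)                      ≡⟨ solve 4 (λ q w L k → L :* (q :* w :+ con 2 :* q :* k) := q :* (L :* (w :+ con 2 :* k))) ≡.refl q w L k ⟩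
      q ℕ.* A₂                                         ∎

    unknowns : A₁ ℕ.* q < (S ℕ.* q) ℕ.* (U ℕ.* q)
    unknowns = ℕP.+-cancelʳ-< (q ℕ.* k ℕ.* u) _ _ (begin-strict
      A₁ ℕ.* q ℕ.+ q ℕ.* k ℕ.* u
        ≡⟨ solve 4 (λ L w k q → (L :* w :+ con 2 :* k) :* q :+ q :* k :* ((w :+ k :+ con 1) :* q)
                    := L :* (q :* w) :+ (con 2 :* (q :* k) :+ (q :* k) :* (q :* w :+ q :* k :+ q))) ≡.refl L w k q ⟩
      L ℕ.* M ℕ.+ (2 ℕ.* (q ℕ.* k) ℕ.+ q ℕ.* k ℕ.* (M ℕ.+ q ℕ.* k ℕ.+ q))
        <⟨ ℕP.+-monoʳ-< (L ℕ.* M) (begin-strict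
          2 ℕ.* (q ℕ.* k) ℕ.+ q ℕ.* k ℕ.* (M ℕ.+ q ℕ.* k ℕ.+ q)                           <⟨ ℕP.m<m+n _ (ℕP.≤-trans (ℕP.≤-trans (s≤s z≤n) q≥2) (ℕP.m≤n+m q (q ℕ.* M ℕ.+ q))) ⟩
          2 ℕ.* (q ℕ.* k) ℕ.+ q ℕ.* k ℕ.* (M ℕ.+ q ℕ.* k ℕ.+ q) ℕ.+ (q ℕ.* M ℕ.+ q ℕ.+ q)
            ≡⟨ solve 3 (λ t M q → con 2 :* t :+ t :* (M :+ t :+ q) :+ (q :* M :+ q :+ q) := (M :+ t :+ con 2) :* (t :+ q)) ≡.refl (q ℕ.* k) M q ⟩
          (M ℕ.+ q ℕ.* k ℕ.+ 2) ℕ.* (q ℕ.* k ℕ.+ q)                                       ≤⟨ ℕP.*-monoˡ-≤ (q ℕ.* k ℕ.+ q) L≥ ⟩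
          L ℕ.* (q ℕ.* k ℕ.+ q)                                                           ∎) ⟩
      L ℕ.* M ℕ.+ L ℕ.* (q ℕ.* k ℕ.+ q)                    ≡⟨ solve 4 (λ L w k q → L :* (q :* w) :+ L :* (q :* k :+ q) := L :* ((w :+ k :+ con 1) :* q)) ≡.refl L w k q ⟩
      L ℕ.* u                                              ≡⟨ ≡.cong (ℕ._* u) (≡.sym qS+qk≡L) ⟩
      (q ℕ.* S ℕ.+ q ℕ.* k) ℕ.* u                          ≡⟨ solve 4 (λ q S k u → (q :* S :+ q :* k) :* u := (S :* q) :* u :+ q :* k :* u) ≡.refl q S k u ⟩
      (S ℕ.* q) ℕ.* u ℕ.+ q ℕ.* k ℕ.* u                    ∎)
      where u = U ℕ.* q

    module Aux = Auxiliary c (suc m') (suc l') S U A₁ A₂ small (wt-unique coprime) bound₁ unknowns bound₂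

-- Companion matrices and block matrices

module Matrices (K : FiniteField) where
  open FiniteField K using (commRing; sumFin; I; Tr)
  open CommutativeRing commRing hiding (zero)
  open FieldFacts K using (finite)
  open RingTools commRing
  open import Algebra.Properties.Semiring.Sum semiring
  open SumTools commRing using (sum-zero; sum-single)
  open import Relation.Binary.Reasoning.Setoid setoid

  Rect : ℕ → ℕ → Set
  Rect m n = Fin m → Fin n → Carrier

  infix 4 _≈ʳ_
  _≈ʳ_ : ∀ {m n} → Rect m n → Rect m n → Set
  g ≈ʳ h = ∀ i j → g i j ≈ h i j

  infixl 7 _⊙_
  _⊙_ : ∀ {m n p} → Rect m n → Rect n p → Rect m p
  _⊙_ {n = n} g h i j = sumFin n (λ l → g i l * h l j)

  sumFin≡sum : ∀ n (f : Fin n → Carrier) → sumFin n f ≡ sum f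
  sumFin≡sum zero    f = ≡.refl
  sumFin≡sum (suc n) f = ≡.cong (f zero +_) (sumFin≡sum n (λ i → f (suc i)))

  private
    ↓ : ∀ {n} (f : Fin n → Carrier) → sumFin n f ≈ sum f
    ↓ {n} f = reflexive (sumFin≡sum n f)

  Σ-cong : ∀ n {f g : Fin n → Carrier} → (∀ i → f i ≈ g i) → sumFin n f ≈ sumFin n g
  Σ-cong n {f} {g} e = trans (↓ f) (trans (sum-cong-≋ e) (sym (↓ g)))

  Σ-+ : ∀ n (f g : Fin n → Carrier) → sumFin n (λ i → f i + g i) ≈ sumFin n f + sumFin n g
  Σ-+ n f g = trans (↓ (λ i → f i + g i)) (trans (∑-distrib-+ f g) (sym (+-cong (↓ f) (↓ g))))

  Σ-*ˡ : ∀ n c (f : Fin n → Carrier) → c * sumFin n f ≈ sumFin n (λ i → c * f i)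
  Σ-*ˡ n c f = trans (*-congˡ (↓ f)) (trans (*-distribˡ-sum c f) (sym (↓ (λ i → c * f i))))

  Σ-*ʳ : ∀ n c (f : Fin n → Carrier) → sumFin n f * c ≈ sumFin n (λ i → f i * c)
  Σ-*ʳ n c f = trans (*-comm _ c) (trans (Σ-*ˡ n c f) (Σ-cong n (λ i → *-comm c (f i))))

  Σ-zero : ∀ n {f : Fin n → Carrier} → (∀ i → f i ≈ 0#) → sumFin n f ≈ 0#
  Σ-zero n {f} e = trans (↓ f) (sum-zero f e)

  Σ-swap : ∀ m n (f : Fin m → Fin n → Carrier) →
    sumFin m (λ i → sumFin n (f i)) ≈ sumFin n (λ j → sumFin m (λ i → f i j))
  Σ-swap m n f = trans (↓ (λ i → sumFin n (f i))) (trans (sum-cong-≋ {m} (λ i → ↓ (f i))) (trans (∑-comm f) (sym (trans (↓ (λ j → sumFin m (λ i → f i j))) (sum-cong-≋ {n} (λ j → ↓ (λ i → f i j)))))))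

  I-diag : ∀ {n} (i : Fin n) → I i i ≈ 1#
  I-diag i with i FinP.≟ i
  ... | yes _ = refl
  ... | no n  = ⊥-elim (n ≡.refl)

  I-off : ∀ {n} {i j : Fin n} → i ≢ j → I i j ≈ 0#
  I-off {i = i} {j} ne with i FinP.≟ j
  ... | yes e = ⊥-elim (ne e)
  ... | no _  = refl

  Σ-Iˡ : ∀ n (i : Fin n) (f : Fin n → Carrier) → sumFin n (λ l → I i l * f l) ≈ f i
  Σ-Iˡ n i f = trans (↓ (λ l → I i l * f l)) (trans (sum-single (λ l → I i l * f l) i (λ j ne → trans (*-congʳ (I-off (λ e → ne (≡.sym e)))) (zeroˡ _)))
    (trans (*-congʳ (I-diag i)) (*-identityˡ _)))

  Σ-Iʳ : ∀ n (i : Fin n) (f : Fin n → Carrier) → sumFin n (λ l → f l * I l i) ≈ f i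
  Σ-Iʳ n i f = trans (↓ (λ l → f l * I l i)) (trans (sum-single (λ l → f l * I l i) i (λ j ne → trans (*-congˡ (I-off ne)) (zeroʳ _)))
    (trans (*-congˡ (I-diag i)) (*-identityʳ _)))

  ⊙-cong : ∀ {m n p} {g g' : Rect m n} {h h' : Rect n p} → g ≈ʳ g' → h ≈ʳ h' → g ⊙ h ≈ʳ g' ⊙ h'
  ⊙-cong {n = n} e e' i j = Σ-cong n (λ l → *-cong (e i l) (e' l j))

  ⊙-congˡ : ∀ {m n p} (g : Rect m n) {h h' : Rect n p} → h ≈ʳ h' → g ⊙ h ≈ʳ g ⊙ h'
  ⊙-congˡ {n = n} g e i j = Σ-cong n (λ l → *-congˡ (e l j))

  ⊙-congʳ : ∀ {m n p} {g g' : Rect m n} (h : Rect n p) → g ≈ʳ g' → g ⊙ h ≈ʳ g' ⊙ h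
  ⊙-congʳ {n = n} h e i j = Σ-cong n (λ l → *-congʳ (e i l))

  ⊙-assoc : ∀ {m n p r} (f : Rect m n) (g : Rect n p) (h : Rect p r) → (f ⊙ g) ⊙ h ≈ʳ f ⊙ (g ⊙ h)
  ⊙-assoc {m} {n} {p} f g h i j = begin
    sumFin p (λ b → sumFin n (λ a → f i a * g a b) * h b j)       ≈⟨ Σ-cong p (λ b → Σ-*ʳ n (h b j) (λ a → f i a * g a b)) ⟩
    sumFin p (λ b → sumFin n (λ a → f i a * g a b * h b j))       ≈⟨ Σ-swap p n (λ b a → f i a * g a b * h b j) ⟩
    sumFin n (λ a → sumFin p (λ b → f i a * g a b * h b j))       ≈⟨ Σ-cong n (λ a → Σ-cong p (λ b → *-assoc _ _ _)) ⟩
    sumFin n (λ a → sumFin p (λ b → f i a * (g a b * h b j)))     ≈⟨ Σ-cong n (λ a → sym (Σ-*ˡ p (f i a) (λ b → g a b * h b j))) ⟩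
    sumFin n (λ a → f i a * sumFin p (λ b → g a b * h b j))       ∎

  ⊙-identityˡ : ∀ {m n} (g : Rect m n) → I ⊙ g ≈ʳ g
  ⊙-identityˡ {m} g i j = Σ-Iˡ m i (λ l → g l j)

  ⊙-identityʳ : ∀ {m n} (g : Rect m n) → g ⊙ I ≈ʳ g
  ⊙-identityʳ {n = n} g i j = Σ-Iʳ n j (g i)

  Tr-comm : ∀ {m n} (g : Rect m n) (h : Rect n m) → Tr (g ⊙ h) ≈ Tr (h ⊙ g)
  Tr-comm {m} {n} g h = trans (Σ-swap m n (λ i j → g i j * h j i)) (Σ-cong n (λ j → Σ-cong m (λ i → *-comm _ _)))

  Tr-cong : ∀ {n} {g h : Rect n n} → g ≈ʳ h → Tr g ≈ Tr h
  Tr-cong {n} e = Σ-cong n (λ i → e i i)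

  Invertible : ∀ {n} → Rect n n → Set
  Invertible {n} g = ∃ λ (h : Rect n n) → (g ⊙ h ≈ʳ I) × (h ⊙ g ≈ʳ I)

  infixl 7 _·ᵥ_
  _·ᵥ_ : ∀ {m n} → Rect m n → (Fin n → Carrier) → Fin m → Carrier
  _·ᵥ_ {n = n} g w i = sumFin n (λ l → g i l * w l)

  Injective : ∀ {m n} → Rect m n → Set
  Injective g = ∀ w → (∀ i → (g ·ᵥ w) i ≈ 0#) → ∀ i → w i ≈ 0#

  ·ᵥ-difference : ∀ {m n} (g : Rect m n) w w' i → (g ·ᵥ (λ l → w l - w' l)) i ≈ (g ·ᵥ w) i - (g ·ᵥ w') i
  ·ᵥ-difference {n = n} g w w' i = begin
    sumFin n (λ l → g i l * (w l - w' l))                       ≈⟨ Σ-cong n (λ l → solve 3 (λ g w w' → g :* (w :- w') := g :* w :+ (:- (g :* w'))) refl (g i l) (w l) (w' l)) ⟩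
    sumFin n (λ l → g i l * w l + (- (g i l * w' l)))           ≈⟨ Σ-+ n (λ l → g i l * w l) (λ l → - (g i l * w' l)) ⟩
    (g ·ᵥ w) i + sumFin n (λ l → - (g i l * w' l))              ≈⟨ +-congˡ (trans (Σ-cong n (λ l → sym (-1*x≈-x _))) (trans (sym (Σ-*ˡ n (- 1#) (λ l → g i l * w' l))) (-1*x≈-x _))) ⟩
    (g ·ᵥ w) i - (g ·ᵥ w') i                                    ∎
    where open import Algebra.Properties.Ring ring using (-1*x≈-x)

  injective-cancel : ∀ {m n} (g : Rect m n) → Injective g → ∀ {w w'} → (∀ i → (g ·ᵥ w) i ≈ (g ·ᵥ w') i) → ∀ i → w i ≈ w' i
  injective-cancel g inj {w} {w'} e i = FieldFacts.x-y≈0⇒x≈y K (inj (λ l → w l - w' l)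
    (λ i → trans (·ᵥ-difference g w w' i) (trans (+-congʳ (e i)) (-‿inverseʳ _))) i)

  -- Surjectivity, from counting vectors, gives a right inverse h column by column. It is also a
  -- left inverse, since g (h g) = g and g cancels on the left.
  injective⇒invertible : ∀ {n} (g : Rect n n) → Injective g → Invertible g
  injective⇒invertible {n} g inj = h , gh , hg
    where
    column : ∀ j → ∃ λ w → ∀ i → I i j ≈ (g ·ᵥ w) i
    column j = inj⇒surj (n ⇒ finite) (g ·ᵥ_) (λ e i → Σ-cong n (λ l → *-congˡ (e l))) (injective-cancel g inj) (λ i → I i j)
    h : Rect n n
    h i j = proj₁ (column j) i
    gh : g ⊙ h ≈ʳ I
    gh i j = sym (proj₂ (column j) i)
    hg : h ⊙ g ≈ʳ I
    hg i j = injective-cancel g inj {λ l → (h ⊙ g) l j} {λ l → I l j}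
      (λ i → trans (sym (⊙-assoc g h g i j)) (trans (⊙-congʳ g gh i j) (trans (⊙-identityˡ g i j) (sym (⊙-identityʳ g i j))))) i

  invertible⇒injective : ∀ {n} (g : Rect n n) → Invertible g → Injective g
  invertible⇒injective {n} g (h , gh , hg) w e i = begin
    w i                                        ≈⟨ sym (Σ-Iˡ n i w) ⟩
    sumFin n (λ l → I i l * w l)               ≈⟨ Σ-cong n (λ l → *-congʳ (sym (hg i l))) ⟩
    ((h ⊙ g) ⊙ (λ l _ → w l)) i zero'          ≈⟨ ⊙-assoc h g (λ l (_ : Fin 1) → w l) i zero' ⟩
    sumFin n (λ l → h i l * (g ·ᵥ w) l)        ≈⟨ Σ-zero n (λ l → trans (*-congˡ (e l)) (zeroʳ _)) ⟩
    0#                                         ∎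
    where
    zero' : Fin 1
    zero' = zero

module Companion (F : FiniteField) where
  open FiniteField F using (commRing; sumFin; I; _^ᴹ_; Tr; traceSum) renaming (card to q)
  open CommutativeRing commRing hiding (zero)
  open RingTools commRing
  open Poly commRing
  open Matrices F
  open Factorisation F
  open PrimeCount F
  open Irreducible using (deg; poly; pred-deg; lower)

  -- The matrix of multiplication by x on remainders: column l is `step v` of the l-th unit vector.
  -- Sharing `step` with division makes its action on vectors immediate.
  companion : ∀ {n} → (Fin (suc n) → Carrier) → Rect (suc n) (suc n)
  companion v i l = step v (λ j → I j l) i

  companion-·ᵥ : ∀ {n} (v : Fin (suc n) → Carrier) r i → (companion v ·ᵥ r) i ≈ step v r i
  companion-·ᵥ {n} v r i = trans (Σ-cong (suc n) (λ l → solve 4 (λ s t v r → (s :+ (:- (t :* v))) :* r := s :* r :+ (:- v) :* (t :* r)) refl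
      (shift v (λ j → I j l) i) (I (fromℕ n) l) (v i) (r l)))
    (trans (Σ-+ (suc n) (λ l → shift v (λ j → I j l) i * r l) (λ l → (- v i) * (I (fromℕ n) l * r l))) (+-cong (shifted i) (trans (sym (Σ-*ˡ (suc n) (- v i) (λ l → I (fromℕ n) l * r l))) (trans (*-congˡ (Σ-Iˡ (suc n) (fromℕ n) r))
      (solve 2 (λ v r → (:- v) :* r := :- (r :* v)) refl (v i) (r (fromℕ n)))))))
    where
    shifted : ∀ i → sumFin (suc n) (λ l → shift v (λ j → I j l) i * r l) ≈ shift v r i
    shifted zero    = Σ-zero (suc n) (λ l → zeroˡ (r l))
    shifted (suc i) = Σ-Iˡ (suc n) (inject₁ i) r

  companion-cong : ∀ {n} {v v' : Fin (suc n) → Carrier} → (∀ i → v i ≈ v' i) → companion v ≈ʳ companion v'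
  companion-cong {n} e zero    l = +-congˡ (-‿cong (*-congˡ (e zero)))
  companion-cong {n} e (suc i) l = +-congˡ (-‿cong (*-congˡ (e (suc i))))

  -- The Vandermonde matrix of the conjugates X^(q^j) diagonalises the companion matrix over F[X]/P.
  module PowerSums (P : Irreducible) where
    open Residue P using (K; toK; too-few; all-fixed; module AlgK; module K)
    open Hom toK
    open Eval toK
    private
      Kr = FiniteField.commRing K
      d = deg P
      C = companion (lower P)
      module MK = Matrices K
    open import Algebra.Properties.CommutativeSemiring.Exp K.commutativeSemiring
    import Algebra.Properties.Semiring.Sum K.semiring as SK
    open RingTools Kr using () renaming (solve to solveᴷ; _:=_ to _:=ᴷ_; _:+_ to _:+ᴷ_; _:-_ to _:-ᴷ_)

    θ : ℕ → K.Carrier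
    θ j = X ^ (q ℕ.^ j)

    frobenius-injective : ∀ n u w → u ^ (q ℕ.^ n) K.≈ w ^ (q ℕ.^ n) → u K.≈ w
    frobenius-injective n u w e = FieldFacts.x-y≈0⇒x≈y K {u} {w} (FieldFacts.^-zero⇒zero K (u K.- w) (q ℕ.^ n) (cancel (K.trans
      (K.sym (AlgK.^qⁿ-+ n (u K.- w) w)) (K.trans (^-congˡ (q ℕ.^ n) (solveᴷ 2 (λ u w → (u :-ᴷ w) :+ᴷ w :=ᴷ u) K.refl u w)) e))))
      where
      cancel : ∀ {x y} → x K.+ y K.≈ y → x K.≈ K.0#
      cancel {x} {y} e = K.trans (solveᴷ 2 (λ x y → x :=ᴷ (x :+ᴷ y) :-ᴷ y) K.refl x y) (K.trans (K.+-congʳ {K.- y} e) (K.-‿inverseʳ y))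

    -- By injectivity of Frobenius an equality descends to X = X^(q^r) with 0 < r < deg P, which
    -- would make the r-th power of Frobenius the identity on the residue field.
    θ-distinct : ∀ i j → i < j → j < d → ¬ (θ i K.≈ θ j)
    θ-distinct i j i<j j<d e = too-few r (ℕP.m<n⇒0<n∸m i<j) (ℕP.≤-<-trans (ℕP.m∸n≤m j i) j<d)
      (all-fixed r (K.sym (frobenius-injective i X (X ^ (q ℕ.^ r)) (K.trans e (K.trans (^-congʳ X split) (K.sym (^-assocʳ X (q ℕ.^ r) (q ℕ.^ i))))))))
      where
      r = j ℕ.∸ i
      split : q ℕ.^ j ≡ q ℕ.^ r ℕ.* q ℕ.^ i
      split = ≡.trans (≡.cong (q ℕ.^_) (≡.sym (ℕP.m∸n+n≡m (ℕP.<⇒≤ i<j)))) (ℕP.^-distribˡ-+-* q r i)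

    θᶠ-distinct : ∀ (i j : Fin d) → i ≢ j → ¬ (θ (toℕ i) K.≈ θ (toℕ j))
    θᶠ-distinct i j ne e with ℕP.<-cmp (toℕ i) (toℕ j)
    ... | tri< l _ _ = θ-distinct (toℕ i) (toℕ j) l (FinP.toℕ<n j) e
    ... | tri≈ _ p _ = ne (FinP.toℕ-injective p)
    ... | tri> _ _ l = θ-distinct (toℕ j) (toℕ i) l (FinP.toℕ<n i) (K.sym e)

    V : MK.Rect d d
    V j i = θ (toℕ j) ^ toℕ i

    V-injective : MK.Injective V
    V-injective w e i = K.trans (K.sym (PK.coeff-lst w i)) (PK.at zero-poly (toℕ i))
      where
      module PK = Poly Kr
      zero-poly : PK.lst w PK.≋ []
      zero-poly = FieldFacts.roots K (λ j → θ (toℕ j)) θᶠ-distinct (PK.lst w) (PK.lst-deg w) (λ j →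
        K.trans (Eval.ev-lst (idHom Kr) (θ (toℕ j)) w) (K.trans (SK.sum-cong-≋ {d} (λ i → K.*-comm (w i) (V j i)))
          (K.trans (K.reflexive (≡.sym (MK.sumFin≡sum d (λ i → V j i K.* w i)))) (e j))))

    root : ∀ j → ev (θ j) (poly P) K.≈ K.0#
    root j = K.trans (K.sym (AlgK.ev-^qⁿ j X (poly P))) (K.trans (^-congˡ (q ℕ.^ j) (K.trans (ev-X-quotient (lower P) (poly P))
      (Division.mk (Division.rem-monic (lower P))))) (AlgK.0^qⁿ j))

    ev-step : ∀ j r → ev (θ j) (lst (step (lower P) r)) K.≈ θ j K.* ev (θ j) (lst r)
    ev-step j r = K.sym (K.trans (K.sym (K.trans (K.+-congʳ {θ j K.* ev (θ j) (lst r)} ι-0) (K.+-identityˡ (θ j K.* ev (θ j) (lst r)))))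
      (K.trans (ev-cong {θ j} {θ j} K.refl (0# ∷ lst r) (lst (step (lower P) r) ⊕ (r (fromℕ (pred-deg P)) · poly P)) (Division.X-lst (lower P) r))
      (K.trans (ev-⊕ (θ j) (lst (step (lower P) r)) (r (fromℕ (pred-deg P)) · poly P))
      (K.trans (K.+-congˡ {ev (θ j) (lst (step (lower P) r))} (K.trans (ev-· (θ j) (r (fromℕ (pred-deg P))) (poly P))
        (K.trans (K.*-congˡ {ι (r (fromℕ (pred-deg P)))} (root j)) (K.zeroʳ (ι (r (fromℕ (pred-deg P))))))))
        (K.+-identityʳ (ev (θ j) (lst (step (lower P) r))))))))

    ev-column : ∀ j (r : Fin d → Carrier) → ev (θ j) (lst r) K.≈ SK.sum (λ i → θ j ^ toℕ i K.* ι (r i))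
    ev-column j r = K.trans (ev-lst (θ j) r) (SK.sum-cong-≋ {d} (λ i → K.*-comm (ι (r i)) (θ j ^ toℕ i)))

    eigenrow : ∀ j l → FiniteField.sumFin K d (λ i → V j i K.* ι (C i l)) K.≈ θ (toℕ j) K.* V j l
    eigenrow j l = K.trans (K.reflexive (MK.sumFin≡sum d (λ i → V j i K.* ι (C i l)))) (K.trans (K.sym (ev-column (toℕ j) (λ i → C i l)))
      (K.trans (ev-step (toℕ j) (λ i → I i l)) (K.*-congˡ {θ (toℕ j)} (K.trans (ev-column (toℕ j) (λ i → I i l))
        (K.trans (SumTools.sum-single Kr (λ i → θ (toℕ j) ^ toℕ i K.* ι (I i l)) l (λ i ne →
            K.trans (K.*-congˡ {θ (toℕ j) ^ toℕ i} (K.trans (ι-cong (I-off ne)) ι-0)) (K.zeroʳ (θ (toℕ j) ^ toℕ i))))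
          (K.trans (K.*-congˡ {θ (toℕ j) ^ toℕ l} (K.trans (ι-cong (I-diag l)) ι-1)) (K.*-identityʳ (θ (toℕ j) ^ toℕ l))))))))

    ι-sumFin : ∀ n (f : Fin n → Carrier) → ι (sumFin n f) K.≈ FiniteField.sumFin K n (λ i → ι (f i))
    ι-sumFin zero    f = ι-0
    ι-sumFin (suc n) f = K.trans (ι-+ (f zero) _) (K.+-congˡ {ι (f zero)} (ι-sumFin n (λ i → f (suc i))))

    power : ℕ → MK.Rect d d
    power n i l = ι ((C ^ᴹ n) i l)

    eigenpower : ∀ n j l → (V MK.⊙ power n) j l K.≈ θ (toℕ j) ^ n K.* V j l
    eigenpower zero    j l = K.trans (MK.⊙-congˡ V {power 0} {FiniteField.I K} ι-I j l) (K.trans (MK.⊙-identityʳ V j l) (K.sym (K.*-identityˡ (V j l))))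
      where
      ι-I : ∀ a b → ι (I a b) K.≈ FiniteField.I K a b
      ι-I a b with a FinP.≟ b
      ... | yes _ = ι-1
      ... | no _  = ι-0
    eigenpower (suc n) j l = K.trans (MK.⊙-congˡ V {power (suc n)} {power' MK.⊙ power n} step-power j l)
      (K.trans (K.sym (MK.⊙-assoc V power' (power n) j l)) (K.trans (MK.⊙-congʳ {g = V MK.⊙ power'} {g' = λ j l → θ (toℕ j) K.* V j l} (power n) eigenrow j l)
        (K.trans (MK.Σ-cong d (λ b → K.*-assoc (θ (toℕ j)) (V j b) (power n b l))) (K.trans (K.sym (MK.Σ-*ˡ d (θ (toℕ j)) (λ b → V j b K.* power n b l)))
          (K.trans (K.*-congˡ {θ (toℕ j)} (eigenpower n j l)) (K.sym (K.*-assoc (θ (toℕ j)) (θ (toℕ j) ^ n) (V j l))))))))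
      where
      power' : MK.Rect d d
      power' i l = ι (C i l)
      step-power : power (suc n) MK.≈ʳ power' MK.⊙ power n
      step-power a b = K.trans (ι-sumFin d (λ t → C a t * (C ^ᴹ n) t b)) (MK.Σ-cong d (λ t → ι-* (C a t) ((C ^ᴹ n) t b)))

    -- With Δ the diagonal matrix of the conjugates, V Cⁿ = Δⁿ V. Hence Tr(Cⁿ) = Tr(W Δⁿ V) = Tr(Δⁿ
    -- V W) = Tr(Δⁿ), where W is the inverse of V and `N` is Δⁿ V.
    powerSum : ∀ n → ι (Tr (C ^ᴹ n)) K.≈ FiniteField.sumFin K d (λ j → θ (toℕ j) ^ n)
    powerSum n = K.trans (ι-sumFin d (λ i → (C ^ᴹ n) i i)) (K.trans
        (MK.Tr-cong {g = power n} {h = W MK.⊙ N} (λ i l → K.sym (K.trans (MK.⊙-congˡ W {N} {V MK.⊙ power n} (λ a b → K.sym (eigenpower n a b)) i l)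
          (K.trans (K.sym (MK.⊙-assoc W V (power n) i l)) (K.trans (MK.⊙-congʳ {g = W MK.⊙ V} {g' = FiniteField.I K} (power n) WV i l) (MK.⊙-identityˡ (power n) i l))))))
        (K.trans (MK.Tr-comm W N) (MK.Σ-cong d (λ j →
          K.trans (MK.Σ-cong d (λ l → K.*-assoc (θ (toℕ j) ^ n) (V j l) (W l j))) (K.trans (K.sym (MK.Σ-*ˡ d (θ (toℕ j) ^ n) (λ l → V j l K.* W l j)))
            (K.trans (K.*-congˡ {θ (toℕ j) ^ n} (K.trans (VW j j) (MK.I-diag j))) (K.*-identityʳ (θ (toℕ j) ^ n))))))))
      where
      inv = MK.injective⇒invertible V V-injective
      W = proj₁ inv
      VW = proj₁ (proj₂ inv)
      WV = proj₂ (proj₂ inv)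
      N : MK.Rect d d
      N j l = θ (toℕ j) ^ n K.* V j l

    module _ (k : ℕ) (1≤k : 1 ≤ k) (a : ℕ → Carrier) (aₖ≉0 : ¬ (a k ≈ 0#)) where
      open ArtinSchreier F k 1≤k a aₖ≉0 using (hAt; module Fibre)
      open Fibre P using (trace)

      private
        hθ : ∀ j n → SumTools.sum₁ Kr n (λ i → ι (a i) K.* X ^ i) ^ (q ℕ.^ j) K.≈ SumTools.sum₁ Kr n (λ i → ι (a i) K.* θ j ^ i)
        hθ j zero    = AlgK.0^qⁿ j
        hθ j (suc n) = K.trans (AlgK.^qⁿ-+ j (SumTools.sum₁ Kr n (λ i → ι (a i) K.* X ^ i)) (ι (a (suc n)) K.* X ^ suc n)) (K.+-cong (hθ j n)
          (K.trans (^-distrib-* (ι (a (suc n))) (X ^ suc n) (q ℕ.^ j)) (K.*-cong (AlgK.ι-^qⁿ j (a (suc n)))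
            (K.trans (^-assocʳ X (suc n) (q ℕ.^ j)) (K.trans (^-congʳ X (ℕP.*-comm (suc n) (q ℕ.^ j))) (K.sym (^-assocʳ X (q ℕ.^ j) (suc n))))))))

        trace≈ : ∀ n → trace n K.≈ SK.sum {n} (λ j → hAt toK (θ (toℕ j)))
        trace≈ zero    = K.refl
        trace≈ (suc n) = K.sym (K.trans (SK.sum-init-last {n} (λ j → hAt toK (θ (toℕ j)))) (K.+-cong
          (K.trans (SK.sum-cong-≋ {n} (λ j → K.reflexive (≡.cong (λ z → hAt toK (θ z)) (FinP.toℕ-inject₁ j)))) (K.sym (trace≈ n)))
          (K.trans (K.reflexive (≡.cong (λ z → hAt toK (θ z)) (FinP.toℕ-fromℕ n))) (K.sym (hθ n k)))))

        sums : ∀ n → SK.sum {d} (λ j → SumTools.sum₁ Kr n (λ i → ι (a i) K.* θ (toℕ j) ^ i)) K.≈ ι (FiniteField.sum1to F n (λ i → a i * Tr (C ^ᴹ i)))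
        sums zero    = K.trans (SK.sum-replicate-zero d) (K.sym ι-0)
        sums (suc n) = K.trans (SK.∑-distrib-+ {d} (λ j → SumTools.sum₁ Kr n (λ i → ι (a i) K.* θ (toℕ j) ^ i)) (λ j → ι (a (suc n)) K.* θ (toℕ j) ^ suc n))
          (K.trans (K.+-cong (sums n) (K.trans (K.sym (SK.*-distribˡ-sum {d} (ι (a (suc n))) (λ j → θ (toℕ j) ^ suc n)))
              (K.trans (K.*-congˡ {ι (a (suc n))} (K.trans (K.reflexive (≡.sym (MK.sumFin≡sum d (λ j → θ (toℕ j) ^ suc n)))) (K.sym (powerSum (suc n)))))
                (K.sym (ι-* (a (suc n)) (Tr (C ^ᴹ suc n)))))))
            (K.sym (ι-+ (FiniteField.sum1to F n (λ i → a i * Tr (C ^ᴹ i))) (a (suc n) * Tr (C ^ᴹ suc n)))))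

      -- Frobenius fixes the coefficients aᵢ, so the conjugates of h(X) are the values of h at the
      -- θⱼ. Exchanging the sums over j and i leaves the power sums, which are the traces of Cⁱ.
      trace-companion : trace d K.≈ ι (traceSum k a C)
      trace-companion = K.trans (trace≈ d) (sums k)

-- The general linear group and block triangular matrices

module LinearGroup (F : FiniteField) where
  open FiniteField F using (commRing; sumFin; I)
  open CommutativeRing commRing hiding (zero)
  open FieldFacts F using (finite)
  open Matrices F

  RectF : ℕ → ℕ → Finite
  RectF m n = m ⇒ (n ⇒ finite)

  infix 4 _≟ʳ_
  _≟ʳ_ : ∀ {m n} (g h : Rect m n) → Dec (g ≈ʳ h)
  _≟ʳ_ {m} {n} = Finite._≟_ (RectF m n)

  ∑ʳ : ∀ {m n} → (Rect m n → ℕ) → ℕ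
  ∑ʳ {m} {n} = ∑ (Finite.list (RectF m n))

  ≈ʳ-refl : ∀ {m n} {g : Rect m n} → g ≈ʳ g
  ≈ʳ-refl i j = refl

  ≈ʳ-sym : ∀ {m n} {g h : Rect m n} → g ≈ʳ h → h ≈ʳ g
  ≈ʳ-sym e i j = sym (e i j)

  ≈ʳ-trans : ∀ {m n} {f g h : Rect m n} → f ≈ʳ g → g ≈ʳ h → f ≈ʳ h
  ≈ʳ-trans e e' i j = trans (e i j) (e' i j)

  0ʳ : ∀ {m n} → Rect m n
  0ʳ i j = 0#

  Inverses : ∀ {n} → Rect n n → Rect n n → Set
  Inverses g h = (g ⊙ h ≈ʳ I) × (h ⊙ g ≈ʳ I)

  Inverses-cong : ∀ {n} {g g' h h' : Rect n n} → g ≈ʳ g' → h ≈ʳ h' → Inverses g h → Inverses g' h'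
  Inverses-cong e e' (l , r) = ≈ʳ-trans (⊙-cong (≈ʳ-sym e) (≈ʳ-sym e')) l , ≈ʳ-trans (⊙-cong (≈ʳ-sym e') (≈ʳ-sym e)) r

  inv? : ∀ {n} (g : Rect n n) → Dec (Invertible g)
  inv? {n} g = Finite.search (RectF n n) (λ h → ((g ⊙ h) ≟ʳ I) ×-dec ((h ⊙ g) ≟ʳ I)) (λ {h} {h'} e → Inverses-cong {g = g} {g} {h} {h'} ≈ʳ-refl e)

  Invertible-cong : ∀ {n} {g g' : Rect n n} → g ≈ʳ g' → Invertible g → Invertible g'
  Invertible-cong e (h , p) = h , Inverses-cong e ≈ʳ-refl p

  cancelˡ : ∀ {n p} {B B' : Rect n n} → Inverses B B' → (φ : Rect n p) → B' ⊙ (B ⊙ φ) ≈ʳ φ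
  cancelˡ {B = B} {B'} (_ , r) φ = ≈ʳ-trans (≈ʳ-sym (⊙-assoc B' B φ)) (≈ʳ-trans (⊙-congʳ φ r) (⊙-identityˡ φ))

  cancelʳ : ∀ {n p} {B B' : Rect n n} → Inverses B B' → (φ : Rect n p) → B ⊙ (B' ⊙ φ) ≈ʳ φ
  cancelʳ {B = B} {B'} (l , _) φ = ≈ʳ-trans (≈ʳ-sym (⊙-assoc B B' φ)) (≈ʳ-trans (⊙-congʳ φ l) (⊙-identityˡ φ))

  Inverses-sym : ∀ {n} {B B' : Rect n n} → Inverses B B' → Inverses B' B
  Inverses-sym (l , r) = r , l

  Inverses-⊙ : ∀ {n} {g g' h h' : Rect n n} → Inverses g g' → Inverses h h' → Inverses (g ⊙ h) (h' ⊙ g')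
  Inverses-⊙ {g = g} {g'} {h} {h'} p r =
    ≈ʳ-trans (⊙-assoc g h (h' ⊙ g')) (≈ʳ-trans (⊙-congˡ g (cancelʳ r g')) (proj₁ p)) ,
    ≈ʳ-trans (⊙-assoc h' g' (g ⊙ h)) (≈ʳ-trans (⊙-congˡ h' (cancelˡ p h)) (proj₂ r))

  Invertible-⊙ : ∀ {n} {g h : Rect n n} → Invertible g → Invertible h → Invertible (g ⊙ h)
  Invertible-⊙ (g' , p) (h' , r) = (h' ⊙ g') , Inverses-⊙ p r

  conj : ∀ {n} → Rect n n → Rect n n → Rect n n → Rect n n
  conj B B' g = B ⊙ (g ⊙ B')

  conj-cong : ∀ {n} (B B' : Rect n n) {g g'} → g ≈ʳ g' → conj B B' g ≈ʳ conj B B' g'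
  conj-cong B B' e = ⊙-congˡ B (⊙-congʳ B' e)

  conj-conj : ∀ {n} {B B' : Rect n n} → Inverses B B' → ∀ g → conj B' B (conj B B' g) ≈ʳ g
  conj-conj {B = B} {B'} p g = ≈ʳ-trans (⊙-congˡ B' (⊙-assoc B (g ⊙ B') B)) (≈ʳ-trans (cancelˡ p ((g ⊙ B') ⊙ B))
    (≈ʳ-trans (⊙-assoc g B' B) (≈ʳ-trans (⊙-congˡ g (proj₂ p)) (⊙-identityʳ g))))

  Invertible-conj : ∀ {n} {B B' : Rect n n} → Inverses B B' → ∀ {g} → Invertible g → Invertible (conj B B' g)
  Invertible-conj {B = B} {B'} p i = Invertible-⊙ (B' , p) (Invertible-⊙ i (B , Inverses-sym p))

  inv-cong : ∀ {n} {g g' : Rect n n} → g ≈ʳ g' → ⟦ inv? g ⟧ ≡ ⟦ inv? g' ⟧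
  inv-cong {g = g} {g'} e = ⟦⟧-⇔ (inv? g) (inv? g') (Invertible-cong e) (Invertible-cong (≈ʳ-sym e))

  inv-conj : ∀ {n} {B B' : Rect n n} → Inverses B B' → ∀ g → ⟦ inv? (conj B B' g) ⟧ ≡ ⟦ inv? g ⟧
  inv-conj {B = B} {B'} p g = ⟦⟧-⇔ (inv? (conj B B' g)) (inv? g)
    (λ i → Invertible-cong (conj-conj p g) (Invertible-conj (Inverses-sym p) i)) (Invertible-conj p)

  ∑-conj : ∀ {n} {B B' : Rect n n} → Inverses B B' → (f : Rect n n → ℕ) → (∀ {g h} → g ≈ʳ h → f g ≡ f h) →
    ∑ʳ f ≡ ∑ʳ (λ g → f (conj B B' g))
  ∑-conj {n} {B} {B'} p f f-cong = ∑-reindex (RectF n n) (RectF n n) (conj B B') (conj B' B)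
    (λ {g} {h} e → ≈ʳ-sym (≈ʳ-trans (conj-cong B B' e) (conj-conj (Inverses-sym p) h)))
    (λ {g} {h} e → ≈ʳ-sym (≈ʳ-trans (conj-cong B' B e) (conj-conj p g))) f f-cong

  ∑-leftmul : ∀ {n m} {B B' : Rect n n} → Inverses B B' → (f : Rect n m → ℕ) → (∀ {g h} → g ≈ʳ h → f g ≡ f h) →
    ∑ʳ f ≡ ∑ʳ (λ g → f (B ⊙ g))
  ∑-leftmul {n} {m} {B} {B'} p f f-cong = ∑-reindex (RectF n m) (RectF n m) (B ⊙_) (B' ⊙_)
    (λ {g} {h} e → ≈ʳ-sym (≈ʳ-trans (⊙-congˡ B e) (cancelʳ p h)))
    (λ {g} {h} e → ≈ʳ-sym (≈ʳ-trans (⊙-congˡ B' e) (cancelˡ p g))) f f-cong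

  -- The order of GL_n(F).
  γ : ℕ → ℕ
  γ n = ∑ʳ {n} {n} (λ g → ⟦ inv? g ⟧)

  Fin-cases : ∀ m {d} (P : Fin (m ℕ.+ d) → Set) → (∀ i → P (i ↑ˡ d)) → (∀ j → P (m ↑ʳ j)) → ∀ x → P x
  Fin-cases zero    P l r x       = r x
  Fin-cases (suc m) P l r zero    = l zero
  Fin-cases (suc m) P l r (suc x) = Fin-cases m (λ x → P (suc x)) (λ i → l (suc i)) r x

  Σ-split : ∀ m d (f : Fin (m ℕ.+ d) → Carrier) → sumFin (m ℕ.+ d) f ≈ sumFin m (λ i → f (i ↑ˡ d)) + sumFin d (λ j → f (m ↑ʳ j))
  Σ-split zero    d f = sym (+-identityˡ _)
  Σ-split (suc m) d f = trans (+-congˡ (Σ-split m d (λ i → f (suc i)))) (sym (+-assoc _ _ _))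

  I-suc : ∀ {n} (i j : Fin n) → I (suc i) (suc j) ≈ I i j
  I-suc i j with i FinP.≟ j
  ... | yes _ = refl
  ... | no _  = refl

  I-↑ˡ : ∀ m {d} (i j : Fin m) → I (i ↑ˡ d) (j ↑ˡ d) ≈ I i j
  I-↑ˡ (suc m)     zero    zero    = refl
  I-↑ˡ (suc m)     zero    (suc j) = refl
  I-↑ˡ (suc m)     (suc i) zero    = refl
  I-↑ˡ (suc m) {d} (suc i) (suc j) = trans (I-suc (i ↑ˡ d) (j ↑ˡ d)) (trans (I-↑ˡ m i j) (sym (I-suc i j)))

  I-↑ʳ : ∀ m {d} (i j : Fin d) → I (m ↑ʳ i) (m ↑ʳ j) ≈ I i j
  I-↑ʳ zero    i j = refl
  I-↑ʳ (suc m) i j = trans (I-suc (m ↑ʳ i) (m ↑ʳ j)) (I-↑ʳ m i j)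

  ↑ˡ≢↑ʳ : ∀ m {d} (i : Fin m) (j : Fin d) → i ↑ˡ d ≢ m ↑ʳ j
  ↑ˡ≢↑ʳ (suc m) zero    j ()
  ↑ˡ≢↑ʳ (suc m) (suc i) j e = ↑ˡ≢↑ʳ m i j (FinP.suc-injective e)

  stack : ∀ {m d n} → Rect m n → Rect d n → Rect (m ℕ.+ d) n
  stack {m} u w i j = [ (λ i → u i j) , (λ i → w i j) ] (splitAt m i)

  stack-↑ˡ : ∀ {m d n} (u : Rect m n) (w : Rect d n) i j → stack u w (i ↑ˡ d) j ≈ u i j
  stack-↑ˡ {m} {d} u w i j = reflexive (≡.cong [ (λ i → u i j) , (λ i → w i j) ] (FinP.splitAt-↑ˡ m i d))

  stack-↑ʳ : ∀ {m d n} (u : Rect m n) (w : Rect d n) i j → stack u w (m ↑ʳ i) j ≈ w i j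
  stack-↑ʳ {m} {d} u w i j = reflexive (≡.cong [ (λ i → u i j) , (λ i → w i j) ] (FinP.splitAt-↑ʳ m d i))

  stack-cong : ∀ {m d n} {u u' : Rect m n} {w w' : Rect d n} → u ≈ʳ u' → w ≈ʳ w' → stack u w ≈ʳ stack u' w'
  stack-cong {m} {u = u} {u'} {w} {w'} e e' i j with splitAt m i
  ... | inj₁ i' = e i' j
  ... | inj₂ i' = e' i' j

  top : ∀ {m d n} → Rect (m ℕ.+ d) n → Rect m n
  top {m} {d} g i j = g (i ↑ˡ d) j

  bottom : ∀ {m d n} → Rect (m ℕ.+ d) n → Rect d n
  bottom {m} g i j = g (m ↑ʳ i) j

  stack-split : ∀ {m d n} (g : Rect (m ℕ.+ d) n) → g ≈ʳ stack (top {m} g) (bottom {m} g)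
  stack-split {m} {d} g i j = Fin-cases m (λ i → g i j ≈ stack (top {m} g) (bottom {m} g) i j)
    (λ i → sym (stack-↑ˡ (top {m} g) (bottom {m} g) i j)) (λ i → sym (stack-↑ʳ (top {m} g) (bottom {m} g) i j)) i

  left : ∀ {m d n} → Rect n (m ℕ.+ d) → Rect n m
  left {m} {d} g i j = g i (j ↑ˡ d)

  right : ∀ {m d n} → Rect n (m ℕ.+ d) → Rect n d
  right {m} g i j = g i (m ↑ʳ j)

  beside : ∀ {m d n} → Rect n m → Rect n d → Rect n (m ℕ.+ d)
  beside {m} u w i j = [ u i , w i ] (splitAt m j)

  left-beside : ∀ {m d n} (u : Rect n m) (w : Rect n d) → left {m} (beside u w) ≈ʳ u
  left-beside {m} {d} u w i j = reflexive (≡.cong [ u i , w i ] (FinP.splitAt-↑ˡ m j d))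

  right-beside : ∀ {m d n} (u : Rect n m) (w : Rect n d) → right {m} (beside u w) ≈ʳ w
  right-beside {m} {d} u w i j = reflexive (≡.cong [ u i , w i ] (FinP.splitAt-↑ʳ m d j))

  beside-cong : ∀ {m d n} {u u' : Rect n m} {w w' : Rect n d} → u ≈ʳ u' → w ≈ʳ w' → beside u w ≈ʳ beside u' w'
  beside-cong {m} e e' i j with splitAt m j
  ... | inj₁ j' = e i j'
  ... | inj₂ j' = e' i j'

  beside-split : ∀ {m d n} (g : Rect n (m ℕ.+ d)) → g ≈ʳ beside (left {m} g) (right {m} g)
  beside-split {m} {d} g i j = Fin-cases m (λ j → g i j ≈ beside (left {m} g) (right {m} g) i j)
    (λ j → sym (left-beside (left {m} g) (right {m} g) i j)) (λ j → sym (right-beside (left {m} g) (right {m} g) i j)) j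

  ∑-stack : ∀ {m d n} (f : Rect (m ℕ.+ d) n → ℕ) → (∀ {g h} → g ≈ʳ h → f g ≡ f h) →
    ∑ʳ f ≡ ∑ʳ (λ (u : Rect m n) → ∑ʳ (λ (w : Rect d n) → f (stack u w)))
  ∑-stack {m} {d} {n} f f-cong = ≡.trans (∑-reindex (RectF m n ⊠ RectF d n) (RectF (m ℕ.+ d) n)
      (λ (u , w) → stack u w) (λ g → top {m} g , bottom {m} g)
      (λ {(u , w)} {g} (e , e') → ≈ʳ-trans (stack-split {m} {d} g) (≈ʳ-sym (stack-cong e e')))
      (λ {(u , w)} {g} e → (λ i j → sym (trans (e (i ↑ˡ d) j) (stack-↑ˡ u w i j))) , (λ i j → sym (trans (e (m ↑ʳ i) j) (stack-↑ʳ u w i j)))) f f-cong)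
    (∑-pair (RectF m n) (RectF d n) (λ (u , w) → f (stack u w)))

  ∑-beside : ∀ {m d n} (f : Rect n (m ℕ.+ d) → ℕ) → (∀ {g h} → g ≈ʳ h → f g ≡ f h) →
    ∑ʳ f ≡ ∑ʳ (λ (u : Rect n m) → ∑ʳ (λ (w : Rect n d) → f (beside u w)))
  ∑-beside {m} {d} {n} f f-cong = ≡.trans (∑-reindex (RectF n m ⊠ RectF n d) (RectF n (m ℕ.+ d))
      (λ (u , w) → beside u w) (λ g → left {m} g , right {m} g)
      (λ {(u , w)} {g} (e , e') → ≈ʳ-trans (beside-split {m} {d} g) (≈ʳ-sym (beside-cong e e')))
      (λ {(u , w)} {g} e → (λ i j → sym (trans (e i (j ↑ˡ d)) (left-beside u w i j))) , (λ i j → sym (trans (e i (m ↑ʳ j)) (right-beside u w i j)))) f f-cong)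
    (∑-pair (RectF n m) (RectF n d) (λ (u , w) → f (beside u w)))

  -- The inclusion of the last d coordinates into the space of dimension m + d.
  E : ∀ {m d} → Rect (m ℕ.+ d) d
  E {m} i j = I i (m ↑ʳ j)

  ⊙E : ∀ {m d n} (g : Rect n (m ℕ.+ d)) → g ⊙ E {m} {d} ≈ʳ right {m} g
  ⊙E {m} {d} g i j = Σ-Iʳ (m ℕ.+ d) (m ↑ʳ j) (g i)

  top-E : ∀ {m d n} (C : Rect d n) → top {m} (E {m} {d} ⊙ C) ≈ʳ 0ʳ
  top-E {m} {d} C i j = Σ-zero d (λ l → trans (*-congʳ (I-off (↑ˡ≢↑ʳ m i l))) (zeroˡ _))

  bottom-E : ∀ {m d n} (C : Rect d n) → bottom {m} (E {m} {d} ⊙ C) ≈ʳ C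
  bottom-E {m} {d} C i j = trans (Σ-cong d (λ l → *-congʳ (I-↑ʳ m i l))) (Σ-Iˡ d i (λ l → C l j))

  -- Block rows (D, 0) and (Y, C): the span of the last d basis vectors is invariant, and C is the
  -- action on it.
  block : ∀ {m d} → Rect m m → Rect d m → Rect d d → Rect (m ℕ.+ d) (m ℕ.+ d)
  block D Y C = beside (stack D Y) (stack 0ʳ C)

  Fixes : ∀ {m d} → Rect d d → Rect (m ℕ.+ d) (m ℕ.+ d) → Set
  Fixes {m} C g = g ⊙ E {m} ≈ʳ E {m} ⊙ C

  fixes? : ∀ {m d} (C : Rect d d) (g : Rect (m ℕ.+ d) (m ℕ.+ d)) → Dec (Fixes {m} C g)
  fixes? {m} C g = (g ⊙ E {m}) ≟ʳ (E {m} ⊙ C)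

  E⊙≈stack : ∀ {m d} (C : Rect d d) → E {m} ⊙ C ≈ʳ stack 0ʳ C
  E⊙≈stack {m} C = ≈ʳ-trans (stack-split {m} (E {m} ⊙ C)) (stack-cong (top-E {m} C) (bottom-E {m} C))

  -- The condition g E = E C prescribes the last d columns of g and leaves D and Y free.
  ∑-fixes : ∀ {m d} (C : Rect d d) (f : Rect (m ℕ.+ d) (m ℕ.+ d) → ℕ) → (∀ {g h} → g ≈ʳ h → f g ≡ f h) →
    ∑ʳ (λ g → ⟦ fixes? {m} C g ⟧ ℕ.* f g) ≡ ∑ʳ (λ (D : Rect m m) → ∑ʳ (λ (Y : Rect d m) → f (block D Y C)))
  ∑-fixes {m} {d} C f f-cong =
    ≡.trans (∑-beside {m} {d} (λ g → ⟦ fixes? {m} C g ⟧ ℕ.* f g) F-cong)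
    (≡.trans (∑-cong (Finite.list (RectF (m ℕ.+ d) m)) (λ u → ≡.trans
        (∑-cong (Finite.list (RectF (m ℕ.+ d) d)) (λ w → ≡.cong (ℕ._* f (beside u w)) (indicator u w)))
        (∑-pick (RectF (m ℕ.+ d) d) (stack 0ʳ C) (λ w → f (beside u w)) (λ e → f-cong (beside-cong (≈ʳ-refl {g = u}) e)))))
      (∑-stack {m} {d} (λ u → f (beside u (stack 0ʳ C))) (λ e → f-cong (beside-cong e ≈ʳ-refl))))
    where
    F-cong : ∀ {g h} → g ≈ʳ h → ⟦ fixes? {m} C g ⟧ ℕ.* f g ≡ ⟦ fixes? {m} C h ⟧ ℕ.* f h
    F-cong {g} {h} e = ≡.cong₂ ℕ._*_ (⟦⟧-⇔ (fixes? {m} C g) (fixes? {m} C h)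
      (λ p → ≈ʳ-trans (⊙-congʳ (E {m}) (≈ʳ-sym e)) p) (λ p → ≈ʳ-trans (⊙-congʳ (E {m}) e) p)) (f-cong e)
    indicator : ∀ (u : Rect (m ℕ.+ d) m) (w : Rect (m ℕ.+ d) d) → ⟦ fixes? {m} C (beside u w) ⟧ ≡ ⟦ w ≟ʳ stack 0ʳ C ⟧
    indicator u w = ⟦⟧-⇔ (fixes? {m} C (beside u w)) (w ≟ʳ stack 0ʳ C)
      (λ p → ≈ʳ-trans (≈ʳ-sym (right-beside u w)) (≈ʳ-trans (≈ʳ-sym (⊙E {m} (beside u w))) (≈ʳ-trans p (E⊙≈stack {m} C))))
      (λ p → ≈ʳ-trans (⊙E {m} (beside u w)) (≈ʳ-trans (right-beside u w) (≈ʳ-trans p (≈ʳ-sym (E⊙≈stack {m} C)))))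

  block-⊙ : ∀ {m d n} (D : Rect m m) (Y : Rect d m) (C : Rect d d) (φ : Rect (m ℕ.+ d) n) →
    (top {m} (block D Y C ⊙ φ) ≈ʳ D ⊙ top {m} φ) × (bottom {m} (block D Y C ⊙ φ) ≈ʳ λ i j → (Y ⊙ top {m} φ) i j + (C ⊙ bottom {m} φ) i j)
  block-⊙ {m} {d} D Y C φ = upper , lower
    where
    row : ∀ i j → (block D Y C ⊙ φ) i j ≈ sumFin m (λ l → stack D Y i l * φ (l ↑ˡ d) j) + sumFin d (λ l → stack 0ʳ C i l * φ (m ↑ʳ l) j)
    row i j = trans (Σ-split m d _) (+-cong (Σ-cong m (λ l → *-congʳ (left-beside (stack D Y) (stack 0ʳ C) i l))) (Σ-cong d (λ l → *-congʳ (right-beside (stack D Y) (stack 0ʳ C) i l))))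
    upper : top {m} (block D Y C ⊙ φ) ≈ʳ D ⊙ top {m} φ
    upper i j = trans (row (i ↑ˡ d) j) (trans (+-cong (Σ-cong m (λ l → *-congʳ (stack-↑ˡ D Y i l)))
      (Σ-zero d (λ l → trans (*-congʳ (stack-↑ˡ 0ʳ C i l)) (zeroˡ _)))) (+-identityʳ _))
    lower : bottom {m} (block D Y C ⊙ φ) ≈ʳ λ i j → (Y ⊙ top {m} φ) i j + (C ⊙ bottom {m} φ) i j
    lower i j = trans (row (m ↑ʳ i) j) (+-cong (Σ-cong m (λ l → *-congʳ (stack-↑ʳ D Y i l))) (Σ-cong d (λ l → *-congʳ (stack-↑ʳ {m} 0ʳ C i l))))

  private
    column : ∀ {n} → (Fin n → Carrier) → Rect n 1
    column w i _ = w i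

  block-invertible : ∀ {m d} (D : Rect m m) (Y : Rect d m) (C : Rect d d) → Invertible C →
    (Invertible (block D Y C) → Invertible D) × (Invertible D → Invertible (block D Y C))
  block-invertible {m} {d} D Y C (C' , CC' , C'C) = to , from
    where
    to : Invertible (block D Y C) → Invertible D
    to inv = injective⇒invertible D λ w Dw≈0 i →
      -- A kernel vector w of D is completed by -C⁻¹ Y w to a kernel vector of the block matrix.
      let w' = λ i j → - (C' ⊙ (Y ⊙ column w)) i j
          φ = stack (column w) w'
          C⊙- : ∀ i j → (C ⊙ (λ i j → - (C' ⊙ (Y ⊙ column w)) i j)) i j ≈ - (Y ⊙ column w) i j
          C⊙- i j = trans (Σ-cong d (λ l → trans (sym (-‿distribʳ-* _ _)) (sym (-1*x≈-x _)))) (trans (sym (Σ-*ˡ d (- 1#) (λ l → C i l * (C' ⊙ (Y ⊙ column w)) l j)))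
            (trans (-1*x≈-x _) (-‿cong (cancelʳ (CC' , C'C) (Y ⊙ column w) i j))))
          zero-image : ∀ x → (block D Y C ⊙ φ) x zero ≈ 0#
          zero-image = Fin-cases m (λ x → (block D Y C ⊙ φ) x zero ≈ 0#)
            (λ i → trans (proj₁ (block-⊙ D Y C φ) i zero) (trans (Σ-cong m (λ l → *-congˡ (stack-↑ˡ (column w) w' l zero))) (Dw≈0 i)))
            (λ i → trans (proj₂ (block-⊙ D Y C φ) i zero) (trans (+-cong (Σ-cong m (λ l → *-congˡ (stack-↑ˡ (column w) w' l zero)))
              (trans (Σ-cong d (λ l → *-congˡ (stack-↑ʳ (column w) w' l zero))) (C⊙- i zero))) (-‿inverseʳ _)))
      in trans (sym (stack-↑ˡ (column w) (λ i j → - (C' ⊙ (Y ⊙ column w)) i j) i zero))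
           (invertible⇒injective (block D Y C) inv (λ x → φ x zero) zero-image (i ↑ˡ d))
      where open import Algebra.Properties.Ring ring using (-‿distribʳ-*; -1*x≈-x)
    from : Invertible D → Invertible (block D Y C)
    from inv = injective⇒invertible (block D Y C) λ w e →
      let φ = column w
          w₁≈0 : ∀ i → w (i ↑ˡ d) ≈ 0#
          w₁≈0 = invertible⇒injective D inv (λ i → w (i ↑ˡ d)) (λ i → trans (sym (proj₁ (block-⊙ D Y C φ) i zero)) (e (i ↑ˡ d)))
          w₂≈0 : ∀ i → w (m ↑ʳ i) ≈ 0#
          w₂≈0 = invertible⇒injective C (C' , CC' , C'C) (λ i → w (m ↑ʳ i)) (λ i →
            trans (sym (trans (+-congʳ (Σ-zero m (λ l → trans (*-congˡ (w₁≈0 l)) (zeroʳ _)))) (+-identityˡ _)))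
              (trans (sym (proj₂ (block-⊙ D Y C φ) i zero)) (e (m ↑ʳ i))))
      in Fin-cases m (λ x → w x ≈ 0#) w₁≈0 w₂≈0

  inv-block : ∀ {m d} (D : Rect m m) (Y : Rect d m) (C : Rect d d) → Invertible C → ⟦ inv? (block D Y C) ⟧ ≡ ⟦ inv? D ⟧
  inv-block D Y C i = ⟦⟧-⇔ (inv? (block D Y C)) (inv? D) (proj₁ (block-invertible D Y C i)) (proj₂ (block-invertible D Y C i))

  I-invertible : ∀ {n} → Invertible (I {n})
  I-invertible = I , ⊙-identityˡ I , ⊙-identityˡ I

  Extends : ∀ {m d} → Rect (m ℕ.+ d) d → Set
  Extends {m} {d} φ = ∃ λ (B : Rect (m ℕ.+ d) (m ℕ.+ d)) → Invertible B × φ ≈ʳ B ⊙ E {m}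

  Extends-resp : ∀ {m d} (φ : Rect (m ℕ.+ d) d) {B B'} → B ≈ʳ B' → Invertible B × φ ≈ʳ B ⊙ E {m} → Invertible B' × φ ≈ʳ B' ⊙ E {m}
  Extends-resp {m} φ e (i , p) = Invertible-cong e i , ≈ʳ-trans p (⊙-congʳ (E {m}) e)

  extends? : ∀ {m d} (φ : Rect (m ℕ.+ d) d) → Dec (Extends {m} φ)
  extends? {m} {d} φ = Finite.search (RectF (m ℕ.+ d) (m ℕ.+ d)) (λ B → inv? B ×-dec (φ ≟ʳ (B ⊙ E {m}))) (Extends-resp {m} φ)

  -- κ is the number of d-frames in dimension m + d, given as those φ that are the last d columns of
  -- an invertible matrix; ρ is the number of blocks Y.
  κ ρ : ℕ → ℕ → ℕ
  κ m d = ∑ʳ {m ℕ.+ d} {d} (λ φ → ⟦ extends? {m} φ ⟧)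
  ρ m d = Finite.card (RectF d m)

  -- Orbit and stabiliser by double counting: the group acts transitively on the extendable φ by
  -- left multiplication, and the stabiliser of E consists of the invertible block matrices with C =
  -- I.
  γ-split : ∀ m d → γ (m ℕ.+ d) ≡ κ m d ℕ.* (ρ m d ℕ.* γ m)
  γ-split m d = begin
    γ n                                                                   ≡⟨ ∑-cong Bs (λ B → ≡.sym (≡.trans (∑-*ˡ φs ⟦ inv? B ⟧ (λ φ → ⟦ φ ≟ʳ (B ⊙ E {m}) ⟧))
                                                                                (≡.trans (≡.cong (⟦ inv? B ⟧ ℕ.*_) (Finite.once (RectF n d) (B ⊙ E {m}))) (ℕP.*-identityʳ _)))) ⟩
    ∑ Bs (λ B → ∑ φs (λ φ → ⟦ inv? B ⟧ ℕ.* ⟦ φ ≟ʳ (B ⊙ E {m}) ⟧))         ≡⟨ ∑-swap Bs φs _ ⟩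
    ∑ φs (λ φ → ∑ Bs (λ B → ⟦ inv? B ⟧ ℕ.* ⟦ φ ≟ʳ (B ⊙ E {m}) ⟧))         ≡⟨ ∑-cong φs per-φ ⟩
    ∑ φs (λ φ → ⟦ extends? {m} φ ⟧ ℕ.* (ρ m d ℕ.* γ m))                   ≡⟨ ∑-*ʳ φs (ρ m d ℕ.* γ m) _ ⟩
    κ m d ℕ.* (ρ m d ℕ.* γ m)                                             ∎
    where
    open ≡.≡-Reasoning
    n = m ℕ.+ d
    Bs = Finite.list (RectF n n)
    φs = Finite.list (RectF n d)
    base : ∑ Bs (λ B → ⟦ fixes? {m} I B ⟧ ℕ.* ⟦ inv? B ⟧) ≡ ρ m d ℕ.* γ m
    base = ≡.trans (∑-fixes {m} {d} I (λ B → ⟦ inv? B ⟧) inv-cong)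
      (≡.trans (∑-cong (Finite.list (RectF m m)) (λ D → ≡.trans (∑-cong (Finite.list (RectF d m)) (λ Y → inv-block D Y I I-invertible))
        (∑-const (Finite.list (RectF d m)) ⟦ inv? D ⟧))) (∑-*ˡ (Finite.list (RectF m m)) (ρ m d) (λ D → ⟦ inv? D ⟧)))
    per-φ : ∀ φ → ∑ Bs (λ B → ⟦ inv? B ⟧ ℕ.* ⟦ φ ≟ʳ (B ⊙ E {m}) ⟧) ≡ ⟦ extends? {m} φ ⟧ ℕ.* (ρ m d ℕ.* γ m)
    per-φ φ = ⟦⟧-select (extends? {m} φ) (extended φ) (λ ¬ext → ≡.trans
        (∑-cong Bs (λ B → ⟦⟧-disjoint (inv? B) (φ ≟ʳ (B ⊙ E {m})) (λ i e → ¬ext (B , i , e)))) (∑-0 Bs))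
      where
      extended : ∀ φ → Extends {m} φ → ∑ Bs (λ B → ⟦ inv? B ⟧ ℕ.* ⟦ φ ≟ʳ (B ⊙ E {m}) ⟧) ≡ ρ m d ℕ.* γ m
      extended φ (B₀ , (B₀' , p) , e) = ≡.trans (∑-leftmul p (λ B → ⟦ inv? B ⟧ ℕ.* ⟦ φ ≟ʳ (B ⊙ E {m}) ⟧) F-cong)
          (≡.trans (∑-cong Bs (λ B → ≡.trans (≡.cong₂ ℕ._*_ (inv≡ B) (fix≡ B)) (ℕP.*-comm ⟦ inv? B ⟧ _))) base)
        where
        F-cong : ∀ {g h : Rect n n} → g ≈ʳ h → ⟦ inv? g ⟧ ℕ.* ⟦ φ ≟ʳ (g ⊙ E {m}) ⟧ ≡ ⟦ inv? h ⟧ ℕ.* ⟦ φ ≟ʳ (h ⊙ E {m}) ⟧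
        F-cong {g} {h} e = ≡.cong₂ ℕ._*_ (inv-cong e) (⟦⟧-⇔ (φ ≟ʳ (g ⊙ E {m})) (φ ≟ʳ (h ⊙ E {m}))
          (λ r → ≈ʳ-trans r (⊙-congʳ (E {m}) e)) (λ r → ≈ʳ-trans r (⊙-congʳ (E {m}) (≈ʳ-sym e))))
        inv≡ : ∀ B → ⟦ inv? (B₀ ⊙ B) ⟧ ≡ ⟦ inv? B ⟧
        inv≡ B = ⟦⟧-⇔ (inv? (B₀ ⊙ B)) (inv? B) (λ i → Invertible-cong (cancelˡ p B) (Invertible-⊙ (B₀ , Inverses-sym p) i)) (Invertible-⊙ (B₀' , p))
        fix≡ : ∀ B → ⟦ φ ≟ʳ ((B₀ ⊙ B) ⊙ E {m}) ⟧ ≡ ⟦ fixes? {m} I B ⟧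
        fix≡ B = ⟦⟧-⇔ (φ ≟ʳ ((B₀ ⊙ B) ⊙ E {m})) (fixes? {m} I B)
          (λ r → ≈ʳ-trans (≈ʳ-sym (cancelˡ p (B ⊙ E {m}))) (≈ʳ-trans (⊙-congˡ B₀' (≈ʳ-trans (≈ʳ-sym (⊙-assoc B₀ B (E {m}))) (≈ʳ-trans (≈ʳ-sym r) e)))
            (≈ʳ-trans (cancelˡ p (E {m})) (≈ʳ-sym (⊙-identityʳ (E {m}))))))
          (λ r → ≈ʳ-trans e (≈ʳ-trans (⊙-congˡ B₀ (≈ʳ-trans (≈ʳ-sym (⊙-identityʳ (E {m}))) (≈ʳ-sym r))) (≈ʳ-sym (⊙-assoc B₀ B (E {m})))))

-- Moments of the number of embedded blocks

module Intertwiners (F : FiniteField) where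
  open FiniteField F using (commRing; I; 0≉1; inverse) renaming (card to q; _≟_ to _≟F_)
  open CommutativeRing commRing hiding (zero)
  open FieldFacts F using (finite; q≥2)
  open Matrices F
  open RingTools commRing
  open LinearGroup F
  open Poly commRing
  open Factorisation F
  open Irreducible using (deg; poly; lower; irr; field')
  open Companion F

  ·ᵥ-cong : ∀ {m n} (g : Rect m n) {w w'} → (∀ i → w i ≈ w' i) → ∀ i → (g ·ᵥ w) i ≈ (g ·ᵥ w') i
  ·ᵥ-cong {n = n} g e i = Σ-cong n (λ l → *-congˡ (e l))

  ·ᵥ-assoc : ∀ {m n p} (f : Rect m n) (g : Rect n p) w i → ((f ⊙ g) ·ᵥ w) i ≈ (f ·ᵥ (g ·ᵥ w)) i
  ·ᵥ-assoc f g w i = ⊙-assoc f g (λ l (_ : Fin 1) → w l) i zero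

  ·ᵥ-zero : ∀ {m n} (g : Rect m n) {w} → (∀ i → w i ≈ 0#) → ∀ i → (g ·ᵥ w) i ≈ 0#
  ·ᵥ-zero {n = n} g e i = Σ-zero n (λ l → trans (*-congˡ (e l)) (zeroʳ _))

  ·ᵥ-linear : ∀ {m n} (g : Rect m n) a w w' i → (g ·ᵥ (λ l → a * w l + w' l)) i ≈ a * (g ·ᵥ w) i + (g ·ᵥ w') i
  ·ᵥ-linear {n = n} g a w w' i = trans (Σ-cong n (λ l → solve 4 (λ g a w w' → g :* (a :* w :+ w') := a :* (g :* w) :+ g :* w') refl (g i l) a (w l) (w' l)))
    (trans (Σ-+ n (λ l → a * (g i l * w l)) (λ l → g i l * w' l)) (+-congʳ (sym (Σ-*ˡ n a (λ l → g i l * w l)))))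

  outside : ∀ {n k} (B : Rect n k) → k < n → ∃ λ v → ∀ w → ¬ (∀ i → v i ≈ (B ·ᵥ w) i)
  outside {n} {k} B k<n with Finite.search (n ⇒ finite) (λ v → ¬? (image? v)) resp
    where
    image? : ∀ v → Dec (∃ λ w → ∀ i → v i ≈ (B ·ᵥ w) i)
    image? v = Finite.search (k ⇒ finite) (λ w → Finite._≟_ (n ⇒ finite) v (B ·ᵥ w)) (λ e p i → trans (p i) (·ᵥ-cong B e i))
    resp : ∀ {v v' : Fin n → Carrier} → (∀ i → v i ≈ v' i) → ¬ (∃ λ w → ∀ i → v i ≈ (B ·ᵥ w) i) → ¬ (∃ λ w → ∀ i → v' i ≈ (B ·ᵥ w) i)
    resp e ne (w , p) = ne (w , λ i → trans (e i) (p i))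
  ... | yes (v , ne) = v , λ w e → ne (w , e)
  ... | no none = ⊥-elim (ℕP.<⇒≱ (ℕP.^-monoʳ-< q q≥2 k<n) (≡.subst₂ _≤_ (card-⇒ n finite) (card-⇒ k finite)
      (card-inj (n ⇒ finite) (k ⇒ finite) (λ v → proj₁ (preimage v)) (λ {v} {v'} e i → trans (proj₂ (preimage v) i) (trans (·ᵥ-cong B e i) (sym (proj₂ (preimage v') i)))))))
    where
    image? : ∀ v → Dec (∃ λ w → ∀ i → v i ≈ (B ·ᵥ w) i)
    image? v = Finite.search (k ⇒ finite) (λ w → Finite._≟_ (n ⇒ finite) v (B ·ᵥ w)) (λ e p i → trans (p i) (·ᵥ-cong B e i))
    preimage : ∀ v → ∃ λ w → ∀ i → v i ≈ (B ·ᵥ w) i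
    preimage v with image? v
    ... | yes p = p
    ... | no ¬p = ⊥-elim (none (v , ¬p))

  -- Basis completion. New columns outside the current span are put in front, so that φ ends up as
  -- the last d columns, where `Extends` expects it.
  complete-columns : ∀ {n d} (φ : Rect n d) → Injective φ → ∀ m → m ℕ.+ d ≤ n →
    ∃ λ (B : Rect n (m ℕ.+ d)) → Injective B × (∀ i j → B i (m ↑ʳ j) ≈ φ i j)
  complete-columns φ inj zero    l = φ , inj , λ i j → refl
  complete-columns {n} {d} φ inj (suc m) l with complete-columns φ inj m (ℕP.<⇒≤ l)
  ... | B , B-inj , e = B⁺ , B⁺-inj , e
    where
    v = proj₁ (outside B l)
    v-out = proj₂ (outside B l)
    B⁺ : Rect n (suc m ℕ.+ d)
    B⁺ i zero    = v i
    B⁺ i (suc j) = B i j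
    B⁺-inj : Injective B⁺
    B⁺-inj w z = λ { zero → w₀≈0 ; (suc j) → B-inj (λ j → w (suc j)) (λ i → trans (sym (trans (+-congʳ (trans (*-congˡ w₀≈0) (zeroʳ _))) (+-identityˡ _))) (z i)) j }
      where
      w₀≈0 : w zero ≈ 0#
      w₀≈0 with w zero ≟F 0#
      ... | yes p = p
      ... | no p  = ⊥-elim (v-out (λ j → (- r) * w (suc j) + 0#) (λ i → trans (v≈ i) (sym (trans (·ᵥ-linear B (- r) (λ j → w (suc j)) (λ _ → 0#) i)
              (trans (+-congˡ (·ᵥ-zero B (λ _ → refl) i)) (+-identityʳ _))))))
        where
        r = proj₁ (inverse (w zero) p)
        v≈ : ∀ i → v i ≈ (- r) * (B ·ᵥ (λ j → w (suc j))) i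
        v≈ i = trans (sym (trans (*-congˡ (proj₂ (inverse (w zero) p))) (*-identityʳ _)))
          (trans (solve 4 (λ v w r b → v :* (w :* r) := r :* (v :* w :+ b) :+ (:- r) :* b) refl (v i) (w zero) r ((B ·ᵥ (λ j → w (suc j))) i))
            (trans (+-congʳ (trans (*-congˡ (z i)) (zeroʳ r))) (+-identityˡ _)))

  injective⇒extends : ∀ {m d} (φ : Rect (m ℕ.+ d) d) → Injective φ → Extends {m} φ
  injective⇒extends {m} φ inj with complete-columns φ inj m ℕP.≤-refl
  ... | B , B-inj , e = B , injective⇒invertible B B-inj , λ i j → sym (trans (⊙E {m} B i j) (e i j))

  module Counts {d : ℕ} (C : Rect d d) where
    Intertwines : ∀ {n} → Rect n n → Rect n d → Set
    Intertwines g φ = g ⊙ φ ≈ʳ φ ⊙ C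

    int? : ∀ {n} (g : Rect n n) (φ : Rect n d) → Dec (Intertwines g φ)
    int? g φ = (g ⊙ φ) ≟ʳ (φ ⊙ C)

    Intertwines-cong : ∀ {n} {g g' : Rect n n} {φ φ' : Rect n d} → g ≈ʳ g' → φ ≈ʳ φ' → Intertwines g φ → Intertwines g' φ'
    Intertwines-cong e e' p = ≈ʳ-trans (⊙-cong (≈ʳ-sym e) (≈ʳ-sym e')) (≈ʳ-trans p (⊙-congʳ C e'))

    int-cong : ∀ {n} {g g' : Rect n n} {φ φ' : Rect n d} → g ≈ʳ g' → φ ≈ʳ φ' → ⟦ int? g φ ⟧ ≡ ⟦ int? g' φ' ⟧
    int-cong {g = g} {g'} {φ} {φ'} e e' = ⟦⟧-⇔ (int? g φ) (int? g' φ') (Intertwines-cong e e') (Intertwines-cong (≈ʳ-sym e) (≈ʳ-sym e'))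

    nonzero? : ∀ {n} (φ : Rect n d) → Dec (¬ (φ ≈ʳ 0ʳ))
    nonzero? φ = ¬? (φ ≟ʳ 0ʳ)

    -- `H` is the number of F[x]-module homomorphisms from C to g, zero included, which behaves well
    -- under extensions; `N` omits zero and is the quantity with mean 1.
    H N : ∀ {n} → Rect n n → ℕ
    H g = ∑ʳ (λ φ → ⟦ int? g φ ⟧)
    N g = ∑ʳ (λ φ → ⟦ nonzero? φ ⟧ ℕ.* ⟦ int? g φ ⟧)

    H≡1+N : ∀ {n} (g : Rect n n) → H g ≡ 1 ℕ.+ N g
    H≡1+N {n} g = ≡.trans (∑-cong φs (λ φ → ≡.trans (≡.sym (≡.trans (≡.cong (ℕ._* ⟦ int? g φ ⟧) (⟦⟧-¬ (φ ≟ʳ 0ʳ))) (ℕP.*-identityˡ _)))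
          (ℕP.*-distribʳ-+ ⟦ int? g φ ⟧ ⟦ φ ≟ʳ 0ʳ ⟧ ⟦ nonzero? φ ⟧)))
        (≡.trans (∑-+ φs (λ φ → ⟦ φ ≟ʳ 0ʳ ⟧ ℕ.* ⟦ int? g φ ⟧) _) (≡.cong (ℕ._+ N g) (≡.trans (∑-pick (RectF n d) 0ʳ (λ φ → ⟦ int? g φ ⟧) (int-cong (≈ʳ-refl {g = g})))
          (⟦⟧-yes (int? g 0ʳ) (λ i j → trans (Σ-zero n (λ l → zeroʳ _)) (sym (Σ-zero d (λ l → zeroˡ _))))))))
      where φs = Finite.list (RectF n d)

    N-cong : ∀ {n} {g g' : Rect n n} → g ≈ʳ g' → N g ≡ N g'
    N-cong {n} e = ∑-cong (Finite.list (RectF n d)) (λ φ → ≡.cong (⟦ nonzero? φ ⟧ ℕ.*_) (int-cong e ≈ʳ-refl))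

    conj-int : ∀ {n} {B B' : Rect n n} → Inverses B B' → ∀ g (φ : Rect n d) → ⟦ int? (conj B B' g) (B ⊙ φ) ⟧ ≡ ⟦ int? g φ ⟧
    conj-int {B = B} {B'} p g φ = ⟦⟧-⇔ (int? (conj B B' g) (B ⊙ φ)) (int? g φ)
      (λ r → ≈ʳ-trans (≈ʳ-sym (cancelˡ p (g ⊙ φ))) (≈ʳ-trans (⊙-congˡ B' (≈ʳ-trans (≈ʳ-sym lhs) (≈ʳ-trans r (⊙-assoc B φ C)))) (cancelˡ p (φ ⊙ C))))
      (λ r → ≈ʳ-trans lhs (≈ʳ-trans (⊙-congˡ B r) (≈ʳ-sym (⊙-assoc B φ C))))
      where
      lhs : conj B B' g ⊙ (B ⊙ φ) ≈ʳ B ⊙ (g ⊙ φ)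
      lhs = ≈ʳ-trans (⊙-assoc B (g ⊙ B') (B ⊙ φ)) (⊙-congˡ B (≈ʳ-trans (⊙-assoc g B' (B ⊙ φ)) (⊙-congˡ g (cancelˡ p φ))))

    N-conj : ∀ {n} {B B' : Rect n n} → Inverses B B' → ∀ g → N (conj B B' g) ≡ N g
    N-conj {n} {B} {B'} p g = ≡.trans (∑-leftmul p (λ φ → ⟦ nonzero? φ ⟧ ℕ.* ⟦ int? (conj B B' g) φ ⟧)
        (λ {φ} {φ'} e → ≡.cong₂ ℕ._*_ (⟦⟧-⇔ (nonzero? φ) (nonzero? φ') (λ n z → n (≈ʳ-trans e z)) (λ n z → n (≈ʳ-trans (≈ʳ-sym e) z))) (int-cong (≈ʳ-refl {g = conj B B' g}) e)))
      (∑-cong (Finite.list (RectF n d)) (λ φ → ≡.cong₂ ℕ._*_ (⟦⟧-⇔ (nonzero? (B ⊙ φ)) (nonzero? φ)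
          (λ n z → n (λ i j → trans (⊙-congˡ B z i j) (·ᵥ-zero B (λ _ → refl) i)))
          (λ n z → n (≈ʳ-trans (≈ʳ-sym (cancelˡ p φ)) (λ i j → trans (⊙-congˡ B' z i j) (·ᵥ-zero B' (λ _ → refl) i))))) (conj-int p g φ)))

    module FirstMoment (1≤d : 1 ≤ d) (C-inv : Invertible C)
      (simple : ∀ {n} (g : Rect n n) (φ : Rect n d) → Intertwines g φ → ¬ (φ ≈ʳ 0ʳ) → Injective φ) where

      -- A nonzero intertwiner φ is injective, hence φ = B E with B invertible, and conjugation by B
      -- turns g φ = φ C into g E = E C. So every φ contributes the same sum S₀, taken over block
      -- matrices.
      first-moment : ∀ m (f : Rect (m ℕ.+ d) (m ℕ.+ d) → ℕ) → (∀ {g h} → g ≈ʳ h → f g ≡ f h) →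
        (∀ {B B'} → Inverses B B' → ∀ g → f (conj B B' g) ≡ f g) →
        ∑ʳ (λ g → ⟦ inv? g ⟧ ℕ.* f g ℕ.* N g) ≡ κ m d ℕ.* ∑ʳ (λ (D : Rect m m) → ⟦ inv? D ⟧ ℕ.* ∑ʳ (λ (Y : Rect d m) → f (block D Y C)))
      first-moment m f f-cong f-conj = begin
        ∑ gs (λ g → w g ℕ.* N g)                                            ≡⟨ ∑-cong gs (λ g → ≡.sym (∑-*ˡ φs (w g) (λ φ → ⟦ nonzero? φ ⟧ ℕ.* ⟦ int? g φ ⟧))) ⟩
        ∑ gs (λ g → ∑ φs (λ φ → w g ℕ.* (⟦ nonzero? φ ⟧ ℕ.* ⟦ int? g φ ⟧)))   ≡⟨ ∑-swap gs φs _ ⟩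
        ∑ φs (λ φ → ∑ gs (λ g → w g ℕ.* (⟦ nonzero? φ ⟧ ℕ.* ⟦ int? g φ ⟧)))   ≡⟨ ∑-cong φs per-φ ⟩
        ∑ φs (λ φ → ⟦ extends? {m} φ ⟧ ℕ.* S₀)                              ≡⟨ ∑-*ʳ φs S₀ (λ φ → ⟦ extends? {m} φ ⟧) ⟩
        κ m d ℕ.* S₀                                                        ≡⟨ ≡.cong (κ m d ℕ.*_) S₀≡ ⟩
        κ m d ℕ.* ∑ Ds (λ D → ⟦ inv? D ⟧ ℕ.* ∑ Ys (λ Y → f (block D Y C)))  ∎
        where
        open ≡.≡-Reasoning
        n = m ℕ.+ d
        gs = Finite.list (RectF n n)
        φs = Finite.list (RectF n d)
        Ds = Finite.list (RectF m m)
        Ys = Finite.list (RectF d m)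
        w : Rect n n → ℕ
        w g = ⟦ inv? g ⟧ ℕ.* f g
        w-cong : ∀ {g h} → g ≈ʳ h → w g ≡ w h
        w-cong e = ≡.cong₂ ℕ._*_ (inv-cong e) (f-cong e)
        S₀ = ∑ gs (λ g → ⟦ fixes? {m} C g ⟧ ℕ.* w g)
        S₀≡ : S₀ ≡ ∑ Ds (λ D → ⟦ inv? D ⟧ ℕ.* ∑ Ys (λ Y → f (block D Y C)))
        S₀≡ = ≡.trans (∑-fixes {m} {d} C w w-cong) (∑-cong Ds (λ D → ≡.trans
          (∑-cong Ys (λ Y → ≡.cong (ℕ._* f (block D Y C)) (inv-block D Y C C-inv))) (∑-*ˡ Ys ⟦ inv? D ⟧ (λ Y → f (block D Y C)))))
        per-φ : ∀ φ → ∑ gs (λ g → w g ℕ.* (⟦ nonzero? φ ⟧ ℕ.* ⟦ int? g φ ⟧)) ≡ ⟦ extends? {m} φ ⟧ ℕ.* S₀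
        per-φ φ = ⟦⟧-select (extends? {m} φ) (extended φ) (λ ¬ext → ≡.trans (∑-cong gs (λ g → ≡.trans (≡.cong (w g ℕ.*_)
            (⟦⟧-disjoint (nonzero? φ) (int? g φ) (λ φ≉0 e → ¬ext (injective⇒extends {m} φ (simple g φ e φ≉0))))) (ℕP.*-zeroʳ (w g)))) (∑-0 gs))
          where
          extended : ∀ φ → Extends {m} φ → ∑ gs (λ g → w g ℕ.* (⟦ nonzero? φ ⟧ ℕ.* ⟦ int? g φ ⟧)) ≡ S₀
          extended φ (B , (B' , p) , e) = ≡.trans (∑-conj p (λ g → w g ℕ.* (⟦ nonzero? φ ⟧ ℕ.* ⟦ int? g φ ⟧))
                (λ {g} {h} e → ≡.cong₂ ℕ._*_ (w-cong e) (≡.cong (⟦ nonzero? φ ⟧ ℕ.*_) (int-cong e (≈ʳ-refl {g = φ})))))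
              (∑-cong gs term)
            where
            E≉0 : Fin d → ¬ (E {m} {d} ≈ʳ 0ʳ)
            E≉0 j z = 0≉1 (trans (sym (z (m ↑ʳ j) j)) (trans (I-↑ʳ m j j) (I-diag j)))
            φ≉0 : ¬ (φ ≈ʳ 0ʳ)
            φ≉0 z = E≉0 (fromℕ< 1≤d) (≈ʳ-trans (≈ʳ-sym (cancelˡ p (E {m}))) (≈ʳ-trans (⊙-congˡ B' (≈ʳ-trans (≈ʳ-sym e) z)) (λ i j → ·ᵥ-zero B' {λ _ → 0#} (λ _ → refl) i)))
            term : ∀ g → w (conj B B' g) ℕ.* (⟦ nonzero? φ ⟧ ℕ.* ⟦ int? (conj B B' g) φ ⟧) ≡ ⟦ fixes? {m} C g ⟧ ℕ.* w g
            term g = ≡.trans (≡.cong₂ ℕ._*_ (≡.cong₂ ℕ._*_ (inv-conj p g) (f-conj p g)) (≡.trans (≡.cong₂ ℕ._*_ (⟦⟧-yes (nonzero? φ) φ≉0)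
                (≡.trans (int-cong (≈ʳ-refl {g = conj B B' g}) e) (conj-int p g (E {m})))) (ℕP.*-identityˡ _)))
              (ℕP.*-comm (w g) _)

      -- A random g has one embedding of the block C on average.
      mean : ∀ m → ∑ʳ {m ℕ.+ d} {m ℕ.+ d} (λ g → ⟦ inv? g ⟧ ℕ.* N g) ≡ γ (m ℕ.+ d)
      mean m = ≡.trans (∑-cong (Finite.list (RectF (m ℕ.+ d) (m ℕ.+ d))) (λ g → ≡.cong (ℕ._* N g) (≡.sym (ℕP.*-identityʳ ⟦ inv? g ⟧))))
        (≡.trans (first-moment m (λ _ → 1) (λ _ → ≡.refl) (λ _ _ → ≡.refl))
        (≡.trans (≡.cong (κ m d ℕ.*_) (≡.trans (∑-cong (Finite.list (RectF m m)) (λ D → ≡.trans (≡.cong (⟦ inv? D ⟧ ℕ.*_) (≡.sym (card-∑ (RectF d m)))) (ℕP.*-comm _ (ρ m d))))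
            (∑-*ˡ (Finite.list (RectF m m)) (ρ m d) (λ D → ⟦ inv? D ⟧)))) (≡.sym (γ-split m d))))

      -- For n < d no n × d matrix is injective and the mean is 0. The bound thus covers whatever
      -- size the complementary block has in the second moment.
      mean-≤ : ∀ n → ∑ʳ {n} {n} (λ g → ⟦ inv? g ⟧ ℕ.* N g) ≤ γ n
      mean-≤ n = [ (λ d≤n → ℕP.≤-reflexive (≡.subst (λ z → ∑ʳ {z} {z} (λ g → ⟦ inv? g ⟧ ℕ.* N g) ≡ γ z) (ℕP.m∸n+n≡m d≤n) (mean (n ℕ.∸ d)))) ,
          (λ n<d → ℕP.≤-trans (ℕP.≤-reflexive (≡.trans (∑-cong (Finite.list (RectF n n)) (λ g → ≡.trans (≡.cong (⟦ inv? g ⟧ ℕ.*_) (none n<d g)) (ℕP.*-zeroʳ ⟦ inv? g ⟧))) (∑-0 (Finite.list (RectF n n))))) z≤n) ]′ (ℕP.≤-<-connex d n)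
        where
        impossible : n < d → ∀ g (φ : Rect n d) → ¬ (φ ≈ʳ 0ʳ) → ¬ Intertwines g φ
        impossible n<d g φ φ≉0 e = ℕP.<⇒≱ (ℕP.^-monoʳ-< q q≥2 n<d) (≡.subst₂ _≤_ (card-⇒ d finite) (card-⇒ n finite)
          (card-inj (d ⇒ finite) (n ⇒ finite) (φ ·ᵥ_) (injective-cancel φ (simple g φ e φ≉0))))
        none : n < d → ∀ g → N g ≡ 0
        none n<d g = ≡.trans (∑-cong (Finite.list (RectF n d)) (λ φ → ⟦⟧-disjoint (nonzero? φ) (int? g φ) (impossible n<d g φ))) (∑-0 (Finite.list (RectF n d)))

  module _ {d' : ℕ} (C' : Rect d' d') where
    open Counts C'

    -- Left exactness of Hom(C', -). The upper part of an intertwiner intertwines C' with D; for a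
    -- given upper part the lower parts are either absent or a coset of Hom(C', C).
    H-block : ∀ {m d} (D : Rect m m) (Y : Rect d m) (C : Rect d d) → H (block D Y C) ≤ H D ℕ.* H C
    H-block {m} {d} D Y C = begin
      H (block D Y C)                                                      ≡⟨ ∑-stack {m} {d} (λ φ → ⟦ int? (block D Y C) φ ⟧) (int-cong (≈ʳ-refl {g = block D Y C})) ⟩
      ∑ us (λ u → ∑ ws (λ w → ⟦ int? (block D Y C) (stack u w) ⟧))         ≤⟨ ∑-≤ us per-u ⟩
      ∑ us (λ u → ⟦ int? D u ⟧ ℕ.* H C)                                    ≡⟨ ∑-*ʳ us (H C) (λ u → ⟦ int? D u ⟧) ⟩
      H D ℕ.* H C                                                          ∎
      where
      open ℕP.≤-Reasoning
      us = Finite.list (RectF m d')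
      ws = Finite.list (RectF d d')
      Bottom : Rect m d' → Rect d d' → Set
      Bottom u w = (λ i j → (Y ⊙ u) i j + (C ⊙ w) i j) ≈ʳ w ⊙ C'
      bottom? : ∀ u w → Dec (Bottom u w)
      bottom? u w = (λ i j → (Y ⊙ u) i j + (C ⊙ w) i j) ≟ʳ (w ⊙ C')
      bottom-cong : ∀ u {w w'} → w ≈ʳ w' → Bottom u w → Bottom u w'
      bottom-cong u {w} {w'} e p i j = trans (+-congˡ (⊙-congˡ C (≈ʳ-sym e) i j)) (trans (p i j) (⊙-congʳ C' e i j))
      stack⊙ : ∀ u w → stack u w ⊙ C' ≈ʳ stack (u ⊙ C') (w ⊙ C')
      stack⊙ u w i j = Fin-cases m {d} (λ i → (stack u w ⊙ C') i j ≈ stack (u ⊙ C') (w ⊙ C') i j)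
        (λ i → trans (Σ-cong d' (λ l → *-congʳ (stack-↑ˡ u w i l))) (sym (stack-↑ˡ (u ⊙ C') (w ⊙ C') i j)))
        (λ i → trans (Σ-cong d' (λ l → *-congʳ (stack-↑ʳ u w i l))) (sym (stack-↑ʳ (u ⊙ C') (w ⊙ C') i j))) i
      parts : ∀ u w → Intertwines (block D Y C) (stack u w) → Intertwines D u × Bottom u w
      parts u w e = (λ i j → trans (⊙-congˡ D (λ i j → sym (stack-↑ˡ u w i j)) i j) (trans (sym (proj₁ (block-⊙ D Y C (stack u w)) i j))
                      (trans (e (i ↑ˡ d) j) (trans (stack⊙ u w (i ↑ˡ d) j) (stack-↑ˡ (u ⊙ C') (w ⊙ C') i j))))) ,
                    (λ i j → trans (+-cong (⊙-congˡ Y (λ i j → sym (stack-↑ˡ u w i j)) i j) (⊙-congˡ C (λ i j → sym (stack-↑ʳ u w i j)) i j))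
                      (trans (sym (proj₂ (block-⊙ D Y C (stack u w)) i j)) (trans (e (m ↑ʳ i) j) (trans (stack⊙ u w (m ↑ʳ i) j) (stack-↑ʳ (u ⊙ C') (w ⊙ C') i j)))))
      bottoms : ∀ u → ∑ ws (λ w → ⟦ bottom? u w ⟧) ≤ H C
      bottoms u = go (Finite.search (RectF d d') (bottom? u) (bottom-cong u))
        where
        go : Dec (∃ (Bottom u)) → ∑ ws (λ w → ⟦ bottom? u w ⟧) ≤ H C
        go (no none) = ℕP.≤-trans (ℕP.≤-reflexive (≡.trans (∑-cong ws (λ w → ⟦⟧-no (bottom? u w) (λ b → none (w , b)))) (∑-0 ws))) z≤n
        go (yes (w₀ , p₀)) = ℕP.≤-reflexive (≡.trans
            (∑-reindex (RectF d d') (RectF d d') (λ ψ i j → ψ i j + w₀ i j) (λ w i j → w i j - w₀ i j)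
              (λ {ψ} {w} e i j → trans (solve 2 (λ w t → w := (w :- t) :+ t) refl (w i j) (w₀ i j)) (+-congʳ (sym (e i j))))
              (λ {ψ} {w} e i j → trans (solve 2 (λ s t → s := (s :+ t) :- t) refl (ψ i j) (w₀ i j)) (+-congʳ (sym (e i j))))
              (λ w → ⟦ bottom? u w ⟧) (λ {w} {w'} e → ⟦⟧-⇔ (bottom? u w) (bottom? u w') (bottom-cong u e) (bottom-cong u (≈ʳ-sym e))))
            (∑-cong ws (λ ψ → ⟦⟧-⇔ (bottom? u (shifted ψ)) (int? C ψ)
              (λ p i j → cancel (trans (sym (C⊙ ψ i j)) (trans (p i j) (⊙C' ψ i j))))
              (λ p i j → trans (C⊙ ψ i j) (trans (+-cong (p i j) (p₀ i j)) (sym (⊙C' ψ i j)))))))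
          where
          shifted : Rect d d' → Rect d d'
          shifted ψ i j = ψ i j + w₀ i j
          C⊙ : ∀ ψ i j → (Y ⊙ u) i j + (C ⊙ shifted ψ) i j ≈ (C ⊙ ψ) i j + ((Y ⊙ u) i j + (C ⊙ w₀) i j)
          C⊙ ψ i j = trans (+-congˡ (trans (Σ-cong d (λ l → distribˡ _ _ _)) (Σ-+ d (λ l → C i l * ψ l j) (λ l → C i l * w₀ l j))))
            (solve 3 (λ a b c → a :+ (b :+ c) := b :+ (a :+ c)) refl ((Y ⊙ u) i j) ((C ⊙ ψ) i j) ((C ⊙ w₀) i j))
          ⊙C' : ∀ ψ i j → (shifted ψ ⊙ C') i j ≈ (ψ ⊙ C') i j + (w₀ ⊙ C') i j
          ⊙C' ψ i j = trans (Σ-cong d' (λ l → distribʳ _ _ _)) (Σ-+ d' (λ l → ψ i l * C' l j) (λ l → w₀ i l * C' l j))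
          cancel : ∀ {i j} {x y} → x + ((Y ⊙ u) i j + (C ⊙ w₀) i j) ≈ y + (w₀ ⊙ C') i j → x ≈ y
          cancel {i} {j} {x} {y} e = trans (solve 2 (λ x t → x := (x :+ t) :- t) refl x ((w₀ ⊙ C') i j))
            (trans (+-congʳ (trans (+-congˡ (sym (p₀ i j))) e)) (solve 2 (λ y t → (y :+ t) :- t := y) refl y ((w₀ ⊙ C') i j)))
      per-u : ∀ u → ∑ ws (λ w → ⟦ int? (block D Y C) (stack u w) ⟧) ≤ ⟦ int? D u ⟧ ℕ.* H C
      per-u u = ⟦⟧-select-≤ (int? D u)
        (λ _ → ℕP.≤-trans (∑-≤ ws (λ w → ⟦⟧-mono (int? (block D Y C) (stack u w)) (bottom? u w) (λ e → proj₂ (parts u w e)))) (bottoms u))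
        (λ ¬i → ≡.trans (∑-cong ws (λ w → ⟦⟧-no (int? (block D Y C) (stack u w)) (λ e → ¬i (proj₁ (parts u w e))))) (∑-0 ws))

  private
    e₀ : ∀ {n} (v : Fin (suc n) → Carrier) → Fin (suc n) → Carrier
    e₀ v = const v 1#

    rem-∷ : ∀ {n} (v : Fin (suc n) → Carrier) a u z i → rem v ((a ∷ u) ⊛ z) i ≈ a * rem v z i + step v (rem v (u ⊛ z)) i
    rem-∷ v a u z i = trans (D.rem-⊕ (a · z) (0# ∷ (u ⊛ z)) i) (+-cong (D.rem-· a z i) (D.rem-shift (u ⊛ z) i))
      where module D = Division v

    step-intertwines : ∀ {n n'} (v : Fin (suc n') → Carrier) (g : Rect n n) (φ : Rect n (suc n')) → g ⊙ φ ≈ʳ φ ⊙ companion v →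
      ∀ r i → (φ ·ᵥ step v r) i ≈ (g ·ᵥ (φ ·ᵥ r)) i
    step-intertwines {n} {n'} v g φ e r i = trans (·ᵥ-cong φ (λ l → sym (companion-·ᵥ v r l)) i) (trans (sym (·ᵥ-assoc φ (companion v) r i))
      (trans (Σ-cong (suc n') (λ l → *-congʳ {r l} (sym (e i l)))) (·ᵥ-assoc g φ r i)))

    unit-columns : ∀ {n d} (φ : Rect n d) → (∀ r i → (φ ·ᵥ r) i ≈ 0#) → φ ≈ʳ 0ʳ
    unit-columns {d = d} φ z i j = trans (sym (Σ-Iʳ d j (φ i))) (z (λ l → I l j) i)

  -- Schur's lemma: the kernel of φ is closed under multiplication by x, so it is an ideal of the
  -- field F[x]/P, and one nonzero kernel vector forces φ = 0.
  simple : ∀ P {n} (g : Rect n n) (φ : Rect n (deg P)) → g ⊙ φ ≈ʳ φ ⊙ companion (lower P) → ¬ (φ ≈ʳ 0ʳ) → Injective φ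
  simple P {n} g φ e φ≉0 w φw≈0 = decidable-stable (FinP.all? (λ i → w i ≟F 0#)) (λ w≉0 → φ≉0 (unit-columns φ (all-zero w≉0)))
    where
    v = lower P
    open Division v
    module K = CommutativeRing quotient
    open RingTools quotient using () renaming (solve to solveᴷ; _:=_ to _:=ᴷ_; _:*_ to _:*ᴷ_)
    Ker : (Fin (deg P) → Carrier) → Set
    Ker r = ∀ i → (φ ·ᵥ r) i ≈ 0#
    ker-step : ∀ r → Ker r → Ker (step v r)
    ker-step r k i = trans (step-intertwines v g φ e r i) (·ᵥ-zero g k i)
    ker-multiple : ∀ u z → Ker (rem v z) → Ker (rem v (u ⊛ z))
    ker-multiple []      z k i = ·ᵥ-zero φ {λ _ → 0#} (λ _ → refl) i
    ker-multiple (a ∷ u) z k i = trans (·ᵥ-cong φ (rem-∷ v a u z) i) (trans (·ᵥ-linear φ a (rem v z) (step v (rem v (u ⊛ z))) i)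
      (trans (+-cong (trans (*-congˡ (k i)) (zeroʳ a)) (ker-step (rem v (u ⊛ z)) (ker-multiple u z k) i)) (+-identityˡ _)))
    all-zero : ¬ (∀ i → w i ≈ 0#) → ∀ r i → (φ ·ᵥ r) i ≈ 0#
    all-zero w≉0 r i = trans (·ᵥ-cong φ (λ l → sym (trans (on reach l) (rem-lst r l))) i)
      (ker-multiple (lst r ⊛ u') (lst w) (λ i → trans (·ᵥ-cong φ (rem-lst w) i) (φw≈0 i)) i)
      where
      inv : ∃ λ u' → lst w ⊛ u' ≃ one
      inv = invert v (irr P) (lst w) (λ z → w≉0 (λ i → trans (sym (rem-lst w i)) (on z i)))
      u' = proj₁ inv
      reach : ((lst r ⊛ u') ⊛ lst w) ≃ lst r
      reach = K.trans (solveᴷ 3 (λ r u w → (r :*ᴷ u) :*ᴷ w :=ᴷ r :*ᴷ (w :*ᴷ u)) K.refl (lst r) u' (lst w))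
        (K.trans (K.*-congˡ {lst r} (proj₂ inv)) (K.*-identityʳ (lst r)))

  -- Multiplication by X is injective on the field F[X]/P; the degree condition excludes P = X, for
  -- which it would be zero.
  companion-invertible : ∀ P → 2 ≤ deg P → Invertible (companion (lower P))
  companion-invertible P 2≤d = injective⇒invertible (companion v) λ w e → conclude w e
    where
    v = lower P
    open Division v
    module K = CommutativeRing quotient
    X≄0 : ¬ (X ≃ [])
    X≄0 z = ¬∣-small P X (λ { (suc (suc i)) _ → refl ; (suc zero) p → ⊥-elim (ℕP.<⇒≱ 2≤d p) ; zero () }) (λ e → 0≉1 (sym (at e 1))) (on z)
    conclude : ∀ w → (∀ i → (companion v ·ᵥ w) i ≈ 0#) → ∀ i → w i ≈ 0#
    conclude w e i = [ (λ z → ⊥-elim (X≄0 z)) , (λ z → trans (sym (rem-lst w i)) (on z i)) ]′ (FieldFacts.noZeroDivisors (field' P) {X} {lst w} (K.trans (≋⇒≃ (X⊛ (lst w))) (mk λ i →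
        trans (rem-shift (lst w) i) (trans (step-cong (rem-lst w) i) (trans (sym (companion-·ᵥ v w i)) (e i))))))

  module Pair (P P' : Irreducible) where
    private
      v = lower P
      v' = lower P'
      module D = Division v
      module D' = Division v'
    open Counts (companion v')

    private
      const-1 : ∀ a i → const v' a i ≈ a * e₀ v' i
      const-1 a zero    = sym (*-identityʳ a)
      const-1 a (suc i) = sym (zeroʳ a)

      image : Rect (deg P) (deg P') → Fin (deg P) → Carrier
      image φ = φ ·ᵥ e₀ v'

      -- An intertwiner is F[x]-linear, so φ(z) = z φ(1).
      determined : ∀ φ → Intertwines (companion v) φ → ∀ z i → (φ ·ᵥ rem v' z) i ≈ rem v (z ⊛ lst (image φ)) i
      determined φ e []      i = ·ᵥ-zero φ {λ _ → 0#} (λ _ → refl) i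
      determined φ e (a ∷ z) i = trans (·ᵥ-cong φ (λ l → +-congʳ {step v' (rem v' z) l} (const-1 a l)) i) (trans (·ᵥ-linear φ a (e₀ v') (step v' (rem v' z)) i)
        (trans (+-cong (*-congˡ (sym (D.rem-lst (image φ) i)))
          (trans (step-intertwines v' (companion v) φ e (rem v' z) i) (trans (·ᵥ-cong (companion v) (determined φ e z) i) (companion-·ᵥ v (rem v (z ⊛ lst (image φ))) i))))
          (sym (rem-∷ v a z (lst (image φ)) i))))

      apply : ∀ φ → Intertwines (companion v) φ → ∀ r i → (φ ·ᵥ r) i ≈ rem v (lst r ⊛ lst (image φ)) i
      apply φ e r i = trans (·ᵥ-cong φ (λ l → sym (D'.rem-lst r l)) i) (determined φ e (lst r) i)

    -- The evaluation φ ↦ φ(1) embeds the homomorphisms F[x]/P' → F[x]/P into F[x]/P.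
    H-companion-≤ : H (companion v) ≤ q ℕ.^ deg P
    H-companion-≤ = begin
      ∑ φs (λ φ → ⟦ int? (companion v) φ ⟧)                                               ≡⟨ ∑-cong φs (λ φ → ≡.sym (≡.trans (∑-*ˡ us ⟦ int? (companion v) φ ⟧ (λ u → ⟦ Finite._≟_ (Vec (deg P)) u (image φ) ⟧))
                                                                                              (≡.trans (≡.cong (⟦ int? (companion v) φ ⟧ ℕ.*_) (Finite.once (Vec (deg P)) (image φ))) (ℕP.*-identityʳ _)))) ⟩
      ∑ φs (λ φ → ∑ us (λ u → ⟦ int? (companion v) φ ⟧ ℕ.* ⟦ Finite._≟_ (Vec (deg P)) u (image φ) ⟧))  ≡⟨ ∑-swap φs us _ ⟩
      ∑ us (λ u → ∑ φs (λ φ → ⟦ int? (companion v) φ ⟧ ℕ.* ⟦ Finite._≟_ (Vec (deg P)) u (image φ) ⟧))  ≡⟨ ∑-cong us (λ u → ∑-cong φs (λ φ →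
                                                                                              ≡.sym (⟦⟧-× (int? (companion v) φ) (Finite._≟_ (Vec (deg P)) u (image φ)) (both? u φ) (λ r → r) _,_))) ⟩
      ∑ us (λ u → ∑ φs (λ φ → ⟦ both? u φ ⟧))                                             ≤⟨ ∑-≤ us (λ u → Finite.at-most-one (RectF (deg P) (deg P')) (both? u) (unique u)) ⟩
      ∑ us (λ _ → 1)                                                                      ≡⟨ ≡.trans (≡.sym (card-∑ (Vec (deg P)))) (card-⇒ (deg P) finite) ⟩
      q ℕ.^ deg P                                                                         ∎
      where
      open ℕP.≤-Reasoning
      φs = Finite.list (RectF (deg P) (deg P'))
      us = Finite.list (Vec (deg P))
      Both : (Fin (deg P) → Carrier) → Rect (deg P) (deg P') → Set
      Both u φ = Intertwines (companion v) φ × (∀ i → u i ≈ image φ i)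
      both? : ∀ u φ → Dec (Both u φ)
      both? u φ = int? (companion v) φ ×-dec Finite._≟_ (Vec (deg P)) u (image φ)
      unique : ∀ u {φ ψ} → Both u φ → Both u ψ → φ ≈ʳ ψ
      unique u {φ} {ψ} (e , i≈) (e' , i≈') a b = trans (sym (Σ-Iʳ (deg P') b (φ a))) (trans (trans (apply φ e r a)
          (trans (D.rem-cong (lst r ⊛ lst (image φ)) (lst r ⊛ lst (image ψ)) (⊛-congˡ (lst r) (lst-cong (λ i → trans (sym (i≈ i)) (i≈' i)))) a) (sym (apply ψ e' r a))))
          (Σ-Iʳ (deg P') b (ψ a)))
        where r = λ l → I l b

    -- P' annihilates the source, so P divides P' φ(1); as P does not divide P', φ(1) = 0.
    H-companion-distinct : ¬ (poly P' ≋ poly P) → H (companion v) ≡ 1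
    H-companion-distinct ne = ≡.trans (H≡1+N (companion v)) (≡.cong suc (≡.trans (∑-cong φs (λ φ → ⟦⟧-disjoint (nonzero? φ) (int? (companion v) φ) (λ φ≉0 e → φ≉0 (must-vanish φ e)))) (∑-0 φs)))
      where
      φs = Finite.list (RectF (deg P) (deg P'))
      must-vanish : ∀ φ → Intertwines (companion v) φ → φ ≈ʳ 0ʳ
      must-vanish φ e = [ (λ p → ⊥-elim (ne (irreducible-∣ P' P p))) ,
          (λ p → unit-columns φ (λ r i → trans (apply φ e r i) (D.rem-⊛-zero (lst r) {lst (image φ)} p i))) ]′
        (∣-⊛ P (poly P') (lst (image φ)) (λ i → trans (sym (determined φ e (poly P') i)) (·ᵥ-zero φ D'.rem-monic i)))

  embeddings : Irreducible → ∀ {n} → Rect n n → ℕ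
  embeddings P = Counts.N (companion (lower P))

  module SecondMoment (P P' : Irreducible) (2≤d : 2 ≤ deg P) (2≤d' : 2 ≤ deg P') where
    private
      C = companion (lower P)
      C' = companion (lower P')
      module N = Counts C
      module N' = Counts C'
      module FM = N.FirstMoment (ℕP.≤-trans (s≤s z≤n) 2≤d) (companion-invertible P 2≤d) (simple P)
      module FM' = N'.FirstMoment (ℕP.≤-trans (s≤s z≤n) 2≤d') (companion-invertible P' 2≤d') (simple P')

      -- Weighting by N_P turns g into a block matrix with corner C and complementary block D
      -- uniform in GL_m. There N_P' is at most b N_P'(D) + b', and N_P'(D) has mean at most 1.
      bounded : ∀ m b b' → (∀ (D : Rect m m) Y → N'.N (block D Y C) ≤ b ℕ.* N'.N D ℕ.+ b') →
        ∑ʳ {m ℕ.+ deg P} {m ℕ.+ deg P} (λ g → ⟦ inv? g ⟧ ℕ.* N'.N g ℕ.* N.N g) ≤ γ (m ℕ.+ deg P) ℕ.* (b ℕ.+ b')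
      bounded m b b' bound = begin
        ∑ʳ {m ℕ.+ deg P} {m ℕ.+ deg P} (λ g → ⟦ inv? g ⟧ ℕ.* N'.N g ℕ.* N.N g)      ≡⟨ FM.first-moment m N'.N N'.N-cong N'.N-conj ⟩
        k ℕ.* ∑ Ds (λ D → ⟦ inv? D ⟧ ℕ.* ∑ Ys (λ Y → N'.N (block D Y C)))           ≤⟨ ℕP.*-monoʳ-≤ k (∑-≤ Ds (λ D → ℕP.*-monoʳ-≤ ⟦ inv? D ⟧
                                                                                        (ℕP.≤-trans (∑-≤ Ys (bound D)) (ℕP.≤-reflexive (∑-const Ys (b ℕ.* N'.N D ℕ.+ b')))))) ⟩
        k ℕ.* ∑ Ds (λ D → ⟦ inv? D ⟧ ℕ.* (r ℕ.* (b ℕ.* N'.N D ℕ.+ b')))             ≡⟨ ≡.cong (k ℕ.*_) (≡.trans (∑-cong Ds (λ D → arith ⟦ inv? D ⟧ (N'.N D)))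
                                                                                        (≡.trans (∑-*ˡ Ds r _) (≡.cong (r ℕ.*_) (≡.trans (∑-+ Ds (λ D → b ℕ.* (⟦ inv? D ⟧ ℕ.* N'.N D)) (λ D → b' ℕ.* ⟦ inv? D ⟧))
                                                                                          (≡.cong₂ ℕ._+_ (∑-*ˡ Ds b (λ D → ⟦ inv? D ⟧ ℕ.* N'.N D)) (∑-*ˡ Ds b' (λ D → ⟦ inv? D ⟧))))))) ⟩
        k ℕ.* (r ℕ.* (b ℕ.* ∑ Ds (λ D → ⟦ inv? D ⟧ ℕ.* N'.N D) ℕ.+ b' ℕ.* γ m))     ≤⟨ ℕP.*-monoʳ-≤ k (ℕP.*-monoʳ-≤ r (ℕP.+-monoˡ-≤ (b' ℕ.* γ m) (ℕP.*-monoʳ-≤ b (FM'.mean-≤ m)))) ⟩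
        k ℕ.* (r ℕ.* (b ℕ.* γ m ℕ.+ b' ℕ.* γ m))                                    ≡⟨ solveℕ 5 (λ k r b b' g → k :*ℕ (r :*ℕ (b :*ℕ g :+ℕ b' :*ℕ g)) :=ℕ k :*ℕ (r :*ℕ g) :*ℕ (b :+ℕ b')) ≡.refl k r b b' (γ m) ⟩
        k ℕ.* (r ℕ.* γ m) ℕ.* (b ℕ.+ b')                                            ≡⟨ ≡.cong (ℕ._* (b ℕ.+ b')) (≡.sym (γ-split m (deg P))) ⟩
        γ (m ℕ.+ deg P) ℕ.* (b ℕ.+ b')                                              ∎
        where
        open ℕP.≤-Reasoning
        open +-*-Solver using () renaming (solve to solveℕ; _:*_ to _:*ℕ_; _:+_ to _:+ℕ_; _:=_ to _:=ℕ_)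
        k = κ m (deg P)
        r = ρ m (deg P)
        Ds = Finite.list (RectF m m)
        Ys = Finite.list (RectF (deg P) m)
        arith : ∀ i x → i ℕ.* (r ℕ.* (b ℕ.* x ℕ.+ b')) ≡ r ℕ.* (b ℕ.* (i ℕ.* x) ℕ.+ b' ℕ.* i)
        arith i x = solveℕ 5 (λ i r b x b' → i :*ℕ (r :*ℕ (b :*ℕ x :+ℕ b')) :=ℕ r :*ℕ (b :*ℕ (i :*ℕ x) :+ℕ b' :*ℕ i)) ≡.refl i r b x b'

    private
      total : ℕ → ℕ
      total m = ∑ʳ {m ℕ.+ deg P} {m ℕ.+ deg P} (λ g → ⟦ inv? g ⟧ ℕ.* N'.N g ℕ.* N.N g)

    -- Hom(C', C) has at most q^(deg P) elements, so N' of the block matrix is at most (1 + N' D)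
    -- q^(deg P).
    second-moment : ∀ m → ∑ʳ {m ℕ.+ deg P} {m ℕ.+ deg P} (λ g → ⟦ inv? g ⟧ ℕ.* embeddings P' g ℕ.* embeddings P g) ≤ γ (m ℕ.+ deg P) ℕ.* (2 ℕ.* q ℕ.^ deg P)
    second-moment m = ≡.subst (λ z → total m ≤ γ (m ℕ.+ deg P) ℕ.* z) (≡.cong (q ℕ.^ deg P ℕ.+_) (≡.sym (ℕP.+-identityʳ _)))
      (bounded m (q ℕ.^ deg P) (q ℕ.^ deg P) (λ D Y → ℕP.≤-trans (ℕP.≤-trans (ℕP.n≤1+n _) (ℕP.≤-reflexive (≡.sym (N'.H≡1+N (block D Y C)))))
        (ℕP.≤-trans (H-block C' D Y C) (ℕP.≤-trans (ℕP.*-mono-≤ (ℕP.≤-reflexive (N'.H≡1+N D)) (Pair.H-companion-≤ P P'))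
          (ℕP.≤-reflexive (≡.trans (ℕP.+-comm (q ℕ.^ deg P) _) (≡.cong (ℕ._+ q ℕ.^ deg P) (ℕP.*-comm (N'.N D) (q ℕ.^ deg P)))))))))

    -- Hom(C', C) = 0 gives N' of the block matrix at most N' D, whence b = 1 and b' = 0: the two
    -- counts are at most uncorrelated.
    second-moment-distinct : ¬ (poly P' ≋ poly P) → ∀ m →
      ∑ʳ {m ℕ.+ deg P} {m ℕ.+ deg P} (λ g → ⟦ inv? g ⟧ ℕ.* embeddings P' g ℕ.* embeddings P g) ≤ γ (m ℕ.+ deg P)
    second-moment-distinct ne m = ≡.subst (total m ≤_) (ℕP.*-identityʳ (γ (m ℕ.+ deg P)))
      (bounded m 1 0 (λ D Y → ℕP.≤-pred (ℕP.≤-trans (ℕP.≤-reflexive (≡.sym (N'.H≡1+N (block D Y C)))) (ℕP.≤-trans (H-block C' D Y C)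
        (ℕP.≤-reflexive (≡.trans (≡.cong₂ ℕ._*_ (N'.H≡1+N D) (Pair.H-companion-distinct P P' ne)) (≡.trans (ℕP.*-identityʳ _)
          (≡.cong suc (≡.sym (≡.trans (ℕP.+-identityʳ _) (ℕP.*-identityˡ _)))))))))))

-- The trace statistic under conjugation and on block matrices

module TraceStatistic (F : FiniteField) (k : ℕ) (a : ℕ → FiniteField.Carrier F) where
  open FiniteField F using (commRing; sum1to; I; _^ᴹ_; Tr; traceSum)
  open CommutativeRing commRing hiding (zero)
  open Matrices F
  open LinearGroup F
  open RingTools commRing

  ^ᴹ-cong : ∀ {n} {g h : Rect n n} → g ≈ʳ h → ∀ i → g ^ᴹ i ≈ʳ h ^ᴹ i
  ^ᴹ-cong e zero    = ≈ʳ-refl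
  ^ᴹ-cong e (suc i) = ⊙-cong e (^ᴹ-cong e i)

  sum1to-cong : ∀ n {f g : ℕ → Carrier} → (∀ i → f i ≈ g i) → sum1to n f ≈ sum1to n g
  sum1to-cong zero    e = refl
  sum1to-cong (suc n) e = +-cong (sum1to-cong n e) (e (suc n))

  sum1to-+ : ∀ n (f g : ℕ → Carrier) → sum1to n (λ i → f i + g i) ≈ sum1to n f + sum1to n g
  sum1to-+ zero    f g = sym (+-identityˡ _)
  sum1to-+ (suc n) f g = trans (+-congʳ (sum1to-+ n f g)) (solve 4 (λ a b c d → (a :+ b) :+ (c :+ d) := (a :+ c) :+ (b :+ d)) refl (sum1to n f) (sum1to n g) (f (suc n)) (g (suc n)))

  statistic : ∀ {n} → Rect n n → Carrier
  statistic = traceSum k a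

  statistic-cong : ∀ {n} {g h : Rect n n} → g ≈ʳ h → statistic g ≈ statistic h
  statistic-cong e = sum1to-cong k (λ i → *-congˡ (Tr-cong (^ᴹ-cong e i)))

  conj-^ : ∀ {n} {B B' : Rect n n} → Inverses B B' → ∀ g i → conj B B' g ^ᴹ i ≈ʳ conj B B' (g ^ᴹ i)
  conj-^ {B = B} {B'} p g zero    = ≈ʳ-sym (≈ʳ-trans (⊙-congˡ B (⊙-identityˡ B')) (proj₁ p))
  conj-^ {B = B} {B'} p g (suc i) = ≈ʳ-trans (⊙-congˡ (conj B B' g) (conj-^ p g i))
    (≈ʳ-trans (⊙-assoc B (g ⊙ B') (B ⊙ ((g ^ᴹ i) ⊙ B'))) (⊙-congˡ B (≈ʳ-trans (⊙-assoc g B' (B ⊙ ((g ^ᴹ i) ⊙ B')))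
      (≈ʳ-trans (⊙-congˡ g (cancelˡ p ((g ^ᴹ i) ⊙ B'))) (≈ʳ-sym (⊙-assoc g (g ^ᴹ i) B'))))))

  Tr-conj : ∀ {n} {B B' : Rect n n} → Inverses B B' → ∀ g → Tr (conj B B' g) ≈ Tr g
  Tr-conj {B = B} {B'} p g = trans (Tr-comm B (g ⊙ B')) (Tr-cong (≈ʳ-trans (⊙-assoc g B' B) (≈ʳ-trans (⊙-congˡ g (proj₂ p)) (⊙-identityʳ g))))

  statistic-conj : ∀ {n} {B B' : Rect n n} → Inverses B B' → ∀ g → statistic (conj B B' g) ≈ statistic g
  statistic-conj p g = sum1to-cong k (λ i → *-congˡ (trans (Tr-cong (conj-^ p g i)) (Tr-conj p (g ^ᴹ i))))

  module _ {m d : ℕ} (D : Rect m m) (Y : Rect d m) (C : Rect d d) where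
    block-tl : ∀ i j → block D Y C (i ↑ˡ d) (j ↑ˡ d) ≈ D i j
    block-tl i j = trans (left-beside (stack D Y) (stack 0ʳ C) (i ↑ˡ d) j) (stack-↑ˡ D Y i j)

    block-tr : ∀ i j → block D Y C (i ↑ˡ d) (m ↑ʳ j) ≈ 0#
    block-tr i j = trans (right-beside (stack D Y) (stack 0ʳ C) (i ↑ˡ d) j) (stack-↑ˡ {m} {d} 0ʳ C i j)

    block-bl : ∀ i j → block D Y C (m ↑ʳ i) (j ↑ˡ d) ≈ Y i j
    block-bl i j = trans (left-beside (stack D Y) (stack 0ʳ C) (m ↑ʳ i) j) (stack-↑ʳ D Y i j)

    block-br : ∀ i j → block D Y C (m ↑ʳ i) (m ↑ʳ j) ≈ C i j
    block-br i j = trans (right-beside (stack D Y) (stack 0ʳ C) (m ↑ʳ i) j) (stack-↑ʳ {m} {d} 0ʳ C i j)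

    block-≈ : (g : Rect (m ℕ.+ d) (m ℕ.+ d)) → (∀ i j → g (i ↑ˡ d) (j ↑ˡ d) ≈ D i j) → (∀ i j → g (i ↑ˡ d) (m ↑ʳ j) ≈ 0#) →
      (∀ i j → g (m ↑ʳ i) (j ↑ˡ d) ≈ Y i j) → (∀ i j → g (m ↑ʳ i) (m ↑ʳ j) ≈ C i j) → g ≈ʳ block D Y C
    block-≈ g tl tr bl br i j = Fin-cases m {d} (λ i → g i j ≈ block D Y C i j)
      (λ i → Fin-cases m {d} (λ j → g (i ↑ˡ d) j ≈ block D Y C (i ↑ˡ d) j) (λ j → trans (tl i j) (sym (block-tl i j))) (λ j → trans (tr i j) (sym (block-tr i j))) j)
      (λ i → Fin-cases m {d} (λ j → g (m ↑ʳ i) j ≈ block D Y C (m ↑ʳ i) j) (λ j → trans (bl i j) (sym (block-bl i j))) (λ j → trans (br i j) (sym (block-br i j))) j) i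

    Tr-block : Tr (block D Y C) ≈ Tr D + Tr C
    Tr-block = trans (Σ-split m d (λ i → block D Y C i i)) (+-cong (Σ-cong m (λ i → block-tl i i)) (Σ-cong d (λ i → block-br i i)))

  -- The off-diagonal block of the power is left existential, since only the diagonal blocks reach
  -- the trace.
  block-power : ∀ {m d} (D : Rect m m) (Y : Rect d m) (C : Rect d d) i → ∃ λ Y' → block D Y C ^ᴹ i ≈ʳ block (D ^ᴹ i) Y' (C ^ᴹ i)
  block-power {m} {d} D Y C zero = 0ʳ , block-≈ {m} {d} I 0ʳ I I (I-↑ˡ m) (λ i j → I-off (↑ˡ≢↑ʳ m i j)) (λ i j → I-off (λ e → ↑ˡ≢↑ʳ m j i (≡.sym e))) (I-↑ʳ m)
  block-power {m} {d} D Y C (suc i) with block-power D Y C i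
  ... | Y' , e = Y'' , ≈ʳ-trans (⊙-congˡ (block D Y C) e) (block-≈ (D ⊙ D') Y'' (C ⊙ C') (block D Y C ⊙ g')
      (λ a b → trans (proj₁ (block-⊙ D Y C g') a (b ↑ˡ d)) (Σ-cong m (λ l → *-congˡ (block-tl D' Y' C' l b))))
      (λ a b → trans (proj₁ (block-⊙ D Y C g') a (m ↑ʳ b)) (Σ-zero m (λ l → trans (*-congˡ (block-tr D' Y' C' l b)) (zeroʳ _))))
      (λ a b → trans (proj₂ (block-⊙ D Y C g') a (b ↑ˡ d)) (+-cong (Σ-cong m (λ l → *-congˡ (block-tl D' Y' C' l b))) (Σ-cong d (λ l → *-congˡ (block-bl D' Y' C' l b)))))
      (λ a b → trans (proj₂ (block-⊙ D Y C g') a (m ↑ʳ b)) (trans (+-cong (Σ-zero m (λ l → trans (*-congˡ (block-tr D' Y' C' l b)) (zeroʳ _)))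
        (Σ-cong d (λ l → *-congˡ (block-br D' Y' C' l b)))) (+-identityˡ _))))
    where
    D' = D ^ᴹ i
    C' = C ^ᴹ i
    g' = block D' Y' C'
    Y'' : Rect d m
    Y'' a b = (Y ⊙ D') a b + (C ⊙ Y') a b

  statistic-block : ∀ {m d} (D : Rect m m) (Y : Rect d m) (C : Rect d d) → statistic (block D Y C) ≈ statistic D + statistic C
  statistic-block D Y C = trans (sum1to-cong k (λ i → trans (*-congˡ (trans (Tr-cong (proj₂ (block-power D Y C i))) (Tr-block (D ^ᴹ i) (proj₁ (block-power D Y C i)) (C ^ᴹ i))))
    (distribˡ (a i) _ _))) (sum1to-+ k (λ i → a i * Tr (D ^ᴹ i)) (λ i → a i * Tr (C ^ᴹ i)))

-- Moments of the weighted sum over a range of degrees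

range : ℕ → List ℕ
range zero    = []
range (suc n) = n ∷ range n

range-< : ∀ n → All (_< n) (range n)
range-< zero    = []
range-< (suc n) = ℕP.≤-refl ∷ All.map ℕP.m≤n⇒m≤1+n (range-< n)

∑-range : ∀ n f → ∑ (range n) f ≡ sumTo n f
∑-range zero    f = ≡.refl
∑-range (suc n) f = ≡.trans (≡.cong (f n ℕ.+_) (∑-range n f)) (ℕP.+-comm (f n) _)

∑-cong-All : {A : Set} (xs : List A) {f g : A → ℕ} → All (λ x → f x ≡ g x) xs → ∑ xs f ≡ ∑ xs g
∑-cong-All []       []       = ≡.refl
∑-cong-All (x ∷ xs) (e ∷ es) = ≡.cong₂ ℕ._+_ e (∑-cong-All xs es)

∑-≤-All : {A : Set} (xs : List A) {f g : A → ℕ} → All (λ x → f x ≤ g x) xs → ∑ xs f ≤ ∑ xs g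
∑-≤-All []       []       = z≤n
∑-≤-All (x ∷ xs) (e ∷ es) = ℕP.+-mono-≤ e (∑-≤-All xs es)

range-unique : ∀ b n e → ∑ (range n) (λ t → ⟦ b ℕ.+ t ℕ.≟ e ⟧) ≤ 1
range-unique b n e = ∑-≤1 n
  where
  ∑-≤1 : ∀ n → ∑ (range n) (λ t → ⟦ b ℕ.+ t ℕ.≟ e ⟧) ≤ 1
  ∑-≤1 zero    = z≤n
  ∑-≤1 (suc n) = go (b ℕ.+ n ℕ.≟ e)
    where
    go : (d : Dec (b ℕ.+ n ≡ e)) → ⟦ d ⟧ ℕ.+ ∑ (range n) (λ t → ⟦ b ℕ.+ t ℕ.≟ e ⟧) ≤ 1
    go (no _)  = ∑-≤1 n
    go (yes p) = ℕP.≤-reflexive (≡.cong suc (≡.trans (∑-cong-All (range n) (All.map (λ {t} t<n →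
      ⟦⟧-no (b ℕ.+ t ℕ.≟ e) (λ p' → ℕP.<⇒≢ t<n (ℕP.+-cancelˡ-≡ b _ _ (≡.trans p' (≡.sym p))))) (range-< n))) (∑-0 (range n))))

module Variance (F : FiniteField) (k : ℕ) (a : ℕ → FiniteField.Carrier F) (n b R : ℕ) (1≤b : 1 ≤ b) (b+R≤n : b ℕ.+ R ≤ n) where
  open FiniteField F using (commRing) renaming (card to q; _≟_ to _≟F_)
  open CommutativeRing commRing hiding (zero)
  open Matrices F
  open LinearGroup F
  open Poly commRing using (monic; _≋_; coeff-monic; at)
  open Factorisation F
  open PrimeCount F
  open Companion F
  open Intertwiners F
  open TraceStatistic F k a

  Index : Set
  Index = ∃ λ d → Fin (suc d) → Carrier

  private
    vecs : ∀ d → List (Fin (suc d) → Carrier)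
    vecs d = Finite.list (Vec (suc d))

    gs : List (Rect n n)
    gs = Finite.list (RectF n n)

  idx : List Index
  idx = concatMap (λ t → map (λ v → b ℕ.+ t , v) (vecs (b ℕ.+ t))) (range R)

  ∑-idx : ∀ f → ∑ idx f ≡ ∑ (range R) (λ t → ∑ (vecs (b ℕ.+ t)) (λ v → f (b ℕ.+ t , v)))
  ∑-idx f = ≡.trans (∑-concatMap _ (range R) f) (∑-cong (range R) (λ t → ∑-map _ (vecs (b ℕ.+ t)) f))

  InRange : ℕ → Set
  InRange d = b ≤ d × suc d ≤ n

  2≤deg : ∀ {d} → InRange d → 2 ≤ suc d
  2≤deg (b≤d , _) = s≤s (ℕP.≤-trans 1≤b b≤d)

  in-range : ∀ {t} → t < R → InRange (b ℕ.+ t)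
  in-range {t} t<R = ℕP.m≤m+n b t ,
    ℕP.≤-trans (ℕP.≤-reflexive (≡.sym (ℕP.+-suc b t))) (ℕP.≤-trans (ℕP.+-monoʳ-≤ b t<R) b+R≤n)

  idx-All : {T : Index → Set} → (∀ d v → InRange d → T (d , v)) → All T idx
  idx-All {T} h = AllP.concat⁺ (AllP.map⁺ (All.map (λ {t} t<R → AllP.map⁺ (All.tabulate (λ {v} _ → h (b ℕ.+ t) v (in-range t<R)))) (range-< R)))

  -- With this weight degree d + 1 contributes about q^n / (d + 1) to μ, and ω q^(d+1) ≤ q^n tames
  -- the diagonal of the second moment. Reducible polynomials stay in the index list with weight 0.
  ω : Index → ℕ
  ω (d , v) = q ℕ.^ (n ℕ.∸ suc d) ℕ.* ⟦ irr? v ⟧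

  emb : Index → Rect n n → ℕ
  emb (d , v) = Counts.N (companion v)

  W : Rect n n → ℕ
  W g = ∑ idx (λ x → ω x ℕ.* emb x g)

  μ : ℕ
  μ = ∑ idx ω

  private
    ω-irr : ∀ d v {x y : ℕ} → (Irr v → x ≤ y) → ω (d , v) ℕ.* x ≤ ω (d , v) ℕ.* y
    ω-irr d v {x} {y} h = go (irr? v)
      where
      c = q ℕ.^ (n ℕ.∸ suc d)
      go : (i : Dec (Irr v)) → c ℕ.* ⟦ i ⟧ ℕ.* x ≤ c ℕ.* ⟦ i ⟧ ℕ.* y
      go (yes i) = ℕP.*-monoʳ-≤ (c ℕ.* 1) (h i)
      go (no _)  = ℕP.≤-reflexive (≡.trans (≡.cong (ℕ._* x) (ℕP.*-zeroʳ c)) (≡.sym (≡.cong (ℕ._* y) (ℕP.*-zeroʳ c))))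

    transport : ∀ {ℓ} (T : ℕ → Set ℓ) {d} → d ≤ n → T (n ℕ.∸ d ℕ.+ d) → T n
    transport T d≤n = ≡.subst T (ℕP.m∸n+n≡m d≤n)

  mean-emb : ∀ d v → InRange d → Irr v → ∑ gs (λ g → ⟦ inv? g ⟧ ℕ.* emb (d , v) g) ≡ γ n
  mean-emb d v r@(_ , d≤n) i = transport (λ z → ∑ʳ {z} {z} (λ g → ⟦ inv? g ⟧ ℕ.* embeddings P g) ≡ γ z) d≤n
    (Counts.FirstMoment.mean (companion v) (ℕP.≤-trans (s≤s z≤n) 2≤d) (companion-invertible P 2≤d) (simple P) (n ℕ.∸ suc d))
    where
    P = irreducible v i
    2≤d = 2≤deg r

  first : μ ℕ.* γ n ≤ ∑ gs (λ g → ⟦ inv? g ⟧ ℕ.* W g)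
  first = begin
    μ ℕ.* γ n                                                        ≡⟨ ≡.sym (∑-*ʳ idx (γ n) ω) ⟩
    ∑ idx (λ x → ω x ℕ.* γ n)                                        ≤⟨ ∑-≤-All idx (idx-All (λ d v r → ω-irr d v (λ i → ℕP.≤-reflexive (≡.sym (mean-emb d v r i))))) ⟩
    ∑ idx (λ x → ω x ℕ.* ∑ gs (λ g → ⟦ inv? g ⟧ ℕ.* emb x g))        ≡⟨ ∑-cong idx (λ x → ≡.sym (∑-*ˡ gs (ω x) _)) ⟩
    ∑ idx (λ x → ∑ gs (λ g → ω x ℕ.* (⟦ inv? g ⟧ ℕ.* emb x g)))      ≡⟨ ∑-swap idx gs _ ⟩
    ∑ gs (λ g → ∑ idx (λ x → ω x ℕ.* (⟦ inv? g ⟧ ℕ.* emb x g)))      ≡⟨ ∑-cong gs (λ g → ≡.trans (∑-cong idx (λ x → arith (ω x) ⟦ inv? g ⟧ (emb x g))) (∑-*ˡ idx ⟦ inv? g ⟧ (λ x → ω x ℕ.* emb x g))) ⟩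
    ∑ gs (λ g → ⟦ inv? g ⟧ ℕ.* W g)                                  ∎
    where
    open ℕP.≤-Reasoning
    arith : ∀ w i e → w ℕ.* (i ℕ.* e) ≡ i ℕ.* (w ℕ.* e)
    arith = solve 3 (λ w i e → w :* (i :* e) := i :* (w :* e)) ≡.refl
      where open +-*-Solver using (solve; _:*_; _:=_)

  private
    same : Index → Index → ℕ
    same (d , v) (d' , v') = go (d' ℕ.≟ d)
      where
      go : Dec (d' ≡ d) → ℕ
      go (yes ≡.refl) = ⟦ Finite._≟_ (Vec (suc d)) v' v ⟧
      go (no _)       = 0

    same-sum : ∀ d v d' → ∑ (vecs d') (λ v' → same (d , v) (d' , v') ℕ.* ω (d' , v')) ≡ ⟦ d' ℕ.≟ d ⟧ ℕ.* ω (d , v)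
    same-sum d v d' with d' ℕ.≟ d
    ... | no _       = ∑-0 (vecs d')
    ... | yes ≡.refl = ≡.trans (∑-pick (Vec (suc d)) v (λ v' → ω (d , v')) (λ {x} {y} e → ≡.cong (q ℕ.^ (n ℕ.∸ suc d) ℕ.*_)
            (⟦⟧-⇔ (irr? x) (irr? y) (Irr-resp e) (Irr-resp (λ i → sym (e i)))))) (≡.sym (ℕP.*-identityˡ _))

    same-≤ : ∀ x → ∑ idx (λ y → same x y ℕ.* ω y) ≤ ω x
    same-≤ x@(d , v) = begin
      ∑ idx (λ y → same x y ℕ.* ω y)                                      ≡⟨ ∑-idx _ ⟩
      ∑ (range R) (λ t → ∑ (vecs (b ℕ.+ t)) (λ v' → same x (b ℕ.+ t , v') ℕ.* ω (b ℕ.+ t , v')))  ≡⟨ ∑-cong (range R) (λ t → same-sum d v (b ℕ.+ t)) ⟩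
      ∑ (range R) (λ t → ⟦ b ℕ.+ t ℕ.≟ d ⟧ ℕ.* ω x)                       ≡⟨ ∑-*ʳ (range R) (ω x) (λ t → ⟦ b ℕ.+ t ℕ.≟ d ⟧) ⟩
      ∑ (range R) (λ t → ⟦ b ℕ.+ t ℕ.≟ d ⟧) ℕ.* ω x                       ≤⟨ ℕP.*-monoˡ-≤ (ω x) (range-unique b R d) ⟩
      1 ℕ.* ω x                                                           ≡⟨ ℕP.*-identityˡ (ω x) ⟩
      ω x                                                                 ∎
      where open ℕP.≤-Reasoning

    pair-sum : Index → Index → ℕ
    pair-sum x y = ∑ gs (λ g → ⟦ inv? g ⟧ ℕ.* emb y g ℕ.* emb x g)

    q^deg : Index → ℕ
    q^deg (d , _) = q ℕ.^ suc d

    pair-≤ : ∀ d v d' v' → InRange d → InRange d' → Irr v → Irr v' →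
      pair-sum (d , v) (d' , v') ≤ γ n ℕ.* (1 ℕ.+ same (d , v) (d' , v') ℕ.* (2 ℕ.* q ℕ.^ suc d))
    pair-≤ d v d' v' r@(_ , d≤n) r' i i' with d' ℕ.≟ d
    ... | no ne = ℕP.≤-trans (transport (λ z → ∑ʳ {z} {z} (λ g → ⟦ inv? g ⟧ ℕ.* embeddings P' g ℕ.* embeddings P g) ≤ γ z) d≤n
            (SecondMoment.second-moment-distinct P P' (2≤deg r) (2≤deg r') distinct (n ℕ.∸ suc d))) (ℕP.≤-reflexive (≡.sym (ℕP.*-identityʳ (γ n))))
      where
      P = irreducible v i
      P' = irreducible v' i'
      distinct : ¬ (monic v' ≋ monic v)
      distinct e = FiniteField.0≉1 F (clash (ℕP.<-cmp d d'))
        where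
        open Poly commRing using (coeff-monic-top; monic-deg)
        open import Relation.Binary using (Tri; tri<; tri≈; tri>)
        clash : Tri (d < d') (d ≡ d') (d' < d) → 0# ≈ 1#
        clash (tri≈ _ p _) = ⊥-elim (ne (≡.sym p))
        clash (tri< l _ _) = trans (sym (monic-deg v (suc d') (s≤s l))) (trans (sym (at e (suc d'))) (coeff-monic-top v'))
        clash (tri> _ _ l) = trans (sym (monic-deg v' (suc d) (s≤s l))) (trans (at e (suc d)) (coeff-monic-top v))
    ... | yes ≡.refl with Finite._≟_ (Vec (suc d)) v' v
    ...   | yes _ = ℕP.≤-trans (transport (λ z → ∑ʳ {z} {z} (λ g → ⟦ inv? g ⟧ ℕ.* embeddings P' g ℕ.* embeddings P g) ≤ γ z ℕ.* (2 ℕ.* q ℕ.^ suc d)) d≤n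
              (SecondMoment.second-moment P P' (2≤deg r) (2≤deg r') (n ℕ.∸ suc d)))
              (ℕP.*-monoʳ-≤ (γ n) (ℕP.≤-trans (ℕP.≤-reflexive (≡.sym (ℕP.*-identityˡ _))) (ℕP.n≤1+n _)))
      where
      P = irreducible v i
      P' = irreducible v' i'
    ...   | no ne = ℕP.≤-trans (transport (λ z → ∑ʳ {z} {z} (λ g → ⟦ inv? g ⟧ ℕ.* embeddings P' g ℕ.* embeddings P g) ≤ γ z) d≤n
              (SecondMoment.second-moment-distinct P P' (2≤deg r) (2≤deg r') (λ e → ne (λ j → trans (sym (coeff-monic v' j)) (trans (at e (toℕ j)) (coeff-monic v j)))) (n ℕ.∸ suc d)))
              (ℕP.≤-reflexive (≡.sym (ℕP.*-identityʳ (γ n))))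
      where
      P = irreducible v i
      P' = irreducible v' i'

    ω-q^deg : ∀ d v → InRange d → ω (d , v) ℕ.* q ℕ.^ suc d ≤ q ℕ.^ n
    ω-q^deg d v (_ , d≤n) = begin
      q ℕ.^ (n ℕ.∸ suc d) ℕ.* ⟦ irr? v ⟧ ℕ.* q ℕ.^ suc d    ≤⟨ ℕP.*-monoˡ-≤ (q ℕ.^ suc d) (ℕP.≤-trans (ℕP.*-monoʳ-≤ (q ℕ.^ (n ℕ.∸ suc d)) (⟦⟧-≤1 (irr? v))) (ℕP.≤-reflexive (ℕP.*-identityʳ (q ℕ.^ (n ℕ.∸ suc d))))) ⟩
      q ℕ.^ (n ℕ.∸ suc d) ℕ.* q ℕ.^ suc d                   ≡⟨ ≡.trans (≡.sym (ℕP.^-distribˡ-+-* q (n ℕ.∸ suc d) (suc d))) (≡.cong (q ℕ.^_) (ℕP.m∸n+n≡m d≤n)) ⟩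
      q ℕ.^ n                                               ∎
      where open ℕP.≤-Reasoning

  -- Every pair of indices contributes at most its product of weights, together μ². A diagonal pair
  -- costs an extra 2 ω² q^deg, at most 2 q^n ω.
  second : ∑ gs (λ g → ⟦ inv? g ⟧ ℕ.* (W g ℕ.* W g)) ≤ γ n ℕ.* (μ ℕ.* μ ℕ.+ 2 ℕ.* q ℕ.^ n ℕ.* μ)
  second = begin
    ∑ gs (λ g → ⟦ inv? g ⟧ ℕ.* (W g ℕ.* W g))                                       ≡⟨ ∑-cong gs expand ⟩
    ∑ gs (λ g → ∑ idx (λ x → ∑ idx (λ y → ω x ℕ.* (ω y ℕ.* (⟦ inv? g ⟧ ℕ.* emb y g ℕ.* emb x g)))))   ≡⟨ ≡.trans (∑-swap gs idx _) (∑-cong idx (λ x → ∑-swap gs idx _)) ⟩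
    ∑ idx (λ x → ∑ idx (λ y → ∑ gs (λ g → ω x ℕ.* (ω y ℕ.* (⟦ inv? g ⟧ ℕ.* emb y g ℕ.* emb x g)))))   ≡⟨ ∑-cong idx (λ x → ≡.trans (∑-cong idx (λ y → ≡.trans (∑-*ˡ gs (ω x) _) (≡.cong (ω x ℕ.*_) (∑-*ˡ gs (ω y) _)))) (∑-*ˡ idx (ω x) (λ y → ω y ℕ.* pair-sum x y))) ⟩
    ∑ idx (λ x → ω x ℕ.* ∑ idx (λ y → ω y ℕ.* pair-sum x y))                        ≤⟨ ∑-≤-All idx (idx-All (λ d v r → ω-irr d v (λ i → ∑-≤-All idx (idx-All (λ d' v' r' → ω-irr d' v' (λ i' → pair-≤ d v d' v' r r' i i')))))) ⟩
    ∑ idx (λ x → ω x ℕ.* ∑ idx (λ y → ω y ℕ.* (G ℕ.* (1 ℕ.+ same x y ℕ.* (2 ℕ.* q^deg x)))))         ≡⟨ ∑-cong idx (λ x → ≡.cong (ω x ℕ.*_) (≡.trans (∑-cong idx (λ y → arith (ω y) (same x y) (2 ℕ.* q^deg x)))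
                                                                                            (≡.trans (∑-+ idx _ _) (≡.cong₂ ℕ._+_ (∑-*ˡ idx G ω) (∑-*ˡ idx (G ℕ.* (2 ℕ.* q^deg x)) (λ y → same x y ℕ.* ω y)))))) ⟩
    ∑ idx (λ x → ω x ℕ.* (G ℕ.* μ ℕ.+ G ℕ.* (2 ℕ.* q^deg x) ℕ.* ∑ idx (λ y → same x y ℕ.* ω y)))     ≤⟨ ∑-≤ idx (λ x → ℕP.*-monoʳ-≤ (ω x) (ℕP.+-monoʳ-≤ (G ℕ.* μ) (ℕP.*-monoʳ-≤ (G ℕ.* (2 ℕ.* q^deg x)) (same-≤ x)))) ⟩
    ∑ idx (λ x → ω x ℕ.* (G ℕ.* μ ℕ.+ G ℕ.* (2 ℕ.* q^deg x) ℕ.* ω x))               ≡⟨ ∑-cong idx (λ x → arith' (ω x) (q^deg x)) ⟩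
    ∑ idx (λ x → ω x ℕ.* (G ℕ.* μ) ℕ.+ G ℕ.* 2 ℕ.* ω x ℕ.* (ω x ℕ.* q^deg x))       ≤⟨ ∑-≤-All idx (idx-All (λ d v r → ℕP.+-monoʳ-≤ (ω (d , v) ℕ.* (G ℕ.* μ)) (ℕP.*-monoʳ-≤ (G ℕ.* 2 ℕ.* ω (d , v)) (ω-q^deg d v r)))) ⟩
    ∑ idx (λ x → ω x ℕ.* (G ℕ.* μ) ℕ.+ G ℕ.* 2 ℕ.* ω x ℕ.* Z)                       ≡⟨ ≡.trans (∑-cong idx (λ x → arith'' (ω x))) (∑-*ʳ idx (G ℕ.* μ ℕ.+ G ℕ.* 2 ℕ.* Z) ω) ⟩
    μ ℕ.* (G ℕ.* μ ℕ.+ G ℕ.* 2 ℕ.* Z)                                               ≡⟨ solve 3 (λ m g z → m :* (g :* m :+ g :* con 2 :* z) := g :* (m :* m :+ con 2 :* z :* m)) ≡.refl μ G Z ⟩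
    G ℕ.* (μ ℕ.* μ ℕ.+ 2 ℕ.* Z ℕ.* μ)                                               ∎
    where
    open ℕP.≤-Reasoning
    open +-*-Solver using (solve; _:*_; _:+_; _:=_; con)
    G = γ n
    Z = q ℕ.^ n
    expand : ∀ g → ⟦ inv? g ⟧ ℕ.* (W g ℕ.* W g) ≡ ∑ idx (λ x → ∑ idx (λ y → ω x ℕ.* (ω y ℕ.* (⟦ inv? g ⟧ ℕ.* emb y g ℕ.* emb x g))))
    expand g = ≡.trans (≡.cong (⟦ inv? g ⟧ ℕ.*_) (≡.sym (∑-*ʳ idx (W g) (λ x → ω x ℕ.* emb x g))))
      (≡.trans (≡.sym (∑-*ˡ idx ⟦ inv? g ⟧ _)) (∑-cong idx (λ x → ≡.trans (solve 4 (λ i o e w → i :* ((o :* e) :* w) := (i :* o :* e) :* w) ≡.refl ⟦ inv? g ⟧ (ω x) (emb x g) (W g))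
        (≡.trans (≡.sym (∑-*ˡ idx (⟦ inv? g ⟧ ℕ.* ω x ℕ.* emb x g) (λ y → ω y ℕ.* emb y g)))
          (∑-cong idx (λ y → solve 5 (λ i o e o' e' → (i :* o :* e) :* (o' :* e') := o :* (o' :* (i :* e' :* e))) ≡.refl ⟦ inv? g ⟧ (ω x) (emb x g) (ω y) (emb y g)))))))
    arith : ∀ w s t → w ℕ.* (G ℕ.* (1 ℕ.+ s ℕ.* t)) ≡ G ℕ.* w ℕ.+ G ℕ.* t ℕ.* (s ℕ.* w)
    arith w s t = solve 4 (λ w g s t → w :* (g :* (con 1 :+ s :* t)) := g :* w :+ g :* t :* (s :* w)) ≡.refl w G s t
    arith' : ∀ w t → w ℕ.* (G ℕ.* μ ℕ.+ G ℕ.* (2 ℕ.* t) ℕ.* w) ≡ w ℕ.* (G ℕ.* μ) ℕ.+ G ℕ.* 2 ℕ.* w ℕ.* (w ℕ.* t)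
    arith' w t = solve 4 (λ w g m t → w :* (g :* m :+ g :* (con 2 :* t) :* w) := w :* (g :* m) :+ g :* con 2 :* w :* (w :* t)) ≡.refl w G μ t
    arith'' : ∀ w → w ℕ.* (G ℕ.* μ) ℕ.+ G ℕ.* 2 ℕ.* w ℕ.* Z ≡ w ℕ.* (G ℕ.* μ ℕ.+ G ℕ.* 2 ℕ.* Z)
    arith'' w = solve 4 (λ w g m z → w :* (g :* m) :+ g :* con 2 :* w :* z := w :* (g :* m :+ g :* con 2 :* z)) ≡.refl w G μ Z

  module _ (u w : ℕ) (ratio : ∀ d → InRange d → ∀ {T : (Fin (suc d) → Carrier) → Set} (T? : ∀ v → Dec (T v)) →
      (∃ λ c → ∀ v → T v → statistic (companion v) ≈ c) → u ℕ.* count T? ≤ w ℕ.* π d) (c : Carrier) where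

    private
      hit : ∀ {m} → Rect m m → ℕ
      hit g = ⟦ statistic g ≟F c ⟧

      hit-cong : ∀ {m} {g h : Rect m m} → g ≈ʳ h → hit g ≡ hit h
      hit-cong {g = g} {h} e = ⟦⟧-⇔ (statistic g ≟F c) (statistic h ≟F c) (trans (sym (statistic-cong e))) (trans (statistic-cong e))

      hit-conj : ∀ {m} {B B' : Rect m m} → Inverses B B' → ∀ g → hit (conj B B' g) ≡ hit g
      hit-conj {B = B} {B'} p g = ⟦⟧-⇔ (statistic (conj B B' g) ≟F c) (statistic g ≟F c) (trans (sym (statistic-conj p g))) (trans (statistic-conj p g))

      -- For a fixed D the condition X(D) + X(C_P) = c prescribes the value of X(C_P), so `ratio`
      -- applies to each D separately and its bound survives the average over D.
      per-degree : ∀ d m → 2 ≤ suc d → InRange d →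
        u ℕ.* ∑ (vecs d) (λ v → ⟦ irr? v ⟧ ℕ.* ∑ʳ {m ℕ.+ suc d} {m ℕ.+ suc d} (λ g → ⟦ inv? g ⟧ ℕ.* hit g ℕ.* Counts.N (companion v) g)) ≤ w ℕ.* π d ℕ.* γ (m ℕ.+ suc d)
      per-degree d m 2≤d r = begin
        u ℕ.* ∑ vs (λ v → ⟦ irr? v ⟧ ℕ.* S v)                        ≡⟨ ≡.cong (u ℕ.*_) (∑-cong vs evaluate) ⟩
        u ℕ.* ∑ vs (λ v → K ℕ.* (∑ Ds (λ D → ⟦ inv? D ⟧ ℕ.* (⟦ irr? v ⟧ ℕ.* ⟦ T? D v ⟧))))   ≡⟨ ≡.cong (u ℕ.*_) (≡.trans (∑-*ˡ vs K _) (≡.cong (K ℕ.*_) (≡.trans (∑-swap vs Ds _) (∑-cong Ds (λ D → ∑-*ˡ vs ⟦ inv? D ⟧ _))))) ⟩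
        u ℕ.* (K ℕ.* ∑ Ds (λ D → ⟦ inv? D ⟧ ℕ.* count (T? D)))       ≡⟨ ≡.trans (solve 3 (λ u k s → u :* (k :* s) := k :* (u :* s)) ≡.refl u K _) (≡.cong (K ℕ.*_) (≡.sym (∑-*ˡ Ds u _))) ⟩
        K ℕ.* ∑ Ds (λ D → u ℕ.* (⟦ inv? D ⟧ ℕ.* count (T? D)))       ≤⟨ ℕP.*-monoʳ-≤ K (∑-≤ Ds (λ D → ℕP.≤-trans (ℕP.≤-reflexive (swap u ⟦ inv? D ⟧ (count (T? D))))
                                                                          (ℕP.*-monoʳ-≤ ⟦ inv? D ⟧ (ratio d r (T? D) (c - statistic D , λ v t → solve-c D v t))))) ⟩
        K ℕ.* ∑ Ds (λ D → ⟦ inv? D ⟧ ℕ.* (w ℕ.* π d))                ≡⟨ ≡.cong (K ℕ.*_) (∑-*ʳ Ds (w ℕ.* π d) (λ D → ⟦ inv? D ⟧)) ⟩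
        K ℕ.* (γ m ℕ.* (w ℕ.* π d))                                  ≡⟨ solve 4 (λ k r g t → k :* r :* (g :* t) := t :* (k :* (r :* g))) ≡.refl (κ m (suc d)) (ρ m (suc d)) (γ m) (w ℕ.* π d) ⟩
        w ℕ.* π d ℕ.* (κ m (suc d) ℕ.* (ρ m (suc d) ℕ.* γ m))        ≡⟨ ≡.cong (w ℕ.* π d ℕ.*_) (≡.sym (γ-split m (suc d))) ⟩
        w ℕ.* π d ℕ.* γ (m ℕ.+ suc d)                                ∎
        where
        open ℕP.≤-Reasoning
        open +-*-Solver using (solve; _:*_; _:+_; _:=_)
        vs = vecs d
        Ds = Finite.list (RectF m m)
        Ys = Finite.list (RectF (suc d) m)
        K = κ m (suc d) ℕ.* ρ m (suc d)
        S : (Fin (suc d) → Carrier) → ℕ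
        S v = ∑ʳ {m ℕ.+ suc d} {m ℕ.+ suc d} (λ g → ⟦ inv? g ⟧ ℕ.* hit g ℕ.* Counts.N (companion v) g)
        T? : ∀ (D : Rect m m) v → Dec (statistic D + statistic (companion v) ≈ c)
        T? D v = (statistic D + statistic (companion v)) ≟F c
        swap : ∀ a b e → a ℕ.* (b ℕ.* e) ≡ b ℕ.* (a ℕ.* e)
        swap = solve 3 (λ a b e → a :* (b :* e) := b :* (a :* e)) ≡.refl
        solve-c : ∀ (D : Rect m m) v → statistic D + statistic (companion v) ≈ c → statistic (companion v) ≈ c - statistic D
        solve-c D v t = trans (RT.solve 2 (λ s x → x RT.:= (s RT.:+ x) RT.:- s) refl (statistic D) (statistic (companion v))) (+-congʳ t)
          where module RT = RingTools commRing
        moment : ∀ v → Irr v → S v ≡ K ℕ.* ∑ Ds (λ D → ⟦ inv? D ⟧ ℕ.* ⟦ T? D v ⟧)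
        moment v i = ≡.trans (Counts.FirstMoment.first-moment (companion v) (ℕP.≤-trans (s≤s z≤n) 2≤d) (companion-invertible (irreducible v i) 2≤d) (simple (irreducible v i)) m hit hit-cong hit-conj)
          (≡.trans (≡.cong (κ m (suc d) ℕ.*_) (≡.trans (∑-cong Ds (λ D → ≡.trans (≡.cong (⟦ inv? D ⟧ ℕ.*_) (≡.trans (∑-cong Ys (λ Y →
              ⟦⟧-⇔ (statistic (block D Y (companion v)) ≟F c) (T? D v) (trans (sym (statistic-block D Y (companion v)))) (trans (statistic-block D Y (companion v)))))
              (∑-const Ys ⟦ T? D v ⟧))) (swap ⟦ inv? D ⟧ (ρ m (suc d)) ⟦ T? D v ⟧)))
            (∑-*ˡ Ds (ρ m (suc d)) (λ D → ⟦ inv? D ⟧ ℕ.* ⟦ T? D v ⟧)))) (≡.sym (ℕP.*-assoc (κ m (suc d)) (ρ m (suc d)) _)))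
        evaluate : ∀ v → ⟦ irr? v ⟧ ℕ.* S v ≡ K ℕ.* ∑ Ds (λ D → ⟦ inv? D ⟧ ℕ.* (⟦ irr? v ⟧ ℕ.* ⟦ T? D v ⟧))
        evaluate v = ≡.trans (go (irr? v)) (≡.trans (swap ⟦ irr? v ⟧ K _) (≡.cong (K ℕ.*_) (≡.trans (≡.sym (∑-*ˡ Ds ⟦ irr? v ⟧ _)) (∑-cong Ds (λ D → swap ⟦ irr? v ⟧ ⟦ inv? D ⟧ ⟦ T? D v ⟧)))))
          where
          go : (i : Dec (Irr v)) → ⟦ i ⟧ ℕ.* S v ≡ ⟦ i ⟧ ℕ.* (K ℕ.* ∑ Ds (λ D → ⟦ inv? D ⟧ ℕ.* ⟦ T? D v ⟧))
          go (yes i) = ≡.cong (1 ℕ.*_) (moment v i)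
          go (no _)  = ≡.refl

    weighted : u ℕ.* ∑ gs (λ g → ⟦ inv? g ⟧ ℕ.* hit g ℕ.* W g) ≤ w ℕ.* μ ℕ.* γ n
    weighted = begin
      u ℕ.* ∑ gs (λ g → ⟦ inv? g ⟧ ℕ.* hit g ℕ.* W g)                                ≡⟨ ≡.cong (u ℕ.*_) (≡.trans (∑-cong gs (λ g → ≡.sym (∑-*ˡ idx (⟦ inv? g ⟧ ℕ.* hit g) (λ x → ω x ℕ.* emb x g)))) (≡.trans (∑-swap gs idx _) (∑-idx _))) ⟩
      u ℕ.* ∑ (range R) (λ t → ∑ (vecs (b ℕ.+ t)) (λ v → ∑ gs (λ g → ⟦ inv? g ⟧ ℕ.* hit g ℕ.* (ω (b ℕ.+ t , v) ℕ.* emb (b ℕ.+ t , v) g))))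
                                                                                     ≡⟨ ≡.cong (u ℕ.*_) (∑-cong (range R) (λ t → factor (b ℕ.+ t))) ⟩
      u ℕ.* ∑ (range R) (λ t → Q (b ℕ.+ t) ℕ.* V (b ℕ.+ t))                          ≡⟨ ≡.trans (≡.sym (∑-*ˡ (range R) u _)) (∑-cong (range R) (λ t → swap u (Q (b ℕ.+ t)) (V (b ℕ.+ t)))) ⟩
      ∑ (range R) (λ t → Q (b ℕ.+ t) ℕ.* (u ℕ.* V (b ℕ.+ t)))                        ≤⟨ ∑-≤-All (range R) (All.map (λ {t} t<R → ℕP.*-monoʳ-≤ (Q (b ℕ.+ t)) (degree-bound' (b ℕ.+ t) (in-range t<R))) (range-< R)) ⟩
      ∑ (range R) (λ t → Q (b ℕ.+ t) ℕ.* (w ℕ.* π (b ℕ.+ t) ℕ.* γ n))                ≡⟨ ≡.trans (∑-cong (range R) (λ t → solve 4 (λ q w p g → q :* (w :* p :* g) := (w :* g) :* (q :* p)) ≡.refl (Q (b ℕ.+ t)) w (π (b ℕ.+ t)) (γ n)))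
                                                                                          (∑-*ˡ (range R) (w ℕ.* γ n) (λ t → Q (b ℕ.+ t) ℕ.* π (b ℕ.+ t))) ⟩
      w ℕ.* γ n ℕ.* ∑ (range R) (λ t → Q (b ℕ.+ t) ℕ.* π (b ℕ.+ t))                  ≡⟨ ≡.cong (w ℕ.* γ n ℕ.*_) (≡.sym (≡.trans (∑-idx ω) (∑-cong (range R) (λ t → ∑-*ˡ (vecs (b ℕ.+ t)) (Q (b ℕ.+ t)) (λ v → ⟦ irr? v ⟧))))) ⟩
      w ℕ.* γ n ℕ.* μ                                                                ≡⟨ solve 3 (λ w g m → w :* g :* m := w :* m :* g) ≡.refl w (γ n) μ ⟩
      w ℕ.* μ ℕ.* γ n                                                                ∎
      where
      open ℕP.≤-Reasoning
      open +-*-Solver using (solve; _:*_; _:=_)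
      swap : ∀ a b e → a ℕ.* (b ℕ.* e) ≡ b ℕ.* (a ℕ.* e)
      swap = solve 3 (λ a b e → a :* (b :* e) := b :* (a :* e)) ≡.refl
      Q V : ℕ → ℕ
      Q d = q ℕ.^ (n ℕ.∸ suc d)
      V d = ∑ (vecs d) (λ v → ⟦ irr? v ⟧ ℕ.* ∑ gs (λ g → ⟦ inv? g ⟧ ℕ.* hit g ℕ.* Counts.N (companion v) g))
      factor : ∀ d → ∑ (vecs d) (λ v → ∑ gs (λ g → ⟦ inv? g ⟧ ℕ.* hit g ℕ.* (ω (d , v) ℕ.* emb (d , v) g))) ≡ Q d ℕ.* V d
      factor d = ≡.trans (∑-cong (vecs d) (λ v → ≡.trans (∑-cong gs (λ g → solve 4 (λ h q i e → h :* (q :* i :* e) := (q :* i) :* (h :* e)) ≡.refl (⟦ inv? g ⟧ ℕ.* hit g) (Q d) ⟦ irr? v ⟧ (emb (d , v) g)))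
          (≡.trans (∑-*ˡ gs (Q d ℕ.* ⟦ irr? v ⟧) _) (ℕP.*-assoc (Q d) ⟦ irr? v ⟧ _)))) (∑-*ˡ (vecs d) (Q d) _)
      degree-bound' : ∀ d → InRange d → u ℕ.* V d ≤ w ℕ.* π d ℕ.* γ n
      degree-bound' d r = transport (λ z → u ℕ.* ∑ (vecs d) (λ v → ⟦ irr? v ⟧ ℕ.* ∑ʳ {z} {z} (λ g → ⟦ inv? g ⟧ ℕ.* hit g ℕ.* Counts.N (companion v) g)) ≤ w ℕ.* π d ℕ.* γ z)
        (proj₂ r) (per-degree d (n ℕ.∸ suc d) (2≤deg r) r)

-- Chebyshev's inequality for counts in ℕ

2ab≤a²+b² : ∀ a b → 2 ℕ.* a ℕ.* b ≤ a ℕ.* a ℕ.+ b ℕ.* b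
2ab≤a²+b² a b = [ (λ l → sorted a b l) , (λ l → ≡.subst₂ _≤_ (solve 2 (λ a b → con 2 :* b :* a := con 2 :* a :* b) ≡.refl a b) (ℕP.+-comm (b ℕ.* b) (a ℕ.* a)) (sorted b a l)) ]′ (ℕP.≤-total a b)
  where
  open +-*-Solver using (solve; _:*_; _:+_; _:=_; con)
  sorted : ∀ a b → a ≤ b → 2 ℕ.* a ℕ.* b ≤ a ℕ.* a ℕ.+ b ℕ.* b
  sorted a b l = ≡.subst (λ z → 2 ℕ.* a ℕ.* z ≤ a ℕ.* a ℕ.+ z ℕ.* z) (ℕP.m+[n∸m]≡n l) (ℕP.≤-trans (ℕP.m≤m+n _ (e ℕ.* e))
    (ℕP.≤-reflexive (solve 2 (λ a e → con 2 :* a :* (a :+ e) :+ e :* e := a :* a :+ (a :+ e) :* (a :+ e)) ≡.refl a e)))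
    where e = b ℕ.∸ a

-- The witness is e = |x − y|; the inequality combines x ≤ y + e with 2 T e ≤ e² + T².
deviation : ∀ T x y → ∃ λ e → (e ℕ.* e ℕ.+ 2 ℕ.* x ℕ.* y ≡ x ℕ.* x ℕ.+ y ℕ.* y) × (2 ℕ.* T ℕ.* x ≤ 2 ℕ.* T ℕ.* y ℕ.+ (e ℕ.* e ℕ.+ T ℕ.* T))
deviation T x y = [ below , above ]′ (ℕP.≤-total x y)
  where
  open +-*-Solver using (solve; _:*_; _:+_; _:=_; con)
  Goal = ∃ λ e → (e ℕ.* e ℕ.+ 2 ℕ.* x ℕ.* y ≡ x ℕ.* x ℕ.+ y ℕ.* y) × (2 ℕ.* T ℕ.* x ≤ 2 ℕ.* T ℕ.* y ℕ.+ (e ℕ.* e ℕ.+ T ℕ.* T))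
  below : x ≤ y → Goal
  below l = e , ≡.subst (λ y → e ℕ.* e ℕ.+ 2 ℕ.* x ℕ.* y ≡ x ℕ.* x ℕ.+ y ℕ.* y) (ℕP.m+[n∸m]≡n l)
        (solve 2 (λ x e → e :* e :+ con 2 :* x :* (x :+ e) := x :* x :+ (x :+ e) :* (x :+ e)) ≡.refl x e) ,
      ℕP.≤-trans (ℕP.*-monoʳ-≤ (2 ℕ.* T) l) (ℕP.m≤m+n _ _)
    where e = y ℕ.∸ x
  above : y ≤ x → Goal
  above l = e , ≡.subst (λ x → e ℕ.* e ℕ.+ 2 ℕ.* x ℕ.* y ≡ x ℕ.* x ℕ.+ y ℕ.* y) (ℕP.m+[n∸m]≡n l)
        (solve 2 (λ y e → e :* e :+ con 2 :* (y :+ e) :* y := (y :+ e) :* (y :+ e) :+ y :* y) ≡.refl y e) ,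
      ≡.subst (λ x → 2 ℕ.* T ℕ.* x ≤ 2 ℕ.* T ℕ.* y ℕ.+ (e ℕ.* e ℕ.+ T ℕ.* T)) (ℕP.m+[n∸m]≡n l)
        (ℕP.≤-trans (ℕP.≤-reflexive (ℕP.*-distribˡ-+ (2 ℕ.* T) y e)) (ℕP.+-monoʳ-≤ (2 ℕ.* T ℕ.* y)
          (ℕP.≤-trans (2ab≤a²+b² T e) (ℕP.≤-reflexive (ℕP.+-comm (T ℕ.* T) (e ℕ.* e))))))
    where e = x ℕ.∸ y

module Chebyshev {A : Set} (xs : List A) (i h W : A → ℕ) (h≤1 : ∀ x → h x ≤ 1) (G μ V u w : ℕ)
  (G≡ : ∑ xs i ≡ G)
  (first : μ ℕ.* G ≤ ∑ xs (λ x → i x ℕ.* W x))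
  (second : ∑ xs (λ x → i x ℕ.* (W x ℕ.* W x)) ≤ G ℕ.* (μ ℕ.* μ ℕ.+ V))
  (weighted : u ℕ.* ∑ xs (λ x → i x ℕ.* h x ℕ.* W x) ≤ w ℕ.* μ ℕ.* G) where
  open +-*-Solver using (solve; _:*_; _:+_; _:=_; con)
  open ℕP.≤-Reasoning

  private
    a = ∑ xs (λ x → i x ℕ.* h x)

    module _ (T : ℕ) where
      e² : A → ℕ
      e² x = let e = proj₁ (deviation T μ (W x)) in e ℕ.* e

      -- The expansion of (W - μ)² with the cross term moved to the left. Its negative sign is why
      -- the first moment is bounded from below while the second is bounded from above.
      variance : ∑ xs (λ x → i x ℕ.* e² x) ≤ G ℕ.* V
      variance = ℕP.+-cancelʳ-≤ (2 ℕ.* μ ℕ.* (μ ℕ.* G)) _ _ (begin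
        ∑ xs (λ x → i x ℕ.* e² x) ℕ.+ 2 ℕ.* μ ℕ.* (μ ℕ.* G)                          ≤⟨ ℕP.+-monoʳ-≤ (∑ xs (λ x → i x ℕ.* e² x)) (ℕP.*-monoʳ-≤ (2 ℕ.* μ) first) ⟩
        ∑ xs (λ x → i x ℕ.* e² x) ℕ.+ 2 ℕ.* μ ℕ.* ∑ xs (λ x → i x ℕ.* W x)           ≡⟨ ≡.cong (∑ xs (λ x → i x ℕ.* e² x) ℕ.+_) (≡.sym (∑-*ˡ xs (2 ℕ.* μ) (λ x → i x ℕ.* W x))) ⟩
        ∑ xs (λ x → i x ℕ.* e² x) ℕ.+ ∑ xs (λ x → 2 ℕ.* μ ℕ.* (i x ℕ.* W x))         ≡⟨ ≡.sym (∑-+ xs _ _) ⟩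
        ∑ xs (λ x → i x ℕ.* e² x ℕ.+ 2 ℕ.* μ ℕ.* (i x ℕ.* W x))                      ≡⟨ ∑-cong xs (λ x → ≡.trans (solve 4 (λ i e m W → i :* e :+ con 2 :* m :* (i :* W) := i :* (e :+ con 2 :* m :* W)) ≡.refl (i x) (e² x) μ (W x))
                                                                                           (≡.trans (≡.cong (i x ℕ.*_) (proj₁ (proj₂ (deviation T μ (W x))))) (≡.trans (ℕP.*-distribˡ-+ (i x) (μ ℕ.* μ) (W x ℕ.* W x)) (≡.cong (ℕ._+ i x ℕ.* (W x ℕ.* W x)) (ℕP.*-comm (i x) (μ ℕ.* μ)))))) ⟩
        ∑ xs (λ x → μ ℕ.* μ ℕ.* i x ℕ.+ i x ℕ.* (W x ℕ.* W x))                       ≡⟨ ≡.trans (∑-+ xs _ _) (≡.cong (ℕ._+ ∑ xs (λ x → i x ℕ.* (W x ℕ.* W x))) (≡.trans (∑-*ˡ xs (μ ℕ.* μ) i) (≡.cong (μ ℕ.* μ ℕ.*_) G≡))) ⟩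
        μ ℕ.* μ ℕ.* G ℕ.+ ∑ xs (λ x → i x ℕ.* (W x ℕ.* W x))                         ≤⟨ ℕP.+-monoʳ-≤ (μ ℕ.* μ ℕ.* G) second ⟩
        μ ℕ.* μ ℕ.* G ℕ.+ G ℕ.* (μ ℕ.* μ ℕ.+ V)                                      ≡⟨ solve 3 (λ m g v → m :* m :* g :+ g :* (m :* m :+ v) := g :* v :+ con 2 :* m :* (m :* g)) ≡.refl μ G V ⟩
        G ℕ.* V ℕ.+ 2 ℕ.* μ ℕ.* (μ ℕ.* G)                                            ∎)

      -- Instead of separating an exceptional set, the pointwise bound 2 T μ ≤ 2 T W + e² + T² is
      -- summed over the hits, and its error terms are then extended to all of `xs`.
      inequality : 2 ℕ.* T ℕ.* μ ℕ.* a ≤ 2 ℕ.* T ℕ.* ∑ xs (λ x → i x ℕ.* h x ℕ.* W x) ℕ.+ G ℕ.* (V ℕ.+ T ℕ.* T)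
      inequality = begin
        2 ℕ.* T ℕ.* μ ℕ.* a                                                          ≡⟨ ≡.sym (∑-*ˡ xs (2 ℕ.* T ℕ.* μ) (λ x → i x ℕ.* h x)) ⟩
        ∑ xs (λ x → 2 ℕ.* T ℕ.* μ ℕ.* (i x ℕ.* h x))                                 ≤⟨ ∑-≤ xs pointwise ⟩
        ∑ xs (λ x → 2 ℕ.* T ℕ.* (i x ℕ.* h x ℕ.* W x) ℕ.+ (i x ℕ.* e² x ℕ.+ T ℕ.* T ℕ.* i x))  ≡⟨ ≡.trans (∑-+ xs _ _) (≡.cong₂ ℕ._+_ (∑-*ˡ xs (2 ℕ.* T) _) (≡.trans (∑-+ xs _ _) (≡.cong (∑ xs (λ x → i x ℕ.* e² x) ℕ.+_) (≡.trans (∑-*ˡ xs (T ℕ.* T) i) (≡.cong (T ℕ.* T ℕ.*_) G≡))))) ⟩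
        2 ℕ.* T ℕ.* S ℕ.+ (∑ xs (λ x → i x ℕ.* e² x) ℕ.+ T ℕ.* T ℕ.* G)              ≤⟨ ℕP.+-monoʳ-≤ (2 ℕ.* T ℕ.* S) (ℕP.+-monoˡ-≤ (T ℕ.* T ℕ.* G) variance) ⟩
        2 ℕ.* T ℕ.* S ℕ.+ (G ℕ.* V ℕ.+ T ℕ.* T ℕ.* G)                                ≡⟨ ≡.cong (2 ℕ.* T ℕ.* S ℕ.+_) (solve 3 (λ g v t → g :* v :+ t :* g := g :* (v :+ t)) ≡.refl G V (T ℕ.* T)) ⟩
        2 ℕ.* T ℕ.* S ℕ.+ G ℕ.* (V ℕ.+ T ℕ.* T)                                      ∎
        where
        S = ∑ xs (λ x → i x ℕ.* h x ℕ.* W x)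
        pointwise : ∀ x → 2 ℕ.* T ℕ.* μ ℕ.* (i x ℕ.* h x) ≤ 2 ℕ.* T ℕ.* (i x ℕ.* h x ℕ.* W x) ℕ.+ (i x ℕ.* e² x ℕ.+ T ℕ.* T ℕ.* i x)
        pointwise x = begin
          2 ℕ.* T ℕ.* μ ℕ.* (i x ℕ.* h x)                                            ≤⟨ ℕP.*-monoˡ-≤ (i x ℕ.* h x) (proj₂ (proj₂ (deviation T μ (W x)))) ⟩
          (2 ℕ.* T ℕ.* W x ℕ.+ (e² x ℕ.+ T ℕ.* T)) ℕ.* (i x ℕ.* h x)                 ≡⟨ solve 5 (λ t W r i h → (t :* W :+ r) :* (i :* h) := t :* (i :* h :* W) :+ i :* r :* h) ≡.refl (2 ℕ.* T) (W x) (e² x ℕ.+ T ℕ.* T) (i x) (h x) ⟩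
          2 ℕ.* T ℕ.* (i x ℕ.* h x ℕ.* W x) ℕ.+ i x ℕ.* (e² x ℕ.+ T ℕ.* T) ℕ.* h x   ≤⟨ ℕP.+-monoʳ-≤ (2 ℕ.* T ℕ.* (i x ℕ.* h x ℕ.* W x)) (ℕP.*-monoʳ-≤ (i x ℕ.* (e² x ℕ.+ T ℕ.* T)) (h≤1 x)) ⟩
          2 ℕ.* T ℕ.* (i x ℕ.* h x ℕ.* W x) ℕ.+ i x ℕ.* (e² x ℕ.+ T ℕ.* T) ℕ.* 1     ≡⟨ ≡.cong (2 ℕ.* T ℕ.* (i x ℕ.* h x ℕ.* W x) ℕ.+_) (solve 3 (λ i e t → i :* (e :+ t) :* con 1 := i :* e :+ t :* i) ≡.refl (i x) (e² x) (T ℕ.* T)) ⟩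
          2 ℕ.* T ℕ.* (i x ℕ.* h x ℕ.* W x) ℕ.+ (i x ℕ.* e² x ℕ.+ T ℕ.* T ℕ.* i x)   ∎

  -- The threshold T = Z u balances the two error terms.
  chebyshev : ∀ Z C → V ≡ 2 ℕ.* Z ℕ.* μ → w ≡ suc C → 1 ≤ u → 1 ≤ Z → 2 ℕ.* (u ℕ.* u) ℕ.* Z ≤ 4 ℕ.* μ →
    u ℕ.* a ≤ (C ℕ.+ 3) ℕ.* G
  chebyshev Z C ≡.refl ≡.refl 1≤u 1≤Z J = ℕP.*-cancelˡ-≤ (2 ℕ.* μ ℕ.* (Z ℕ.* u)) {{nonzero}} (begin
    2 ℕ.* μ ℕ.* (Z ℕ.* u) ℕ.* (u ℕ.* a)                                     ≡⟨ solve 4 (λ m z u a → con 2 :* m :* (z :* u) :* (u :* a) := u :* (con 2 :* (z :* u) :* m :* a)) ≡.refl μ Z u a ⟩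
    u ℕ.* (2 ℕ.* T ℕ.* μ ℕ.* a)                                             ≤⟨ ℕP.*-monoʳ-≤ u (inequality T) ⟩
    u ℕ.* (2 ℕ.* T ℕ.* S ℕ.+ G ℕ.* (2 ℕ.* Z ℕ.* μ ℕ.+ T ℕ.* T))             ≡⟨ solve 4 (λ u t s r → u :* (con 2 :* t :* s :+ r) := con 2 :* t :* (u :* s) :+ u :* r) ≡.refl u T S (G ℕ.* (2 ℕ.* Z ℕ.* μ ℕ.+ T ℕ.* T)) ⟩
    2 ℕ.* T ℕ.* (u ℕ.* S) ℕ.+ u ℕ.* (G ℕ.* (2 ℕ.* Z ℕ.* μ ℕ.+ T ℕ.* T))     ≤⟨ ℕP.+-monoˡ-≤ _ (ℕP.*-monoʳ-≤ (2 ℕ.* T) weighted) ⟩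
    2 ℕ.* T ℕ.* (suc C ℕ.* μ ℕ.* G) ℕ.+ u ℕ.* (G ℕ.* (2 ℕ.* Z ℕ.* μ ℕ.+ T ℕ.* T))   ≡⟨ solve 5 (λ z u c m g → con 2 :* (z :* u) :* ((con 1 :+ c) :* m :* g) :+ u :* (g :* (con 2 :* z :* m :+ (z :* u) :* (z :* u)))
                                                                                       := (z :* u :* g) :* (con 2 :* (con 1 :+ c) :* m :+ con 2 :* m) :+ (z :* u :* g) :* (u :* u :* z)) ≡.refl Z u C μ G ⟩
    (Z ℕ.* u ℕ.* G) ℕ.* (2 ℕ.* suc C ℕ.* μ ℕ.+ 2 ℕ.* μ) ℕ.+ (Z ℕ.* u ℕ.* G) ℕ.* (u ℕ.* u ℕ.* Z)   ≤⟨ ℕP.+-monoʳ-≤ ((Z ℕ.* u ℕ.* G) ℕ.* (2 ℕ.* suc C ℕ.* μ ℕ.+ 2 ℕ.* μ)) (ℕP.*-monoʳ-≤ (Z ℕ.* u ℕ.* G) half) ⟩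
    (Z ℕ.* u ℕ.* G) ℕ.* (2 ℕ.* suc C ℕ.* μ ℕ.+ 2 ℕ.* μ) ℕ.+ (Z ℕ.* u ℕ.* G) ℕ.* (2 ℕ.* μ)         ≡⟨ solve 5 (λ z u c m g → (z :* u :* g) :* (con 2 :* (con 1 :+ c) :* m :+ con 2 :* m) :+ (z :* u :* g) :* (con 2 :* m)
                                                                                       := con 2 :* m :* (z :* u) :* ((c :+ con 3) :* g)) ≡.refl Z u C μ G ⟩
    2 ℕ.* μ ℕ.* (Z ℕ.* u) ℕ.* ((C ℕ.+ 3) ℕ.* G)                             ∎)
    where
    T = Z ℕ.* u
    S = ∑ xs (λ x → i x ℕ.* h x ℕ.* W x)
    half : u ℕ.* u ℕ.* Z ≤ 2 ℕ.* μ
    half = ℕP.*-cancelˡ-≤ 2 (ℕP.≤-trans (ℕP.≤-reflexive (solve 2 (λ u z → con 2 :* (u :* z) := con 2 :* u :* z) ≡.refl (u ℕ.* u) Z)) (ℕP.≤-trans J (ℕP.≤-reflexive (solve 1 (λ m → con 4 :* m := con 2 :* (con 2 :* m)) ≡.refl μ))))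
    1≤2μ : 1 ≤ 2 ℕ.* μ
    1≤2μ = ℕP.≤-trans (ℕP.*-mono-≤ (ℕP.*-mono-≤ 1≤u 1≤u) 1≤Z) half
    nonzero : ℕ.NonZero (2 ℕ.* μ ℕ.* (Z ℕ.* u))
    nonzero = ℕ.>-nonZero (ℕP.*-mono-≤ 1≤2μ (ℕP.*-mono-≤ 1≤Z 1≤u))

-- A lower bound for the harmonic sum by dyadic blocks

sumTo-+ : ∀ m n f → sumTo (m ℕ.+ n) f ≡ sumTo m f ℕ.+ sumTo n (λ t → f (m ℕ.+ t))
sumTo-+ m zero    f = ≡.trans (≡.cong (λ z → sumTo z f) (ℕP.+-identityʳ m)) (≡.sym (ℕP.+-identityʳ _))
sumTo-+ m (suc n) f = ≡.trans (≡.cong (λ z → sumTo z f) (ℕP.+-suc m n)) (≡.trans (≡.cong (ℕ._+ f (m ℕ.+ n)) (sumTo-+ m n f)) (ℕP.+-assoc (sumTo m f) _ _))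

sumTo-const : ∀ n c → sumTo n (λ _ → c) ≡ n ℕ.* c
sumTo-const zero    c = ≡.refl
sumTo-const (suc n) c = ≡.trans (≡.cong (ℕ._+ c) (sumTo-const n c)) (ℕP.+-comm (n ℕ.* c) c)

sumTo-*ˡ : ∀ n c f → sumTo n (λ t → c ℕ.* f t) ≡ c ℕ.* sumTo n f
sumTo-*ˡ zero    c f = ≡.sym (ℕP.*-zeroʳ c)
sumTo-*ˡ (suc n) c f = ≡.trans (≡.cong (ℕ._+ c ℕ.* f n) (sumTo-*ˡ n c f)) (≡.sym (ℕP.*-distribˡ-+ c (sumTo n f) (f n)))

module Dyadic (D₀ : ℕ) (1≤D₀ : 1 ≤ D₀) (f : ℕ → ℕ) (Z : ℕ) where
  open +-*-Solver using (solve; _:*_; _:+_; _:=_; con)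
  open ℕP.≤-Reasoning

  width : ℕ → ℕ
  width zero    = 0
  width (suc J) = width J ℕ.+ D₀ ℕ.* 2 ℕ.^ J

  end : ∀ J → D₀ ℕ.+ width J ≡ D₀ ℕ.* 2 ℕ.^ J
  end zero    = ≡.trans (ℕP.+-identityʳ D₀) (≡.sym (ℕP.*-identityʳ D₀))
  end (suc J) = ≡.trans (≡.sym (ℕP.+-assoc D₀ (width J) _)) (≡.trans (≡.cong (ℕ._+ D₀ ℕ.* 2 ℕ.^ J) (end J))
    (solve 2 (λ d p → d :* p :+ d :* p := d :* (con 2 :* p)) ≡.refl D₀ (2 ℕ.^ J)))

  -- With s = D₀ 2^J, the block from s to 2 s has s terms, and each is at least Z / (4 s) because D₀
  -- + t stays below 2 s. So every dyadic block adds at least Z / 4.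
  harmonic : ∀ J → (∀ t → t < width J → Z ≤ 2 ℕ.* (D₀ ℕ.+ t) ℕ.* f t) → J ℕ.* Z ≤ 4 ℕ.* sumTo (width J) f
  harmonic zero    h = z≤n
  harmonic (suc J) h = begin
    Z ℕ.+ J ℕ.* Z                                                                 ≡⟨ ℕP.+-comm Z (J ℕ.* Z) ⟩
    J ℕ.* Z ℕ.+ Z                                                                 ≤⟨ ℕP.+-mono-≤ (harmonic J (λ t l → h t (ℕP.≤-trans l (ℕP.m≤m+n (width J) s)))) block ⟩
    4 ℕ.* sumTo (width J) f ℕ.+ 4 ℕ.* sumTo s (λ t → f (width J ℕ.+ t))           ≡⟨ ≡.trans (≡.sym (ℕP.*-distribˡ-+ 4 (sumTo (width J) f) _)) (≡.cong (4 ℕ.*_) (≡.sym (sumTo-+ (width J) s f))) ⟩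
    4 ℕ.* sumTo (width J ℕ.+ s) f                                                 ∎
    where
    s = D₀ ℕ.* 2 ℕ.^ J
    1≤s : 1 ≤ s
    1≤s = ℕP.*-mono-≤ 1≤D₀ (ℕP.m^n>0 2 J)
    term : ∀ t → t < s → Z ≤ 4 ℕ.* s ℕ.* f (width J ℕ.+ t)
    term t t<s = begin
      Z                                                          ≤⟨ h (width J ℕ.+ t) (ℕP.+-monoʳ-< (width J) t<s) ⟩
      2 ℕ.* (D₀ ℕ.+ (width J ℕ.+ t)) ℕ.* f (width J ℕ.+ t)       ≤⟨ ℕP.*-monoˡ-≤ (f (width J ℕ.+ t)) (ℕP.*-monoʳ-≤ 2 (begin
        D₀ ℕ.+ (width J ℕ.+ t)   ≡⟨ ≡.trans (≡.sym (ℕP.+-assoc D₀ (width J) t)) (≡.cong (ℕ._+ t) (end J)) ⟩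
        s ℕ.+ t                  ≤⟨ ℕP.+-monoʳ-≤ s (ℕP.<⇒≤ t<s) ⟩
        s ℕ.+ s                  ∎)) ⟩
      2 ℕ.* (s ℕ.+ s) ℕ.* f (width J ℕ.+ t)                      ≡⟨ ≡.cong (ℕ._* f (width J ℕ.+ t)) (solve 1 (λ s → con 2 :* (s :+ s) := con 4 :* s) ≡.refl s) ⟩
      4 ℕ.* s ℕ.* f (width J ℕ.+ t)                              ∎
    block : Z ≤ 4 ℕ.* sumTo s (λ t → f (width J ℕ.+ t))
    block = ℕP.*-cancelˡ-≤ s {{ℕ.>-nonZero 1≤s}} (begin
      s ℕ.* Z                                                    ≡⟨ ≡.sym (sumTo-const s Z) ⟩
      sumTo s (λ _ → Z)                                          ≤⟨ sumTo-≤ s term ⟩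
      sumTo s (λ t → 4 ℕ.* s ℕ.* f (width J ℕ.+ t))              ≡⟨ sumTo-*ˡ s (4 ℕ.* s) (λ t → f (width J ℕ.+ t)) ⟩
      4 ℕ.* s ℕ.* sumTo s (λ t → f (width J ℕ.+ t))              ≡⟨ solve 2 (λ s x → con 4 :* s :* x := s :* (con 4 :* x)) ≡.refl s (sumTo s (λ t → f (width J ℕ.+ t))) ⟩
      s ℕ.* (4 ℕ.* sumTo s (λ t → f (width J ℕ.+ t)))            ∎)

-- The upper bound for the frequency of each value

module UpperBound (F : FiniteField) (k : ℕ) (1≤k : 1 ≤ k) (a : ℕ → FiniteField.Carrier F)
  (aₖ≉0 : ¬ (FiniteField._≈_ F (a k) (FiniteField.0# F))) (coprime : Coprime (FiniteField.card F) k)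
  (C : ℕ) (1≤C : 1 ≤ C) (m' : ℕ)
  (M≥ : 2 ℕ.+ C ℕ.* (2 ℕ.* FiniteField.card F ℕ.* k ℕ.+ 2) ≤ FiniteField.card F ℕ.^ suc m') where
  open FiniteField F using (commRing) renaming (card to q; _≟_ to _≟F_)
  open CommutativeRing commRing hiding (zero)
  open FieldFacts F using (q≥2)
  open LinearGroup F
  open Factorisation F
  open PrimeCount F
  open Companion F
  open TraceStatistic F k a
  open +-*-Solver using (solve; _:*_; _:+_; _:=_; con)
  open ℕP.≤-Reasoning

  private
    M M₀ : ℕ
    M = q ℕ.^ suc m'
    M₀ = M ℕ.∸ 2

    instance
      q≢0 : ℕ.NonZero q
      q≢0 = ℕ.>-nonZero (ℕP.≤-trans (s≤s z≤n) q≥2)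

    M≡ : 2 ℕ.+ M₀ ≡ M
    M≡ = ℕP.m+[n∸m]≡n (ℕP.≤-trans (ℕP.m≤m+n 2 _) M≥)

    M₀≥ : C ℕ.* (2 ℕ.* q ℕ.* k ℕ.+ 2) ≤ M₀
    M₀≥ = ℕP.+-cancelˡ-≤ 2 _ _ (ℕP.≤-trans M≥ (ℕP.≤-reflexive (≡.sym M≡)))

    qk≤M₀ : 2 ℕ.* q ℕ.* k ℕ.+ 2 ≤ M₀
    qk≤M₀ = ℕP.≤-trans (ℕP.≤-trans (ℕP.≤-reflexive (≡.sym (ℕP.*-identityˡ _))) (ℕP.*-monoˡ-≤ (2 ℕ.* q ℕ.* k ℕ.+ 2) 1≤C)) M₀≥

  -- An index d stands for degree d + 1, so the degrees used start at 3 (m' + 1).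
  b : ℕ
  b = 2 ℕ.+ 3 ℕ.* m'

  module Degree (d : ℕ) (b≤d : b ≤ d) where
    private
      l' = d ℕ.∸ suc m'
      L = q ℕ.^ suc l'
      Q = q ℕ.^ suc d

      m≤d : suc m' ≤ d
      m≤d = ℕP.≤-trans (ℕP.≤-trans (s≤s (ℕP.≤-trans (ℕP.m≤m+n m' _) (ℕP.≤-reflexive (ℕP.+-comm m' _)))) (ℕP.n≤1+n _))
              (ℕP.≤-trans (ℕP.≤-reflexive (≡.cong (2 ℕ.+_) (solve 1 (λ m → (con 2 :* m) :+ m := con 3 :* m) ≡.refl m'))) b≤d)

      d≡ : suc d ≡ suc l' ℕ.+ suc m'
      d≡ = ≡.cong suc (≡.sym (ℕP.m∸n+n≡m m≤d))

      LM≡Q : L ℕ.* M ≡ Q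
      LM≡Q = ≡.trans (≡.sym (ℕP.^-distribˡ-+-* q (suc l') (suc m'))) (≡.cong (q ℕ.^_) (≡.sym d≡))

      2m≤l : 2 ℕ.* suc m' ≤ suc l'
      2m≤l = ℕP.+-cancelʳ-≤ (suc m') _ _ (begin
        2 ℕ.* suc m' ℕ.+ suc m'   ≡⟨ solve 1 (λ m → con 2 :* (con 1 :+ m) :+ (con 1 :+ m) := con 1 :+ (con 2 :+ con 3 :* m)) ≡.refl m' ⟩
        suc b                     ≤⟨ s≤s b≤d ⟩
        suc d                     ≡⟨ d≡ ⟩
        suc l' ℕ.+ suc m'         ∎)

      L≥ : M ℕ.+ q ℕ.* k ℕ.+ 2 ≤ L
      L≥ = begin
        M ℕ.+ q ℕ.* k ℕ.+ 2                  ≡⟨ ℕP.+-assoc M (q ℕ.* k) 2 ⟩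
        M ℕ.+ (q ℕ.* k ℕ.+ 2)                ≤⟨ ℕP.+-monoʳ-≤ M (ℕP.≤-trans (ℕP.+-monoˡ-≤ 2 (ℕP.≤-trans (ℕP.m≤m+n (q ℕ.* k) (q ℕ.* k)) (ℕP.≤-reflexive (solve 2 (λ q k → q :* k :+ q :* k := con 2 :* q :* k) ≡.refl q k))))
                                                  (ℕP.≤-trans qk≤M₀ (ℕP.m∸n≤m M 2))) ⟩
        M ℕ.+ M                              ≡⟨ ≡.cong (M ℕ.+_) (≡.sym (ℕP.+-identityʳ M)) ⟩
        2 ℕ.* M                              ≤⟨ ℕP.*-monoˡ-≤ M (ℕP.≤-trans (ℕP.m≤m+n 2 M₀) (ℕP.≤-reflexive M≡)) ⟩
        M ℕ.* M                              ≡⟨ ≡.trans (≡.sym (ℕP.^-distribˡ-+-* q (suc m') (suc m'))) (≡.cong (λ z → q ℕ.^ (suc m' ℕ.+ z)) (≡.sym (ℕP.+-identityʳ (suc m')))) ⟩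
        q ℕ.^ (2 ℕ.* suc m')                 ≤⟨ ℕP.^-monoʳ-≤ q 2m≤l ⟩
        L                                    ∎

      half : q ℕ.^ ⌊ suc d /2⌋ ℕ.* M ≤ Q
      half = begin
        q ℕ.^ ⌊ suc d /2⌋ ℕ.* M                      ≡⟨ ≡.sym (ℕP.^-distribˡ-+-* q ⌊ suc d /2⌋ (suc m')) ⟩
        q ℕ.^ (⌊ suc d /2⌋ ℕ.+ suc m')               ≤⟨ ℕP.^-monoʳ-≤ q (ℕP.≤-trans (ℕP.+-monoʳ-≤ ⌊ suc d /2⌋ m≤half) (ℕP.≤-reflexive (ℕP.⌊n/2⌋+⌈n/2⌉≡n (suc d)))) ⟩
        Q                                            ∎
        where
        m≤half : suc m' ≤ ⌈ suc d /2⌉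
        m≤half = ≡.subst (_≤ ⌈ suc d /2⌉) (≡.sym (ℕP.n≡⌈n+n/2⌉ (suc m'))) (ℕP.⌈n/2⌉-mono (ℕP.≤-trans (ℕP.≤-reflexive (≡.cong (suc m' ℕ.+_) (≡.sym (ℕP.+-identityʳ (suc m')))))
          (ℕP.≤-trans 2m≤l (ℕP.≤-trans (ℕP.m≤m+n (suc l') (suc m')) (ℕP.≤-reflexive (≡.sym d≡))))))

    -- The error 2 q^⌊(d+1)/2⌋ of `π-lower` is at most 2 Q / M, since m' + 1 is at most half of d +
    -- 1 rounded up. Hence (d + 1) π(d) ≥ Q (1 - 2 / M).
    primes : Q ℕ.* M₀ ≤ suc d ℕ.* π d ℕ.* M
    primes = ℕP.+-cancelʳ-≤ (2 ℕ.* Q) _ _ (begin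
      Q ℕ.* M₀ ℕ.+ 2 ℕ.* Q                                        ≡⟨ solve 2 (λ q m → q :* m :+ con 2 :* q := q :* (con 2 :+ m)) ≡.refl Q M₀ ⟩
      Q ℕ.* (2 ℕ.+ M₀)                                            ≡⟨ ≡.cong (Q ℕ.*_) M≡ ⟩
      Q ℕ.* M                                                     ≤⟨ ℕP.*-monoˡ-≤ M (π-lower d) ⟩
      (suc d ℕ.* π d ℕ.+ 2 ℕ.* q ℕ.^ ⌊ suc d /2⌋) ℕ.* M           ≡⟨ solve 3 (λ p h m → (p :+ con 2 :* h) :* m := p :* m :+ con 2 :* (h :* m)) ≡.refl (suc d ℕ.* π d) (q ℕ.^ ⌊ suc d /2⌋) M ⟩
      suc d ℕ.* π d ℕ.* M ℕ.+ 2 ℕ.* (q ℕ.^ ⌊ suc d /2⌋ ℕ.* M)     ≤⟨ ℕP.+-monoʳ-≤ (suc d ℕ.* π d ℕ.* M) (ℕP.*-monoʳ-≤ 2 half) ⟩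
      suc d ℕ.* π d ℕ.* M ℕ.+ 2 ℕ.* Q                             ∎)

    -- As L M = Q, `trace-count` gives q (d + 1) · count ≤ Q (1 + 2 q k / M). Against `primes` the
    -- quotient is (M + 2 q k) / (M - 2) = 1 + (2 q k + 2) / (M - 2), at most 1 + 1 / C by the
    -- choice of M.
    ratio : ∀ {T : (Fin (suc d) → Carrier) → Set} (T? : ∀ v → Dec (T v)) →
      (∃ λ c → ∀ v → T v → statistic (companion v) ≈ c) → q ℕ.* C ℕ.* count T? ≤ suc C ℕ.* π d
    ratio {T} T? (c , T⇒c) = ℕP.*-cancelˡ-≤ (suc d ℕ.* M) {{dM≢0}} (begin
      suc d ℕ.* M ℕ.* (q ℕ.* C ℕ.* n)                             ≡⟨ solve 5 (λ d m q c n → d :* m :* (q :* c :* n) := c :* (q :* (d :* n) :* m)) ≡.refl (suc d) M q C n ⟩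
      C ℕ.* (q ℕ.* (suc d ℕ.* n) ℕ.* M)                           ≤⟨ ℕP.*-monoʳ-≤ C (ℕP.*-monoˡ-≤ M (TraceBound.trace-count F k 1≤k a aₖ≉0 coprime d m' l' d≡ L≥ c T? trace)) ⟩
      C ℕ.* ((Q ℕ.+ 2 ℕ.* q ℕ.* k ℕ.* L) ℕ.* M)                   ≡⟨ ≡.cong (C ℕ.*_) (≡.trans (solve 4 (λ Q t l m → (Q :+ t :* l) :* m := Q :* m :+ t :* (l :* m)) ≡.refl Q (2 ℕ.* q ℕ.* k) L M)
                                                                       (≡.cong₂ (λ x y → Q ℕ.* x ℕ.+ 2 ℕ.* q ℕ.* k ℕ.* y) (≡.sym M≡) LM≡Q)) ⟩
      C ℕ.* (Q ℕ.* (2 ℕ.+ M₀) ℕ.+ 2 ℕ.* q ℕ.* k ℕ.* Q)            ≡⟨ solve 4 (λ c Q m t → c :* (Q :* (con 2 :+ m) :+ t :* Q) := c :* (Q :* m) :+ Q :* (c :* (t :+ con 2))) ≡.refl C Q M₀ (2 ℕ.* q ℕ.* k) ⟩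
      C ℕ.* (Q ℕ.* M₀) ℕ.+ Q ℕ.* (C ℕ.* (2 ℕ.* q ℕ.* k ℕ.+ 2))    ≤⟨ ℕP.+-monoʳ-≤ (C ℕ.* (Q ℕ.* M₀)) (ℕP.*-monoʳ-≤ Q M₀≥) ⟩
      C ℕ.* (Q ℕ.* M₀) ℕ.+ Q ℕ.* M₀                               ≡⟨ ℕP.+-comm (C ℕ.* (Q ℕ.* M₀)) (Q ℕ.* M₀) ⟩
      suc C ℕ.* (Q ℕ.* M₀)                                        ≤⟨ ℕP.*-monoʳ-≤ (suc C) primes ⟩
      suc C ℕ.* (suc d ℕ.* π d ℕ.* M)                             ≡⟨ solve 4 (λ c d p m → c :* (d :* p :* m) := d :* m :* (c :* p)) ≡.refl (suc C) (suc d) (π d) M ⟩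
      suc d ℕ.* M ℕ.* (suc C ℕ.* π d)                             ∎)
      where
      n = count T?
      dM≢0 : ℕ.NonZero (suc d ℕ.* M)
      dM≢0 = ℕ.>-nonZero (ℕP.*-mono-≤ {1} {suc d} {1} {M} (s≤s z≤n) (ℕP.m^n>0 q (suc m')))
      trace : ∀ v (i : Irr v) → T v → CommutativeRing._≈_ (FiniteField.commRing (residueField v i))
        (ArtinSchreier.Fibre.trace F k 1≤k a aₖ≉0 (irreducible v i) (suc d)) (c ∷ [])
      trace v i t = K.trans (PowerSums.trace-companion (irreducible v i) k 1≤k a aₖ≉0) (Hom.ι-cong (toQuotient v) (T⇒c v t))
        where module K = CommutativeRing (FiniteField.commRing (residueField v i))

    density : Q ≤ 2 ℕ.* suc d ℕ.* π d
    density = ℕP.*-cancelʳ-≤ Q (2 ℕ.* suc d ℕ.* π d) M₀ {{ℕ.>-nonZero 1≤M₀}} (begin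
      Q ℕ.* M₀                           ≤⟨ primes ⟩
      suc d ℕ.* π d ℕ.* M                ≤⟨ ℕP.*-monoʳ-≤ (suc d ℕ.* π d) (ℕP.≤-trans (ℕP.≤-reflexive (≡.sym M≡)) (ℕP.+-monoˡ-≤ M₀ (ℕP.≤-trans (ℕP.m≤n+m 2 (2 ℕ.* q ℕ.* k)) qk≤M₀))) ⟩
      suc d ℕ.* π d ℕ.* (M₀ ℕ.+ M₀)      ≡⟨ solve 3 (λ d p m → d :* p :* (m :+ m) := con 2 :* d :* p :* m) ≡.refl (suc d) (π d) M₀ ⟩
      2 ℕ.* suc d ℕ.* π d ℕ.* M₀         ∎)
      where
      1≤M₀ : 1 ≤ M₀
      1≤M₀ = ℕP.≤-trans (s≤s z≤n) (ℕP.≤-trans (ℕP.m≤n+m 2 (2 ℕ.* q ℕ.* k)) qk≤M₀)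

  hits : ∀ n → Carrier → ℕ
  hits n c = ∑ʳ {n} {n} (λ g → ⟦ inv? g ⟧ ℕ.* ⟦ statistic g ≟F c ⟧)

  -- `chebyshev` asks for 2 u² q^n ≤ 4 μ with u = q C, and J dyadic blocks give J q^n ≤ 4 μ; this
  -- fixes J = 2 u². The hypothesis makes room for the degrees from b + 1 up to (b + 1) 2^J inside
  -- n.
  upper : ∀ n → suc b ℕ.* 2 ℕ.^ (2 ℕ.* ((q ℕ.* C) ℕ.* (q ℕ.* C))) ≤ n → ∀ c → q ℕ.* C ℕ.* hits n c ≤ (C ℕ.+ 3) ℕ.* γ n
  upper n room c = Cheb.chebyshev (q ℕ.^ n) C ≡.refl ≡.refl (ℕP.*-mono-≤ (ℕP.≤-trans (s≤s z≤n) q≥2) 1≤C) (ℕP.m^n>0 q n) J-bound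
    where
    J = 2 ℕ.* ((q ℕ.* C) ℕ.* (q ℕ.* C))
    f : ℕ → ℕ
    f t = q ℕ.^ (n ℕ.∸ suc (b ℕ.+ t)) ℕ.* π (b ℕ.+ t)
    module Dy = Dyadic (suc b) (s≤s z≤n) f (q ℕ.^ n)
    R = Dy.width J
    b+R<n : suc b ℕ.+ R ≤ n
    b+R<n = ℕP.≤-trans (ℕP.≤-reflexive (Dy.end J)) room
    module V = Variance F k a n b R (s≤s z≤n) (ℕP.<⇒≤ b+R<n)
    module Cheb = Chebyshev (Finite.list (RectF n n)) (λ g → ⟦ inv? g ⟧) (λ g → ⟦ statistic g ≟F c ⟧) V.W (λ g → ⟦⟧-≤1 (statistic g ≟F c))
      (γ n) V.μ (2 ℕ.* q ℕ.^ n ℕ.* V.μ) (q ℕ.* C) (suc C) ≡.refl V.first V.second (V.weighted (q ℕ.* C) (suc C) (λ d r → Degree.ratio d (proj₁ r)) c)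
    μ≡ : V.μ ≡ sumTo R f
    μ≡ = ≡.trans (V.∑-idx V.ω) (≡.trans (∑-cong (range R) (λ t → ∑-*ˡ (Finite.list (Vec (suc (b ℕ.+ t)))) (q ℕ.^ (n ℕ.∸ suc (b ℕ.+ t))) (λ v → ⟦ irr? v ⟧))) (∑-range R f))
    dense : ∀ t → t < R → q ℕ.^ n ≤ 2 ℕ.* (suc b ℕ.+ t) ℕ.* f t
    dense t t<R = begin
      q ℕ.^ n                                                     ≡⟨ ≡.trans (≡.cong (q ℕ.^_) (≡.sym (ℕP.m∸n+n≡m d≤n))) (ℕP.^-distribˡ-+-* q (n ℕ.∸ d) d) ⟩
      q ℕ.^ (n ℕ.∸ d) ℕ.* q ℕ.^ d                                 ≤⟨ ℕP.*-monoʳ-≤ (q ℕ.^ (n ℕ.∸ d)) (Degree.density (b ℕ.+ t) (ℕP.m≤m+n b t)) ⟩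
      q ℕ.^ (n ℕ.∸ d) ℕ.* (2 ℕ.* d ℕ.* π (b ℕ.+ t))               ≡⟨ solve 3 (λ q d p → q :* (con 2 :* d :* p) := con 2 :* d :* (q :* p)) ≡.refl (q ℕ.^ (n ℕ.∸ d)) d (π (b ℕ.+ t)) ⟩
      2 ℕ.* d ℕ.* f t                                             ∎
      where
      d = suc (b ℕ.+ t)
      d≤n : d ≤ n
      d≤n = ℕP.≤-trans (ℕP.+-monoʳ-≤ (suc b) (ℕP.<⇒≤ t<R)) b+R<n
    J-bound : J ℕ.* q ℕ.^ n ≤ 4 ℕ.* V.μ
    J-bound = ℕP.≤-trans (Dy.harmonic J dense) (ℕP.≤-reflexive (≡.cong (4 ℕ.*_) (≡.sym μ≡)))

-- Equidistribution

open import Data.Nat using (_*_)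
open FiniteField using (Carrier; 0#; card; countGL; traceSum; GL; HasCharacteristic)

-- `FiniteField.allMats n` is built by a local function on (number of rows, row length);
-- unification recovers it from the unfolding of `allMats (suc n)`.
private
  data Is {A : Set} : A → Set where
    is : ∀ x → Is x

mutual
  private
    tails : (F : FiniteField) (n : ℕ) → List (Fin n → Fin (suc n) → FiniteField.Carrier F)
    tails F n = _

    tails-unfold : ∀ F n → FiniteField.allMats F (suc n) ≡ concatMap (λ r → map (λ rs → _) (tails F n)) (FiniteField.allVecs F (suc n))
    tails-unfold F n = ≡.refl

mutual
  rows : (F : FiniteField) (w m : ℕ) → List (Fin m → Fin w → FiniteField.Carrier F)
  rows F w m = _

  private
    rows-unfold : ∀ F n → Is (tails F n)
    rows-unfold F n with suc n
    ... | w = is (rows F w n)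

module Enumerations (F : FiniteField) where
  open FiniteField F using (commRing; invertible?; allMats; allVecs) renaming (_≟_ to _≟F_; GL to GLᶠ; countGL to countGLᶠ)
  open CommutativeRing commRing using (_≈_; trans; sym)
  open FieldFacts F using (finite)
  open Matrices F
  open LinearGroup F

  vectors : Functions.Enumeration finite
  vectors = record
    { lists = allVecs ; cons = λ n x v → _ ; nil = _ ; cons-zero = λ _ _ _ → ≡.refl ; cons-suc = λ _ _ _ _ → ≡.refl
    ; lists-zero = ≡.refl ; lists-suc = λ _ → ≡.refl }

  matrices : ∀ n → Functions.Enumeration (Functions.Enumeration.finite vectors n)
  matrices n = record
    { lists = rows F n ; cons = λ m r rs → _ ; nil = _ ; cons-zero = λ _ _ _ → ≡.refl ; cons-suc = λ _ _ _ _ → ≡.refl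
    ; lists-zero = ≡.refl ; lists-suc = λ _ → ≡.refl }

  Matrix : ℕ → Finite
  Matrix n = Functions.Enumeration.finite (matrices n) n

  -- Both enumerations meet each class of matrices once, so the identity map reindexes one to the
  -- other.
  ∑-allMats : ∀ n (f : Rect n n → ℕ) → (∀ {g h} → g ≈ʳ h → f g ≡ f h) → ∑ (allMats n) f ≡ ∑ʳ f
  ∑-allMats n f f-cong = ∑-reindex (RectF n n) (Matrix n) (λ g → g) (λ g → g) ≈ʳ-sym ≈ʳ-sym f f-cong

  invertible≡ : ∀ {n} (g : Rect n n) → ⟦ invertible? g ⟧ ≡ ⟦ inv? g ⟧
  invertible≡ {n} g = ⟦⟧-⇔ (invertible? g) (inv? g) Any.satisfied
    (λ (h , p) → Any.map (λ {h'} e → Inverses-cong {g = g} {g} {h} {h'} ≈ʳ-refl (≈ʳ-sym e) p) (Finite.complete (Matrix n) h))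

  length-GL : ∀ n → length (GLᶠ n) ≡ γ n
  length-GL n = ≡.trans (length-∑ (GLᶠ n)) (≡.trans (filter-∑ invertible? (allMats n) (λ _ → 1))
    (≡.trans (∑-cong (allMats n) (λ g → ≡.trans (ℕP.*-identityʳ ⟦ invertible? g ⟧) (invertible≡ g))) (∑-allMats n (λ g → ⟦ inv? g ⟧) inv-cong)))

  countGL≡ : ∀ n (X : Rect n n → FiniteField.Carrier F) → (∀ {g h} → g ≈ʳ h → X g ≈ X h) → ∀ c →
    countGLᶠ n X c ≡ ∑ʳ (λ g → ⟦ inv? g ⟧ ℕ.* ⟦ X g ≟F c ⟧)
  countGL≡ n X X-cong c = ≡.trans (length-∑ (filter (λ g → X g ≟F c) (GLᶠ n))) (≡.trans (filter-∑ (λ g → X g ≟F c) (GLᶠ n) (λ _ → 1))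
    (≡.trans (filter-∑ invertible? (allMats n) (λ g → ⟦ X g ≟F c ⟧ ℕ.* 1))
    (≡.trans (∑-cong (allMats n) (λ g → ≡.cong₂ ℕ._*_ (invertible≡ g) (ℕP.*-identityʳ ⟦ X g ≟F c ⟧)))
      (∑-allMats n (λ g → ⟦ inv? g ⟧ ℕ.* ⟦ X g ≟F c ⟧) (λ {g} {h} e → ≡.cong₂ ℕ._*_ (inv-cong e)
        (⟦⟧-⇔ (X g ≟F c) (X h ≟F c) (trans (sym (X-cong e))) (trans (X-cong e))))))))

  γ>0 : ∀ n → 1 ≤ γ n
  γ>0 n = Any-∑ inv? (Finite.list (RectF n n)) (Any.map (λ e → Invertible-cong (≈ʳ-sym e) I-invertible) (Finite.complete (RectF n n) (FiniteField.I F)))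

  ∑-values : ∀ n (X : Rect n n → FiniteField.Carrier F) →
    ∑ (Finite.list finite) (λ c → ∑ʳ (λ g → ⟦ inv? g ⟧ ℕ.* ⟦ X g ≟F c ⟧)) ≡ γ n
  ∑-values n X = ≡.trans (∑-swap cs gs _) (∑-cong gs (λ g → ≡.trans (∑-*ˡ cs ⟦ inv? g ⟧ (λ c → ⟦ X g ≟F c ⟧))
    (≡.trans (≡.cong (⟦ inv? g ⟧ ℕ.*_) (≡.trans (∑-cong cs (λ c → ⟦⟧-⇔ (X g ≟F c) (c ≟F X g) sym sym)) (Finite.once finite (X g)))) (ℕP.*-identityʳ _))))
    where
    cs = Finite.list finite
    gs = Finite.list (RectF n n)

-- An upper bound at every value forces the matching lower bound, since the values sum to G.
module TwoSided (A : Finite) (hit : Finite.Carrier A → ℕ) (hit-cong : ∀ {x y} → Finite._≈_ A x y → hit x ≡ hit y)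
  (G C : ℕ) (total : ∑ (Finite.list A) hit ≡ G) (upper : ∀ c → Finite.card A ℕ.* C ℕ.* hit c ≤ (C ℕ.+ 3) ℕ.* G) where
  open +-*-Solver using (solve; _:*_; _:+_; _:=_; con)
  open ℕP.≤-Reasoning
  private
    q = Finite.card A
    xs = Finite.list A
    _≟A_ = Finite._≟_ A

  1≤q : Finite.Carrier A → 1 ≤ q
  1≤q c = ℕP.≤-trans (ℕP.≤-reflexive (≡.sym (Finite.once A c))) (ℕP.≤-trans (∑-≤ xs (λ x → ⟦⟧-≤1 (x ≟A c))) (ℕP.≤-reflexive (≡.sym (card-∑ A))))

  above : ∀ c → C ℕ.* (hit c ℕ.* q) ≤ C ℕ.* G ℕ.+ 3 ℕ.* q ℕ.* G
  above c = begin
    C ℕ.* (hit c ℕ.* q)             ≡⟨ solve 3 (λ c h q → c :* (h :* q) := q :* c :* h) ≡.refl C (hit c) q ⟩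
    q ℕ.* C ℕ.* hit c               ≤⟨ upper c ⟩
    (C ℕ.+ 3) ℕ.* G                 ≡⟨ ℕP.*-distribʳ-+ G C 3 ⟩
    C ℕ.* G ℕ.+ 3 ℕ.* G             ≤⟨ ℕP.+-monoʳ-≤ (C ℕ.* G) (ℕP.*-monoˡ-≤ G (ℕP.*-monoʳ-≤ 3 (1≤q c))) ⟩
    C ℕ.* G ℕ.+ 3 ℕ.* q ℕ.* G       ∎

  below : ∀ c → C ℕ.* G ≤ C ℕ.* (hit c ℕ.* q) ℕ.+ 3 ℕ.* q ℕ.* G
  below c = ℕP.+-cancelʳ-≤ (q ℕ.* C ℕ.* G) _ _ (begin
    C ℕ.* G ℕ.+ q ℕ.* C ℕ.* G                                            ≤⟨ ℕP.+-monoʳ-≤ (C ℕ.* G) split ⟩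
    C ℕ.* G ℕ.+ (q ℕ.* C ℕ.* hit c ℕ.+ rest ℕ.* ((C ℕ.+ 3) ℕ.* G))       ≤⟨ ℕP.m≤m+n _ (3 ℕ.* G) ⟩
    C ℕ.* G ℕ.+ (q ℕ.* C ℕ.* hit c ℕ.+ rest ℕ.* ((C ℕ.+ 3) ℕ.* G)) ℕ.+ 3 ℕ.* G
      ≡⟨ solve 4 (λ c g x r → c :* g :+ (x :+ r :* ((c :+ con 3) :* g)) :+ con 3 :* g := x :+ (con 1 :+ r) :* ((c :+ con 3) :* g)) ≡.refl C G (q ℕ.* C ℕ.* hit c) rest ⟩
    q ℕ.* C ℕ.* hit c ℕ.+ (1 ℕ.+ rest) ℕ.* ((C ℕ.+ 3) ℕ.* G)             ≡⟨ ≡.cong (λ z → q ℕ.* C ℕ.* hit c ℕ.+ z ℕ.* ((C ℕ.+ 3) ℕ.* G)) 1+rest≡q ⟩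
    q ℕ.* C ℕ.* hit c ℕ.+ q ℕ.* ((C ℕ.+ 3) ℕ.* G)                        ≡⟨ solve 4 (λ q c h g → q :* c :* h :+ q :* ((c :+ con 3) :* g) := c :* (h :* q) :+ con 3 :* q :* g :+ q :* c :* g) ≡.refl q C (hit c) G ⟩
    C ℕ.* (hit c ℕ.* q) ℕ.+ 3 ℕ.* q ℕ.* G ℕ.+ q ℕ.* C ℕ.* G              ∎)
    where
    rest = ∑ xs (λ x → ⟦ ¬? (x ≟A c) ⟧)
    1+rest≡q : 1 ℕ.+ rest ≡ q
    1+rest≡q = ≡.trans (≡.cong (ℕ._+ rest) (≡.sym (Finite.once A c))) (≡.trans (≡.sym (∑-+ xs _ _)) (≡.trans (∑-cong xs (λ x → ⟦⟧-¬ (x ≟A c))) (≡.sym (card-∑ A))))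
    split : q ℕ.* C ℕ.* G ≤ q ℕ.* C ℕ.* hit c ℕ.+ rest ℕ.* ((C ℕ.+ 3) ℕ.* G)
    split = begin
      q ℕ.* C ℕ.* G                                                                                 ≡⟨ ≡.trans (≡.cong (q ℕ.* C ℕ.*_) (≡.sym total)) (≡.sym (∑-*ˡ xs (q ℕ.* C) hit)) ⟩
      ∑ xs (λ x → q ℕ.* C ℕ.* hit x)                                                                ≡⟨ ∑-cong xs (λ x → ≡.trans (≡.sym (≡.trans (≡.cong (ℕ._* (q ℕ.* C ℕ.* hit x)) (⟦⟧-¬ (x ≟A c))) (ℕP.*-identityˡ _))) (ℕP.*-distribʳ-+ (q ℕ.* C ℕ.* hit x) ⟦ x ≟A c ⟧ ⟦ ¬? (x ≟A c) ⟧)) ⟩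
      ∑ xs (λ x → ⟦ x ≟A c ⟧ ℕ.* (q ℕ.* C ℕ.* hit x) ℕ.+ ⟦ ¬? (x ≟A c) ⟧ ℕ.* (q ℕ.* C ℕ.* hit x))   ≡⟨ ∑-+ xs _ _ ⟩
      ∑ xs (λ x → ⟦ x ≟A c ⟧ ℕ.* (q ℕ.* C ℕ.* hit x)) ℕ.+ ∑ xs (λ x → ⟦ ¬? (x ≟A c) ⟧ ℕ.* (q ℕ.* C ℕ.* hit x))
        ≤⟨ ℕP.+-mono-≤ (ℕP.≤-reflexive (∑-pick A c (λ x → q ℕ.* C ℕ.* hit x) (λ e → ≡.cong (q ℕ.* C ℕ.*_) (hit-cong e)))) (∑-≤ xs (λ x → ℕP.*-monoʳ-≤ ⟦ ¬? (x ≟A c) ⟧ (upper x))) ⟩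
      q ℕ.* C ℕ.* hit c ℕ.+ ∑ xs (λ x → ⟦ ¬? (x ≟A c) ⟧ ℕ.* ((C ℕ.+ 3) ℕ.* G))                      ≡⟨ ≡.cong (q ℕ.* C ℕ.* hit c ℕ.+_) (∑-*ʳ xs ((C ℕ.+ 3) ℕ.* G) (λ x → ⟦ ¬? (x ≟A c) ⟧)) ⟩
      q ℕ.* C ℕ.* hit c ℕ.+ rest ℕ.* ((C ℕ.+ 3) ℕ.* G)                                              ∎

  distance : ∀ c → C ℕ.* ∣ hit c ℕ.* q - G ∣ ≤ 3 ℕ.* q ℕ.* G
  distance c = [ (λ l → ℕP.≤-trans (ℕP.≤-reflexive (≡.trans (≡.cong (C ℕ.*_) (ℕP.m≤n⇒∣m-n∣≡n∸m l)) (ℕP.*-distribˡ-∸ C G (hit c ℕ.* q)))) (ℕP.m≤n+o⇒m∸n≤o _ _ (below c))) ,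
                 (λ l → ℕP.≤-trans (ℕP.≤-reflexive (≡.trans (≡.cong (C ℕ.*_) (ℕP.m≤n⇒∣n-m∣≡n∸m l)) (ℕP.*-distribˡ-∸ C (hit c ℕ.* q) G))) (ℕP.m≤n+o⇒m∸n≤o _ _ (above c))) ]′ (ℕP.≤-total (hit c ℕ.* q) G)

n<2^n : ∀ n → n < 2 ℕ.^ n
n<2^n zero    = s≤s z≤n
n<2^n (suc n) = ℕP.≤-trans (ℕP.+-mono-≤ (ℕP.m^n>0 2 n) (n<2^n n)) (ℕP.≤-reflexive (≡.cong (2 ℕ.^ n ℕ.+_) (≡.sym (ℕP.+-identityʳ (2 ℕ.^ n)))))

log₂ : ∀ k → 1 ≤ k → ∃ λ s → 2 ℕ.^ s ≤ k × k < 2 ℕ.^ suc s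
log₂ (suc zero)    _ = 0 , s≤s z≤n , s≤s (s≤s z≤n)
log₂ (suc (suc k)) _ with log₂ (suc k) (s≤s z≤n)
... | s , lo , hi with suc (suc k) ℕ.<? 2 ℕ.^ suc s
...   | yes p = s , ℕP.≤-trans lo (ℕP.n≤1+n _) , p
...   | no p  = suc s , ℕP.≮⇒≥ p , ℕP.≤-<-trans hi (ℕP.^-monoʳ-< 2 ℕP.≤-refl (ℕP.n<1+n (suc s)))

2^-cancel-≤ : ∀ {m n} → 2 ℕ.^ m ≤ 2 ℕ.^ n → m ≤ n
2^-cancel-≤ {m} {n} l = ℕP.≮⇒≥ (λ n<m → ℕP.<⇒≱ (ℕP.^-monoʳ-< 2 ℕP.≤-refl n<m) l)

theorem1p2 : (F : FiniteField) →
    (p : ℕ) → HasCharacteristic F p →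
    (k : ℕ → ℕ) → (∀ n → 1 ≤ k n) → (∀ n → ¬ (p ∣ k n)) → LogLittleO k →
    (a : ℕ → ℕ → Carrier F) → (∀ n → ¬ FiniteField._≈_ F (a n (k n)) (0# F)) →
    ∀ num den → 1 ≤ num → 1 ≤ den →
    ∃ λ N → ∀ n → N ≤ n → ∀ (c : Carrier F) →
    den * ∣ countGL F n (traceSum F (k n) (a n)) c * card F - length (GL F n) ∣
    < num * length (GL F n) * card F
theorem1p2 F p char k 1≤k p∤k logk a aₖ≉0 num den 1≤num 1≤den = N₀ ℕ.+ 2 ℕ.* (T ℕ.* (3 ℕ.+ c₀)) , main
  where
  q = card F
  -- `distance` bounds C times the deviation by 3 q G; the factor 4 leaves den times the deviation
  -- at most (3/4) q G, strictly below num · G · q.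
  C = 4 * den
  -- The size condition on q^(m'+1) is implied by c₀ k ≤ q^(m'+1). With m' = s + c₀ the exponent
  -- splits into c₀, where 2^c₀ exceeds c₀, and s + 1, where 2^(s+1) exceeds k.
  c₀ = 4 * C * q ℕ.+ 2
  P = 2 ℕ.^ (2 * ((q * C) * (q * C)))
  -- `P` is the factor 2^J of `upper`, and the 3 comes from the first degree 3 (m' + 1) = 3 (s + c₀
  -- + 1).
  T = 3 * P
  1≤q : 1 ≤ q
  1≤q = ℕP.≤-trans (s≤s z≤n) (FieldFacts.q≥2 F)
  1≤C : 1 ≤ C
  1≤C = ℕP.≤-trans 1≤den (ℕP.m≤m+n den _)
  1≤T : 1 ≤ T
  1≤T = ℕP.*-mono-≤ {1} {3} {1} {P} (s≤s z≤n) (ℕP.m^n>0 2 (2 * ((q * C) * (q * C))))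
  -- With ε = 1 / (2 T) the part of the first degree that depends on k uses at most half of n; the
  -- threshold on n reserves the other half for the constant part.
  o = logk 1 (2 * T) (s≤s z≤n) (ℕP.*-mono-≤ {1} {2} (s≤s z≤n) 1≤T)
  N₀ = proj₁ o

  main : ∀ n → N₀ ℕ.+ 2 ℕ.* (T ℕ.* (3 ℕ.+ c₀)) ≤ n → ∀ c →
    den * ∣ countGL F n (traceSum F (k n) (a n)) c * card F - length (GL F n) ∣ < num * length (GL F n) * card F
  main n N≤n c = ≡.subst₂ (λ x g → den * ∣ x * q - g ∣ < num * g * q)
      (≡.sym (Enumerations.countGL≡ F n (traceSum F (k n) (a n)) (TraceStatistic.statistic-cong F (k n) (a n)) c)) (≡.sym (Enumerations.length-GL F n))
      (ℕP.*-cancelˡ-< 4 (den * ∣ UB.hits n c * q - G ∣) (num * G * q) (ℕP.<-≤-trans (ℕP.≤-<-trans (ℕP.≤-trans (ℕP.≤-reflexive (≡.sym (ℕP.*-assoc 4 den _))) (D.distance c))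
        (ℕP.*-monoˡ-< G {{ℕ.>-nonZero 1≤G}} (ℕP.*-monoˡ-< q {{ℕ.>-nonZero 1≤q}} {3} {4} ℕP.≤-refl)))
        (ℕP.≤-trans (ℕP.≤-reflexive (solve 2 (λ q g → con 4 :* q :* g := con 4 :* (con 1 :* g :* q)) ≡.refl q G))
          (ℕP.*-monoʳ-≤ 4 (ℕP.*-monoˡ-≤ q (ℕP.*-monoˡ-≤ G 1≤num))))))
    where
    open +-*-Solver using (solve; _:*_; _:+_; _:=_; con)
    open ℕP.≤-Reasoning
    κ = k n
    lg = log₂ κ (1≤k n)
    s = proj₁ lg
    m' = s ℕ.+ c₀
    G = LinearGroup.γ F n
    1≤G = Enumerations.γ>0 F n
    s-small : s * (2 * T) ≤ n
    s-small = 2^-cancel-≤ (begin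
      2 ℕ.^ (s * (2 * T))      ≡⟨ ≡.sym (ℕP.^-*-assoc 2 s (2 * T)) ⟩
      (2 ℕ.^ s) ℕ.^ (2 * T)    ≤⟨ ℕP.^-monoˡ-≤ (2 * T) (proj₁ (proj₂ lg)) ⟩
      κ ℕ.^ (2 * T)            ≤⟨ proj₂ o n (ℕP.≤-trans (ℕP.m≤m+n N₀ _) N≤n) ⟩
      2 ℕ.^ (1 * n)            ≡⟨ ≡.cong (2 ℕ.^_) (ℕP.*-identityˡ n) ⟩
      2 ℕ.^ n                  ∎)
    M≥ : 2 ℕ.+ C * (2 * q * κ ℕ.+ 2) ≤ q ℕ.^ suc m'
    M≥ = begin
      2 ℕ.+ C * (2 * q * κ ℕ.+ 2)              ≤⟨ ℕP.+-mono-≤ {2} {2 * κ} (ℕP.*-monoʳ-≤ 2 (1≤k n)) (ℕP.*-monoʳ-≤ C (ℕP.+-monoʳ-≤ (2 * q * κ) (ℕP.*-mono-≤ {2} {2 * q} {1} {κ} (ℕP.*-monoʳ-≤ 2 1≤q) (1≤k n)))) ⟩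
      2 * κ ℕ.+ C * (2 * q * κ ℕ.+ 2 * q * κ)  ≡⟨ solve 3 (λ c q k → con 2 :* k :+ c :* (con 2 :* q :* k :+ con 2 :* q :* k) := (con 4 :* c :* q :+ con 2) :* k) ≡.refl C q κ ⟩
      c₀ * κ                                   ≤⟨ ℕP.*-mono-≤ (ℕP.<⇒≤ (n<2^n c₀)) (ℕP.<⇒≤ (proj₂ (proj₂ lg))) ⟩
      2 ℕ.^ c₀ * 2 ℕ.^ suc s                   ≡⟨ ≡.trans (≡.sym (ℕP.^-distribˡ-+-* 2 c₀ (suc s))) (≡.cong (2 ℕ.^_) (≡.trans (ℕP.+-suc c₀ s) (≡.cong suc (ℕP.+-comm c₀ s)))) ⟩
      2 ℕ.^ suc m'                             ≤⟨ ℕP.^-monoˡ-≤ (suc m') (FieldFacts.q≥2 F) ⟩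
      q ℕ.^ suc m'                             ∎
    module UB = UpperBound F κ (1≤k n) (a n) (aₖ≉0 n) (Characteristic.q-coprime F p char κ (p∤k n)) C 1≤C m' M≥
    room : suc UB.b * P ≤ n
    room = ℕP.*-cancelˡ-≤ 2 (begin
      2 * (suc UB.b * P)                                   ≡⟨ solve 3 (λ s c p → con 2 :* ((con 1 :+ (con 2 :+ con 3 :* (s :+ c))) :* p) := s :* (con 2 :* (con 3 :* p)) :+ con 2 :* ((con 3 :* p) :* (con 1 :+ c))) ≡.refl s c₀ P ⟩
      s * (2 * T) ℕ.+ 2 * (T * (1 ℕ.+ c₀))                 ≤⟨ ℕP.+-mono-≤ s-small (ℕP.≤-trans (ℕP.*-monoʳ-≤ 2 (ℕP.*-monoʳ-≤ T (ℕP.m≤n+m (1 ℕ.+ c₀) 2))) (ℕP.≤-trans (ℕP.m≤n+m _ N₀) N≤n)) ⟩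
      n ℕ.+ n                                              ≡⟨ ≡.cong (n ℕ.+_) (≡.sym (ℕP.+-identityʳ n)) ⟩
      2 * n                                                ∎)
    open CommutativeRing (FiniteField.commRing F) using (sym; trans)
    hits-cong : ∀ {x y} → Finite._≈_ (FieldFacts.finite F) x y → UB.hits n x ≡ UB.hits n y
    hits-cong {x} {y} e = ∑-cong (Finite.list (LinearGroup.RectF F n n)) (λ g → ≡.cong (⟦ LinearGroup.inv? F g ⟧ ℕ.*_)
      (⟦⟧-⇔ (FiniteField._≟_ F (traceSum F κ (a n) g) x) (FiniteField._≟_ F (traceSum F κ (a n) g) y) (λ r → trans r e) (λ r → trans r (sym e))))
    values = Enumerations.∑-values F n (traceSum F κ (a n))
    module D = TwoSided (FieldFacts.finite F) (UB.hits n) hits-cong G C values (UB.upper n room)
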